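{- As $n \to \infty$, $$\frac{2}{3\sqrt{3}}\, n^{3/2}(1+o(1)) \le ex(n, \{C_5, K_{2,2}\text{ -ind}\}) \le \frac{n^{3/2}}{2}(1+o(1)).$$
   Context: All graphs are finite and simple. $C_5$ is the cycle of length $5$ and $K_{2,2}$ is the complete bipartite graph with both parts of size $2$ (i.e. the $4$-cycle). For graphs $H$ and $F$, $ex(n, \{H, F\text{ -ind}\})$ denotes the maximum number of edges in an $n$-vertex graph that contains no copy of $H$ as a (not necessarily induced) subgraph and no induced subgraph isomorphic to $F$. -}

module Defs where

open import Data.Bool using (Bool; true; false; _∧_; _xor_; if_then_else_)
open import Data.Nat using (ℕ; _+_)
open import Data.Fin using (Fin; zero; suc; toℕ; _<?_)
open import Data.List using (List; map; allFin)
open import Data.Nat.ListAction using (sum)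
open import Data.Product using (Σ; _×_)
open import Relation.Binary.PropositionalEquality using (_≡_)
open import Relation.Nullary using (¬_)
open import Relation.Nullary.Decidable using (isYes)
open import Function.Definitions using (Injective)

record Graph (n : ℕ) : Set where
  field
    adj    : Fin n → Fin n → Bool
    sym    : ∀ i j → adj i j ≡ adj j i
    irrefl : ∀ i → adj i i ≡ false
open Graph public

edges : ∀ {n} → Graph n → ℕ
edges {n} G =
  sum (map (λ i → sum (map (λ j → if adj G i j ∧ isYes (i <? j) then 1 else 0)
                             (allFin n)))
           (allFin n))

next5 : Fin 5 → Fin 5
next5 zero = suc zero
next5 (suc zero) = suc (suc zero)
next5 (suc (suc zero)) = suc (suc (suc zero))
next5 (suc (suc (suc zero))) = suc (suc (suc (suc zero)))
next5 (suc (suc (suc (suc zero)))) = zero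

ContainsC5 : ∀ {n} → Graph n → Set
ContainsC5 {n} G =
  Σ (Fin 5 → Fin n) λ f → Injective _≡_ _≡_ f × (∀ k → adj G (f k) (f (next5 k)) ≡ true)

parity4 : Fin 4 → Bool
parity4 zero = false
parity4 (suc zero) = true
parity4 (suc (suc zero)) = false
parity4 (suc (suc (suc zero))) = true

k22adj : Fin 4 → Fin 4 → Bool
k22adj i j = parity4 i xor parity4 j

ContainsInducedK22 : ∀ {n} → Graph n → Set
ContainsInducedK22 {n} G =
  Σ (Fin 4 → Fin n) λ f → Injective _≡_ _≡_ f × (∀ i j → adj G (f i) (f j) ≡ k22adj i j)

Admissible : ∀ {n} → Graph n → Set
Admissible G = ¬ ContainsC5 G × ¬ ContainsInducedK22 G

-- Upper bound.  In an admissible graph, nonadjacent vertices have at most two common neighbours, and if uv is an edge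
-- and x is adjacent to neither u nor v, then x has at most two neighbours in common with u and with v together: for a
-- common neighbour w of u, x and w′ ≠ w of v, x, the vertices u w x w′ v form a pentagon.  Neighbourhoods induce no path
-- on four vertices, so the remaining vertices x contribute little.  With E = 2e, this gives at most nE + O(n²) walks of
-- length three; there are at least E³/n² of them, whence E² ≤ (1 + o(1)) n³.
--
-- Lower bound.  Take the incidence graph of the points and the lines y = sx + t over ℤ/P, and replace each point by two
-- adjacent copies: it has 3P² vertices and at least 2P³ edges.  For all large n this needs a prime P with 3P² close to n,
-- that is, a prime in (y, (1 + ε) y] for all large y.
--
-- Primes.  Selberg's formula ψ(x) log x + Σ Λ(k) ψ(x/k) = 2x log x + O(x) gives ψ(v) − ψ(u) ≤ (2 + o(1)) (v − u) for v/u
-- bounded.  Let r = 1 + 1/b, and suppose that all intervals (y, r^(R+1) y] contain a positive proportion of primes but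
-- (u, r^R u] has few.  By the formula, for most primes k the intervals (u r^i / k, u r^(i+1) / k] with i < R then have
-- almost the maximal density 2.  As such k occur with gaps of ratio about r^(R+1), the sum of Λ(m)/m over a long range
-- exceeds what Mertens' estimate allows.  So R + 1 can be lowered step by step to 9, while r is as close to 1 as desired.
-- Logarithms are avoided: harmonic numbers give their size, and at each scale X a rational-valued completely additive
-- function approximates them closely enough for the convolution identities.
module Submission where

open import Algebra.Structures using (IsCommutativeRing)
open import Data.Bool as Bool using (Bool; true; false; _∧_; if_then_else_)
open import Data.Bool.Properties using (T-∧)
open import Data.Empty using (⊥; ⊥-elim)
open import Data.Fin as Fin using (Fin; toℕ; zero; suc; fromℕ<; inject≤)
import Data.Fin.Properties as Finₚ
open import Data.Integer as ℤ using (ℤ; -[1+_]) renaming (+_ to pos)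
import Data.Integer.Properties as ℤₚ
open import Data.List as List using (List; []; _∷_; map; allFin; length)
import Data.List.Membership.DecPropositional as DecMembership
open import Data.List.Membership.Propositional using (_∈_; _∉_)
open import Data.List.Membership.Propositional.Properties using (∈-allFin; ∈-lookup)
open import Data.List.Properties as Listₚ using (≡-dec)
open import Data.List.Relation.Binary.Permutation.Propositional as Perm using (_↭_)
open import Data.List.Relation.Unary.All as All using (All; []; _∷_)
open import Data.List.Relation.Unary.AllPairs using ([]; _∷_)
open import Data.List.Relation.Unary.Any using (here; there)
open import Data.List.Relation.Unary.Unique.Propositional using (Unique)
open import Data.List.Relation.Unary.Unique.Propositional.Properties using (allFin⁺)
open import Data.Nat as ℕ using (ℕ; zero; suc)
open import Data.Nat.Coprimality using (Coprime; coprime-divisor)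
import Data.Nat.DivMod as DivMod
open import Data.Nat.Divisibility using (_∣_; _∣?_; divides; ∣⇒≤; ∣1⇒≡1; m∣m*n; ∣n⇒∣m*n; *-monoʳ-∣; *-cancelˡ-∣; ∣-refl; 1∣_; ∣m+n∣m⇒∣n; n∣m*n)
open import Data.Nat.Induction using (<-rec)
open import Data.Nat.ListAction using (product; sum)
open import Data.Nat.Primality using (Prime; prime?; euclidsLemma; prime⇒nonTrivial; prime⇒nonZero; prime⇒irreducible; productOfPrimes≥1; ¬prime[1])
open import Data.Nat.Primality.Factorisation using (PrimeFactorisation; factorise; factorisationUnique; primeFactorisation[1]; factors)
import Data.Nat.Properties as ℕₚ
open import Data.Product using (Σ; _×_; _,_; proj₁; proj₂; ∃-syntax)
open import Data.Rational as ℚ using (ℚ)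
import Data.Rational.Properties as ℚₚ
open import Data.Rational.Unnormalised as ℚᵘ using (mkℚᵘ; *≡*)
import Data.Rational.Unnormalised.Properties as ℚᵘₚ
open import Data.Sum using (_⊎_; inj₁; inj₂; [_,_]′)
open import Data.Vec as Vec using (Vec; []; _∷_)
open import Data.Vec.Properties using (lookup-map)
open import Function.Bundles using (Equivalence)
open import Relation.Binary.PropositionalEquality using (_≡_; _≢_; refl; sym; trans; cong; cong₂; subst; subst₂; module ≡-Reasoning)
open import Relation.Nullary using (¬_; Dec; yes; no)
open import Relation.Nullary.Decidable using (¬?; isYes; _×-dec_)

-- Ordered fields and linear arithmetic

-- The constant 2/(3√3) needs 3P² = (1 + o(1)) n, so a prime between y and 2y is not enough. The
-- obstacle is that Selberg's formula alone lets the local density of primes oscillate between 0 and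
-- 2: an interval with few primes is not absurd by itself. It becomes absurd against Mertens'
-- estimate, by which the average density is 1. An almost empty (u, r^R u] forces density almost 2
-- on (u/k, r^R u/k] for most k, and consecutive such k are at most about R + 5 factors r apart.
-- Counting a partial cell at the end, R dense cells face at most R + 6 cells, so the average
-- density is at worst about 2R/(R + 6). With 2 weakened to 9/5 and 1 to 26/25 to pay for all
-- roundings, the average is still too large when R ≥ 9, and this is why the descent ends at 9. As r
-- = 1 + 1/b is free, r^9 can be as close to 1 as desired.
--
-- Nearly every estimate is a linear consequence of a few products of inequalities. The products are
-- supplied by hand, and `arith` finds the combination.

record OrderedField : Set₁ where
  infixl 6 _+_ _-_
  infixl 7 _*_
  infix 8 -_
  infix 4 _≤_
  field
    R : Set
    ι : ℕ → R
    _+_ _*_ : R → R → R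
    -_ : R → R
    _≤_ : R → R → Set
    -- `recip n` is 1/(n + 1), which makes it total.
    recip : ℕ → R
    isCommutativeRing : IsCommutativeRing _≡_ _+_ _*_ -_ (ι 0) (ι 1)
    ι-suc : ∀ n → ι (suc n) ≡ ι 1 + ι n
    recip-inverse : ∀ n → ι (suc n) * recip n ≡ ι 1
    ≤-refl : ∀ {x} → x ≤ x
    ≤-trans : ∀ {x y z} → x ≤ y → y ≤ z → x ≤ z
    ≤-antisym : ∀ {x y} → x ≤ y → y ≤ x → x ≡ y
    ≤-total : ∀ x y → x ≤ y ⊎ y ≤ x
    +-mono-≤ : ∀ {w x y z} → w ≤ x → y ≤ z → w + y ≤ x + z
    *-nonneg : ∀ {x y} → ι 0 ≤ x → ι 0 ≤ y → ι 0 ≤ x * y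
    0≤1 : ι 0 ≤ ι 1
    1≰0 : ¬ (ι 1 ≤ ι 0)
  _-_ : R → R → R
  x - y = x + - y

module LinearArithmetic (F : OrderedField) where
  open OrderedField F
  open IsCommutativeRing isCommutativeRing
    using (+-assoc; +-comm; +-identityˡ; +-identityʳ; *-assoc; *-comm; *-identityˡ; *-identityʳ;
           distribˡ; distribʳ; zeroˡ; zeroʳ; -‿inverseˡ; -‿inverseʳ)
  open ≡-Reasoning

  private
    interchange : ∀ a b c d → (a + b) + (c + d) ≡ (a + c) + (b + d)
    interchange a b c d = begin
      (a + b) + (c + d) ≡⟨ +-assoc a b (c + d) ⟩
      a + (b + (c + d)) ≡⟨ cong (a +_) (sym (+-assoc b c d)) ⟩
      a + ((b + c) + d) ≡⟨ cong (λ z → a + (z + d)) (+-comm b c) ⟩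
      a + ((c + b) + d) ≡⟨ cong (a +_) (+-assoc c b d) ⟩
      a + (c + (b + d)) ≡⟨ sym (+-assoc a c (b + d)) ⟩
      (a + c) + (b + d) ∎

    *-interchange : ∀ a b c d → (a * b) * (c * d) ≡ (a * c) * (b * d)
    *-interchange a b c d = begin
      (a * b) * (c * d) ≡⟨ *-assoc a b (c * d) ⟩
      a * (b * (c * d)) ≡⟨ cong (a *_) (sym (*-assoc b c d)) ⟩
      a * ((b * c) * d) ≡⟨ cong (λ z → a * (z * d)) (*-comm b c) ⟩
      a * ((c * b) * d) ≡⟨ cong (a *_) (*-assoc c b d) ⟩
      a * (c * (b * d)) ≡⟨ sym (*-assoc a c (b * d)) ⟩
      (a * c) * (b * d) ∎

    neg-unique : ∀ {a b} → a + b ≡ ι 0 → b ≡ - a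
    neg-unique {a} {b} e = begin
      b               ≡⟨ sym (+-identityˡ b) ⟩
      ι 0 + b         ≡⟨ cong (_+ b) (sym (-‿inverseˡ a)) ⟩
      (- a + a) + b   ≡⟨ +-assoc (- a) a b ⟩
      - a + (a + b)   ≡⟨ cong (- a +_) e ⟩
      - a + ι 0       ≡⟨ +-identityʳ (- a) ⟩
      - a ∎

    neg-involutive : ∀ a → - (- a) ≡ a
    neg-involutive a = sym (neg-unique (-‿inverseˡ a))

    neg-*ˡ : ∀ a b → - a * b ≡ - (a * b)
    neg-*ˡ a b = neg-unique (begin
      a * b + - a * b ≡⟨ sym (distribʳ b a (- a)) ⟩
      (a + - a) * b   ≡⟨ cong (_* b) (-‿inverseʳ a) ⟩
      ι 0 * b         ≡⟨ zeroˡ b ⟩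
      ι 0 ∎)

    neg-*ʳ : ∀ a b → a * - b ≡ - (a * b)
    neg-*ʳ a b = trans (*-comm a (- b)) (trans (neg-*ˡ b a) (cong -_ (*-comm b a)))

    neg-+ : ∀ a b → - (a + b) ≡ - a + - b
    neg-+ a b = sym (neg-unique (begin
      (a + b) + (- a + - b) ≡⟨ interchange a b (- a) (- b) ⟩
      (a + - a) + (b + - b) ≡⟨ cong₂ _+_ (-‿inverseʳ a) (-‿inverseʳ b) ⟩
      ι 0 + ι 0             ≡⟨ +-identityˡ (ι 0) ⟩
      ι 0 ∎))

    neg-zero : - ι 0 ≡ ι 0
    neg-zero = sym (neg-unique (+-identityˡ (ι 0)))

  ι-+ : ∀ m n → ι (m ℕ.+ n) ≡ ι m + ι n
  ι-+ zero n = sym (+-identityˡ (ι n))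
  ι-+ (suc m) n = begin
    ι (suc (m ℕ.+ n))   ≡⟨ ι-suc (m ℕ.+ n) ⟩
    ι 1 + ι (m ℕ.+ n)   ≡⟨ cong (ι 1 +_) (ι-+ m n) ⟩
    ι 1 + (ι m + ι n)   ≡⟨ sym (+-assoc (ι 1) (ι m) (ι n)) ⟩
    (ι 1 + ι m) + ι n   ≡⟨ cong (_+ ι n) (sym (ι-suc m)) ⟩
    ι (suc m) + ι n ∎

  ι-* : ∀ m n → ι (m ℕ.* n) ≡ ι m * ι n
  ι-* zero n = sym (zeroˡ (ι n))
  ι-* (suc m) n = begin
    ι (n ℕ.+ m ℕ.* n)       ≡⟨ ι-+ n (m ℕ.* n) ⟩
    ι n + ι (m ℕ.* n)       ≡⟨ cong₂ _+_ (sym (*-identityˡ (ι n))) (ι-* m n) ⟩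
    ι 1 * ι n + ι m * ι n   ≡⟨ sym (distribʳ (ι n) (ι 1) (ι m)) ⟩
    (ι 1 + ι m) * ι n       ≡⟨ cong (_* ι n) (sym (ι-suc m)) ⟩
    ι (suc m) * ι n ∎

  ι-nonneg : ∀ n → ι 0 ≤ ι n
  ι-nonneg zero = ≤-refl
  ι-nonneg (suc n) = subst₂ _≤_ (+-identityˡ (ι 0)) (sym (ι-suc n)) (+-mono-≤ 0≤1 (ι-nonneg n))

  private
    ιᶻ : ℤ → R
    ιᶻ (pos n) = ι n
    ιᶻ -[1+ n ] = - ι (suc n)

    ιᶻ-neg : ∀ i → ιᶻ (ℤ.- i) ≡ - ιᶻ i
    ιᶻ-neg (pos zero) = sym neg-zero
    ιᶻ-neg (pos (suc n)) = refl
    ιᶻ-neg -[1+ n ] = sym (neg-involutive (ι (suc n)))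

    ιᶻ-⊖ : ∀ m n → ιᶻ (m ℤ.⊖ n) ≡ ι m + - ι n
    ιᶻ-⊖ m zero = sym (trans (cong (ι m +_) neg-zero) (+-identityʳ (ι m)))
    ιᶻ-⊖ zero (suc n) = sym (+-identityˡ (- ι (suc n)))
    ιᶻ-⊖ (suc m) (suc n) = begin
      ιᶻ (suc m ℤ.⊖ suc n)                ≡⟨ cong ιᶻ (ℤₚ.[1+m]⊖[1+n]≡m⊖n m n) ⟩
      ιᶻ (m ℤ.⊖ n)                        ≡⟨ ιᶻ-⊖ m n ⟩
      ι m + - ι n                         ≡⟨ sym (+-identityˡ (ι m + - ι n)) ⟩
      ι 0 + (ι m + - ι n)                 ≡⟨ cong (_+ (ι m + - ι n)) (sym (-‿inverseʳ (ι 1))) ⟩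
      (ι 1 + - ι 1) + (ι m + - ι n)       ≡⟨ interchange (ι 1) (- ι 1) (ι m) (- ι n) ⟩
      (ι 1 + ι m) + (- ι 1 + - ι n)       ≡⟨ cong₂ _+_ (sym (ι-suc m)) (sym (neg-+ (ι 1) (ι n))) ⟩
      ι (suc m) + - (ι 1 + ι n)           ≡⟨ cong (λ z → ι (suc m) + - z) (sym (ι-suc n)) ⟩
      ι (suc m) + - ι (suc n) ∎

    ιᶻ-+ : ∀ i j → ιᶻ (i ℤ.+ j) ≡ ιᶻ i + ιᶻ j
    ιᶻ-+ (pos m) (pos n) = ι-+ m n
    ιᶻ-+ (pos m) -[1+ n ] = ιᶻ-⊖ m (suc n)
    ιᶻ-+ -[1+ m ] (pos n) = trans (ιᶻ-⊖ n (suc m)) (+-comm (ι n) (- ι (suc m)))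
    ιᶻ-+ -[1+ m ] -[1+ n ] = begin
      - ι (suc (suc (m ℕ.+ n)))     ≡⟨ cong (λ k → - ι (suc k)) (sym (ℕₚ.+-suc m n)) ⟩
      - ι (suc m ℕ.+ suc n)         ≡⟨ cong -_ (ι-+ (suc m) (suc n)) ⟩
      - (ι (suc m) + ι (suc n))     ≡⟨ neg-+ (ι (suc m)) (ι (suc n)) ⟩
      - ι (suc m) + - ι (suc n) ∎

    ιᶻ-*⁺ : ∀ m j → ιᶻ (pos m ℤ.* j) ≡ ι m * ιᶻ j
    ιᶻ-*⁺ m (pos n) = trans (cong ιᶻ (sym (ℤₚ.pos-* m n))) (ι-* m n)
    ιᶻ-*⁺ m -[1+ n ] = begin
      ιᶻ (pos m ℤ.* -[1+ n ])           ≡⟨ cong ιᶻ (sym (ℤₚ.neg-distribʳ-* (pos m) (pos (suc n)))) ⟩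
      ιᶻ (ℤ.- (pos m ℤ.* pos (suc n)))      ≡⟨ ιᶻ-neg (pos m ℤ.* pos (suc n)) ⟩
      - ιᶻ (pos m ℤ.* pos (suc n))          ≡⟨ cong -_ (ιᶻ-*⁺ m (pos (suc n))) ⟩
      - (ι m * ι (suc n))             ≡⟨ sym (neg-*ʳ (ι m) (ι (suc n))) ⟩
      ι m * - ι (suc n) ∎

    ιᶻ-* : ∀ i j → ιᶻ (i ℤ.* j) ≡ ιᶻ i * ιᶻ j
    ιᶻ-* (pos m) j = ιᶻ-*⁺ m j
    ιᶻ-* -[1+ m ] j = begin
      ιᶻ (-[1+ m ] ℤ.* j)          ≡⟨ cong ιᶻ (sym (ℤₚ.neg-distribˡ-* (pos (suc m)) j)) ⟩
      ιᶻ (ℤ.- (pos (suc m) ℤ.* j))     ≡⟨ ιᶻ-neg (pos (suc m) ℤ.* j) ⟩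
      - ιᶻ (pos (suc m) ℤ.* j)         ≡⟨ cong -_ (ιᶻ-*⁺ (suc m) j) ⟩
      - (ι (suc m) * ιᶻ j)         ≡⟨ sym (neg-*ˡ (ι (suc m)) (ιᶻ j)) ⟩
      - ι (suc m) * ιᶻ j ∎

  infixl 6 _:+_ _:-_
  infixl 7 _:*_
  infix 8 :-_
  infix 9 #_
  infix 4 _:≤_ _:=_
  infixr 3 _⇒_

  data Expr (n : ℕ) : Set where
    var : Fin n → Expr n
    #_ : ℕ → Expr n
    _:+_ _:*_ _:-_ : Expr n → Expr n → Expr n
    :-_ : Expr n → Expr n

  data Formula (n : ℕ) : Set where
    _:≤_ _:=_ : Expr n → Expr n → Formula n
    _⇒_ : Formula n → Formula n → Formula n

  private
    Monomial : ℕ → Set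
    Monomial n = List (Fin n)

    Polynomial : ℕ → Set
    Polynomial n = List (ℤ × Monomial n)

  module _ {n : ℕ} where

    eval : Vec R n → Expr n → R
    eval ρ (var i) = Vec.lookup ρ i
    eval ρ (# k) = ι k
    eval ρ (e :+ f) = eval ρ e + eval ρ f
    eval ρ (e :* f) = eval ρ e * eval ρ f
    eval ρ (e :- f) = eval ρ e - eval ρ f
    eval ρ (:- e) = - eval ρ e

    holds : Vec R n → Formula n → Set
    holds ρ (e :≤ f) = eval ρ e ≤ eval ρ f
    holds ρ (e := f) = eval ρ e ≡ eval ρ f
    holds ρ (φ ⇒ ψ) = holds ρ φ → holds ρ ψ

    evalᵐ : Vec R n → Monomial n → R
    evalᵐ ρ [] = ι 1
    evalᵐ ρ (i ∷ m) = Vec.lookup ρ i * evalᵐ ρ m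

    evalᵖ : Vec R n → Polynomial n → R
    evalᵖ ρ [] = ι 0
    evalᵖ ρ ((c , m) ∷ p) = ιᶻ c * evalᵐ ρ m + evalᵖ ρ p

    _<ᵐ_ : Monomial n → Monomial n → Bool
    [] <ᵐ [] = false
    [] <ᵐ (_ ∷ _) = true
    (_ ∷ _) <ᵐ [] = false
    (i ∷ m) <ᵐ (j ∷ k) =
      if toℕ i ℕ.<ᵇ toℕ j then true else (if toℕ j ℕ.<ᵇ toℕ i then false else m <ᵐ k)

    insertᵛ : Fin n → Monomial n → Monomial n
    insertᵛ i [] = i ∷ []
    insertᵛ i (j ∷ m) = if toℕ i ℕ.≤ᵇ toℕ j then i ∷ j ∷ m else j ∷ insertᵛ i m

    _*ᵐ_ : Monomial n → Monomial n → Monomial n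
    [] *ᵐ k = k
    (i ∷ m) *ᵐ k = insertᵛ i (m *ᵐ k)

    -- Sorting by `_<ᵐ_` makes like monomials meet and cancel; the value is preserved for any input
    -- list.
    insert : ℤ → Monomial n → Polynomial n → Polynomial n
    insert c m [] = (c , m) ∷ []
    insert c m ((d , k) ∷ p) with ≡-dec Finₚ._≟_ m k
    ... | yes _ = (c ℤ.+ d , k) ∷ p
    ... | no _ = if m <ᵐ k then (c , m) ∷ (d , k) ∷ p else (d , k) ∷ insert c m p

    _+ᵖ_ : Polynomial n → Polynomial n → Polynomial n
    [] +ᵖ q = q
    ((c , m) ∷ p) +ᵖ q = insert c m (p +ᵖ q)

    termᵖ : ℤ → Monomial n → Polynomial n → Polynomial n
    termᵖ c m [] = []
    termᵖ c m ((d , k) ∷ p) = insert (c ℤ.* d) (m *ᵐ k) (termᵖ c m p)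

    _*ᵖ_ : Polynomial n → Polynomial n → Polynomial n
    [] *ᵖ q = []
    ((c , m) ∷ p) *ᵖ q = termᵖ c m q +ᵖ (p *ᵖ q)

    scaleᵖ : ℤ → Polynomial n → Polynomial n
    scaleᵖ c [] = []
    scaleᵖ c ((d , k) ∷ p) = (c ℤ.* d , k) ∷ scaleᵖ c p

    normal : Expr n → Polynomial n
    normal (var i) = (pos 1 , i ∷ []) ∷ []
    normal (# k) = (pos k , []) ∷ []
    normal (e :+ f) = normal e +ᵖ normal f
    normal (e :* f) = normal e *ᵖ normal f
    normal (e :- f) = normal e +ᵖ scaleᵖ -[1+ 0 ] (normal f)
    normal (:- e) = scaleᵖ -[1+ 0 ] (normal e)

    -- Nothing is known about the sign of a nonconstant monomial, so its coefficient must have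
    -- cancelled to 0.
    isNonneg : Polynomial n → Bool
    isNonneg [] = true
    isNonneg ((pos c , []) ∷ p) = isNonneg p
    isNonneg ((pos zero , i ∷ m) ∷ p) = isNonneg p
    isNonneg ((pos (suc _) , i ∷ m) ∷ p) = false
    isNonneg ((-[1+ _ ] , m) ∷ p) = false

    combine : List ℕ → List (Polynomial n) → Polynomial n
    combine (c ∷ cs) (p ∷ ps) = scaleᵖ (pos c) p +ᵖ combine cs ps
    combine _ _ = []

    -- Fourier–Motzkin elimination.  It only searches for multipliers, and the
    -- certificate it returns is checked afterwards, so nothing is proved about it.
    Row : Set
    Row = Polynomial n × List ℕ

    reduce : Polynomial n → Polynomial n
    reduce [] = []
    reduce ((pos zero , m) ∷ p) = reduce p
    reduce ((c , m) ∷ p) = (c , m) ∷ reduce p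

    coefficient : Monomial n → Polynomial n → ℤ
    coefficient m [] = pos 0
    coefficient m ((d , k) ∷ p) with ≡-dec Finₚ._≟_ m k
    ... | yes _ = d
    ... | no _ = coefficient m p

    addLists : ℕ → ℕ → List ℕ → List ℕ → List ℕ
    addLists a b (x ∷ xs) (y ∷ ys) = a ℕ.* x ℕ.+ b ℕ.* y ∷ addLists a b xs ys
    addLists a b _ _ = []

    Split : Set
    Split = List (ℕ × Row) × List (ℕ × Row) × List Row

    split : Monomial n → List Row → Split
    split m [] = [] , [] , []
    split m ((p , cs) ∷ rows) with coefficient m p | split m rows
    ... | pos zero | ps , ns , zs = ps , ns , (p , cs) ∷ zs
    ... | pos (suc k) | ps , ns , zs = (suc k , p , cs) ∷ ps , ns , zs
    ... | -[1+ k ] | ps , ns , zs = ps , (suc k , p , cs) ∷ ns , zs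

    cross : List (ℕ × Row) → List (ℕ × Row) → List Row → List Row
    cross [] ns zs = zs
    cross ((a , p , cs) ∷ ps) ns zs =
      List.foldr (λ { (b , q , ds) acc →
        (reduce (scaleᵖ (pos b) p +ᵖ scaleᵖ (pos a) q) , addLists b a cs ds) ∷ acc })
        (cross ps ns zs) ns

    cost : Monomial n → List Row → ℕ
    cost m rows with split m rows
    ... | ps , ns , _ = List.length ps ℕ.* List.length ns

    rowMonomials : Polynomial n → List (Monomial n)
    rowMonomials [] = []
    rowMonomials ((_ , []) ∷ p) = rowMonomials p
    rowMonomials ((_ , m@(_ ∷ _)) ∷ p) = m ∷ rowMonomials p

    best : List Row → Monomial n → ℕ → List (Monomial n) → Monomial n
    best rows m c [] = m
    best rows m c (k ∷ ks) with cost k rows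
    ... | d = if d ℕ.<ᵇ c then best rows k d ks else best rows m c ks

    allMonomials : List Row → List (Monomial n)
    allMonomials [] = []
    allMonomials ((p , _) ∷ rows) = List.foldr add (allMonomials rows) (rowMonomials p)
      where
      add : Monomial n → List (Monomial n) → List (Monomial n)
      add m [] = m ∷ []
      add m (k ∷ ks) with ≡-dec Finₚ._≟_ m k
      ... | yes _ = k ∷ ks
      ... | no _ = k ∷ add m ks

    -- The rows assert the hypotheses and the negated goal. A row that has become 0 or a negative
    -- constant while using the negated goal shows a positive multiple of the goal to be a
    -- combination of the hypotheses plus a nonnegative constant.
    contradictory : List Row → List ℕ
    contradictory [] = []
    contradictory (([] , zero ∷ cs) ∷ rows) = contradictory rows
    contradictory (([] , suc c ∷ cs) ∷ rows) = suc c ∷ cs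
    contradictory (((-[1+ _ ] , []) ∷ _ , zero ∷ cs) ∷ rows) = contradictory rows
    contradictory (((-[1+ _ ] , []) ∷ _ , suc c ∷ cs) ∷ rows) = suc c ∷ cs
    contradictory (_ ∷ rows) = contradictory rows

    eliminate : ℕ → List Row → List ℕ
    eliminate zero rows = contradictory rows
    eliminate (suc fuel) rows with allMonomials rows
    ... | [] = contradictory rows
    ... | m ∷ ms with split (best rows m (cost m rows) ms) rows
    ...   | ps , ns , zs = eliminate fuel (cross ps ns zs)

    unit : ℕ → ℕ → List ℕ
    unit zero _ = []
    unit (suc k) zero = 1 ∷ unit k (suc k)
    unit (suc k) (suc j) = 0 ∷ unit k j

    rowsOf : ℕ → ℕ → List (Polynomial n) → List Row
    rowsOf k j [] = []
    rowsOf k j (p ∷ ps) = (reduce p , unit k j) ∷ rowsOf k (suc j) ps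

    search : List (Polynomial n) → Polynomial n → List ℕ
    -- Entry 0 of each multiplier list belongs to the negated goal; 40 bounds the number of
    -- monomials eliminated.
    search Γ g = eliminate 40 (rowsOf (suc (List.length Γ)) 0 (scaleᵖ -[1+ 0 ] g ∷ Γ))

    check : List (Polynomial n) → Polynomial n → List ℕ → Bool
    check Γ g (suc k ∷ cs) = isNonneg (scaleᵖ (pos (suc k)) g +ᵖ scaleᵖ -[1+ 0 ] (combine cs Γ))
    check Γ g _ = false

    prove : List (Polynomial n) → Polynomial n → Bool
    prove Γ g = check Γ g (search Γ g)

    decide : List (Polynomial n) → Formula n → Bool
    decide Γ (e :≤ f) = prove Γ (normal (f :- e))
    decide Γ (e := f) = prove Γ (normal (f :- e)) ∧ prove Γ (normal (e :- f))
    decide Γ ((e :≤ f) ⇒ ψ) = decide (normal (f :- e) ∷ Γ) ψ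
    decide Γ ((e := f) ⇒ ψ) = decide (normal (f :- e) ∷ normal (e :- f) ∷ Γ) ψ
    decide Γ ((_ ⇒ _) ⇒ _) = false

    module _ (ρ : Vec R n) where
      private
        ⟦_⟧ = evalᵖ ρ
        ⟦_⟧ᵐ = evalᵐ ρ

      insertᵛ-sound : ∀ i m → ⟦ insertᵛ i m ⟧ᵐ ≡ Vec.lookup ρ i * ⟦ m ⟧ᵐ
      insertᵛ-sound i [] = refl
      insertᵛ-sound i (j ∷ m) with toℕ i ℕ.≤ᵇ toℕ j
      ... | true = refl
      ... | false = begin
        x * ⟦ insertᵛ i m ⟧ᵐ  ≡⟨ cong (x *_) (insertᵛ-sound i m) ⟩
        x * (y * ⟦ m ⟧ᵐ)      ≡⟨ sym (*-assoc x y ⟦ m ⟧ᵐ) ⟩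
        (x * y) * ⟦ m ⟧ᵐ      ≡⟨ cong (_* ⟦ m ⟧ᵐ) (*-comm x y) ⟩
        (y * x) * ⟦ m ⟧ᵐ      ≡⟨ *-assoc y x ⟦ m ⟧ᵐ ⟩
        y * (x * ⟦ m ⟧ᵐ) ∎
        where x = Vec.lookup ρ j
              y = Vec.lookup ρ i

      *ᵐ-sound : ∀ m k → ⟦ m *ᵐ k ⟧ᵐ ≡ ⟦ m ⟧ᵐ * ⟦ k ⟧ᵐ
      *ᵐ-sound [] k = sym (*-identityˡ ⟦ k ⟧ᵐ)
      *ᵐ-sound (i ∷ m) k = begin
        ⟦ insertᵛ i (m *ᵐ k) ⟧ᵐ             ≡⟨ insertᵛ-sound i (m *ᵐ k) ⟩
        Vec.lookup ρ i * ⟦ m *ᵐ k ⟧ᵐ        ≡⟨ cong (Vec.lookup ρ i *_) (*ᵐ-sound m k) ⟩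
        Vec.lookup ρ i * (⟦ m ⟧ᵐ * ⟦ k ⟧ᵐ)  ≡⟨ sym (*-assoc (Vec.lookup ρ i) ⟦ m ⟧ᵐ ⟦ k ⟧ᵐ) ⟩
        Vec.lookup ρ i * ⟦ m ⟧ᵐ * ⟦ k ⟧ᵐ ∎

      insert-sound : ∀ c m p → ⟦ insert c m p ⟧ ≡ ιᶻ c * ⟦ m ⟧ᵐ + ⟦ p ⟧
      insert-sound c m [] = refl
      insert-sound c m ((d , k) ∷ p) with ≡-dec Finₚ._≟_ m k
      ... | yes refl = begin
        ιᶻ (c ℤ.+ d) * x + y              ≡⟨ cong (λ z → z * x + y) (ιᶻ-+ c d) ⟩
        (ιᶻ c + ιᶻ d) * x + y             ≡⟨ cong (_+ y) (distribʳ x (ιᶻ c) (ιᶻ d)) ⟩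
        (ιᶻ c * x + ιᶻ d * x) + y         ≡⟨ +-assoc (ιᶻ c * x) (ιᶻ d * x) y ⟩
        ιᶻ c * x + (ιᶻ d * x + y) ∎
        where x = ⟦ m ⟧ᵐ
              y = ⟦ p ⟧
      ... | no _ with m <ᵐ k
      ...   | true = refl
      ...   | false = begin
        b + ⟦ insert c m p ⟧   ≡⟨ cong (b +_) (insert-sound c m p) ⟩
        b + (a + ⟦ p ⟧)        ≡⟨ sym (+-assoc b a ⟦ p ⟧) ⟩
        (b + a) + ⟦ p ⟧        ≡⟨ cong (_+ ⟦ p ⟧) (+-comm b a) ⟩
        (a + b) + ⟦ p ⟧        ≡⟨ +-assoc a b ⟦ p ⟧ ⟩
        a + (b + ⟦ p ⟧) ∎
        where a = ιᶻ c * ⟦ m ⟧ᵐ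
              b = ιᶻ d * ⟦ k ⟧ᵐ

      +ᵖ-sound : ∀ p q → ⟦ p +ᵖ q ⟧ ≡ ⟦ p ⟧ + ⟦ q ⟧
      +ᵖ-sound [] q = sym (+-identityˡ ⟦ q ⟧)
      +ᵖ-sound ((c , m) ∷ p) q = begin
        ⟦ insert c m (p +ᵖ q) ⟧                ≡⟨ insert-sound c m (p +ᵖ q) ⟩
        ιᶻ c * ⟦ m ⟧ᵐ + ⟦ p +ᵖ q ⟧             ≡⟨ cong (ιᶻ c * ⟦ m ⟧ᵐ +_) (+ᵖ-sound p q) ⟩
        ιᶻ c * ⟦ m ⟧ᵐ + (⟦ p ⟧ + ⟦ q ⟧)        ≡⟨ sym (+-assoc _ ⟦ p ⟧ ⟦ q ⟧) ⟩
        ιᶻ c * ⟦ m ⟧ᵐ + ⟦ p ⟧ + ⟦ q ⟧ ∎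

      termᵖ-sound : ∀ c m q → ⟦ termᵖ c m q ⟧ ≡ ιᶻ c * ⟦ m ⟧ᵐ * ⟦ q ⟧
      termᵖ-sound c m [] = sym (zeroʳ _)
      termᵖ-sound c m ((d , k) ∷ q) = begin
        ⟦ insert (c ℤ.* d) (m *ᵐ k) (termᵖ c m q) ⟧
          ≡⟨ insert-sound (c ℤ.* d) (m *ᵐ k) (termᵖ c m q) ⟩
        ιᶻ (c ℤ.* d) * ⟦ m *ᵐ k ⟧ᵐ + ⟦ termᵖ c m q ⟧
          ≡⟨ cong₂ _+_ (cong₂ _*_ (ιᶻ-* c d) (*ᵐ-sound m k)) (termᵖ-sound c m q) ⟩
        (ιᶻ c * ιᶻ d) * (⟦ m ⟧ᵐ * ⟦ k ⟧ᵐ) + ιᶻ c * ⟦ m ⟧ᵐ * ⟦ q ⟧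
          ≡⟨ cong (_+ ιᶻ c * ⟦ m ⟧ᵐ * ⟦ q ⟧) (*-interchange (ιᶻ c) (ιᶻ d) ⟦ m ⟧ᵐ ⟦ k ⟧ᵐ) ⟩
        (ιᶻ c * ⟦ m ⟧ᵐ) * (ιᶻ d * ⟦ k ⟧ᵐ) + ιᶻ c * ⟦ m ⟧ᵐ * ⟦ q ⟧
          ≡⟨ sym (distribˡ (ιᶻ c * ⟦ m ⟧ᵐ) (ιᶻ d * ⟦ k ⟧ᵐ) ⟦ q ⟧) ⟩
        ιᶻ c * ⟦ m ⟧ᵐ * (ιᶻ d * ⟦ k ⟧ᵐ + ⟦ q ⟧) ∎

      *ᵖ-sound : ∀ p q → ⟦ p *ᵖ q ⟧ ≡ ⟦ p ⟧ * ⟦ q ⟧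
      *ᵖ-sound [] q = sym (zeroˡ ⟦ q ⟧)
      *ᵖ-sound ((c , m) ∷ p) q = begin
        ⟦ termᵖ c m q +ᵖ (p *ᵖ q) ⟧                  ≡⟨ +ᵖ-sound (termᵖ c m q) (p *ᵖ q) ⟩
        ⟦ termᵖ c m q ⟧ + ⟦ p *ᵖ q ⟧                 ≡⟨ cong₂ _+_ (termᵖ-sound c m q) (*ᵖ-sound p q) ⟩
        ιᶻ c * ⟦ m ⟧ᵐ * ⟦ q ⟧ + ⟦ p ⟧ * ⟦ q ⟧        ≡⟨ sym (distribʳ ⟦ q ⟧ _ ⟦ p ⟧) ⟩
        (ιᶻ c * ⟦ m ⟧ᵐ + ⟦ p ⟧) * ⟦ q ⟧ ∎

      scaleᵖ-sound : ∀ c p → ⟦ scaleᵖ c p ⟧ ≡ ιᶻ c * ⟦ p ⟧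
      scaleᵖ-sound c [] = sym (zeroʳ (ιᶻ c))
      scaleᵖ-sound c ((d , k) ∷ p) = begin
        ιᶻ (c ℤ.* d) * ⟦ k ⟧ᵐ + ⟦ scaleᵖ c p ⟧
          ≡⟨ cong₂ _+_ (cong (_* ⟦ k ⟧ᵐ) (ιᶻ-* c d)) (scaleᵖ-sound c p) ⟩
        ιᶻ c * ιᶻ d * ⟦ k ⟧ᵐ + ιᶻ c * ⟦ p ⟧
          ≡⟨ cong (_+ ιᶻ c * ⟦ p ⟧) (*-assoc (ιᶻ c) (ιᶻ d) ⟦ k ⟧ᵐ) ⟩
        ιᶻ c * (ιᶻ d * ⟦ k ⟧ᵐ) + ιᶻ c * ⟦ p ⟧
          ≡⟨ sym (distribˡ (ιᶻ c) _ ⟦ p ⟧) ⟩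
        ιᶻ c * (ιᶻ d * ⟦ k ⟧ᵐ + ⟦ p ⟧) ∎

      negate-sound : ∀ p → ⟦ scaleᵖ -[1+ 0 ] p ⟧ ≡ - ⟦ p ⟧
      negate-sound p = begin
        ⟦ scaleᵖ -[1+ 0 ] p ⟧  ≡⟨ scaleᵖ-sound -[1+ 0 ] p ⟩
        - ι 1 * ⟦ p ⟧          ≡⟨ neg-*ˡ (ι 1) ⟦ p ⟧ ⟩
        - (ι 1 * ⟦ p ⟧)        ≡⟨ cong -_ (*-identityˡ ⟦ p ⟧) ⟩
        - ⟦ p ⟧ ∎

      normal-sound : ∀ e → ⟦ normal e ⟧ ≡ eval ρ e
      normal-sound (var i) = trans (+-identityʳ _) (trans (*-identityˡ _) (*-identityʳ _))
      normal-sound (# k) = trans (+-identityʳ _) (*-identityʳ _)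
      normal-sound (e :+ f) =
        trans (+ᵖ-sound (normal e) (normal f)) (cong₂ _+_ (normal-sound e) (normal-sound f))
      normal-sound (e :* f) =
        trans (*ᵖ-sound (normal e) (normal f)) (cong₂ _*_ (normal-sound e) (normal-sound f))
      normal-sound (e :- f) =
        trans (+ᵖ-sound (normal e) (scaleᵖ -[1+ 0 ] (normal f)))
          (cong₂ _+_ (normal-sound e) (trans (negate-sound (normal f)) (cong -_ (normal-sound f))))
      normal-sound (:- e) = trans (negate-sound (normal e)) (cong -_ (normal-sound e))

      isNonneg-sound : ∀ p → Bool.T (isNonneg p) → ι 0 ≤ ⟦ p ⟧
      isNonneg-sound [] _ = ≤-refl
      isNonneg-sound ((pos c , []) ∷ p) t =
        subst (_≤ ι c * ι 1 + ⟦ p ⟧) (+-identityˡ (ι 0))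
          (+-mono-≤ (subst (ι 0 ≤_) (sym (*-identityʳ (ι c))) (ι-nonneg c)) (isNonneg-sound p t))
      isNonneg-sound ((pos zero , i ∷ m) ∷ p) t =
        subst (ι 0 ≤_) (sym (trans (cong (_+ ⟦ p ⟧) (zeroˡ _)) (+-identityˡ ⟦ p ⟧))) (isNonneg-sound p t)
      isNonneg-sound ((pos (suc _) , i ∷ m) ∷ p) ()
      isNonneg-sound ((-[1+ _ ] , m) ∷ p) ()

      combine-sound : ∀ cs Γ → All (λ p → ι 0 ≤ ⟦ p ⟧) Γ → ι 0 ≤ ⟦ combine cs Γ ⟧
      combine-sound [] [] h = ≤-refl
      combine-sound [] (_ ∷ _) h = ≤-refl
      combine-sound (_ ∷ _) [] h = ≤-refl
      combine-sound (c ∷ cs) (p ∷ Γ) (hp ∷ h) =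
        subst₂ _≤_ (+-identityˡ (ι 0))
          (sym (trans (+ᵖ-sound (scaleᵖ (pos c) p) (combine cs Γ))
            (cong (_+ ⟦ combine cs Γ ⟧) (scaleᵖ-sound (pos c) p))))
          (+-mono-≤ (*-nonneg (ι-nonneg c) hp) (combine-sound cs Γ h))

      -- If x ≤ 0, then (k + 1) x ≤ x, and the hypothesis again gives 0 ≤ x.
      cancel-ι : ∀ k x → ι 0 ≤ ι (suc k) * x → ι 0 ≤ x
      cancel-ι k x h =
        [ (λ 0≤x → 0≤x)
        , (λ x≤0 → ≤-trans h (subst₂ _≤_ e (+-identityʳ x) (+-mono-≤ ≤-refl (kx≤0 x≤0)))) ]′
        (≤-total (ι 0) x)
        where
        e : x + ι k * x ≡ ι (suc k) * x
        e = begin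
          x + ι k * x           ≡⟨ cong (_+ ι k * x) (sym (*-identityˡ x)) ⟩
          ι 1 * x + ι k * x     ≡⟨ sym (distribʳ x (ι 1) (ι k)) ⟩
          (ι 1 + ι k) * x       ≡⟨ cong (_* x) (sym (ι-suc k)) ⟩
          ι (suc k) * x ∎
        0≤-x : x ≤ ι 0 → ι 0 ≤ - x
        0≤-x x≤0 = subst₂ _≤_ (-‿inverseʳ x) (+-identityˡ (- x)) (+-mono-≤ x≤0 ≤-refl)
        kx≤0 : x ≤ ι 0 → ι k * x ≤ ι 0
        kx≤0 x≤0 =
          subst₂ _≤_ (+-identityˡ (ι k * x))
            (trans (cong (_+ ι k * x) (neg-*ʳ (ι k) x)) (-‿inverseˡ (ι k * x)))
            (+-mono-≤ (*-nonneg (ι-nonneg k) (0≤-x x≤0)) ≤-refl)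

      check-sound : ∀ Γ g cs → Bool.T (check Γ g cs) → All (λ p → ι 0 ≤ ⟦ p ⟧) Γ → ι 0 ≤ ⟦ g ⟧
      check-sound Γ g (suc k ∷ cs) t h =
        cancel-ι k ⟦ g ⟧ (subst₂ _≤_ (+-identityˡ (ι 0)) e
          (+-mono-≤ (isNonneg-sound (scaleᵖ (pos (suc k)) g +ᵖ scaleᵖ -[1+ 0 ] c) t) (combine-sound cs Γ h)))
        where
        c = combine cs Γ
        e : ⟦ scaleᵖ (pos (suc k)) g +ᵖ scaleᵖ -[1+ 0 ] c ⟧ + ⟦ c ⟧ ≡ ι (suc k) * ⟦ g ⟧
        e = begin
          ⟦ scaleᵖ (pos (suc k)) g +ᵖ scaleᵖ -[1+ 0 ] c ⟧ + ⟦ c ⟧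
            ≡⟨ cong (_+ ⟦ c ⟧) (+ᵖ-sound (scaleᵖ (pos (suc k)) g) _) ⟩
          ⟦ scaleᵖ (pos (suc k)) g ⟧ + ⟦ scaleᵖ -[1+ 0 ] c ⟧ + ⟦ c ⟧
            ≡⟨ cong₂ (λ a b → a + b + ⟦ c ⟧) (scaleᵖ-sound (pos (suc k)) g) (negate-sound c) ⟩
          ι (suc k) * ⟦ g ⟧ + - ⟦ c ⟧ + ⟦ c ⟧
            ≡⟨ +-assoc _ (- ⟦ c ⟧) ⟦ c ⟧ ⟩
          ι (suc k) * ⟦ g ⟧ + (- ⟦ c ⟧ + ⟦ c ⟧)
            ≡⟨ cong (ι (suc k) * ⟦ g ⟧ +_) (-‿inverseˡ ⟦ c ⟧) ⟩
          ι (suc k) * ⟦ g ⟧ + ι 0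
            ≡⟨ +-identityʳ _ ⟩
          ι (suc k) * ⟦ g ⟧ ∎

      ≤⇒diff : ∀ {x y} → x ≤ y → ι 0 ≤ y - x
      ≤⇒diff {x} h = subst (_≤ _) (-‿inverseʳ x) (+-mono-≤ h ≤-refl)

      diff⇒≤ : ∀ {x y} → ι 0 ≤ y - x → x ≤ y
      diff⇒≤ {x} {y} h =
        subst₂ _≤_ (+-identityˡ x)
          (trans (+-assoc y (- x) x) (trans (cong (y +_) (-‿inverseˡ x)) (+-identityʳ y)))
          (+-mono-≤ h ≤-refl)

      fromExpr : ∀ e f → eval ρ e ≤ eval ρ f → ι 0 ≤ ⟦ normal (f :- e) ⟧
      fromExpr e f h = subst (ι 0 ≤_) (sym (normal-sound (f :- e))) (≤⇒diff h)

      toExpr : ∀ e f → ι 0 ≤ ⟦ normal (f :- e) ⟧ → eval ρ e ≤ eval ρ f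
      toExpr e f h = diff⇒≤ (subst (ι 0 ≤_) (normal-sound (f :- e)) h)

      prove-sound : ∀ Γ g → Bool.T (prove Γ g) → All (λ p → ι 0 ≤ ⟦ p ⟧) Γ → ι 0 ≤ ⟦ g ⟧
      prove-sound Γ g = check-sound Γ g (search Γ g)

      decide-sound : ∀ Γ φ → Bool.T (decide Γ φ) → All (λ p → ι 0 ≤ ⟦ p ⟧) Γ → holds ρ φ
      decide-sound Γ (e :≤ f) t h = toExpr e f (prove-sound Γ (normal (f :- e)) t h)
      decide-sound Γ (e := f) t h =
        let t₁ , t₂ = Equivalence.to (T-∧ {prove Γ (normal (f :- e))}) t in
        ≤-antisym (toExpr e f (prove-sound Γ (normal (f :- e)) t₁ h))
                  (toExpr f e (prove-sound Γ (normal (e :- f)) t₂ h))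
      decide-sound Γ ((e :≤ f) ⇒ ψ) t h h′ = decide-sound (normal (f :- e) ∷ Γ) ψ t (fromExpr e f h′ ∷ h)
      decide-sound Γ ((e := f) ⇒ ψ) t h h′ =
        decide-sound (normal (f :- e) ∷ normal (e :- f) ∷ Γ) ψ t (fromExpr e f (subst (eval ρ e ≤_) h′ ≤-refl)
          ∷ fromExpr f e (subst (_≤ eval ρ e) h′ ≤-refl) ∷ h)
      decide-sound Γ ((_ ⇒ _) ⇒ _) () h

  Nary : ℕ → Set → Set → Set
  Nary zero A B = B
  Nary (suc n) A B = A → Nary n A B

  apply : ∀ {A B : Set} n → Nary n A B → Vec A n → B
  apply zero f [] = f
  apply (suc n) f (x ∷ xs) = apply n (f x) xs

  private
    ForAll : ∀ n → (Vec R n → Set) → Set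
    ForAll zero P = P []
    ForAll (suc n) P = ∀ {x} → ForAll n (λ xs → P (x ∷ xs))

    forAll : ∀ n {P : Vec R n → Set} → (∀ ρ → P ρ) → ForAll n P
    forAll zero h = h []
    forAll (suc n) h = forAll n (λ xs → h (_ ∷ xs))

  vars : ∀ n → Vec (Expr n) n
  vars n = Vec.tabulate var

  -- Proves an inequality or an equation from hypotheses of the same kind when it is a nonnegative
  -- linear combination of them, the nonlinear monomials being treated as unknowns.
  arith : ∀ n (f : Nary n (Expr n) (Formula n)) {_ : Bool.T (decide [] (apply n f (vars n)))} →
          ForAll n (λ ρ → holds ρ (apply n f (vars n)))
  arith n f {t} = forAll n (λ ρ → decide-sound ρ [] (apply n f (vars n)) t [])

  ι-mono : ∀ {m n} → m ℕ.≤ n → ι m ≤ ι n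
  ι-mono ℕ.z≤n = ι-nonneg _
  ι-mono (ℕ.s≤s {m} {n} h) =
    subst₂ _≤_ (sym (ι-suc m)) (sym (ι-suc n)) (+-mono-≤ ≤-refl (ι-mono h))

  ι-cancel : ∀ {m n} → ι m ≤ ι n → m ℕ.≤ n
  ι-cancel {zero} h = ℕ.z≤n
  ι-cancel {suc m} {zero} h = ⊥-elim (1≰0 (≤-trans (ι-mono ℕ.z<s) h))
  ι-cancel {suc m} {suc n} h =
    ℕ.s≤s (ι-cancel (arith 3 (λ x y z → x :+ y :≤ x :+ z ⇒ y :≤ z) {x = ι 1}
      (subst₂ _≤_ (ι-suc m) (ι-suc n) h)))

  module _ {n : ℕ} where
    evalℕ : Vec ℕ n → Expr n → ℕ
    evalℕ ρ (var i) = Vec.lookup ρ i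
    evalℕ ρ (# k) = k
    evalℕ ρ (e :+ f) = evalℕ ρ e ℕ.+ evalℕ ρ f
    evalℕ ρ (e :* f) = evalℕ ρ e ℕ.* evalℕ ρ f
    -- Default values: `semiringExpr` rejects subtraction and negation.
    evalℕ ρ (e :- f) = 0
    evalℕ ρ (:- e) = 0

    semiringExpr : Expr n → Bool
    semiringExpr (var i) = true
    semiringExpr (# k) = true
    semiringExpr (e :+ f) = semiringExpr e ∧ semiringExpr f
    semiringExpr (e :* f) = semiringExpr e ∧ semiringExpr f
    semiringExpr (e :- f) = false
    semiringExpr (:- e) = false

    semiringFormula : Formula n → Bool
    semiringFormula (e :≤ f) = semiringExpr e ∧ semiringExpr f
    semiringFormula (e := f) = semiringExpr e ∧ semiringExpr f
    semiringFormula (φ ⇒ ψ) = semiringFormula φ ∧ semiringFormula ψ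

    holdsℕ : Vec ℕ n → Formula n → Set
    holdsℕ ρ (e :≤ f) = evalℕ ρ e ℕ.≤ evalℕ ρ f
    holdsℕ ρ (e := f) = evalℕ ρ e ≡ evalℕ ρ f
    holdsℕ ρ (φ ⇒ ψ) = holdsℕ ρ φ → holdsℕ ρ ψ

    private
      both : ∀ {a b} → Bool.T (a ∧ b) → Bool.T a × Bool.T b
      both {a} = Equivalence.to (T-∧ {a})

    ι-evalℕ : ∀ ρ e → Bool.T (semiringExpr e) → ι (evalℕ ρ e) ≡ eval (Vec.map ι ρ) e
    ι-evalℕ ρ (var i) t = sym (lookup-map i ι ρ)
    ι-evalℕ ρ (# k) t = refl
    ι-evalℕ ρ (e :+ f) t =
      let t₁ , t₂ = both {semiringExpr e} t in
      trans (ι-+ (evalℕ ρ e) (evalℕ ρ f)) (cong₂ _+_ (ι-evalℕ ρ e t₁) (ι-evalℕ ρ f t₂))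
    ι-evalℕ ρ (e :* f) t =
      let t₁ , t₂ = both {semiringExpr e} t in
      trans (ι-* (evalℕ ρ e) (evalℕ ρ f)) (cong₂ _*_ (ι-evalℕ ρ e t₁) (ι-evalℕ ρ f t₂))

    mutual
      -- Both directions are proved together, since an implication reverses the direction in its
      -- hypothesis.
      fromℕ : ∀ ρ φ → Bool.T (semiringFormula φ) → holdsℕ ρ φ → holds (Vec.map ι ρ) φ
      fromℕ ρ (e :≤ f) t h =
        let t₁ , t₂ = both {semiringExpr e} t in
        subst₂ _≤_ (ι-evalℕ ρ e t₁) (ι-evalℕ ρ f t₂) (ι-mono h)
      fromℕ ρ (e := f) t h =
        let t₁ , t₂ = both {semiringExpr e} t in
        subst₂ _≡_ (ι-evalℕ ρ e t₁) (ι-evalℕ ρ f t₂) (cong ι h)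
      fromℕ ρ (φ ⇒ ψ) t h k =
        let t₁ , t₂ = both {semiringFormula φ} t in
        fromℕ ρ ψ t₂ (h (toℕ′ ρ φ t₁ k))

      toℕ′ : ∀ ρ φ → Bool.T (semiringFormula φ) → holds (Vec.map ι ρ) φ → holdsℕ ρ φ
      toℕ′ ρ (e :≤ f) t h =
        let t₁ , t₂ = both {semiringExpr e} t in
        ι-cancel (subst₂ _≤_ (sym (ι-evalℕ ρ e t₁)) (sym (ι-evalℕ ρ f t₂)) h)
      toℕ′ ρ (e := f) t h =
        let t₁ , t₂ = both {semiringExpr e} t
            h′ = subst₂ _≡_ (sym (ι-evalℕ ρ e t₁)) (sym (ι-evalℕ ρ f t₂)) h in
        ℕₚ.≤-antisym (ι-cancel (subst (ι (evalℕ ρ e) ≤_) h′ ≤-refl))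
                     (ι-cancel (subst (_≤ ι (evalℕ ρ e)) h′ ≤-refl))
      toℕ′ ρ (φ ⇒ ψ) t h k =
        let t₁ , t₂ = both {semiringFormula φ} t in
        toℕ′ ρ ψ t₂ (h (fromℕ ρ φ t₁ k))

  nonnegatives : ∀ {n} → List (Fin n) → Formula n → Formula n
  nonnegatives [] φ = φ
  nonnegatives (i ∷ is) φ = (# 0 :≤ var i) ⇒ nonnegatives is φ

  private
    ForAllℕ : ∀ n → (Vec ℕ n → Set) → Set
    ForAllℕ zero P = P []
    ForAllℕ (suc n) P = ∀ x → ForAllℕ n (λ xs → P (x ∷ xs))

    forAllℕ : ∀ n {P : Vec ℕ n → Set} → (∀ ρ → P ρ) → ForAllℕ n P
    forAllℕ zero h = h []
    forAllℕ (suc n) h x = forAllℕ n (λ xs → h (x ∷ xs))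

    discharge : ∀ {n} (ρ : Vec ℕ n) is φ → holdsℕ ρ (nonnegatives is φ) → holdsℕ ρ φ
    discharge ρ [] φ h = h
    discharge ρ (i ∷ is) φ h = discharge ρ is φ (h ℕ.z≤n)

  -- Each variable is given the hypothesis that it is nonnegative, which embedded naturals satisfy
  -- but the search cannot guess.
  arithℕ : ∀ n (f : Nary n (Expr n) (Formula n)) →
           let φ = nonnegatives (List.allFin n) (apply n f (vars n)) in
           {_ : Bool.T (semiringFormula φ)} {_ : Bool.T (decide [] φ)} →
           ForAllℕ n (λ ρ → holdsℕ ρ (apply n f (vars n)))
  arithℕ n f {s} {t} = forAllℕ n (λ ρ → discharge ρ (List.allFin n) (apply n f (vars n))
    (toℕ′ ρ (nonnegatives (List.allFin n) (apply n f (vars n))) s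
      (decide-sound (Vec.map ι ρ) [] (nonnegatives (List.allFin n) (apply n f (vars n))) t [])))

-- Finite sums, reciprocals and integer quotients

infixl 7 _÷_

-- Total, with the default value 0, so that it can stand under sums and rewriting without instance
-- arguments.
_÷_ : ℕ → ℕ → ℕ
n ÷ zero = 0
n ÷ suc k = n ℕ./ suc k

module Sums (F : OrderedField) where
  open OrderedField F
  open LinearArithmetic F

  diff-nonneg : ∀ {a b} → a ≤ b → ι 0 ≤ b - a
  diff-nonneg = arith 2 (λ a b → a :≤ b ⇒ # 0 :≤ b :- a)

  *-swap : ∀ {x y} → x * y ≡ y * x
  *-swap = arith 2 (λ x y → x :* y := y :* x)

  *-zero : ∀ {x} → x * ι 0 ≡ ι 0
  *-zero = arith 1 (λ x → x :* # 0 := # 0)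

  *-one : ∀ {x} → x * ι 1 ≡ x
  *-one = arith 1 (λ x → x :* # 1 := x)

  *-monoˡ : ∀ {a b} c → ι 0 ≤ c → a ≤ b → c * a ≤ c * b
  *-monoˡ {a} {b} c h k =
    arith 3 (λ a b c → # 0 :≤ c :* (b :- a) ⇒ c :* a :≤ c :* b)
      (*-nonneg h (diff-nonneg k))

  *-monoʳ : ∀ {a b} c → ι 0 ≤ c → a ≤ b → a * c ≤ b * c
  *-monoʳ {a} {b} c h k = arith 3 (λ a b c → c :* a :≤ c :* b ⇒ a :* c :≤ b :* c) (*-monoˡ c h k)

  *-mono : ∀ {a b c d} → ι 0 ≤ a → ι 0 ≤ c → a ≤ b → c ≤ d → a * c ≤ b * d
  *-mono {a} {b} {c} {d} ha hc h k =
    ≤-trans (*-monoˡ a ha k) (*-monoʳ d (≤-trans hc k) h)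

  ≡⇒≤ : ∀ {a b} → a ≡ b → a ≤ b
  ≡⇒≤ refl = ≤-refl

  ≤-irrefl-suc : ∀ {n} → ¬ (ι (suc n) ≤ ι n)
  ≤-irrefl-suc h = ℕₚ.1+n≰n (ι-cancel h)

  -- The default at 0 keeps `inv-nonneg` and `inv≤1` unconditional.
  inv : ℕ → R
  inv zero = ι 0
  inv (suc n) = recip n

  inv-cancel : ∀ n → 1 ℕ.≤ n → ι n * inv n ≡ ι 1
  inv-cancel (suc n) _ = recip-inverse n

  square-nonneg : ∀ x → ι 0 ≤ x * x
  square-nonneg x =
    [ (λ h → *-nonneg h h)
    , (λ h → arith 1 (λ x → # 0 :≤ (:- x) :* (:- x) ⇒ # 0 :≤ x :* x)
               (*-nonneg (nonpos h) (nonpos h))) ]′ (≤-total (ι 0) x)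
    where
    nonpos : x ≤ ι 0 → ι 0 ≤ - x
    nonpos = arith 1 (λ x → x :≤ # 0 ⇒ # 0 :≤ :- x)

  -- A reciprocal is n times its own square.
  inv-nonneg : ∀ n → ι 0 ≤ inv n
  inv-nonneg zero = ≤-refl
  inv-nonneg (suc n) =
    arith 2 (λ n x → # 0 :≤ n :* (x :* x) ⇒ n :* x := # 1 ⇒ n :* x :* x := x ⇒ # 0 :≤ x)
      (*-nonneg (ι-nonneg (suc n)) (square-nonneg (recip n))) (recip-inverse n)
      (trans (cong (_* recip n) (recip-inverse n)) (arith 1 (λ x → # 1 :* x := x)))

  cancel-ιˡ : ∀ {x y} n → 1 ℕ.≤ n → ι n * x ≤ ι n * y → x ≤ y
  cancel-ιˡ {x} {y} n 1≤n h =
    subst₂ _≤_ (e x) (e y) (*-monoˡ (inv n) (inv-nonneg n) h)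
    where
    e : ∀ z → inv n * (ι n * z) ≡ z
    e z = trans (arith 3 (λ i n z → i :* (n :* z) := n :* i :* z))
            (trans (cong (_* z) (inv-cancel n 1≤n)) (arith 1 (λ z → # 1 :* z := z)))

  inv-unique : ∀ {x} n → 1 ℕ.≤ n → ι n * x ≡ ι 1 → x ≡ inv n
  inv-unique n 1≤n h =
    ≤-antisym (cancel-ιˡ n 1≤n (≡⇒≤ e)) (cancel-ιˡ n 1≤n (≡⇒≤ (sym e)))
    where e = trans h (sym (inv-cancel n 1≤n))

  inv-* : ∀ m n → 1 ℕ.≤ m → 1 ℕ.≤ n → inv (m ℕ.* n) ≡ inv m * inv n
  inv-* m n hm hn = sym (inv-unique (m ℕ.* n) (ℕₚ.*-mono-≤ hm hn) (begin
    ι (m ℕ.* n) * (inv m * inv n)      ≡⟨ cong (_* (inv m * inv n)) (ι-* m n) ⟩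
    ι m * ι n * (inv m * inv n)        ≡⟨ arith 4 (λ a b c d → a :* b :* (c :* d) := (a :* c) :* (b :* d)) ⟩
    (ι m * inv m) * (ι n * inv n)      ≡⟨ cong₂ _*_ (inv-cancel m hm) (inv-cancel n hn) ⟩
    ι 1 * ι 1                          ≡⟨ arith 0 (# 1 :* # 1 := # 1) ⟩
    ι 1 ∎))
    where open ≡-Reasoning

  inv-1 : inv 1 ≡ ι 1
  inv-1 = sym (inv-unique 1 ℕₚ.≤-refl (arith 0 (# 1 :* # 1 := # 1)))

  inv-anti : ∀ {m n} → 1 ℕ.≤ m → m ℕ.≤ n → inv n ≤ inv m
  inv-anti {m} {n} 1≤m m≤n = cancel-ιˡ n 1≤n
    (subst (_≤ ι n * inv m) (trans (inv-cancel m 1≤m) (sym (inv-cancel n 1≤n)))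
      (*-monoʳ (inv m) (inv-nonneg m) (ι-mono m≤n)))
    where 1≤n = ℕₚ.≤-trans 1≤m m≤n

  inv≤1 : ∀ n → inv n ≤ ι 1
  inv≤1 zero = 0≤1
  inv≤1 (suc n) = subst (inv (suc n) ≤_) inv-1 (inv-anti {1} ℕₚ.≤-refl ℕ.z<s)

  ÷-lower : ∀ n d → d ℕ.* (n ÷ d) ℕ.≤ n
  ÷-lower n zero = ℕ.z≤n
  ÷-lower n d@(suc _) =
    subst (ℕ._≤ n) (ℕₚ.*-comm (n ÷ d) d)
      (subst (n ÷ d ℕ.* d ℕ.≤_) (sym (DivMod.m≡m%n+[m/n]*n n d)) (ℕₚ.m≤n+m _ (n ℕ.% d)))

  ÷-upper : ∀ n d → 1 ℕ.≤ d → n ℕ.< d ℕ.* suc (n ÷ d)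
  ÷-upper n d@(suc _) _ =
    subst (ℕ._< d ℕ.* suc (n ÷ d)) (sym (DivMod.m≡m%n+[m/n]*n n d))
      (arithℕ 3 (λ r q d → # 1 :+ r :≤ d ⇒ # 1 :+ (r :+ q :* d) :≤ d :* (# 1 :+ q))
        (n ℕ.% d) (n ÷ d) d (DivMod.m%n<n n d))

  ÷-unique : ∀ {n} d q → d ℕ.* q ℕ.≤ n → n ℕ.< d ℕ.* suc q → n ÷ d ≡ q
  ÷-unique {n} zero q h k = ⊥-elim (ℕₚ.n≮0 k)
  ÷-unique {n} d@(suc _) q h k = ℕₚ.≤-antisym
    (ℕₚ.≤-pred (ℕₚ.*-cancelˡ-< d _ _ (ℕₚ.≤-<-trans (÷-lower n d) k)))
    (ℕₚ.≤-pred (ℕₚ.*-cancelˡ-< d _ _ (ℕₚ.≤-<-trans h (÷-upper n d ℕ.z<s))))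

  ÷-≤ : ∀ n d → n ÷ d ℕ.≤ n
  ÷-≤ n zero = ℕ.z≤n
  ÷-≤ n d@(suc _) = DivMod.m/n≤m n d

  ÷-mono : ∀ {m n} d → m ℕ.≤ n → m ÷ d ℕ.≤ n ÷ d
  ÷-mono zero h = ℕ.z≤n
  ÷-mono d@(suc _) h = DivMod./-monoˡ-≤ d h

  ÷-greatest : ∀ {n} d q → 1 ℕ.≤ d → d ℕ.* q ℕ.≤ n → q ℕ.≤ n ÷ d
  ÷-greatest {n} d@(suc _) q 1≤d h = ℕₚ.≤-pred (ℕₚ.*-cancelˡ-< d _ _ (ℕₚ.≤-<-trans h (÷-upper n d 1≤d)))

  ÷-small : ∀ {n} d → n ℕ.< d → n ÷ d ≡ 0
  ÷-small {n} d h = ÷-unique d 0 (subst (ℕ._≤ n) (sym (ℕₚ.*-zeroʳ d)) ℕ.z≤n)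
    (subst (n ℕ.<_) (sym (ℕₚ.*-identityʳ d)) h)

  ÷-1 : ∀ n → n ÷ 1 ≡ n
  ÷-1 n = DivMod.n/1≡n n

  ÷-÷ : ∀ n a b → 1 ℕ.≤ a → 1 ℕ.≤ b → (n ÷ a) ÷ b ≡ n ÷ (a ℕ.* b)
  ÷-÷ n a b 1≤a 1≤b = sym (÷-unique (a ℕ.* b) q lower upper)
    where
    p = n ÷ a
    q = p ÷ b
    lower : a ℕ.* b ℕ.* q ℕ.≤ n
    lower = ℕₚ.≤-trans (subst (ℕ._≤ a ℕ.* p) (sym (ℕₚ.*-assoc a b q))
              (ℕₚ.*-monoʳ-≤ a (÷-lower p b))) (÷-lower n a)
    upper : n ℕ.< a ℕ.* b ℕ.* suc q
    upper = ℕₚ.<-≤-trans (÷-upper n a 1≤a) (subst (a ℕ.* suc p ℕ.≤_) (sym (ℕₚ.*-assoc a b (suc q)))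
              (ℕₚ.*-monoʳ-≤ a (÷-upper p b 1≤b)))

  ÷-inv-lower : ∀ n d → 1 ℕ.≤ d → ι (n ÷ d) ≤ ι n * inv d
  ÷-inv-lower n d 1≤d = cancel-ιˡ d 1≤d
    (arith 4 (λ q n d i → d :* q :≤ n ⇒ n :* (d :* i) := n :* # 1 ⇒ d :* q :≤ d :* (n :* i))
      (subst (_≤ ι n) (ι-* d (n ÷ d)) (ι-mono (÷-lower n d))) (cong (ι n *_) (inv-cancel d 1≤d)))

  ÷-inv-upper : ∀ n d → 1 ℕ.≤ d → ι n * inv d ≤ ι (n ÷ d) + ι 1
  ÷-inv-upper n d 1≤d = cancel-ιˡ d 1≤d
    (arith 4 (λ q n d i → n :≤ d :* (# 1 :+ q) ⇒ n :* (d :* i) := n :* # 1 ⇒ d :* (n :* i) :≤ d :* (q :+ # 1))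
      (subst (ι n ≤_) (trans (ι-* d (suc (n ÷ d))) (cong (ι d *_) (ι-suc (n ÷ d))))
        (ι-mono (ℕₚ.<⇒≤ (÷-upper n d 1≤d)))) (cong (ι n *_) (inv-cancel d 1≤d)))

  -- The index runs from 1, so divisors and reciprocals never meet 0.
  ∑ : ℕ → (ℕ → R) → R
  ∑ zero f = ι 0
  ∑ (suc n) f = ∑ n f + f (suc n)

  syntax ∑ n (λ k → t) = ∑[ k ≤ n ] t

  ∑-mono : ∀ n {f g : ℕ → R} → (∀ k → 1 ℕ.≤ k → k ℕ.≤ n → f k ≤ g k) → ∑ n f ≤ ∑ n g
  ∑-mono zero h = ≤-refl
  ∑-mono (suc n) h =
    +-mono-≤ (∑-mono n (λ k 1≤k k≤n → h k 1≤k (ℕₚ.m≤n⇒m≤1+n k≤n))) (h (suc n) ℕ.z<s ℕₚ.≤-refl)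

  ∑-cong : ∀ n {f g : ℕ → R} → (∀ k → 1 ℕ.≤ k → k ℕ.≤ n → f k ≡ g k) → ∑ n f ≡ ∑ n g
  ∑-cong zero h = refl
  ∑-cong (suc n) h =
    cong₂ _+_ (∑-cong n (λ k 1≤k k≤n → h k 1≤k (ℕₚ.m≤n⇒m≤1+n k≤n))) (h (suc n) ℕ.z<s ℕₚ.≤-refl)

  ∑-+ : ∀ n (f g : ℕ → R) → ∑ n (λ k → f k + g k) ≡ ∑ n f + ∑ n g
  ∑-+ zero f g = arith 0 (# 0 := # 0 :+ # 0)
  ∑-+ (suc n) f g = trans (cong (_+ (f (suc n) + g (suc n))) (∑-+ n f g))
    (arith 4 (λ a b c d → (a :+ b) :+ (c :+ d) := (a :+ c) :+ (b :+ d)))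

  ∑-*ˡ : ∀ n c (f : ℕ → R) → ∑ n (λ k → c * f k) ≡ c * ∑ n f
  ∑-*ˡ zero c f = arith 1 (λ c → # 0 := c :* # 0)
  ∑-*ˡ (suc n) c f = trans (cong (_+ c * f (suc n)) (∑-*ˡ n c f))
    (arith 3 (λ c a b → c :* a :+ c :* b := c :* (a :+ b)))

  ∑-neg : ∀ n (f : ℕ → R) → ∑ n (λ k → - f k) ≡ - ∑ n f
  ∑-neg zero f = arith 0 (# 0 := :- # 0)
  ∑-neg (suc n) f = trans (cong (_+ - f (suc n)) (∑-neg n f))
    (arith 2 (λ a b → (:- a) :+ (:- b) := :- (a :+ b)))

  ∑-minus : ∀ n (f g : ℕ → R) → ∑ n (λ k → f k - g k) ≡ ∑ n f - ∑ n g
  ∑-minus n f g = trans (∑-+ n f (λ k → - g k)) (cong (∑ n f +_) (∑-neg n g))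

  ∑-const : ∀ n c → ∑ n (λ _ → c) ≡ ι n * c
  ∑-const zero c = arith 1 (λ c → # 0 := # 0 :* c)
  ∑-const (suc n) c = trans (cong (_+ c) (∑-const n c))
    (trans (arith 2 (λ n c → n :* c :+ c := (# 1 :+ n) :* c)) (cong (_* c) (sym (ι-suc n))))

  ∑-zero : ∀ n → ∑ n (λ _ → ι 0) ≡ ι 0
  ∑-zero n = trans (∑-const n (ι 0)) (arith 1 (λ n → n :* # 0 := # 0))

  ∑-nonneg : ∀ n {f : ℕ → R} → (∀ k → 1 ℕ.≤ k → k ℕ.≤ n → ι 0 ≤ f k) → ι 0 ≤ ∑ n f
  ∑-nonneg n {f} h = subst (_≤ ∑ n f) (∑-zero n) (∑-mono n h)

  ∑-swap : ∀ m n (f : ℕ → ℕ → R) → ∑ m (λ i → ∑ n (f i)) ≡ ∑ n (λ j → ∑ m (λ i → f i j))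
  ∑-swap zero n f = sym (∑-zero n)
  ∑-swap (suc m) n f =
    trans (cong (_+ ∑ n (f (suc m))) (∑-swap m n f)) (sym (∑-+ n (λ j → ∑ m (λ i → f i j)) (f (suc m))))

  ∑-extend : ∀ {m n} {f : ℕ → R} → m ℕ.≤ n → (∀ k → m ℕ.< k → k ℕ.≤ n → f k ≡ ι 0) → ∑ n f ≡ ∑ m f
  ∑-extend {m} {n} {f} m≤n h with ℕₚ.m≤n⇒m<n∨m≡n m≤n
  ... | inj₂ refl = refl
  ∑-extend {m} {suc n} {f} m≤n h | inj₁ (ℕ.s≤s m≤n′) =
    trans (cong₂ _+_ (∑-extend m≤n′ (λ k l u → h k l (ℕₚ.m≤n⇒m≤1+n u))) (h (suc n) (ℕ.s≤s m≤n′) ℕₚ.≤-refl))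
      (arith 1 (λ x → x :+ # 0 := x))

  ∑-grow : ∀ {m n} {f : ℕ → R} → m ℕ.≤ n → (∀ k → m ℕ.< k → k ℕ.≤ n → ι 0 ≤ f k) → ∑ m f ≤ ∑ n f
  ∑-grow {m} {n} m≤n h with ℕₚ.m≤n⇒m<n∨m≡n m≤n
  ... | inj₂ refl = ≤-refl
  ∑-grow {m} {suc n} m≤n h | inj₁ (ℕ.s≤s m≤n′) =
    arith 3 (λ a b c → a :≤ b ⇒ # 0 :≤ c ⇒ a :≤ b :+ c)
      (∑-grow m≤n′ (λ k l u → h k l (ℕₚ.m≤n⇒m≤1+n u))) (h (suc n) (ℕ.s≤s m≤n′) ℕₚ.≤-refl)

  -- Sums over an interval (m, n] are written throughout as differences of two initial sums.
  ∑-tail-mono : ∀ {m n} {f g : ℕ → R} → m ℕ.≤ n → (∀ k → m ℕ.< k → k ℕ.≤ n → f k ≤ g k) →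
                ∑ n f - ∑ m f ≤ ∑ n g - ∑ m g
  ∑-tail-mono {m} {n} m≤n h with ℕₚ.m≤n⇒m<n∨m≡n m≤n
  ... | inj₂ refl = arith 2 (λ a b → a :- a :≤ b :- b)
  ∑-tail-mono {m} {suc n} m≤n h | inj₁ (ℕ.s≤s m≤n′) =
    arith 6 (λ a b c d e f → a :- b :≤ c :- d ⇒ e :≤ f ⇒ (a :+ e) :- b :≤ (c :+ f) :- d)
      (∑-tail-mono m≤n′ (λ k l u → h k l (ℕₚ.m≤n⇒m≤1+n u))) (h (suc n) (ℕ.s≤s m≤n′) ℕₚ.≤-refl)

  𝟙 : {P : Set} → Dec P → R
  𝟙 (yes _) = ι 1
  𝟙 (no _) = ι 0

  𝟙-nonneg : {P : Set} (d : Dec P) → ι 0 ≤ 𝟙 d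
  𝟙-nonneg (yes _) = 0≤1
  𝟙-nonneg (no _) = ≤-refl

  𝟙-yes : {P : Set} (d : Dec P) → P → 𝟙 d ≡ ι 1
  𝟙-yes (yes _) _ = refl
  𝟙-yes (no ¬p) p = ⊥-elim (¬p p)

  𝟙-no : {P : Set} (d : Dec P) → ¬ P → 𝟙 d ≡ ι 0
  𝟙-no (yes p) ¬p = ⊥-elim (¬p p)
  𝟙-no (no _) _ = refl

  𝟙-cong : {P Q : Set} (d : Dec P) (e : Dec Q) → (P → Q) → (Q → P) → 𝟙 d ≡ 𝟙 e
  𝟙-cong (yes p) e f g = sym (𝟙-yes e (f p))
  𝟙-cong (no ¬p) e f g = sym (𝟙-no e (λ q → ¬p (g q)))

  1*-identity : ∀ {x} → ι 1 * x ≡ x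
  1*-identity = arith 1 (λ x → # 1 :* x := x)

  0*-zero : ∀ {x} → ι 0 * x ≡ ι 0
  0*-zero = arith 1 (λ x → # 0 :* x := # 0)

  +-zeroʳ : ∀ {x} → x + ι 0 ≡ x
  +-zeroʳ = arith 1 (λ x → x :+ # 0 := x)

  ÷-step-∣ : ∀ n d → 1 ℕ.≤ d → d ∣ suc n → suc n ≡ d ℕ.* suc (n ÷ d) × suc n ÷ d ≡ suc (n ÷ d)
  ÷-step-∣ n d 1≤d d∣ with suc n ℕₚ.≟ d ℕ.* suc (n ÷ d)
  ... | yes e = e , ÷-unique d (suc (n ÷ d)) (ℕₚ.≤-reflexive (sym e))
          (subst (ℕ._< d ℕ.* suc (suc (n ÷ d))) (sym e) (ℕₚ.*-monoʳ-< d {{ℕ.>-nonZero 1≤d}} (ℕₚ.n<1+n _)))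
  ... | no ≢ = ⊥-elim (between d∣)
    where
    between : ¬ (d ∣ suc n)
    between (divides c e) = ℕₚ.<⇒≱ lower (ℕₚ.≤-pred upper)
      where
      lower : n ÷ d ℕ.< c
      lower = ℕₚ.*-cancelˡ-< d _ _ (subst (d ℕ.* (n ÷ d) ℕ.<_) (trans e (ℕₚ.*-comm c d)) (ℕ.s≤s (÷-lower n d)))
      upper : c ℕ.< suc (n ÷ d)
      upper = ℕₚ.*-cancelˡ-< d _ _ (subst (ℕ._< d ℕ.* suc (n ÷ d)) (trans e (ℕₚ.*-comm c d))
                (ℕₚ.≤∧≢⇒< (÷-upper n d 1≤d) ≢))

  ÷-step-∤ : ∀ n d → 1 ℕ.≤ d → ¬ (d ∣ suc n) → suc n ÷ d ≡ n ÷ d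
  ÷-step-∤ n d 1≤d ∤ = ÷-unique d (n ÷ d) (ℕₚ.m≤n⇒m≤1+n (÷-lower n d))
    (ℕₚ.≤∧≢⇒< (÷-upper n d 1≤d) (λ e → ∤ (divides (suc (n ÷ d)) (trans e (ℕₚ.*-comm d _)))))

  -- Induction on n: the quotient by d grows exactly when d divides the new index.
  ∑-multiples : ∀ n d → 1 ℕ.≤ d → (f : ℕ → R) →
                ∑ n (λ k → 𝟙 (d ∣? k) * f k) ≡ ∑ (n ÷ d) (λ m → f (d ℕ.* m))
  ∑-multiples zero d 1≤d f = sym (cong (λ q → ∑ q (λ m → f (d ℕ.* m))) (÷-small d 1≤d))
  ∑-multiples (suc n) d 1≤d f with d ∣? suc n
  ... | yes d∣ = trans (cong₂ _+_ (∑-multiples n d 1≤d f) (trans 1*-identity (cong f (proj₁ s))))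
                  (sym (cong (λ q → ∑ q (λ m → f (d ℕ.* m))) (proj₂ s)))
    where s = ÷-step-∣ n d 1≤d d∣
  ... | no ∤ = trans (cong₂ _+_ (∑-multiples n d 1≤d f) 0*-zero)
                (trans +-zeroʳ (sym (cong (λ q → ∑ q (λ m → f (d ℕ.* m))) (÷-step-∤ n d 1≤d ∤))))

-- Prime factors and logarithms

prime⇒2≤ : ∀ {p} → Prime p → 2 ℕ.≤ p
prime⇒2≤ pp = ℕ.nonTrivial⇒n>1 _ {{prime⇒nonTrivial pp}}

prime⇒1≤ : ∀ {p} → Prime p → 1 ℕ.≤ p
prime⇒1≤ pp = ℕₚ.<⇒≤ (prime⇒2≤ pp)

1≤*⇒1≤ʳ : ∀ m {n} → 1 ℕ.≤ m ℕ.* n → 1 ℕ.≤ n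
1≤*⇒1≤ʳ m {zero} h = subst (1 ℕ.≤_) (ℕₚ.*-zeroʳ m) h
1≤*⇒1≤ʳ m {suc n} h = ℕ.s≤s ℕ.z≤n

primeFactors : ℕ → List ℕ
primeFactors zero = []
primeFactors (suc n) = factors (factorise (suc n))

primeFactors-prime : ∀ n → All Prime (primeFactors n)
primeFactors-prime zero = []
primeFactors-prime (suc n) = PrimeFactorisation.factorsPrime (factorise (suc n))

primeFactors-product : ∀ n → 1 ℕ.≤ n → n ≡ product (primeFactors n)
primeFactors-product (suc n) _ = PrimeFactorisation.isFactorisation (factorise (suc n))

primeFactors-unique : ∀ n → 1 ℕ.≤ n → (f : PrimeFactorisation n) → primeFactors n ↭ factors f
primeFactors-unique (suc n) _ f = factorisationUnique (factorise (suc n)) f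

primeFactors-* : ∀ {p} m → Prime p → 1 ℕ.≤ m → primeFactors (p ℕ.* m) ↭ p ∷ primeFactors m
primeFactors-* {p} m pp 1≤m = primeFactors-unique (p ℕ.* m) (ℕₚ.*-mono-≤ (prime⇒1≤ pp) 1≤m) (record
  { factors = p ∷ primeFactors m
  ; isFactorisation = cong (p ℕ.*_) (primeFactors-product m 1≤m)
  ; factorsPrime = pp ∷ primeFactors-prime m
  })

primeFactors-1 : primeFactors 1 ↭ []
primeFactors-1 = primeFactors-unique 1 ℕₚ.≤-refl primeFactorisation[1]

-- Arithmetic functions are handled by splitting off one prime at a time, without coprime
-- factorisations.
prime-induction : (P : ℕ → Set) → P 1 → (∀ p m → Prime p → 1 ℕ.≤ m → P m → P (p ℕ.* m)) →
                  ∀ n → 1 ℕ.≤ n → P n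
prime-induction P base step n 1≤n =
  subst P (sym (primeFactors-product n 1≤n)) (go (primeFactors n) (primeFactors-prime n))
  where
  go : ∀ as → All Prime as → P (product as)
  go [] [] = base
  go (a ∷ as) (pa ∷ pas) = step a (product as) pa (productOfPrimes≥1 pas) (go as pas)

data OneOrMultiple : ℕ → Set where
  one : OneOrMultiple 1
  multiple : ∀ p m → Prime p → 1 ℕ.≤ m → OneOrMultiple (p ℕ.* m)

oneOrMultiple : ∀ n → 1 ℕ.≤ n → OneOrMultiple n
oneOrMultiple = prime-induction OneOrMultiple one (λ p m pp 1≤m _ → multiple p m pp 1≤m)

∤⇒coprime : ∀ {p d} → Prime p → ¬ (p ∣ d) → Coprime d p
∤⇒coprime pp ∤ (i∣d , i∣p) with prime⇒irreducible pp i∣p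
... | inj₁ i≡1 = i≡1
... | inj₂ refl = ⊥-elim (∤ i∣d)

module Logarithm (F : OrderedField) where
  open OrderedField F
  open LinearArithmetic F
  open Sums F

  H : ℕ → R
  H n = ∑ n inv

  H-nonneg : ∀ n → ι 0 ≤ H n
  H-nonneg n = ∑-nonneg n (λ k _ _ → inv-nonneg k)

  H-mono : ∀ {m n} → m ℕ.≤ n → H m ≤ H n
  H-mono m≤n = ∑-grow m≤n (λ k _ _ → inv-nonneg k)

  H-1 : H 1 ≡ ι 1
  H-1 = trans (cong (ι 0 +_) inv-1) (arith 0 (# 0 :+ # 1 := # 1))

  1≤H : ∀ {n} → 1 ℕ.≤ n → ι 1 ≤ H n
  1≤H {n} 1≤n = subst (_≤ H n) H-1 (H-mono 1≤n)

  H≤ι : ∀ n → H n ≤ ι n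
  H≤ι n = subst (H n ≤_) (trans (∑-const n (ι 1)) *-one)
            (∑-mono n (λ k _ _ → inv≤1 k))

  H-diff-lower : ∀ {m n} → m ℕ.≤ n → (ι n - ι m) * inv n ≤ H n - H m
  H-diff-lower {m} {n} m≤n =
    subst (_≤ H n - H m)
      (trans (cong₂ _-_ (∑-const n (inv n)) (∑-const m (inv n)))
        (arith 3 (λ a b c → a :* c :- b :* c := (a :- b) :* c)))
      (∑-tail-mono m≤n (λ k m<k k≤n → inv-anti (ℕₚ.≤-trans ℕ.z<s m<k) k≤n))

  H-diff-upper : ∀ {m n} → m ℕ.≤ n → H n - H m ≤ (ι n - ι m) * inv (suc m)
  H-diff-upper {m} {n} m≤n =
    subst (H n - H m ≤_)
      (trans (cong₂ _-_ (∑-const n (inv (suc m))) (∑-const m (inv (suc m))))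
        (arith 3 (λ a b c → a :* c :- b :* c := (a :- b) :* c)))
      (∑-tail-mono m≤n (λ k m<k k≤n → inv-anti ℕ.z<s m<k))

  H-double : ∀ n → H (2 ℕ.* n) - H n ≤ ι 1
  H-double n = ≤-trans (H-diff-upper (ℕₚ.m≤m+n n (n ℕ.+ 0)))
    (≤-trans (≡⇒≤ (cong (λ m → (m - ι n) * inv (suc n)) (ι-* 2 n)))
      (arith 2 (λ n i → (# 1 :+ n) :* i := # 1 ⇒ # 0 :≤ i ⇒ (# 2 :* n :- n) :* i :≤ # 1)
        (trans (cong (_* inv (suc n)) (sym (ι-suc n))) (inv-cancel (suc n) ℕ.z<s))
        (inv-nonneg (suc n))))

  -- δ b j tends to log b as j grows.
  δ : ℕ → ℕ → R
  δ b j = H (b ℕ.* j) - H j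

  private
    -- The block has b terms, each at least 1/(b (j + 1)).
    block-lower : ∀ b j → 1 ℕ.≤ b → inv (suc j) ≤ H (b ℕ.* suc j) - H (b ℕ.* j)
    block-lower b j 1≤b = ≤-trans (≡⇒≤ e) (H-diff-lower (ℕₚ.*-monoʳ-≤ b (ℕₚ.n≤1+n j)))
      where
      open ≡-Reasoning
      e : inv (suc j) ≡ (ι (b ℕ.* suc j) - ι (b ℕ.* j)) * inv (b ℕ.* suc j)
      e = begin
        inv (suc j)                                ≡⟨ sym 1*-identity ⟩
        ι 1 * inv (suc j)                          ≡⟨ cong (_* inv (suc j)) (sym (inv-cancel b 1≤b)) ⟩
        ι b * inv b * inv (suc j)
          ≡⟨ arith 4 (λ b i k j → b :* i :* k := ((b :* (# 1 :+ j)) :- b :* j) :* (i :* k)) {_} {ι b} {inv b}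
            {inv (suc j)} {ι j} ⟩
        (ι b * (ι 1 + ι j) - ι b * ι j) * (inv b * inv (suc j))
          ≡⟨ cong₂ _*_ (cong₂ _-_ (trans (cong (ι b *_) (sym (ι-suc j))) (sym (ι-* b (suc j)))) (sym (ι-* b j)))
               (sym (inv-* b (suc j) 1≤b ℕ.z<s)) ⟩
        (ι (b ℕ.* suc j) - ι (b ℕ.* j)) * inv (b ℕ.* suc j) ∎

    block-upper : ∀ b j → 1 ℕ.≤ b → 1 ℕ.≤ j → H (b ℕ.* suc j) - H (b ℕ.* j) ≤ inv j
    block-upper b j 1≤b 1≤j = ≤-trans (H-diff-upper (ℕₚ.*-monoʳ-≤ b (ℕₚ.n≤1+n j)))
      (≤-trans (≡⇒≤ (cong (_* inv (suc (b ℕ.* j))) e₁))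
        (≤-trans (*-monoˡ (ι b) (ι-nonneg b) (inv-anti (ℕₚ.*-mono-≤ 1≤b 1≤j) (ℕₚ.n≤1+n (b ℕ.* j)))) (≡⇒≤ e₂)))
      where
      open ≡-Reasoning
      e₁ : ι (b ℕ.* suc j) - ι (b ℕ.* j) ≡ ι b
      e₁ = trans (cong₂ _-_ (trans (ι-* b (suc j)) (cong (ι b *_) (ι-suc j))) (ι-* b j))
             (arith 2 (λ b j → b :* (# 1 :+ j) :- b :* j := b))
      e₂ : ι b * inv (b ℕ.* j) ≡ inv j
      e₂ = begin
        ι b * inv (b ℕ.* j)      ≡⟨ cong (ι b *_) (inv-* b j 1≤b 1≤j) ⟩
        ι b * (inv b * inv j)    ≡⟨ arith 3 (λ a b c → a :* (b :* c) := a :* b :* c) ⟩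
        ι b * inv b * inv j      ≡⟨ cong (_* inv j) (inv-cancel b 1≤b) ⟩
        ι 1 * inv j              ≡⟨ 1*-identity ⟩
        inv j ∎

  δ-mono : ∀ b {i j} → 1 ℕ.≤ b → i ℕ.≤ j → δ b i ≤ δ b j
  δ-mono b {i} {j} 1≤b i≤j with ℕₚ.m≤n⇒m<n∨m≡n i≤j
  ... | inj₂ refl = ≤-refl
  δ-mono b {i} {suc j} 1≤b i≤j | inj₁ (ℕ.s≤s i≤j′) =
    arith 5 (λ d h h′ k i → d :≤ h :- k ⇒ i :≤ h′ :- h ⇒ d :≤ h′ :- (k :+ i))
      (δ-mono b 1≤b i≤j′) (block-lower b j 1≤b)

  -- Together with `δ-mono` this confines all values of δ b from i on to an interval of length 1/i:
  -- the rate of convergence.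
  δ-upper : ∀ b {i j} → 1 ℕ.≤ b → 1 ℕ.≤ i → i ℕ.≤ j → δ b j + inv j ≤ δ b i + inv i
  δ-upper b {i} {j} 1≤b 1≤i i≤j with ℕₚ.m≤n⇒m<n∨m≡n i≤j
  ... | inj₂ refl = ≤-refl
  δ-upper b {i} {suc j} 1≤b 1≤i i≤j | inj₁ (ℕ.s≤s i≤j′) =
    arith 6 (λ d h h′ k i j → h :- k :+ j :≤ d ⇒ h′ :- h :≤ j ⇒ h′ :- (k :+ i) :+ i :≤ d)
      (δ-upper b 1≤b 1≤i i≤j′) (block-upper b j 1≤b (ℕₚ.≤-trans 1≤i i≤j′))

  δ≤H : ∀ b j → 1 ℕ.≤ b → δ b j ≤ H b
  δ≤H b zero 1≤b = subst (_≤ H b) (sym e) (H-nonneg b)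
    where
    e : H (b ℕ.* 0) - ι 0 ≡ ι 0
    e = trans (cong (λ k → H k - ι 0) (ℕₚ.*-zeroʳ b)) (arith 0 (# 0 :- # 0 := # 0))
  δ≤H b j@(suc _) 1≤b =
    arith 5 (λ d i h h₁ j → d :+ i :≤ h :- h₁ :+ j ⇒ j := # 1 ⇒ h₁ := # 1 ⇒ # 0 :≤ i ⇒ d :≤ h)
      (subst (λ k → δ b j + inv j ≤ H k - H 1 + inv 1) (ℕₚ.*-identityʳ b)
        (δ-upper b {1} {j} 1≤b ℕₚ.≤-refl ℕ.z<s)) inv-1 H-1 (inv-nonneg j)

  -- H serves as the logarithm up to a bounded error; Log X is an exactly additive function which
  -- approximates it up to a constant (in place of Euler's) with error O(1/n) for n ≤ X.
  record Log (X : ℕ) : Set where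
    field
      L : ℕ → R
      γ : R
      L-1 : L 1 ≡ ι 0
      L-* : ∀ p m → Prime p → 1 ℕ.≤ m → L (p ℕ.* m) ≡ L p + L m
      L-nonneg : ∀ n → ι 0 ≤ L n
      γ-nonneg : ι 0 ≤ γ
      γ≤1 : γ ≤ ι 1
      lower : ∀ n → 1 ℕ.≤ n → n ℕ.≤ X → γ ≤ H n - L n
      upper : ∀ n → 1 ℕ.≤ n → n ℕ.≤ X → H n - L n ≤ γ + ι 2 * inv n

  sumOver : (ℕ → R) → List ℕ → R
  sumOver f [] = ι 0
  sumOver f (x ∷ xs) = f x + sumOver f xs

  sumOver-↭ : ∀ f {xs ys} → xs ↭ ys → sumOver f xs ≡ sumOver f ys
  sumOver-↭ f Perm.refl = refl
  sumOver-↭ f (Perm.prep x h) = cong (f x +_) (sumOver-↭ f h)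
  sumOver-↭ f (Perm.swap x y h) = trans (cong (λ s → f x + (f y + s)) (sumOver-↭ f h))
    (arith 3 (λ a b c → a :+ (b :+ c) := b :+ (a :+ c)))
  sumOver-↭ f (Perm.trans h k) = trans (sumOver-↭ f h) (sumOver-↭ f k)

  module _ (X : ℕ) (1≤X : 1 ℕ.≤ X) where
    private
      -- `ℓ` differs from an additive function by at most n/K at n; with K = X² this is at most 1/n
      -- for n ≤ X.
      K = X ℕ.* X

      1≤K : 1 ℕ.≤ K
      1≤K = ℕₚ.*-mono-≤ 1≤X 1≤X

      ℓ : ℕ → R
      ℓ n = δ n K

      L : ℕ → R
      L n = sumOver ℓ (primeFactors n)

      ℓ-1 : ℓ 1 ≡ ι 0
      ℓ-1 = trans (cong (λ k → H k - H K) (ℕₚ.+-identityʳ K)) (arith 1 (λ a → a :- a := # 0))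

      L-1 : L 1 ≡ ι 0
      L-1 = sumOver-↭ ℓ primeFactors-1

      L-prime : ∀ p → Prime p → L p ≡ ℓ p
      L-prime p pp = trans (cong L (sym (ℕₚ.*-identityʳ p)))
        (trans (sumOver-↭ ℓ (primeFactors-* 1 pp ℕₚ.≤-refl)) (trans (cong (ℓ p +_) L-1) +-zeroʳ))

      L-*′ : ∀ p m → Prime p → 1 ℕ.≤ m → L (p ℕ.* m) ≡ ℓ p + L m
      L-*′ p m pp 1≤m = sumOver-↭ ℓ (primeFactors-* m pp 1≤m)

      ℓ-* : ∀ a b → ℓ (a ℕ.* b) ≡ δ a (b ℕ.* K) + ℓ b
      ℓ-* a b = trans (cong (λ k → H k - H K) (ℕₚ.*-assoc a b K))
        (arith 3 (λ x y z → x :- z := x :- y :+ (y :- z)))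

      ℓ-nonneg : ∀ n → 1 ℕ.≤ n → ι 0 ≤ ℓ n
      ℓ-nonneg n 1≤n = subst (_≤ ℓ n) e (δ-mono n 1≤n (ℕ.z≤n {K}))
        where
        e : H (n ℕ.* 0) - ι 0 ≡ ι 0
        e = trans (cong (λ k → H k - ι 0) (ℕₚ.*-zeroʳ n)) (arith 0 (# 0 :- # 0 := # 0))

      sumOver-nonneg : ∀ {xs} → All Prime xs → ι 0 ≤ sumOver ℓ xs
      sumOver-nonneg [] = ≤-refl
      sumOver-nonneg (pp ∷ ps) = arith 2 (λ a b → # 0 :≤ a ⇒ # 0 :≤ b ⇒ # 0 :≤ a :+ b)
        (ℓ-nonneg _ (prime⇒1≤ pp)) (sumOver-nonneg ps)

      K≤*K : ∀ {m} → 1 ℕ.≤ m → K ℕ.≤ m ℕ.* K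
      K≤*K {m} 1≤m = subst (ℕ._≤ m ℕ.* K) (ℕₚ.+-identityʳ K) (ℕₚ.*-monoˡ-≤ K 1≤m)

      -- In ℓ (p m) = δ p (m K) + ℓ m the point m K lies beyond K, so `δ-mono` makes ℓ
      -- superadditive, while L adds up its values at the primes.
      L≤ℓ : ∀ n → 1 ℕ.≤ n → L n ≤ ℓ n
      L≤ℓ = prime-induction (λ n → L n ≤ ℓ n) (≡⇒≤ (trans L-1 (sym ℓ-1))) λ p m pp 1≤m ih →
        arith 6 (λ a b c d e f → a := b :+ c ⇒ c :≤ d ⇒ b :≤ e ⇒ f := e :+ d ⇒ a :≤ f)
          (L-*′ p m pp 1≤m) ih (δ-mono p (prime⇒1≤ pp) (K≤*K 1≤m)) (ℓ-* p m)

      -- Each prime split off costs at most 1/K by `δ-upper`, and m + 1 ≤ p m lets n/K absorb the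
      -- accumulated cost.
      ℓ≤L : ∀ n → 1 ℕ.≤ n → ℓ n ≤ L n + ι n * inv K
      ℓ≤L = prime-induction (λ n → ℓ n ≤ L n + ι n * inv K)
        (arith 3 (λ a b i → a := # 0 ⇒ b := # 0 ⇒ # 0 :≤ i ⇒ a :≤ b :+ # 1 :* i) ℓ-1 L-1 (inv-nonneg K))
        λ p m pp 1≤m ih →
        ≤-trans
        (arith 8 (λ a b c d e f i m → a := b :+ c ⇒ c :≤ d :+ m :* i ⇒ b :+ e :≤ f :+ i ⇒ # 0 :≤ e ⇒ a :≤ (f :+ d) :+
          (# 1 :+ m) :* i)
          (ℓ-* p m) ih (δ-upper p (prime⇒1≤ pp) 1≤K (K≤*K 1≤m)) (inv-nonneg (m ℕ.* K)))
        (+-mono-≤ (≡⇒≤ (sym (L-*′ p m pp 1≤m)))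
          (*-monoʳ (inv K) (inv-nonneg K) (subst (_≤ ι (p ℕ.* m)) (ι-suc m) (ι-mono (suc≤* (prime⇒2≤ pp) 1≤m)))))
        where
        suc≤* : ∀ {p m} → 2 ℕ.≤ p → 1 ℕ.≤ m → suc m ℕ.≤ p ℕ.* m
        suc≤* {p} {m} 2≤p 1≤m = ℕₚ.≤-trans (arithℕ 1 (λ m → # 1 :≤ m ⇒ # 1 :+ m :≤ # 2 :* m) m 1≤m) (ℕₚ.*-monoˡ-≤ m 2≤p)

      error : ∀ n → 1 ℕ.≤ n → n ℕ.≤ X → ι n * inv K ≤ inv n
      error n 1≤n n≤X = ≤-trans (≡⇒≤ (cong (ι n *_) (inv-* X X 1≤X 1≤X)))
        (≤-trans (≡⇒≤ (arith 2 (λ n i → n :* (i :* i) := n :* i :* i)))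
          (≤-trans (*-monoʳ (inv X) (inv-nonneg X)
            (≤-trans (*-monoʳ (inv X) (inv-nonneg X) (ι-mono n≤X)) (≡⇒≤ (inv-cancel X 1≤X))))
            (≤-trans (≡⇒≤ 1*-identity) (inv-anti 1≤n n≤X))))

      -- Both sides are H n + H K - H (n K). The right side decreases in n, and `γ` is its value at
      -- n = X, a stand-in for Euler's constant.
      H-ℓ : ∀ n → H n - ℓ n ≡ H K - δ K n
      H-ℓ n = trans (cong (λ k → H n - (H k - H K)) (ℕₚ.*-comm n K))
        (arith 3 (λ a b c → a :- (b :- c) := c :- (b :- a)))

      γ : R
      γ = H K - δ K X

      lower : ∀ n → 1 ℕ.≤ n → n ℕ.≤ X → γ ≤ H n - L n
      lower n 1≤n n≤X =
        arith 6 (λ a b c d e f → a :- b := c :- d ⇒ d :≤ e ⇒ f :≤ b ⇒ c :- e :≤ a :- f)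
          (H-ℓ n) (δ-mono K 1≤K n≤X) (L≤ℓ n 1≤n)

    log : Log X
    log = record
      { L = L
      ; γ = γ
      ; L-1 = L-1
      ; L-* = λ p m pp 1≤m → trans (L-*′ p m pp 1≤m) (cong (_+ L m) (sym (L-prime p pp)))
      ; L-nonneg = λ n → sumOver-nonneg (primeFactors-prime n)
      ; γ-nonneg = diff-nonneg (δ≤H K X 1≤K)
      ; γ≤1 = arith 3 (λ g h l → g :≤ h :- l ⇒ h := # 1 ⇒ l := # 0 ⇒ g :≤ # 1) (lower 1 ℕₚ.≤-refl 1≤X) H-1 L-1
      ; lower = lower
      ; upper = λ n 1≤n n≤X →
          arith 9 (λ a b c d e f i j k → a :- b := c :- d ⇒ e :+ i :≤ d :+ j ⇒ # 0 :≤ i ⇒ b :≤ f :+ k ⇒ k :≤ j ⇒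
            a :- f :≤ (c :- e) :+ # 2 :* j)
            (H-ℓ n) (δ-upper K 1≤K 1≤n n≤X) (inv-nonneg X) (ℓ≤L n 1≤n) (error n 1≤n n≤X)
      }

-- Möbius and von Mangoldt functions

module Moebius (F : OrderedField) where
  open OrderedField F
  open LinearArithmetic F
  open Sums F
  open Logarithm F

  χ : ℕ → List ℕ → R
  χ x [] = ι 1
  χ x (y ∷ ys) = 𝟙 (¬? (x ℕ.≟ y)) * χ x ys

  χ-↭ : ∀ x {ys zs} → ys ↭ zs → χ x ys ≡ χ x zs
  χ-↭ x Perm.refl = refl
  χ-↭ x (Perm.prep y h) = cong (𝟙 (¬? (x ℕ.≟ y)) *_) (χ-↭ x h)
  χ-↭ x (Perm.swap y z h) = trans (cong (λ s → 𝟙 (¬? (x ℕ.≟ y)) * (𝟙 (¬? (x ℕ.≟ z)) * s)) (χ-↭ x h))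
    (arith 3 (λ a b c → a :* (b :* c) := b :* (a :* c)))
  χ-↭ x (Perm.trans h k) = trans (χ-↭ x h) (χ-↭ x k)

  -- The Möbius sign of a multiset of primes: 0 if an entry repeats, otherwise -1 to the number of
  -- entries. Invariance under permutation connects it with unique factorisation.
  signOf : List ℕ → R
  signOf [] = ι 1
  signOf (x ∷ xs) = - (χ x xs * signOf xs)

  signOf-↭ : ∀ {xs ys} → xs ↭ ys → signOf xs ≡ signOf ys
  signOf-↭ Perm.refl = refl
  signOf-↭ (Perm.prep x h) = cong -_ (cong₂ _*_ (χ-↭ x h) (signOf-↭ h))
  signOf-↭ {x ∷ y ∷ xs} {_ ∷ _ ∷ ys} (Perm.swap x y h) = begin
    - (𝟙 (¬? (x ℕ.≟ y)) * χ x xs * - (χ y xs * signOf xs))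
      ≡⟨ cong -_ (cong₂ _*_ (cong₂ _*_ (𝟙-cong (¬? (x ℕ.≟ y)) (¬? (y ℕ.≟ x)) (λ n e → n (sym e)) (λ n e → n (sym e)))
        (χ-↭ x h))
           (cong -_ (cong₂ _*_ (χ-↭ y h) (signOf-↭ h)))) ⟩
    - (𝟙 (¬? (y ℕ.≟ x)) * χ x ys * - (χ y ys * signOf ys))
      ≡⟨ arith 4 (λ a b c d → :- (a :* b :* (:- (c :* d))) := :- (a :* c :* (:- (b :* d)))) ⟩
    - (𝟙 (¬? (y ℕ.≟ x)) * χ y ys * - (χ x ys * signOf ys)) ∎
    where open ≡-Reasoning
  signOf-↭ (Perm.trans h k) = trans (signOf-↭ h) (signOf-↭ k)

  μ : ℕ → R
  μ n = signOf (primeFactors n)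

  c : ℕ → ℕ → R
  c p d = 𝟙 (¬? (p ∣? d))

  χ-product : ∀ {p} → Prime p → ∀ {xs} → All Prime xs → χ p xs ≡ c p (product xs)
  χ-product {p} pp [] = sym (𝟙-yes (¬? (p ∣? 1)) (λ h → ¬prime[1] (subst Prime (∣1⇒≡1 h) pp)))
  χ-product {p} pp {x ∷ xs} (px ∷ pxs) with p ℕ.≟ x
  ... | yes refl = trans 0*-zero (sym (𝟙-no (¬? (p ∣? p ℕ.* product xs)) (λ h → h (m∣m*n (product xs)))))
  ... | no p≢x = trans 1*-identity (trans (χ-product pp pxs)
      (𝟙-cong (¬? (p ∣? product xs)) (¬? (p ∣? x ℕ.* product xs)) forth (λ h k → h (∣n⇒∣m*n x k))))
    where
    forth : ¬ (p ∣ product xs) → ¬ (p ∣ x ℕ.* product xs)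
    forth h k with euclidsLemma x (product xs) pp k
    ... | inj₂ k′ = h k′
    ... | inj₁ k′ with prime⇒irreducible px k′
    ...   | inj₁ refl = ¬prime[1] pp
    ...   | inj₂ e = p≢x e

  μ-* : ∀ {p} d → Prime p → 1 ℕ.≤ d → μ (p ℕ.* d) ≡ - (c p d * μ d)
  μ-* {p} d pp 1≤d = trans (signOf-↭ (primeFactors-* d pp 1≤d))
    (cong (λ k → - (k * μ d)) (trans (χ-product pp (primeFactors-prime d))
      (cong (c p) (sym (primeFactors-product d 1≤d)))))

  μ-1 : μ 1 ≡ ι 1
  μ-1 = signOf-↭ primeFactors-1

  𝟙-value : {P : Set} (d : Dec P) → (𝟙 d ≡ ι 0) ⊎ (𝟙 d ≡ ι 1)
  𝟙-value (yes _) = inj₂ refl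
  𝟙-value (no _) = inj₁ refl

  χ-value : ∀ x xs → (χ x xs ≡ ι 0) ⊎ (χ x xs ≡ ι 1)
  χ-value x [] = inj₂ refl
  χ-value x (y ∷ xs) with 𝟙-value (¬? (x ℕ.≟ y))
  ... | inj₁ e = inj₁ (trans (cong (_* χ x xs) e) 0*-zero)
  ... | inj₂ e with χ-value x xs
  ...   | inj₁ e′ = inj₁ (trans (cong₂ _*_ e e′) (arith 0 (# 1 :* # 0 := # 0)))
  ...   | inj₂ e′ = inj₂ (trans (cong₂ _*_ e e′) (arith 0 (# 1 :* # 1 := # 1)))

  signOf-bounds : ∀ xs → (- ι 1 ≤ signOf xs) × (signOf xs ≤ ι 1)
  signOf-bounds [] = arith 0 (:- # 1 :≤ # 1) , ≤-refl
  signOf-bounds (x ∷ xs) with χ-value x xs | signOf-bounds xs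
  ... | inj₁ e | l , u =
    subst (λ k → (- ι 1 ≤ - (k * signOf xs)) × (- (k * signOf xs) ≤ ι 1)) (sym e)
      (arith 1 (λ s → :- # 1 :≤ :- (# 0 :* s)) , arith 1 (λ s → :- (# 0 :* s) :≤ # 1))
  ... | inj₂ e | l , u =
    subst (λ k → (- ι 1 ≤ - (k * signOf xs)) × (- (k * signOf xs) ≤ ι 1)) (sym e)
      (arith 1 (λ s → s :≤ # 1 ⇒ :- # 1 :≤ :- (# 1 :* s)) u , arith 1 (λ s → :- # 1 :≤ s ⇒ :- (# 1 :* s) :≤ # 1) l)

  μ-lower : ∀ n → - ι 1 ≤ μ n
  μ-lower n = proj₁ (signOf-bounds (primeFactors n))

  μ-upper : ∀ n → μ n ≤ ι 1
  μ-upper n = proj₂ (signOf-bounds (primeFactors n))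

  -- Divisor sums are full sums with an indicator, so that exchanging them is an exchange of
  -- ordinary sums.
  Div : ℕ → (ℕ → R) → R
  Div n f = ∑ n (λ d → 𝟙 (d ∣? n) * f d)

  Div-extend : ∀ {n N} f → 1 ℕ.≤ n → n ℕ.≤ N → ∑ N (λ d → 𝟙 (d ∣? n) * f d) ≡ Div n f
  Div-extend {n} f 1≤n n≤N = ∑-extend n≤N (λ d n<d _ →
    trans (cong (_* f d) (𝟙-no (d ∣? n) (λ h → ℕₚ.<⇒≱ n<d (∣⇒≤ {{ℕ.>-nonZero 1≤n}} h)))) 0*-zero)

  Div-cong : ∀ n {f g : ℕ → R} → (∀ d → 1 ℕ.≤ d → f d ≡ g d) → Div n f ≡ Div n g
  Div-cong n h = ∑-cong n (λ d 1≤d _ → cong (𝟙 (d ∣? n) *_) (h d 1≤d))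

  Div-+ : ∀ n (f g : ℕ → R) → Div n (λ d → f d + g d) ≡ Div n f + Div n g
  Div-+ n f g = trans (∑-cong n (λ d _ _ → arith 3 (λ i a b → i :* (a :+ b) := i :* a :+ i :* b)))
    (∑-+ n (λ d → 𝟙 (d ∣? n) * f d) (λ d → 𝟙 (d ∣? n) * g d))

  Div-*ˡ : ∀ n a (f : ℕ → R) → Div n (λ d → a * f d) ≡ a * Div n f
  Div-*ˡ n a f = trans (∑-cong n (λ d _ _ → arith 3 (λ i a b → i :* (a :* b) := a :* (i :* b))))
    (∑-*ˡ n a (λ d → 𝟙 (d ∣? n) * f d))

  Div-neg : ∀ n (f : ℕ → R) → Div n (λ d → - f d) ≡ - Div n f
  Div-neg n f = trans (∑-cong n (λ d _ _ → arith 2 (λ i a → i :* (:- a) := :- (i :* a))))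
    (∑-neg n (λ d → 𝟙 (d ∣? n) * f d))

  Div-1 : ∀ f → Div 1 f ≡ f 1
  Div-1 f = trans (cong (λ i → ι 0 + i * f 1) (𝟙-yes (1 ∣? 1) ∣-refl)) (arith 1 (λ x → # 0 :+ # 1 :* x := x))

  c-split : ∀ p d x → x ≡ c p d * x + 𝟙 (p ∣? d) * x
  c-split p d x with p ∣? d
  ... | yes _ = arith 1 (λ x → x := # 0 :* x :+ # 1 :* x)
  ... | no _ = arith 1 (λ x → x := # 1 :* x :+ # 0 :* x)

  module _ {p : ℕ} (pp : Prime p) where

    private
      1≤p = prime⇒1≤ pp

    c-idem : ∀ d x → c p d * (c p d * x) ≡ c p d * x
    c-idem d x with p ∣? d
    ... | yes _ = arith 1 (λ x → # 0 :* (# 0 :* x) := # 0 :* x)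
    ... | no _ = 1*-identity

    c-multiple : ∀ e x → c p (p ℕ.* e) * x ≡ ι 0
    c-multiple e x = trans (cong (_* x) (𝟙-no (¬? (p ∣? p ℕ.* e)) (λ h → h (m∣m*n e)))) 0*-zero

    *÷-cancel : ∀ m → (p ℕ.* m) ÷ p ≡ m
    *÷-cancel m = ÷-unique p m ℕₚ.≤-refl (ℕₚ.*-monoʳ-< p {{ℕ.>-nonZero 1≤p}} (ℕₚ.n<1+n m))

    m≤p*m : ∀ m → m ℕ.≤ p ℕ.* m
    m≤p*m m = subst (ℕ._≤ p ℕ.* m) (ℕₚ.*-identityˡ m) (ℕₚ.*-monoˡ-≤ m 1≤p)

    -- Divisors of p m not divisible by p divide m by coprimality; the others are p e with e
    -- dividing m. The recursions for μ and Λ below come from this.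
    Div-split : ∀ m f → 1 ℕ.≤ m →
                Div (p ℕ.* m) f ≡ Div m (λ d → c p d * f d) + Div m (λ e → f (p ℕ.* e))
    Div-split m f 1≤m = begin
      Div N f
        ≡⟨ Div-cong N (λ d _ → c-split p d (f d)) ⟩
      Div N (λ d → c p d * f d + 𝟙 (p ∣? d) * f d)
        ≡⟨ Div-+ N (λ d → c p d * f d) (λ d → 𝟙 (p ∣? d) * f d) ⟩
      Div N (λ d → c p d * f d) + Div N (λ d → 𝟙 (p ∣? d) * f d)
        ≡⟨ cong₂ _+_ first second ⟩
      Div m (λ d → c p d * f d) + Div m (λ e → f (p ℕ.* e)) ∎
      where
      open ≡-Reasoning
      N = p ℕ.* m
      same : ∀ d x → 𝟙 (d ∣? N) * (c p d * x) ≡ 𝟙 (d ∣? m) * (c p d * x)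
      same d x with p ∣? d
      ... | yes _ = arith 3 (λ a b x → a :* (# 0 :* x) := b :* (# 0 :* x))
      ... | no ∤ = cong (_* (ι 1 * x)) (𝟙-cong (d ∣? N) (d ∣? m)
                     (coprime-divisor (∤⇒coprime pp ∤)) (∣n⇒∣m*n p))
      first : Div N (λ d → c p d * f d) ≡ Div m (λ d → c p d * f d)
      first = trans (∑-cong N (λ d _ _ → same d (f d))) (Div-extend (λ d → c p d * f d) 1≤m (m≤p*m m))
      second : Div N (λ d → 𝟙 (p ∣? d) * f d) ≡ Div m (λ e → f (p ℕ.* e))
      second = begin
        Div N (λ d → 𝟙 (p ∣? d) * f d)
          ≡⟨ ∑-cong N (λ d _ _ → arith 3 (λ a b x → a :* (b :* x) := b :* (a :* x))) ⟩
        ∑ N (λ d → 𝟙 (p ∣? d) * (𝟙 (d ∣? N) * f d))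
          ≡⟨ ∑-multiples N p 1≤p (λ d → 𝟙 (d ∣? N) * f d) ⟩
        ∑ (N ÷ p) (λ e → 𝟙 (p ℕ.* e ∣? N) * f (p ℕ.* e))
          ≡⟨ cong (λ q → ∑ q (λ e → 𝟙 (p ℕ.* e ∣? N) * f (p ℕ.* e))) (*÷-cancel m) ⟩
        ∑ m (λ e → 𝟙 (p ℕ.* e ∣? N) * f (p ℕ.* e))
          ≡⟨ ∑-cong m (λ e _ _ → cong (_* f (p ℕ.* e)) (𝟙-cong (p ℕ.* e ∣? N) (e ∣? m)
               (*-cancelˡ-∣ p {{ℕ.>-nonZero 1≤p}}) (*-monoʳ-∣ p))) ⟩
        Div m (λ e → f (p ℕ.* e)) ∎

    -- The two parts of `Div-split` cancel, because `μ-*` turns the second into the negative of the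
    -- first.
    Div-μ : ∀ m → 1 ℕ.≤ m → Div (p ℕ.* m) μ ≡ ι 0
    Div-μ m 1≤m = trans (Div-split m μ 1≤m)
      (trans (cong (Div m (λ d → c p d * μ d) +_)
          (trans (Div-cong m (λ e 1≤e → μ-* e pp 1≤e)) (Div-neg m (λ e → c p e * μ e))))
        (arith 1 (λ x → x :+ (:- x) := # 0)))

  Div-μ≡𝟙 : ∀ m → 1 ℕ.≤ m → Div m μ ≡ 𝟙 (m ℕ.≟ 1)
  Div-μ≡𝟙 m 1≤m with oneOrMultiple m 1≤m
  ... | one = trans (Div-1 μ) μ-1
  ... | multiple q m′ pq 1≤m′ = trans (Div-μ pq m′ 1≤m′) (sym (𝟙-no (q ℕ.* m′ ℕ.≟ 1) ≢1))
    where
    ≢1 : ¬ (q ℕ.* m′ ≡ 1)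
    ≢1 e = ℕₚ.<⇒≢ (ℕₚ.≤-trans (prime⇒2≤ pq)
      (subst (ℕ._≤ q ℕ.* m′) (ℕₚ.*-identityʳ q) (ℕₚ.*-monoʳ-≤ q 1≤m′))) (sym e)

  -- s pp m is the indicator of the powers of p.
  module _ {p : ℕ} (pp : Prime p) where

    s : ℕ → R
    s m = Div m (λ d → c p d * μ d)

    s-* : ∀ m → 1 ℕ.≤ m → s (p ℕ.* m) ≡ s m
    s-* m 1≤m = trans (Div-split pp m (λ d → c p d * μ d) 1≤m)
      (trans (cong₂ _+_ (Div-cong m (λ d _ → c-idem pp d (μ d)))
          (trans (Div-cong m (λ e _ → trans (c-multiple pp e (μ (p ℕ.* e))) (sym 0*-zero)))
            (Div-*ˡ m (ι 0) (λ _ → ι 1))))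
        (arith 2 (λ x y → x :+ # 0 :* y := x)))

    s-∤ : ∀ m → ¬ (p ∣ m) → s m ≡ Div m μ
    s-∤ m ∤ = ∑-cong m (λ d _ _ → go d)
      where
      go : ∀ d → 𝟙 (d ∣? m) * (c p d * μ d) ≡ 𝟙 (d ∣? m) * μ d
      go d with d ∣? m
      ... | no _ = arith 2 (λ x y → # 0 :* x := # 0 :* y)
      ... | yes (divides q refl) = cong (ι 1 *_)
          (trans (cong (_* μ d) (𝟙-yes (¬? (p ∣? d)) (λ h → ∤ (∣n⇒∣m*n q h)))) 1*-identity)

    s-∤-one : ∀ m → 1 ℕ.≤ m → ¬ (p ∣ m) → s m ≡ 𝟙 (m ℕ.≟ 1)
    s-∤-one m 1≤m ∤ = trans (s-∤ m ∤) (Div-μ≡𝟙 m 1≤m)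

    s-value : ∀ m → 1 ℕ.≤ m → (s m ≡ ι 0) ⊎ (s m ≡ ι 1 × ∃[ j ] m ≡ p ℕ.^ j)
    s-value = <-rec (λ m → 1 ℕ.≤ m → (s m ≡ ι 0) ⊎ (s m ≡ ι 1 × ∃[ j ] m ≡ p ℕ.^ j)) step
      where
      step : ∀ m → (∀ {k} → k ℕ.< m → 1 ℕ.≤ k → (s k ≡ ι 0) ⊎ (s k ≡ ι 1 × ∃[ j ] k ≡ p ℕ.^ j)) →
             1 ℕ.≤ m → (s m ≡ ι 0) ⊎ (s m ≡ ι 1 × ∃[ j ] m ≡ p ℕ.^ j)
      step m rec 1≤m with p ∣? m
      ... | no ∤ with m ℕ.≟ 1 | s-∤-one m 1≤m ∤
      ...   | yes e | h = inj₂ (h , 0 , e)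
      ...   | no _ | h = inj₁ h
      step m rec 1≤m | yes (divides k refl) with rec k<m 1≤k
        where
        1≤k : 1 ℕ.≤ k
        1≤k = 1≤*⇒1≤ʳ p (subst (1 ℕ.≤_) (ℕₚ.*-comm k p) 1≤m)
        k<m : k ℕ.< k ℕ.* p
        k<m = ℕₚ.m<m*n k p {{ℕ.>-nonZero 1≤k}} (prime⇒2≤ pp)
      ...   | inj₁ e = inj₁ (trans (cong s (ℕₚ.*-comm k p))
          (trans (s-* k (1≤*⇒1≤ʳ p (subst (1 ℕ.≤_) (ℕₚ.*-comm k p) 1≤m))) e))
      ...   | inj₂ (e , j , h) = inj₂
        (trans (cong s (ℕₚ.*-comm k p)) (trans (s-* k (1≤*⇒1≤ʳ p (subst (1 ℕ.≤_) (ℕₚ.*-comm k p) 1≤m))) e)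
        , suc j , trans (ℕₚ.*-comm k p) (cong (p ℕ.*_) h))

  module VonMangoldt {X : ℕ} (lg : Log X) where
    open Log lg

    -- The usual sum of μ(d) log (n/d) over the divisors d of n, without its part log n times the
    -- sum of μ(d): that sum vanishes for n > 1, and log 1 = 0.
    Λ : ℕ → R
    Λ n = - Div n (λ d → μ d * L d)

    Λ-1 : Λ 1 ≡ ι 0
    Λ-1 = trans (cong -_ (trans (Div-1 (λ d → μ d * L d)) (cong (μ 1 *_) L-1))) (arith 1 (λ x → :- (x :* # 0) := # 0))

    -- Pairing d with p d in `Div-split`, additivity of L cancels L d and leaves only L p.
    Λ-* : ∀ {p} (pp : Prime p) m → 1 ℕ.≤ m → Λ (p ℕ.* m) ≡ L p * s pp m
    Λ-* {p} pp m 1≤m = begin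
      - Div (p ℕ.* m) (λ d → μ d * L d)
        ≡⟨ cong -_ (Div-split pp m (λ d → μ d * L d) 1≤m) ⟩
      - (Div m (λ d → c p d * (μ d * L d)) + Div m (λ e → μ (p ℕ.* e) * L (p ℕ.* e)))
        ≡⟨ cong -_ (sym (Div-+ m (λ d → c p d * (μ d * L d)) (λ e → μ (p ℕ.* e) * L (p ℕ.* e)))) ⟩
      - Div m (λ d → c p d * (μ d * L d) + μ (p ℕ.* d) * L (p ℕ.* d))
        ≡⟨ cong -_ (Div-cong m (λ d 1≤d → trans
             (cong (c p d * (μ d * L d) +_) (cong₂ _*_ (μ-* d pp 1≤d) (L-* p d pp 1≤d)))
             (arith 4 (λ c m l k → c :* (m :* l) :+ (:- (c :* m)) :* (k :+ l) := (:- k) :* (c :* m))))) ⟩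
      - Div m (λ d → (- L p) * (c p d * μ d))
        ≡⟨ cong -_ (Div-*ˡ m (- L p) (λ d → c p d * μ d)) ⟩
      - ((- L p) * s pp m)
        ≡⟨ arith 2 (λ a b → :- ((:- a) :* b) := a :* b) ⟩
      L p * s pp m ∎
      where open ≡-Reasoning

    Λ-nonneg : ∀ n → 1 ℕ.≤ n → ι 0 ≤ Λ n
    Λ-nonneg n 1≤n with oneOrMultiple n 1≤n
    ... | one = ≡⇒≤ (sym Λ-1)
    ... | multiple p m pp 1≤m with s-value pp m 1≤m
    ...   | inj₁ e = ≡⇒≤ (sym (trans (Λ-* pp m 1≤m) (trans (cong (L p *_) e) *-zero)))
    ...   | inj₂ (e , _) = subst (ι 0 ≤_) (sym (trans (Λ-* pp m 1≤m) (trans (cong (L p *_) e) *-one)))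
                            (L-nonneg p)

    Λ-support : ∀ n → 1 ℕ.≤ n → (Λ n ≡ ι 0) ⊎ (∃[ p ] ∃[ j ] Prime p × n ≡ p ℕ.^ suc j)
    Λ-support n 1≤n with oneOrMultiple n 1≤n
    ... | one = inj₁ Λ-1
    ... | multiple p m pp 1≤m with s-value pp m 1≤m
    ...   | inj₁ e = inj₁ (trans (Λ-* pp m 1≤m) (trans (cong (L p *_) e) *-zero))
    ...   | inj₂ (_ , j , e) = inj₂ (p , j , pp , cong (p ℕ.*_) e)

    private
      Div-c-s : ∀ {p} (pp : Prime p) m → 1 ℕ.≤ m → Div m (λ d → c p d * s pp d) ≡ ι 1
      Div-c-s {p} pp m 1≤m = trans (∑-cong m (λ d 1≤d _ → cong (𝟙 (d ∣? m) *_) (go d 1≤d)))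
        (trans (∑-extend 1≤m (λ d 1<d _ → trans (cong (λ x → 𝟙 (d ∣? m) * (c p d * x))
          (𝟙-no (d ℕ.≟ 1) (λ e → ℕₚ.<⇒≢ 1<d (sym e))))
            (arith 2 (λ a b → a :* (b :* # 0) := # 0))))
          (trans (cong₂ (λ x y → ι 0 + x * (y * ι 1)) (𝟙-yes (1 ∣? m) (1∣ m))
              (𝟙-yes (¬? (p ∣? 1)) (λ h → ¬prime[1] (subst Prime (∣1⇒≡1 h) pp))))
            (arith 0 (# 0 :+ # 1 :* (# 1 :* # 1) := # 1))))
        where
        go : ∀ d → 1 ℕ.≤ d → c p d * s pp d ≡ c p d * 𝟙 (d ℕ.≟ 1)
        go d 1≤d with p ∣? d
        ... | yes _ = arith 2 (λ x y → # 0 :* x := # 0 :* y)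
        ... | no ∤ = cong (ι 1 *_) (s-∤-one pp d 1≤d ∤)

      Λ-divisible : ∀ {p} (pp : Prime p) d → 1 ℕ.≤ d → 𝟙 (p ∣? d) * Λ d ≡ L p * (𝟙 (p ∣? d) * s pp d)
      Λ-divisible {p} pp d 1≤d with p ∣? d
      ... | no _ = arith 3 (λ x y z → # 0 :* x := y :* (# 0 :* z))
      ... | yes (divides k refl) = trans 1*-identity
        (trans (cong Λ (ℕₚ.*-comm k p)) (trans (Λ-* pp k 1≤k)
          (cong (L p *_) (trans (sym (s-* pp k 1≤k)) (trans (cong (s pp) (ℕₚ.*-comm p k)) (sym 1*-identity))))))
        where
        1≤k : 1 ℕ.≤ k
        1≤k = 1≤*⇒1≤ʳ p (subst (1 ℕ.≤_) (ℕₚ.*-comm k p) 1≤d)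

    -- Passing from m to p m adds exactly one power of p to the divisors, and with it one term L p.
    Div-Λ : ∀ n → 1 ℕ.≤ n → Div n Λ ≡ L n
    Div-Λ = prime-induction (λ n → Div n Λ ≡ L n) (trans (Div-1 Λ) (trans Λ-1 (sym L-1))) step
      where
      step : ∀ p m → Prime p → 1 ℕ.≤ m → Div m Λ ≡ L m → Div (p ℕ.* m) Λ ≡ L (p ℕ.* m)
      step p m pp 1≤m ih =
        trans (trans (Div-split pp m Λ 1≤m) (cong (Div m (λ d → c p d * Λ d) +_)
          (trans (Div-cong m (λ e 1≤e → Λ-* pp e 1≤e)) (Div-*ˡ m (L p) (s pp)))))
        (trans (cong (λ x → Div m (λ d → c p d * Λ d) + L p * x) total)
        (trans (arith 3 (λ a l b → a :+ l :* (# 1 :+ b) := l :+ (a :+ l :* b)))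
        (trans (cong (L p +_) (trans (sym divisible) ih)) (sym (L-* p m pp 1≤m)))))
        where
        total : Div m (s pp) ≡ ι 1 + Div m (λ d → 𝟙 (p ∣? d) * s pp d)
        total = trans (Div-cong m (λ d _ → c-split p d (s pp d)))
          (trans (Div-+ m (λ d → c p d * s pp d) (λ d → 𝟙 (p ∣? d) * s pp d))
            (cong (_+ Div m (λ d → 𝟙 (p ∣? d) * s pp d)) (Div-c-s pp m 1≤m)))
        divisible : Div m Λ ≡ Div m (λ d → c p d * Λ d) + L p * Div m (λ d → 𝟙 (p ∣? d) * s pp d)
        divisible = trans (Div-cong m (λ d _ → c-split p d (Λ d)))
          (trans (Div-+ m (λ d → c p d * Λ d) (λ d → 𝟙 (p ∣? d) * Λ d))
            (cong (Div m (λ d → c p d * Λ d) +_)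
              (trans (Div-cong m (Λ-divisible pp)) (Div-*ˡ m (L p) (λ d → 𝟙 (p ∣? d) * s pp d)))))

    Λ≤L : ∀ n → 1 ℕ.≤ n → Λ n ≤ L n
    Λ≤L (suc n) 1≤n = subst (Λ (suc n) ≤_) (Div-Λ (suc n) 1≤n)
      (subst (_≤ Div (suc n) Λ) (trans (cong (λ x → ι 0 + x * Λ (suc n)) (𝟙-yes (suc n ∣? suc n) ∣-refl))
          (arith 1 (λ x → # 0 :+ # 1 :* x := x)))
        (+-mono-≤ (∑-nonneg n (λ k 1≤k _ → *-nonneg (𝟙-nonneg (k ∣? suc n)) (Λ-nonneg k 1≤k))) ≤-refl))

-- Selberg's formula

halve : ∀ n → ∃[ m ] (n ≡ 2 ℕ.* m ⊎ n ≡ suc (2 ℕ.* m))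
halve zero = 0 , inj₁ refl
halve (suc n) with halve n
... | m , inj₁ e = m , inj₂ (cong suc e)
... | m , inj₂ e = suc m , inj₁ (trans (cong suc e) (sym (ℕₚ.*-suc 2 m)))

module Selberg (F : OrderedField) where
  open OrderedField F
  open LinearArithmetic F
  open Sums F
  open Logarithm F
  open Moebius F

  ∑-÷ : ∀ n i (g : ℕ → R) → 1 ℕ.≤ i → ∑ (n ÷ i) g ≡ ∑ n (λ j → 𝟙 (i ℕ.* j ℕ.≤? n) * g j)
  ∑-÷ n i g 1≤i = trans
    (∑-cong (n ÷ i) (λ j _ j≤ → sym (trans (cong (_* g j) (𝟙-yes (i ℕ.* j ℕ.≤? n)
       (ℕₚ.≤-trans (ℕₚ.*-monoʳ-≤ i j≤) (÷-lower n i)))) 1*-identity)))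
    (sym (∑-extend (÷-≤ n i) (λ j lt _ → trans (cong (_* g j) (𝟙-no (i ℕ.* j ℕ.≤? n)
       (λ h → ℕₚ.<⇒≱ lt (÷-greatest i j 1≤i h)))) 0*-zero)))

  -- Both sides run over the lattice points with i j ≤ n.
  ∑-hyperbola : ∀ n (f : ℕ → ℕ → R) →
                ∑ n (λ i → ∑ (n ÷ i) (λ j → f i j)) ≡ ∑ n (λ j → ∑ (n ÷ j) (λ i → f i j))
  ∑-hyperbola n f = trans (∑-cong n (λ i 1≤i _ → ∑-÷ n i (f i) 1≤i))
    (trans (∑-swap n n (λ i j → 𝟙 (i ℕ.* j ℕ.≤? n) * f i j))
      (∑-cong n (λ j 1≤j _ → trans
        (∑-cong n (λ i _ _ → cong (λ k → 𝟙 (k ℕ.≤? n) * f i j) (ℕₚ.*-comm i j)))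
        (sym (∑-÷ n j (λ i → f i j) 1≤j)))))

  ∑-H : ∀ n → ∑ n H ≡ (ι n + ι 1) * H n - ι n
  ∑-H zero = arith 0 (# 0 := (# 0 :+ # 1) :* # 0 :- # 0)
  ∑-H (suc n) = trans
    (arith 4 (λ a h n i → a := (n :+ # 1) :* h :- n ⇒ (# 1 :+ n) :* i := # 1 ⇒
        a :+ (h :+ i) := ((# 1 :+ n) :+ # 1) :* (h :+ i) :- (# 1 :+ n))
      (∑-H n) (trans (cong (_* inv (suc n)) (sym (ι-suc n))) (inv-cancel (suc n) ℕ.z<s)))
    (cong (λ k → (k + ι 1) * H (suc n) - k) (sym (ι-suc n)))

  H-square : ∀ n → H n * H n ≤ ∑ n (λ j → ι 2 * (H j * inv j))
  H-square zero = arith 0 (# 0 :* # 0 :≤ # 0)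
  H-square (suc n) =
    arith 3 (λ a h i → h :* h :≤ a ⇒ # 0 :≤ i :* i ⇒
        (h :+ i) :* (h :+ i) :≤ a :+ # 2 :* ((h :+ i) :* i))
      (H-square n) (square-nonneg (inv (suc n)))

  -- The second summand bounds the tail of the series.
  H-inv-squares : ∀ n → 1 ℕ.≤ n → ∑ n (λ j → H j * inv j * inv j) + (H n + ι 2) * inv n ≤ ι 4
  H-inv-squares (suc zero) _ =
    subst₂ (λ h i → (ι 0 + h * i * i) + (h + ι 2) * i ≤ ι 4) (sym H-1) (sym inv-1)
      (arith 0 ((# 0 :+ # 1 :* # 1 :* # 1) :+ (# 1 :+ # 2) :* # 1 :≤ # 4))
  H-inv-squares (suc n@(suc _)) _ = ≤-trans
    (arith 4 (λ v h i k → i :- k := i :* k ⇒ h :* (i :- k) := h :* (i :* k) ⇒ # 0 :≤ h :* k :* (i :- k) ⇒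
        # 0 :≤ k :* (i :- k) ⇒ # 0 :≤ k :* k :* (# 1 :- k) ⇒
        (v :+ (h :+ k) :* k :* k) :+ ((h :+ k) :+ # 2) :* k :≤ v :+ (h :+ # 2) :* i)
      difference (cong (H n *_) difference) (*-nonneg (*-nonneg (H-nonneg n) 0≤k) 0≤i-k) (*-nonneg 0≤k 0≤i-k)
      (*-nonneg (square-nonneg k) (arith 1 (λ k → k :≤ # 1 ⇒ # 0 :≤ # 1 :- k) (inv≤1 (suc n)))))
    (H-inv-squares n ℕ.z<s)
    where
    i = inv n
    k = inv (suc n)
    0≤k = inv-nonneg (suc n)
    0≤i-k : ι 0 ≤ i - k
    0≤i-k = arith 2 (λ k i → k :≤ i ⇒ # 0 :≤ i :- k) (inv-anti ℕ.z<s (ℕₚ.n≤1+n n))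
    difference : i - k ≡ i * k
    difference = arith 3 (λ n i k → n :* i :* k := # 1 :* k ⇒ (# 1 :+ n) :* k :* i := # 1 :* i ⇒ i :- k := i :* k)
      (cong (_* k) (inv-cancel n ℕ.z<s))
      (cong (_* i) (trans (cong (_* k) (sym (ι-suc n))) (inv-cancel (suc n) ℕ.z<s)))

  -- Write each square as at most the sum of 2 H j / j up to x/d and exchange: 2x times the
  -- convergent sum of H j / j² remains. A bound of order x, with no logarithm, is what makes the
  -- error in Selberg's formula O(x).
  ∑-H-squares : ∀ x → ∑ x (λ d → H (x ÷ d) * H (x ÷ d)) ≤ ι 8 * ι x
  ∑-H-squares zero = arith 0 (# 0 :≤ # 8 :* # 0)
  ∑-H-squares x@(suc _) =
    ≤-trans (∑-mono x (λ d _ _ → H-square (x ÷ d)))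
    (≤-trans (≡⇒≤ (∑-hyperbola x (λ _ j → ι 2 * (H j * inv j))))
    (≤-trans (∑-mono x (λ j 1≤j _ → bound j 1≤j))
    (≤-trans (≡⇒≤ (∑-*ˡ x (ι 2 * ι x) (λ j → H j * inv j * inv j)))
      (≤-trans (*-monoˡ (ι 2 * ι x) (*-nonneg (ι-nonneg 2) (ι-nonneg x))
          (arith 2 (λ a b → a :+ b :≤ # 4 ⇒ # 0 :≤ b ⇒ a :≤ # 4) (H-inv-squares x ℕ.z<s)
            (*-nonneg (arith 1 (λ h → # 0 :≤ h ⇒ # 0 :≤ h :+ # 2) (H-nonneg x)) (inv-nonneg x))))
        (arith 1 (λ x → # 2 :* x :* # 4 :≤ # 8 :* x))))))
    where
    bound : ∀ j → 1 ℕ.≤ j → ∑ (x ÷ j) (λ _ → ι 2 * (H j * inv j)) ≤ ι 2 * ι x * (H j * inv j * inv j)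
    bound j 1≤j = ≤-trans (≡⇒≤ (∑-const (x ÷ j) (ι 2 * (H j * inv j))))
      (≤-trans (*-monoʳ (ι 2 * (H j * inv j)) (*-nonneg (ι-nonneg 2) (*-nonneg (H-nonneg j) (inv-nonneg j)))
          (÷-inv-lower x j 1≤j))
        (arith 3 (λ x i h → x :* i :* (# 2 :* (h :* i)) :≤ # 2 :* x :* (h :* i :* i))))

  infix 4 _within_

  _within_ : R → R → Set
  a within b = (- b ≤ a) × (a ≤ b)

  within-* : ∀ {a b c d} → a within b → c within d → a * c within b * d
  within-* {a} {b} {c} {d} (l , u) (l′ , u′) =
    arith 4 (λ a b c d → # 0 :≤ (b :- a) :* (d :- c) ⇒ # 0 :≤ (b :+ a) :* (d :+ c) ⇒ :- (b :* d) :≤ a :* c)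
      (*-nonneg b-a d-c) (*-nonneg b+a d+c) ,
    arith 4 (λ a b c d → # 0 :≤ (b :- a) :* (d :+ c) ⇒ # 0 :≤ (b :+ a) :* (d :- c) ⇒ a :* c :≤ b :* d)
      (*-nonneg b-a d+c) (*-nonneg b+a d-c)
    where
    b-a = diff-nonneg u
    d-c = diff-nonneg u′
    b+a = arith 2 (λ a b → :- b :≤ a ⇒ # 0 :≤ b :+ a) l
    d+c = arith 2 (λ a b → :- b :≤ a ⇒ # 0 :≤ b :+ a) l′

  within-∑ : ∀ n {f g : ℕ → R} → (∀ k → 1 ℕ.≤ k → k ℕ.≤ n → f k within g k) → ∑ n f within ∑ n g
  within-∑ n {f} {g} h =
    subst (_≤ ∑ n f) (∑-neg n g) (∑-mono n (λ k l u → proj₁ (h k l u))) ,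
    ∑-mono n (λ k l u → proj₂ (h k l u))

  module _ {X : ℕ} (lg : Log X) where
    open Log lg
    open VonMangoldt lg

    ψ : ℕ → R
    ψ n = ∑ n Λ

    M : ℕ → R
    M n = ∑ n (λ k → Λ k * inv k)

    -- The analogue of the logarithm of n factorial.
    T : ℕ → R
    T n = ∑ n L

    ψ-mono : ∀ {m n} → m ℕ.≤ n → ψ m ≤ ψ n
    ψ-mono m≤n = ∑-grow m≤n (λ k m<k _ → Λ-nonneg k (ℕₚ.≤-trans ℕ.z<s m<k))

    ψ-nonneg : ∀ n → ι 0 ≤ ψ n
    ψ-nonneg n = ∑-nonneg n (λ k 1≤k _ → Λ-nonneg k 1≤k)

    T-∑∑ : ∀ y → T y ≡ ∑ y (λ k → ∑ (y ÷ k) (λ _ → Λ k))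
    T-∑∑ y = trans (∑-cong y (λ n 1≤n n≤y → sym (trans (Div-extend Λ 1≤n n≤y) (Div-Λ n 1≤n))))
      (trans (∑-swap y y (λ n k → 𝟙 (k ∣? n) * Λ k))
        (∑-cong y (λ k 1≤k _ → ∑-multiples y k 1≤k (λ _ → Λ k))))

    T-Λ : ∀ y → T y ≡ ∑ y (λ k → Λ k * ι (y ÷ k))
    T-Λ y = trans (T-∑∑ y) (∑-cong y (λ k _ _ → trans (∑-const (y ÷ k) (Λ k)) *-swap))

    T-ψ : ∀ y → T y ≡ ∑ y (λ m → ψ (y ÷ m))
    T-ψ y = trans (T-∑∑ y) (∑-hyperbola y (λ k _ → Λ k))

    T-upper : ∀ y → y ℕ.≤ X → T y ≤ (ι y + ι 1) * H y - ι y - γ * ι y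
    T-upper y y≤X = ≤-trans
      (∑-mono y {g = λ k → H k - γ} (λ k 1≤k k≤y →
        arith 3 (λ g h l → g :≤ h :- l ⇒ l :≤ h :- g) (lower k 1≤k (ℕₚ.≤-trans k≤y y≤X))))
      (≡⇒≤ (trans (∑-minus y H (λ _ → γ)) (cong₂ _-_ (∑-H y) (trans (∑-const y γ) *-swap))))

    T-lower : ∀ y → y ℕ.≤ X → (ι y + ι 1) * H y - ι y - γ * ι y - ι 2 * H y ≤ T y
    T-lower y y≤X = ≤-trans
      (≡⇒≤ (sym (trans (∑-minus y (λ k → H k - γ) (λ k → ι 2 * inv k))
        (cong₂ _-_ (trans (∑-minus y H (λ _ → γ)) (cong₂ _-_ (∑-H y) (trans (∑-const y γ) *-swap)))
          (∑-*ˡ y (ι 2) inv)))))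
      (∑-mono y (λ k 1≤k k≤y →
        arith 4 (λ g h l i → h :- l :≤ g :+ i ⇒ h :- g :- i :≤ l) (upper k 1≤k (ℕₚ.≤-trans k≤y y≤X))))

    L≤H : ∀ n → 1 ℕ.≤ n → n ℕ.≤ X → L n ≤ H n
    L≤H n 1≤n n≤X = arith 3 (λ g h l → g :≤ h :- l ⇒ # 0 :≤ g ⇒ l :≤ h) (lower n 1≤n n≤X) γ-nonneg

    H≤L+3 : ∀ n → 1 ℕ.≤ n → n ℕ.≤ X → H n ≤ L n + ι 3
    H≤L+3 n 1≤n n≤X = arith 4 (λ g h l i → h :- l :≤ g :+ # 2 :* i ⇒ g :≤ # 1 ⇒ i :≤ # 1 ⇒ h :≤ l :+ # 3)
      (upper n 1≤n n≤X) γ≤1 (inv≤1 n)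

    Λ≤H : ∀ n → 1 ℕ.≤ n → n ℕ.≤ X → Λ n ≤ H n
    Λ≤H n 1≤n n≤X = ≤-trans (Λ≤L n 1≤n) (L≤H n 1≤n n≤X)

    -- Chebyshev's argument with T (2 m) - 2 T m, the logarithm of a central binomial coefficient:
    -- in it every Λ k has a nonnegative multiplicity, at least 1 on (m, 2 m].
    ψ-double : ∀ m → 2 ℕ.* m ℕ.≤ X → ψ (2 ℕ.* m) ≤ ψ m + ι 6 * ι m
    ψ-double m 2m≤X = ≤-trans
      (arith 4 (λ a b c d → a :- b :≤ c :- d ⇒ # 0 :≤ d ⇒ a :≤ b :+ c)
        (∑-tail-mono {f = Λ} {g} m≤2m tail) (∑-nonneg m (λ k 1≤k _ → *-nonneg (Λ-nonneg k 1≤k) (head k 1≤k))))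
      (+-mono-≤ ≤-refl (≤-trans (≡⇒≤ total)
        (arith 7 (λ t u n m h h₂ g → t :≤ (n :+ # 1) :* h₂ :- n :- g :* n ⇒
            (m :+ # 1) :* h :- m :- g :* m :- # 2 :* h :≤ u ⇒ n := # 2 :* m ⇒ g :* n := g :* (# 2 :* m) ⇒ n :* h₂ := # 2
              :* m :* h₂ ⇒
            m :* (h₂ :- h) :≤ m :* # 1 ⇒ h :≤ m ⇒ h₂ :≤ n ⇒
            t :- # 2 :* u :≤ # 6 :* m)
          (T-upper (2 ℕ.* m) 2m≤X) (T-lower m (ℕₚ.≤-trans m≤2m 2m≤X)) (ι-* 2 m) (cong (γ *_) (ι-* 2 m))
          (cong (_* H (2 ℕ.* m)) (ι-* 2 m))
          (*-monoˡ (ι m) (ι-nonneg m) (H-double m)) (H≤ι m) (H≤ι (2 ℕ.* m)))))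
      where
      m≤2m : m ℕ.≤ 2 ℕ.* m
      m≤2m = ℕₚ.m≤m+n m (m ℕ.+ 0)
      g : ℕ → R
      g k = Λ k * (ι ((2 ℕ.* m) ÷ k) - ι 2 * ι (m ÷ k))
      head : ∀ k → 1 ℕ.≤ k → ι 0 ≤ ι ((2 ℕ.* m) ÷ k) - ι 2 * ι (m ÷ k)
      head k 1≤k = diff-nonneg (subst (_≤ ι ((2 ℕ.* m) ÷ k)) (ι-* 2 (m ÷ k))
        (ι-mono (÷-greatest k (2 ℕ.* (m ÷ k)) 1≤k
          (arithℕ 3 (λ k q m → k :* q :≤ m ⇒ k :* (# 2 :* q) :≤ # 2 :* m) k (m ÷ k) m (÷-lower m k)))))
      tail : ∀ k → m ℕ.< k → k ℕ.≤ 2 ℕ.* m → Λ k ≤ g k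
      tail k m<k k≤2m = ≤-trans (≡⇒≤ (sym *-one)) (*-monoˡ (Λ k) (Λ-nonneg k 1≤k)
        (subst (λ q → ι 1 ≤ ι ((2 ℕ.* m) ÷ k) - ι 2 * ι q) (sym (÷-small k m<k))
          (arith 1 (λ x → # 1 :≤ x ⇒ # 1 :≤ x :- # 2 :* # 0)
            (ι-mono (÷-greatest k 1 1≤k (subst (ℕ._≤ 2 ℕ.* m) (sym (ℕₚ.*-identityʳ k)) k≤2m))))))
        where 1≤k = ℕₚ.≤-trans ℕ.z<s m<k
      total : ∑ (2 ℕ.* m) g ≡ T (2 ℕ.* m) - ι 2 * T m
      total = trans (∑-cong (2 ℕ.* m) (λ k _ _ → arith 3 (λ l a b → l :* (a :- # 2 :* b) := l :* a :- # 2 :* (l :* b))))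
        (trans (∑-minus (2 ℕ.* m) (λ k → Λ k * ι ((2 ℕ.* m) ÷ k)) (λ k → ι 2 * (Λ k * ι (m ÷ k))))
          (cong₂ _-_ (sym (T-Λ (2 ℕ.* m))) (trans (∑-*ˡ (2 ℕ.* m) (ι 2) (λ k → Λ k * ι (m ÷ k)))
            (cong (ι 2 *_) (trans (∑-extend m≤2m (λ k m<k _ → trans (cong (λ q → Λ k * ι q) (÷-small k m<k))
                *-zero)) (sym (T-Λ m)))))))

    -- Halve y and apply `ψ-double`; for odd y the extra term Λ y ≤ y is absorbed by the constant.
    chebyshev : ∀ y → y ℕ.≤ X → ψ y ≤ ι 10 * ι y
    chebyshev = <-rec (λ y → y ℕ.≤ X → ψ y ≤ ι 10 * ι y) step
      where
      step : ∀ y → (∀ {k} → k ℕ.< y → k ℕ.≤ X → ψ k ≤ ι 10 * ι k) → y ℕ.≤ X → ψ y ≤ ι 10 * ι y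
      step y rec y≤X with halve y
      ... | zero , inj₁ refl = arith 0 (# 0 :≤ # 10 :* # 0)
      ... | m@(suc m′) , inj₁ refl =
        arith 4 (λ a b n m → a :≤ b :+ # 6 :* m ⇒ b :≤ # 10 :* m ⇒ n := # 2 :* m ⇒ # 0 :≤ m ⇒ a :≤ # 10 :* n)
          (ψ-double m y≤X) (rec m<2m (ℕₚ.≤-trans (ℕₚ.<⇒≤ m<2m) y≤X)) (ι-* 2 m) (ι-nonneg m)
        where
        m<2m : m ℕ.< 2 ℕ.* m
        m<2m = arithℕ 1 (λ m → # 1 :+ (# 1 :+ m) :≤ # 2 :* (# 1 :+ m)) m′
      ... | m , inj₂ refl =
        arith 6 (λ a l b n m n′ → a :≤ b :+ # 6 :* m ⇒ b :≤ # 10 :* m ⇒ n := # 2 :* m ⇒ n′ := # 1 :+ n ⇒ l :≤ n′ ⇒ # 0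
          :≤ m ⇒
            a :+ l :≤ # 10 :* n′)
          (ψ-double m (ℕₚ.≤-trans (ℕₚ.n≤1+n _) y≤X)) (rec (ℕ.s≤s m≤2m) (ℕₚ.≤-trans m≤2m (ℕₚ.≤-trans (ℕₚ.n≤1+n _) y≤X)))
          (ι-* 2 m) (ι-suc (2 ℕ.* m))
          (≤-trans (Λ≤H (suc (2 ℕ.* m)) ℕ.z<s y≤X) (H≤ι (suc (2 ℕ.* m)))) (ι-nonneg m)
        where
        m≤2m : m ℕ.≤ 2 ℕ.* m
        m≤2m = ℕₚ.m≤m+n m (m ℕ.+ 0)

    private
      y*M : ∀ y → ι y * M y ≡ ∑ y (λ k → Λ k * (ι y * inv k))
      y*M y = trans (sym (∑-*ˡ y (ι y) (λ k → Λ k * inv k)))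
        (∑-cong y (λ k _ _ → arith 3 (λ y l i → y :* (l :* i) := l :* (y :* i))))

      T≤y*M : ∀ y → T y ≤ ι y * M y
      T≤y*M y = ≤-trans (≡⇒≤ (T-Λ y)) (≤-trans
        (∑-mono y (λ k 1≤k _ → *-monoˡ (Λ k) (Λ-nonneg k 1≤k) (÷-inv-lower y k 1≤k))) (≡⇒≤ (sym (y*M y))))

      y*M≤T+ψ : ∀ y → ι y * M y ≤ T y + ψ y
      y*M≤T+ψ y = ≤-trans (≡⇒≤ (y*M y)) (≤-trans
        (∑-mono y (λ k 1≤k _ → *-monoˡ (Λ k) (Λ-nonneg k 1≤k) (÷-inv-upper y k 1≤k)))
        (≡⇒≤ (trans (∑-cong y (λ k _ _ → arith 2 (λ l a → l :* (a :+ # 1) := l :* a :+ l)))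
          (trans (∑-+ y (λ k → Λ k * ι (y ÷ k)) Λ) (cong (_+ ψ y) (sym (T-Λ y)))))))

    -- Replacing y/k by its integer part changes y M y into T y at a cost of at most ψ y, and T y is
    -- y H y + O(y).
    mertens-lower : ∀ y → 1 ℕ.≤ y → y ℕ.≤ X → H y ≤ M y + ι 3
    mertens-lower y 1≤y y≤X = cancel-ιˡ y 1≤y
      (arith 5 (λ t y m h g → t :≤ y :* m ⇒ (y :+ # 1) :* h :- y :- g :* y :- # 2 :* h :≤ t ⇒ g :* y :≤ # 1 :* y ⇒ h :≤
        y ⇒
          y :* h :≤ y :* (m :+ # 3))
        (T≤y*M y) (T-lower y y≤X) (*-monoʳ (ι y) (ι-nonneg y) γ≤1) (H≤ι y))

    mertens-upper : ∀ y → 1 ℕ.≤ y → y ℕ.≤ X → M y ≤ H y + ι 10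
    mertens-upper y 1≤y y≤X = cancel-ιˡ y 1≤y
      (arith 6 (λ t y m h g p → y :* m :≤ t :+ p ⇒ t :≤ (y :+ # 1) :* h :- y :- g :* y ⇒ # 0 :≤ g :* y ⇒ h :≤ y ⇒ p :≤ #
        10 :* y ⇒
          y :* m :≤ y :* (h :+ # 10))
        (y*M≤T+ψ y) (T-upper y y≤X) (*-nonneg γ-nonneg (ι-nonneg y)) (H≤ι y) (chebyshev y y≤X))

    S : ℕ → R
    S x = ψ x * H x + ∑ x (λ k → Λ k * ψ (x ÷ k))

    module _ (x : ℕ) (1≤x : 1 ℕ.≤ x) (x≤X : x ℕ.≤ X) where
      private
        -- Cancels the linear part of T y, which is y H y - (1 + γ) y up to a multiple of H y. The
        -- sums `G` are then only of logarithmic size.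
        κ : R
        κ = ι 1 + γ

        f : ℕ → R
        f k = ψ (x ÷ k) - ι x * inv k + κ

        -- The weight log (x/d) of the Tatuzawa-Iseki inversion, of which `identity` is the instance
        -- for f.
        W : ℕ → R
        W d = L x - L d

        G : ℕ → R
        G d = ∑ (x ÷ d) (λ m → f (d ℕ.* m))

        Div-μW : ∀ k → 1 ℕ.≤ k → Div k (λ d → μ d * W d) ≡ L x * 𝟙 (k ℕ.≟ 1) + Λ k
        Div-μW k 1≤k = trans
          (Div-cong k {g = λ d → L x * μ d + - (μ d * L d)}
            (λ d _ → arith 3 (λ m a b → m :* (a :- b) := a :* m :+ (:- (m :* b)))))
          (trans (Div-+ k (λ d → L x * μ d) (λ d → - (μ d * L d)))
            (cong₂ _+_ (trans (Div-*ˡ k (L x) μ) (cong (L x *_) (Div-μ≡𝟙 k 1≤k))) (Div-neg k (λ d → μ d * L d))))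

        at-1 : ∑ x (λ k → f k * (L x * 𝟙 (k ℕ.≟ 1))) ≡ f 1 * L x
        at-1 = trans (∑-extend 1≤x (λ k 1<k _ → trans
            (cong (λ i → f k * (L x * i)) (𝟙-no (k ℕ.≟ 1) (λ e → ℕₚ.<⇒≢ 1<k (sym e))))
                   (arith 2 (λ a b → a :* (b :* # 0) := # 0))))
          (arith 2 (λ a b → # 0 :+ a :* (b :* # 1) := a :* b))

        -- Selberg's identity, obtained by exchanging the order of summation.
        identity : ∑ x (λ d → μ d * W d * G d) ≡ f 1 * L x + ∑ x (λ k → Λ k * f k)
        identity = begin
          ∑ x (λ d → μ d * W d * G d)
            ≡⟨ ∑-cong x (λ d 1≤d _ → trans (cong (μ d * W d *_) (sym (∑-multiples x d 1≤d f)))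
                 (sym (∑-*ˡ x (μ d * W d) (λ k → 𝟙 (d ∣? k) * f k)))) ⟩
          ∑ x (λ d → ∑ x (λ k → μ d * W d * (𝟙 (d ∣? k) * f k)))
            ≡⟨ ∑-swap x x (λ d k → μ d * W d * (𝟙 (d ∣? k) * f k)) ⟩
          ∑ x (λ k → ∑ x (λ d → μ d * W d * (𝟙 (d ∣? k) * f k)))
            ≡⟨ ∑-cong x (λ k 1≤k k≤x → trans
                 (∑-cong x (λ d _ _ → arith 3 (λ m i f → m :* (i :* f) := f :* (i :* m))))
                 (trans (∑-*ˡ x (f k) (λ d → 𝟙 (d ∣? k) * (μ d * W d)))
                   (cong (f k *_) (trans (Div-extend (λ d → μ d * W d) 1≤k k≤x) (Div-μW k 1≤k))))) ⟩
          ∑ x (λ k → f k * (L x * 𝟙 (k ℕ.≟ 1) + Λ k))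
            ≡⟨ ∑-cong x (λ k _ _ → arith 3 (λ f a l → f :* (a :+ l) := f :* a :+ l :* f)) ⟩
          ∑ x (λ k → f k * (L x * 𝟙 (k ℕ.≟ 1)) + Λ k * f k)
            ≡⟨ ∑-+ x (λ k → f k * (L x * 𝟙 (k ℕ.≟ 1))) (λ k → Λ k * f k) ⟩
          ∑ x (λ k → f k * (L x * 𝟙 (k ℕ.≟ 1))) + ∑ x (λ k → Λ k * f k)
            ≡⟨ cong (_+ ∑ x (λ k → Λ k * f k)) at-1 ⟩
          f 1 * L x + ∑ x (λ k → Λ k * f k) ∎
          where open ≡-Reasoning

        module _ (d : ℕ) (1≤d : 1 ℕ.≤ d) (d≤x : d ℕ.≤ x) where
          y = x ÷ d

          1≤y : 1 ℕ.≤ y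
          1≤y = ÷-greatest d 1 1≤d (subst (ℕ._≤ x) (sym (ℕₚ.*-identityʳ d)) d≤x)

          y≤X : y ℕ.≤ X
          y≤X = ℕₚ.≤-trans (÷-≤ x d) x≤X

          G-value : G d ≡ T y - ι x * inv d * H y + κ * ι y
          G-value = trans
            (∑-cong y (λ m 1≤m _ → trans
              (cong₂ (λ q i → ψ q - ι x * i + κ) (sym (÷-÷ x d m 1≤d 1≤m)) (inv-* d m 1≤d 1≤m))
              (arith 5 (λ p x i j k → p :- x :* (i :* j) :+ k := (p :- x :* i :* j) :+ k))))
            (trans (∑-+ y (λ m → ψ (y ÷ m) - ι x * inv d * inv m) (λ _ → κ))
              (cong₂ _+_ (trans (∑-minus y (λ m → ψ (y ÷ m)) (λ m → ι x * inv d * inv m))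
                  (cong₂ _-_ (sym (T-ψ y)) (∑-*ˡ y (ι x * inv d) inv)))
                (trans (∑-const y κ) *-swap)))

          G-bound : G d within ι 2 * H y
          G-bound = subst (_within ι 2 * H y) (sym G-value)
            (arith 5 (λ t h y g z → (y :+ # 1) :* h :- y :- g :* y :- # 2 :* h :≤ t ⇒ z :* h :≤ (y :+ # 1) :* h ⇒
                :- (# 2 :* h) :≤ t :- z :* h :+ (# 1 :+ g) :* y)
              (T-lower y y≤X) (*-monoʳ (H y) (H-nonneg y) (÷-inv-upper x d 1≤d)) ,
             arith 5 (λ t h y g z → t :≤ (y :+ # 1) :* h :- y :- g :* y ⇒ y :* h :≤ z :* h ⇒ # 0 :≤ h ⇒
                t :- z :* h :+ (# 1 :+ g) :* y :≤ # 2 :* h)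
              (T-upper y y≤X) (*-monoʳ (H y) (H-nonneg y) (÷-inv-lower x d 1≤d)) (H-nonneg y))

          Hx-Hd : H x - H d ≤ H y + ι 1
          Hx-Hd = arith 5 (λ a b d h i → a :≤ b ⇒ b :- d :≤ h :+ i ⇒ i :≤ # 1 ⇒ a :- d :≤ h :+ # 1)
            (H-mono (ℕₚ.<⇒≤ (subst (x ℕ.<_) (ℕₚ.*-comm d (suc y)) (÷-upper x d 1≤d))))
            (δ≤H (suc y) d ℕ.z<s) (inv≤1 (suc y))

          W-bound : W d within ι 4 * H y
          W-bound =
            arith 7 (λ lx ld hx hd hy g i → hx :- lx :≤ g :+ # 2 :* i ⇒ g :≤ hd :- ld ⇒ i :≤ # 1 ⇒ hd :≤ hx ⇒ # 1 :≤ hy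
              ⇒
                :- (# 4 :* hy) :≤ lx :- ld)
              (upper x 1≤x x≤X) (lower d 1≤d (ℕₚ.≤-trans d≤x x≤X)) (inv≤1 x) (H-mono d≤x) (1≤H 1≤y) ,
            arith 7 (λ lx ld hx hd hy g i → g :≤ hx :- lx ⇒ hd :- ld :≤ g :+ # 2 :* i ⇒ i :≤ # 1 ⇒ hx :- hd :≤ hy :+ # 1
              ⇒ # 1 :≤ hy ⇒
                lx :- ld :≤ # 4 :* hy)
              (lower x 1≤x x≤X) (upper d 1≤d (ℕₚ.≤-trans d≤x x≤X)) (inv≤1 d) Hx-Hd (1≤H 1≤y)

          term-bound : μ d * W d * G d within ι 8 * (H y * H y)
          term-bound = subst (μ d * W d * G d within_)
              (arith 1 (λ h → # 1 :* (# 4 :* h) :* (# 2 :* h) := # 8 :* (h :* h)))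
            (within-* (within-* (μ-lower d , μ-upper d) W-bound) G-bound)

        E = f 1 * L x + ∑ x (λ k → Λ k * f k)

        E-bound : E within ι 64 * ι x
        E-bound = arith 3 (λ a b x → :- b :≤ a ⇒ b :≤ # 64 :* x ⇒ :- (# 64 :* x) :≤ a) (proj₁ sums) total ,
                  ≤-trans (proj₂ sums) total
          where
          sums : E within ∑ x (λ d → ι 8 * (H (x ÷ d) * H (x ÷ d)))
          sums = subst (_within ∑ x (λ d → ι 8 * (H (x ÷ d) * H (x ÷ d)))) identity (within-∑ x term-bound)
          total : ∑ x (λ d → ι 8 * (H (x ÷ d) * H (x ÷ d))) ≤ ι 64 * ι x
          total = ≤-trans (≡⇒≤ (∑-*ˡ x (ι 8) (λ d → H (x ÷ d) * H (x ÷ d))))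
            (arith 2 (λ a x → a :≤ # 8 :* x ⇒ # 8 :* a :≤ # 64 :* x) (∑-H-squares x))

        Λψ = ∑ x (λ k → Λ k * ψ (x ÷ k))

        E-value : E ≡ (ψ x - ι x + κ) * L x + (Λψ - ι x * M x + κ * ψ x)
        E-value = cong₂ (λ a b → a * L x + b)
          (cong₂ (λ q i → ψ q - i + κ) (÷-1 x) (trans (cong (ι x *_) inv-1) *-one))
          (trans (∑-cong x (λ k _ _ → arith 5 (λ l p x i k → l :* (p :- x :* i :+ k) := (l :* p :- x :* (l :* i)) :+ k
            :* l)))
            (trans (∑-+ x (λ k → Λ k * ψ (x ÷ k) - ι x * (Λ k * inv k)) (λ k → κ * Λ k))
              (cong₂ _+_ (trans (∑-minus x (λ k → Λ k * ψ (x ÷ k)) (λ k → ι x * (Λ k * inv k)))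
                  (cong (λ z → Λψ - z) (∑-*ˡ x (ι x) (λ k → Λ k * inv k)))) (∑-*ˡ x κ Λ))))

      private
        0≤H-L : ι 0 ≤ H x - L x
        0≤H-L = arith 2 (λ l h → l :≤ h ⇒ # 0 :≤ h :- l) (L≤H x 1≤x x≤X)

        H-L≤3 : H x - L x ≤ ι 3
        H-L≤3 = arith 2 (λ l h → h :≤ l :+ # 3 ⇒ h :- l :≤ # 3) (H≤L+3 x 1≤x x≤X)

      -- The constant 104 is attained in the upper bound: 64 from `E-bound`, 30 from replacing L by
      -- H beside ψ x ≤ 10 x, and 10 from Mertens' estimate.
      selberg : S x - ι 2 * ι x * H x within ι 104 * ι x
      selberg =
        arith 8 (λ e p x l h m s g → :- (# 64 :* x) :≤ e ⇒
            e := (p :- x :+ (# 1 :+ g)) :* l :+ (s :- x :* m :+ (# 1 :+ g) :* p) ⇒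
            # 0 :≤ p :* (h :- l) ⇒ x :* (h :- l) :≤ x :* # 3 ⇒ x :* h :≤ x :* (m :+ # 3) ⇒
            g :* l :≤ # 1 :* l ⇒ l :≤ h ⇒ h :≤ x ⇒ g :* p :≤ # 1 :* p ⇒ p :≤ # 10 :* x ⇒ # 0 :≤ x ⇒
            :- (# 104 :* x) :≤ (p :* h :+ s) :- # 2 :* x :* h)
          (proj₁ E-bound) E-value (*-nonneg (ψ-nonneg x) 0≤H-L) (*-monoˡ (ι x) (ι-nonneg x) H-L≤3)
          (*-monoˡ (ι x) (ι-nonneg x) (mertens-lower x 1≤x x≤X)) (*-monoʳ (L x) (L-nonneg x) γ≤1) (L≤H x 1≤x x≤X)
            (H≤ι x)
          (*-monoʳ (ψ x) (ψ-nonneg x) γ≤1) (chebyshev x x≤X) (ι-nonneg x) ,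
        arith 8 (λ e p x l h m s g → e :≤ # 64 :* x ⇒
            e := (p :- x :+ (# 1 :+ g)) :* l :+ (s :- x :* m :+ (# 1 :+ g) :* p) ⇒
            p :* (h :- l) :≤ p :* # 3 ⇒ # 0 :≤ x :* (h :- l) ⇒ x :* m :≤ x :* (h :+ # 10) ⇒
            # 0 :≤ g :* l ⇒ # 0 :≤ l ⇒ # 0 :≤ g :* p ⇒ # 0 :≤ p ⇒ p :≤ # 10 :* x ⇒
            (p :* h :+ s) :- # 2 :* x :* h :≤ # 104 :* x)
          (proj₂ E-bound) E-value (*-monoˡ (ψ x) (ψ-nonneg x) H-L≤3) (*-nonneg (ι-nonneg x) 0≤H-L)
          (*-monoˡ (ι x) (ι-nonneg x) (mertens-upper x 1≤x x≤X)) (*-nonneg γ-nonneg (L-nonneg x)) (L-nonneg x)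
          (*-nonneg γ-nonneg (ψ-nonneg x)) (ψ-nonneg x) (chebyshev x x≤X)

-- Primes in short intervals

-- A discrete intermediate value theorem.
crossing : ∀ (a : ℕ → ℕ) t m d → a m ℕ.≤ t → t ℕ.≤ a (m ℕ.+ suc d) →
           ∃[ i ] m ℕ.≤ i × i ℕ.≤ m ℕ.+ d × a i ℕ.≤ t × t ℕ.≤ a (suc i)
crossing a t m zero l u = m , ℕₚ.≤-refl , ℕₚ.m≤m+n m 0 , l , subst (λ k → t ℕ.≤ a k) (ℕₚ.+-comm m 1) u
crossing a t m (suc d) l u with ℕₚ.≤-total t (a (suc m))
... | inj₁ h = m , ℕₚ.≤-refl , ℕₚ.m≤m+n m (suc d) , l , h
... | inj₂ h with crossing a t (suc m) d h (subst (λ k → t ℕ.≤ a k) (ℕₚ.+-suc m (suc d)) u)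
...   | i , m<i , i≤ , l′ , u′ = i , ℕₚ.<⇒≤ m<i , subst (i ℕ.≤_) (sym (ℕₚ.+-suc m d)) i≤ , l′ , u′

-- P k and N k may both hold: `≤-total` offers overlapping alternatives, and the order of the field
-- is not assumed decidable.
scan : ∀ {P N : ℕ → Set} m n → (∀ k → m ℕ.< k → k ℕ.≤ n → P k ⊎ N k) →
       (∃[ k ] m ℕ.< k × k ℕ.≤ n × P k) ⊎ (∀ k → m ℕ.< k → k ℕ.≤ n → N k)
scan m zero h = inj₂ (λ k m<k k≤0 → ⊥-elim (ℕₚ.n≮0 (ℕₚ.<-≤-trans m<k k≤0)))
scan m (suc n) h with scan m n (λ k l u → h k l (ℕₚ.m≤n⇒m≤1+n u))
... | inj₁ (k , l , u , p) = inj₁ (k , l , ℕₚ.m≤n⇒m≤1+n u , p)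
... | inj₂ none with m ℕ.<? suc n
...   | no m≮ = inj₂ (λ k l u → ⊥-elim (m≮ (ℕₚ.<-≤-trans l u)))
...   | yes m< with h (suc n) m< ℕₚ.≤-refl
...     | inj₁ p = inj₁ (suc n , m< , ℕₚ.≤-refl , p)
...     | inj₂ q = inj₂ all
  where
  all : ∀ k → m ℕ.< k → k ℕ.≤ suc n → _
  all k l u with ℕₚ.m≤n⇒m<n∨m≡n u
  ... | inj₁ k<n = none k l (ℕₚ.≤-pred k<n)
  ... | inj₂ refl = q

n<2^n : ∀ n → n ℕ.< 2 ℕ.^ n
n<2^n zero = ℕₚ.≤-refl
n<2^n (suc n) = ℕₚ.≤-trans (ℕ.s≤s (n<2^n n)) (go (ℕₚ.≤-trans ℕ.z<s (n<2^n n)))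
  where
  go : ∀ {m} → 1 ℕ.≤ m → suc m ℕ.≤ m ℕ.+ (m ℕ.+ 0)
  go {m} h = subst (λ k → suc m ℕ.≤ m ℕ.+ k) (sym (ℕₚ.+-identityʳ m)) (ℕₚ.+-monoˡ-≤ m h)

1≤^ : ∀ {m} n → 1 ℕ.≤ m → 1 ℕ.≤ m ℕ.^ n
1≤^ {m} n h = ℕₚ.m^n>0 m {{ℕ.>-nonZero h}} n

-- Steps of (almost) ratio 1 + 1/b, in integers.
grow : ℕ → ℕ → ℕ → ℕ
grow b zero u = u
grow b (suc i) u = grow b i u ℕ.+ grow b i u ÷ b

module Growth (F : OrderedField) where
  open OrderedField F
  open LinearArithmetic F
  open Sums F
  open Logarithm F

  ÷-compare : ∀ {x y k k′} → 1 ℕ.≤ k → 1 ℕ.≤ k′ → x ℕ.* k′ ℕ.≤ y ℕ.* k → x ÷ k ℕ.≤ y ÷ k′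
  ÷-compare {x} {y} {k} {k′} 1≤k 1≤k′ h = ÷-greatest k′ (x ÷ k) 1≤k′
    (ℕₚ.*-cancelˡ-≤ k {{ℕ.>-nonZero 1≤k}} (ℕₚ.≤-trans
      (arithℕ 4 (λ k q x k′ → k :* q :* k′ :≤ x :* k′ ⇒ k :* (k′ :* q) :≤ x :* k′) k (x ÷ k) x k′
        (ℕₚ.*-monoˡ-≤ k′ (÷-lower x k)))
      (subst (x ℕ.* k′ ℕ.≤_) (ℕₚ.*-comm y k) h)))

  module _ (b : ℕ) where

    grow-step : ∀ i u → grow b i u ℕ.≤ grow b (suc i) u
    grow-step i u = ℕₚ.m≤m+n (grow b i u) (grow b i u ÷ b)

    grow-≤ : ∀ {i j} u → i ℕ.≤ j → grow b i u ℕ.≤ grow b j u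
    grow-≤ {i} {zero} u ℕ.z≤n = ℕₚ.≤-refl
    grow-≤ {i} {suc j} u h with ℕₚ.m≤n⇒m<n∨m≡n h
    ... | inj₂ refl = ℕₚ.≤-refl
    ... | inj₁ (ℕ.s≤s i≤j) = ℕₚ.≤-trans (grow-≤ u i≤j) (grow-step j u)

    grow-+ : ∀ i j u → grow b (i ℕ.+ j) u ≡ grow b i (grow b j u)
    grow-+ zero j u = refl
    grow-+ (suc i) j u = cong (λ v → v ℕ.+ v ÷ b) (grow-+ i j u)

    grow-double : ∀ i u → grow b i u ℕ.≤ 2 ℕ.^ i ℕ.* u
    grow-double zero u = ℕₚ.≤-reflexive (sym (ℕₚ.+-identityʳ u))
    grow-double (suc i) u = arithℕ 4 (λ v d p u → v :≤ p :* u ⇒ d :≤ v ⇒ v :+ d :≤ # 2 :* p :* u)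
      (grow b i u) (grow b i u ÷ b) (2 ℕ.^ i) u (grow-double i u) (÷-≤ (grow b i u) b)

    grow-upper : ∀ i u → b ℕ.^ i ℕ.* grow b i u ℕ.≤ suc b ℕ.^ i ℕ.* u
    grow-upper zero u = ℕₚ.≤-refl
    grow-upper (suc i) u =
      arithℕ 6 (λ b v d p q u → p :* v :≤ q :* u ⇒ b :* (p :* v) :≤ b :* (q :* u) ⇒ p :* (b :* d) :≤ p :* v ⇒
          b :* p :* (v :+ d) :≤ (# 1 :+ b) :* q :* u)
        b (grow b i u) (grow b i u ÷ b) (b ℕ.^ i) (suc b ℕ.^ i) u
        (grow-upper i u) (ℕₚ.*-monoʳ-≤ b (grow-upper i u)) (ℕₚ.*-monoʳ-≤ (b ℕ.^ i) (÷-lower (grow b i u) b))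

    module _ (1≤b : 1 ℕ.≤ b) where

      -- The numbers grow b i u − b are multiplied by at least 1 + 1/b at each step.
      grow-lower : ∀ i u → suc b ℕ.^ i ℕ.* u ℕ.+ b ℕ.^ i ℕ.* b ℕ.≤ b ℕ.^ i ℕ.* grow b i u ℕ.+ suc b ℕ.^ i ℕ.* b
      grow-lower zero u = ℕₚ.≤-refl
      grow-lower (suc i) u =
        arithℕ 6 (λ b v d p q u → b :* (q :* u :+ p :* b) :≤ b :* (p :* v :+ q :* b) ⇒ q :* u :+ p :* b :≤ p :* v :+ q
          :* b ⇒
            p :* v :≤ p :* (b :* (# 1 :+ d)) ⇒
            ((# 1 :+ b) :* q) :* u :+ (b :* p) :* b :≤ (b :* p) :* (v :+ d) :+ ((# 1 :+ b) :* q) :* b)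
          b (grow b i u) (grow b i u ÷ b) (b ℕ.^ i) (suc b ℕ.^ i) u
          (ℕₚ.*-monoʳ-≤ b (grow-lower i u)) (grow-lower i u)
          (ℕₚ.*-monoʳ-≤ (b ℕ.^ i) (ℕₚ.<⇒≤ (÷-upper (grow b i u) b 1≤b)))

      -- The additional factor 1 + 1/b on the side of u pays for all rounding losses there as soon
      -- as u ≥ b² + b.
      grow-compare : ∀ n k u → b ℕ.* b ℕ.+ b ℕ.≤ u → u ℕ.* grow b n k ℕ.≤ grow b (suc n) u ℕ.* k
      grow-compare n k u h = ℕₚ.*-cancelˡ-≤ (b ℕ.^ suc n) {{ℕ.>-nonZero (1≤^ (suc n) 1≤b)}}
        (arithℕ 7 (λ b p q u k v w →
            (b :* u) :* (p :* v) :≤ (b :* u) :* (q :* k) ⇒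
            k :* (((# 1 :+ b) :* q) :* u :+ (b :* p) :* b) :≤ k :* ((b :* p) :* w :+ ((# 1 :+ b) :* q) :* b) ⇒
            (q :* k) :* (b :* b :+ b) :≤ (q :* k) :* u ⇒ # 0 :≤ k :* ((b :* p) :* b) ⇒
            (b :* p) :* (u :* v) :≤ (b :* p) :* (w :* k))
          b (b ℕ.^ n) (suc b ℕ.^ n) u k (grow b n k) (grow b (suc n) u)
          (ℕₚ.*-monoʳ-≤ (b ℕ.* u) (grow-upper n k)) (ℕₚ.*-monoʳ-≤ k (grow-lower (suc n) u))
          (ℕₚ.*-monoʳ-≤ (suc b ℕ.^ n ℕ.* k) h) ℕ.z≤n)

      grow-4 : ∀ k → (b ℕ.+ 4) ℕ.* k ℕ.≤ b ℕ.* grow b 4 k ℕ.+ 4 ℕ.* b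
      grow-4 k = arithℕ 6 (λ b k d₀ d₁ d₂ d₃ → k :≤ b :* (# 1 :+ d₀) ⇒
          b :* d₀ :≤ b :* d₁ ⇒ b :* d₀ :≤ b :* d₂ ⇒ b :* d₀ :≤ b :* d₃ ⇒
          (b :+ # 4) :* k :≤ b :* (k :+ d₀ :+ d₁ :+ d₂ :+ d₃) :+ # 4 :* b)
        b k (grow b 0 k ÷ b) (grow b 1 k ÷ b) (grow b 2 k ÷ b) (grow b 3 k ÷ b)
        (ℕₚ.<⇒≤ (÷-upper k b 1≤b)) (ge 1) (ge 2) (ge 3)
        where
        ge : ∀ i → b ℕ.* (grow b 0 k ÷ b) ℕ.≤ b ℕ.* (grow b i k ÷ b)
        ge i = ℕₚ.*-monoʳ-≤ b (÷-mono b (grow-≤ {0} {i} k ℕ.z≤n))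

      grow-2 : ∀ u → b ℕ.* grow b 2 u ℕ.≤ (b ℕ.+ 3) ℕ.* u
      grow-2 u = ℕₚ.*-cancelˡ-≤ b {{ℕ.>-nonZero 1≤b}}
        (arithℕ 3 (λ b v u → b :* (b :* # 1) :* v :≤ (# 1 :+ b) :* ((# 1 :+ b) :* # 1) :* u ⇒ # 1 :* u :≤ b :* u ⇒
            b :* (b :* v) :≤ b :* ((b :+ # 3) :* u))
          b (grow b 2 u) u (grow-upper 2 u) (ℕₚ.*-monoˡ-≤ u 1≤b))

      -- Two steps from u gain at most 3 u/b; four steps from k gain at least 4 k/b - 4, which is no
      -- less than 3 k/b when k ≥ 4 b.
      grow-2-4 : ∀ k u → 4 ℕ.* b ℕ.≤ k → grow b 2 u ℕ.* k ℕ.≤ u ℕ.* grow b 4 k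
      grow-2-4 k u h = ℕₚ.*-cancelˡ-≤ b {{ℕ.>-nonZero 1≤b}}
        (arithℕ 5 (λ b k u v w → k :* (b :* v) :≤ k :* ((b :+ # 3) :* u) ⇒ u :* ((b :+ # 4) :* k) :≤ u :*
          (b :* w :+ # 4 :* b) ⇒
            u :* (# 4 :* b) :≤ u :* k ⇒ b :* (v :* k) :≤ b :* (u :* w))
          b k u (grow b 2 u) (grow b 4 k)
          (ℕₚ.*-monoʳ-≤ k (grow-2 u)) (ℕₚ.*-monoʳ-≤ u (grow-4 k)) (ℕₚ.*-monoʳ-≤ u h))

  H-subadditive : ∀ a b → 1 ℕ.≤ a → H (a ℕ.* b) ≤ H a + H b
  H-subadditive a b 1≤a = arith 3 (λ x y z → x :- y :≤ z ⇒ x :≤ z :+ y) (δ≤H a b 1≤a)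

  H-^-upper : ∀ K m → 1 ℕ.≤ K → H (K ℕ.^ m) ≤ ι m * ι K + ι 1
  H-^-upper K zero 1≤K = ≤-trans (≡⇒≤ H-1) (arith 1 (λ k → # 1 :≤ # 0 :* k :+ # 1))
  H-^-upper K (suc m) 1≤K = ≤-trans (H-subadditive K (K ℕ.^ m) 1≤K)
    (≤-trans (+-mono-≤ (H≤ι K) (H-^-upper K m 1≤K))
      (≡⇒≤ (trans (arith 2 (λ k m → k :+ (m :* k :+ # 1) := (# 1 :+ m) :* k :+ # 1))
        (cong (λ s → s * ι K + ι 1) (sym (ι-suc m))))))

  H-double-lower : ∀ n → 1 ℕ.≤ n → ι 1 ≤ ι 2 * (H (2 ℕ.* n) - H n)
  H-double-lower n 1≤n = ≤-trans (≡⇒≤ e) (*-monoˡ (ι 2) (ι-nonneg 2) (H-diff-lower (ℕₚ.m≤m+n n (n ℕ.+ 0))))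
    where
    e : ι 1 ≡ ι 2 * ((ι (2 ℕ.* n) - ι n) * inv (2 ℕ.* n))
    e = trans (sym (inv-cancel (2 ℕ.* n) (ℕₚ.*-mono-≤ {1} {2} ℕ.z<s 1≤n)))
      (trans (cong (_* inv (2 ℕ.* n)) (ι-* 2 n))
        (trans (arith 2 (λ n i → # 2 :* n :* i := # 2 :* ((# 2 :* n :- n) :* i)))
          (cong (λ m → ι 2 * ((m - ι n) * inv (2 ℕ.* n))) (sym (ι-* 2 n)))))

  -- A doubling adds at least 1/2. This yields explicit thresholds beyond which H is large.
  H-4^ : ∀ m → ι m ≤ H (4 ℕ.^ m)
  H-4^ zero = H-nonneg 1
  H-4^ (suc m) = subst₂ _≤_ (sym (ι-suc m)) (cong H (sym (ℕₚ.*-assoc 2 2 n)))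
    (arith 4 (λ a x y z → # 1 :≤ # 2 :* (y :- x) ⇒ # 1 :≤ # 2 :* (z :- y) ⇒ a :≤ x ⇒ # 1 :+ a :≤ z)
      (H-double-lower n 1≤n) (H-double-lower (2 ℕ.* n) (ℕₚ.*-mono-≤ {1} {2} ℕ.z<s 1≤n)) (H-4^ m))
    where
    n = 4 ℕ.^ m
    1≤n = 1≤^ {4} m ℕ.z<s

  H-large : ∀ m n → 4 ℕ.^ m ℕ.≤ n → ι m ≤ H n
  H-large m n h = ≤-trans (H-4^ m) (H-mono h)

-- Selberg's formula on a cell (x₁, x₂] and on its images (x₁/k, x₂/k]

module Cells (F : OrderedField) where
  open OrderedField F
  open LinearArithmetic F
  open Sums F
  open Logarithm F
  open Moebius F
  open Selberg F
  open Growth F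

  module _ (b k x₁ : ℕ) (1≤b : 1 ℕ.≤ b) (1≤k : 1 ℕ.≤ k) (25bk≤x₁ : 25 ℕ.* b ℕ.* k ℕ.≤ x₁) where
    private
      β = inv b
      x₂ = x₁ ℕ.+ x₁ ÷ b
      a₁ = x₁ ÷ k
      a₂ = x₂ ÷ k
      x₁≤x₂ : x₁ ℕ.≤ x₂
      x₁≤x₂ = ℕₚ.m≤m+n x₁ (x₁ ÷ b)
      1≤x₁ : 1 ℕ.≤ x₁
      1≤x₁ = ℕₚ.≤-trans (ℕₚ.*-mono-≤ (ℕₚ.*-mono-≤ {1} {25} ℕ.z<s 1≤b) 1≤k) 25bk≤x₁
      ιx₂ : ι x₂ ≡ ι x₁ + ι (x₁ ÷ b)
      ιx₂ = ι-+ x₁ (x₁ ÷ b)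

    -- The logarithmic length of a cell is at most 1/b. Rounding its end points adds at most one
    -- unit to its length, which relative to x₁/k ≥ 25 b is at most 1/(25 b).
    cell-H : ι 25 * (H ((x₁ ℕ.+ x₁ ÷ b) ÷ k) - H (x₁ ÷ k)) ≤ ι 26 * inv b
    cell-H = ≤-trans (*-monoˡ (ι 25) (ι-nonneg 25) (≤-trans (H-diff-upper (÷-mono k x₁≤x₂))
        (≤-trans (*-monoˡ _ 0≤diff inv-a₁) (*-monoʳ _ 0≤k*inv diff))))
      (cancel-ιˡ x₁ 1≤x₁ (cancel-ιˡ b 1≤b
        (arith 7 (λ b x k j i β d → x :* j := # 1 ⇒ x :* j :* (b :* d) := # 1 :* (b :* d) ⇒ x :* j :* (b :* k) := # 1 :*
          (b :* k) ⇒
            k :* i :* (x :* j :* (b :* d)) := # 1 :* (x :* j :* (b :* d)) ⇒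
            b :* β :* x := # 1 :* x ⇒ b :* d :≤ x ⇒ # 25 :* b :* k :≤ x ⇒
            b :* (x :* (# 25 :* ((d :* i :+ # 1) :* (k :* j)))) :≤ b :* (x :* (# 26 :* β)))
          (inv-cancel x₁ 1≤x₁) (cong (_* (ι b * ι (x₁ ÷ b))) (inv-cancel x₁ 1≤x₁))
            (cong (_* (ι b * ι k)) (inv-cancel x₁ 1≤x₁))
          (cong (_* (ι x₁ * inv x₁ * (ι b * ι (x₁ ÷ b)))) (inv-cancel k 1≤k)) (cong (_* ι x₁) (inv-cancel b 1≤b))
          (subst (_≤ ι x₁) (ι-* b (x₁ ÷ b)) (ι-mono (÷-lower x₁ b)))
          (subst (_≤ ι x₁) (trans (ι-* (25 ℕ.* b) k) (cong (_* ι k) (ι-* 25 b)))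
            (ι-mono 25bk≤x₁)))))
      where
      0≤diff : ι 0 ≤ ι a₂ - ι a₁
      0≤diff = diff-nonneg (ι-mono (÷-mono k x₁≤x₂))
      0≤k*inv : ι 0 ≤ ι k * inv x₁
      0≤k*inv = *-nonneg (ι-nonneg k) (inv-nonneg x₁)
      diff : ι a₂ - ι a₁ ≤ ι (x₁ ÷ b) * inv k + ι 1
      diff = arith 6 (λ a₁ a₂ x₁ x₂ d i → a₂ :≤ x₂ :* i ⇒ x₁ :* i :≤ a₁ :+ # 1 ⇒ x₂ :* i := (x₁ :+ d) :* i ⇒ a₂ :- a₁ :≤
          d :* i :+ # 1)
        (÷-inv-lower x₂ k 1≤k) (÷-inv-upper x₁ k 1≤k) (cong (_* inv k) ιx₂)
      inv-a₁ : inv (suc a₁) ≤ ι k * inv x₁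
      inv-a₁ = cancel-ιˡ x₁ 1≤x₁ (cancel-ιˡ (suc a₁) ℕ.z<s
        (arith 5 (λ a x k i j → x :≤ k :* a ⇒ x :* i :* (a :* k) := # 1 :* (a :* k) ⇒ a :* j :* x := # 1 :* x ⇒
            a :* (x :* j) :≤ a :* (x :* (k :* i)))
          (subst (ι x₁ ≤_) (ι-* k (suc a₁)) (ι-mono (ℕₚ.<⇒≤ (÷-upper x₁ k 1≤k))))
          (cong (_* (ι (suc a₁) * ι k)) (inv-cancel x₁ 1≤x₁)) (cong (_* ι x₁) (inv-cancel (suc a₁) ℕ.z<s))))

  module _ {X : ℕ} (lg : Log X) where
    open VonMangoldt lg
    private
      ψ′ = ψ lg
      M′ = M lg

    ψ-diff : ∀ {m n} → m ℕ.≤ n → ι 0 ≤ ψ′ n - ψ′ m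
    ψ-diff m≤n = diff-nonneg (ψ-mono lg m≤n)

    ∑Λψ-extend : ∀ {x y} → x ℕ.≤ y → ∑ y (λ k → Λ k * ψ′ (x ÷ k)) ≡ ∑ x (λ k → Λ k * ψ′ (x ÷ k))
    ∑Λψ-extend x≤y = ∑-extend x≤y (λ k x<k _ →
      trans (cong (λ q → Λ k * ψ′ q) (÷-small k x<k)) *-zero)

    -- Selberg's formula at v minus that at u; the convolution sums increase and are dropped. The
    -- constant is 104 + 104 from the two errors and 4 from H v - H u ≤ 2.
    ψ-short : ∀ u v → 1 ℕ.≤ u → u ℕ.≤ v → v ℕ.≤ 3 ℕ.* u → v ℕ.≤ X →
              (ψ′ v - ψ′ u) * H u ≤ ι 2 * (ι v - ι u) * H u + ι 212 * ι v
    ψ-short u v 1≤u u≤v v≤3u v≤X =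
      arith 10 (λ pu pv hu hv eu ev u v su sv →
          su := pu :* hu :+ eu ⇒ sv := pv :* hv :+ ev ⇒ eu :≤ ev ⇒ # 0 :≤ pv :* (hv :- hu) ⇒
          :- (# 104 :* u) :≤ su :- # 2 :* u :* hu ⇒ sv :- # 2 :* v :* hv :≤ # 104 :* v ⇒
          v :* (hv :- hu) :≤ v :* # 2 ⇒ u :≤ v ⇒
          (pv :- pu) :* hu :≤ # 2 :* (v :- u) :* hu :+ # 212 :* v)
        {x = ψ′ u} {ψ′ v} {H u} {H v} {∑ u (λ k → Λ k * ψ′ (u ÷ k))} {∑ v (λ k → Λ k * ψ′ (v ÷ k))} {ι u} {ι v} {S lg u}
          {S lg v}
        refl refl Λψ-mono (*-nonneg (ψ-nonneg lg v) 0≤Hv-Hu)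
        (proj₁ (selberg lg u 1≤u (ℕₚ.≤-trans u≤v v≤X))) (proj₂ (selberg lg v (ℕₚ.≤-trans 1≤u u≤v) v≤X))
        (*-monoˡ (ι v) (ι-nonneg v) Hv-Hu≤2) (ι-mono u≤v)
      where
      0≤Hv-Hu : ι 0 ≤ H v - H u
      0≤Hv-Hu = diff-nonneg (H-mono u≤v)
      Hv-Hu≤2 : H v - H u ≤ ι 2
      Hv-Hu≤2 = ≤-trans (H-diff-upper u≤v) (≤-trans
        (*-monoʳ (inv (suc u)) (inv-nonneg (suc u))
          (arith 3 (λ v u s → v :≤ # 3 :* u ⇒ s := # 1 :+ u ⇒ v :- u :≤ # 2 :* s)
            (subst (ι v ≤_) (ι-* 3 u) (ι-mono v≤3u)) (ι-suc u)))
        (arith 2 (λ s i → s :* i := # 1 ⇒ # 2 :* s :* i :≤ # 2) (inv-cancel (suc u) ℕ.z<s)))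
      Λψ-mono : ∑ u (λ k → Λ k * ψ′ (u ÷ k)) ≤ ∑ v (λ k → Λ k * ψ′ (v ÷ k))
      Λψ-mono = subst (_≤ ∑ v (λ k → Λ k * ψ′ (v ÷ k))) (∑Λψ-extend u≤v)
        (∑-mono v (λ k 1≤k _ → *-monoˡ (Λ k) (Λ-nonneg k 1≤k) (ψ-mono lg (÷-mono k u≤v))))

    -- Density at most 2, as in the Brun-Titchmarsh inequality: dividing `ψ-short` by H u ≥ 212 Q
    -- leaves the error v/Q. When ψ does not exceed the main term there is nothing to divide.
    ψ-sieve : ∀ Q u v → 1 ℕ.≤ u → u ℕ.≤ v → v ℕ.≤ 3 ℕ.* u → v ℕ.≤ X → ι (212 ℕ.* Q) ≤ H u →
              ι Q * (ψ′ v - ψ′ u) ≤ ι Q * (ι 2 * (ι v - ι u)) + ι v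
    ψ-sieve Q u v 1≤u u≤v v≤3u v≤X h =
      [ (λ w≤0 → arith 4 (λ q w d v → # 0 :≤ q :* (# 0 :- (w :- d)) ⇒ # 0 :≤ v ⇒ q :* w :≤ q :* d :+ v)
                   (*-nonneg (ι-nonneg Q) (arith 1 (λ w → w :≤ # 0 ⇒ # 0 :≤ # 0 :- w) w≤0)) (ι-nonneg v))
      , (λ 0≤w → arith 5 (λ q w d v h → # 212 :* q :* (w :- # 2 :* d) :≤ h :* (w :- # 2 :* d) ⇒
                     w :* h :≤ # 2 :* d :* h :+ # 212 :* v ⇒ q :* w :≤ q :* (# 2 :* d) :+ v)
                   (*-monoʳ _ 0≤w (subst (_≤ H u) (ι-* 212 Q) h)) (ψ-short u v 1≤u u≤v v≤3u v≤X)) ]′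
      (≤-total (ψ′ v - ψ′ u - ι 2 * (ι v - ι u)) (ι 0))

    -- excess k compares the Λ-mass of (x₁/k, x₂/k] with the bound given by ψ-short.
    module Excess (Q x₁ x₂ : ℕ) where

      q : R
      q = inv Q

      -- Twice the length of the cell plus a slack 2 x₂/Q. After division by k, half of the slack
      -- pays for the error of `ψ-sieve` and half for the rounding of x₁/k and x₂/k.
      D : R
      D = ι 2 * (ι x₂ - ι x₁) + ι 2 * (q * ι x₂)

      Δ : ℕ → R
      Δ k = ψ′ (x₂ ÷ k) - ψ′ (x₁ ÷ k)

      excess : ℕ → R
      excess k = D * inv k - Δ k

    module Cell (Q Y₁ u x₁ x₂ : ℕ) (1≤Q : 1 ℕ.≤ Q) (Y₁-large : 4 ℕ.^ (212 ℕ.* Q) ℕ.≤ Y₁) (2Q≤Y₁ : 2 ℕ.* Q ℕ.≤ Y₁)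
                (u≤x₁ : u ℕ.≤ x₁) (x₁≤x₂ : x₁ ℕ.≤ x₂) (x₂≤2x₁ : x₂ ℕ.≤ 2 ℕ.* x₁) (x₂≤X : x₂ ℕ.≤ X) where

      open Excess Q x₁ x₂

      private
        q-cancel : ι Q * q ≡ ι 1
        q-cancel = inv-cancel Q 1≤Q

        0≤q : ι 0 ≤ q
        0≤q = inv-nonneg Q

        1≤Y₁ : 1 ℕ.≤ Y₁
        1≤Y₁ = ℕₚ.≤-trans (1≤^ {4} (212 ℕ.* Q) ℕ.z<s) Y₁-large

        0≤D : ι 0 ≤ D
        0≤D = arith 3 (λ a b c → a :≤ b ⇒ # 0 :≤ c ⇒ # 0 :≤ # 2 :* (b :- a) :+ # 2 :* c)
          (ι-mono x₁≤x₂) (*-nonneg 0≤q (ι-nonneg x₂))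

        Δ-nonneg : ∀ k → ι 0 ≤ Δ k
        Δ-nonneg k = ψ-diff (÷-mono k x₁≤x₂)

      excess-nonneg : ∀ k → 1 ℕ.≤ k → k ℕ.* Y₁ ℕ.≤ u → ι 0 ≤ excess k
      excess-nonneg k 1≤k kY₁≤u =
        arith 7 (λ δ a₁ a₂ q x₁ x₂ i → δ :≤ # 2 :* (a₂ :- a₁) :+ q :* a₂ ⇒ a₂ :≤ x₂ :* i ⇒ x₁ :* i :≤ a₁ :+ # 1 ⇒
            q :* a₂ :≤ q :* (x₂ :* i) ⇒ # 2 :≤ q :* (x₂ :* i) ⇒
            # 0 :≤ (# 2 :* (x₂ :- x₁) :+ # 2 :* (q :* x₂)) :* i :- δ)
          sieve (÷-inv-lower x₂ k 1≤k) (÷-inv-upper x₁ k 1≤k) (*-monoˡ q 0≤q (÷-inv-lower x₂ k 1≤k)) two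
        where
        a₁ = x₁ ÷ k
        a₂ = x₂ ÷ k
        Y₁≤a₁ : Y₁ ℕ.≤ a₁
        Y₁≤a₁ = ÷-greatest k Y₁ 1≤k (ℕₚ.≤-trans kY₁≤u u≤x₁)
        a₂≤3a₁ : a₂ ℕ.≤ 3 ℕ.* a₁
        a₂≤3a₁ = ℕₚ.≤-trans (ℕₚ.≤-pred (ℕₚ.*-cancelˡ-< k a₂ (2 ℕ.* suc a₁)
          (ℕₚ.≤-<-trans (ℕₚ.≤-trans (÷-lower x₂ k) x₂≤2x₁)
            (ℕₚ.<-≤-trans (ℕₚ.*-monoʳ-< 2 (÷-upper x₁ k 1≤k))
              (arithℕ 2 (λ k a → # 2 :* (k :* (# 1 :+ a)) :≤ k :* (# 2 :* (# 1 :+ a))) k a₁)))))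
          (ℕₚ.≤-trans (ℕₚ.≤-reflexive (cong (a₁ ℕ.+_) (ℕₚ.+-identityʳ (suc a₁))))
            (arithℕ 1 (λ a → # 1 :≤ a ⇒ a :+ (# 1 :+ a) :≤ # 3 :* a) a₁ (ℕₚ.≤-trans 1≤Y₁ Y₁≤a₁)))
        sieve : Δ k ≤ ι 2 * (ι a₂ - ι a₁) + q * ι a₂
        sieve = cancel-ιˡ Q 1≤Q (arith 5 (λ Q δ d a q → Q :* δ :≤ Q :* d :+ a ⇒ Q :* q :* a := # 1 :* a ⇒ Q :* δ :≤ Q :*
            (d :+ q :* a))
          (ψ-sieve Q a₁ a₂ (ℕₚ.≤-trans 1≤Y₁ Y₁≤a₁) (÷-mono k x₁≤x₂) a₂≤3a₁ (ℕₚ.≤-trans (÷-≤ x₂ k) x₂≤X)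
            (H-large (212 ℕ.* Q) a₁ (ℕₚ.≤-trans Y₁-large Y₁≤a₁)))
          (cong (_* ι a₂) q-cancel))
        two : ι 2 ≤ q * (ι x₂ * inv k)
        two = cancel-ιˡ Q 1≤Q (cancel-ιˡ k 1≤k
          (arith 5 (λ k Q q x i → k :* (# 2 :* Q) :≤ x ⇒ k :* i :* (Q :* q) := # 1 ⇒ k :* i :* (Q :* q) :* x := # 1 :* x
            ⇒
              k :* (Q :* # 2) :≤ k :* (Q :* (q :* (x :* i))))
            (subst (_≤ ι x₂) (trans (ι-* k (2 ℕ.* Q)) (cong (ι k *_) (ι-* 2 Q)))
              (ι-mono (ℕₚ.≤-trans (ℕₚ.*-monoʳ-≤ k 2Q≤Y₁) (ℕₚ.≤-trans kY₁≤u (ℕₚ.≤-trans u≤x₁ x₁≤x₂)))))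
            cancelled (cong (_* ι x₂) cancelled)))
          where
          cancelled : ι k * inv k * (ι Q * q) ≡ ι 1
          cancelled = trans (cong₂ _*_ (inv-cancel k 1≤k) q-cancel) 1*-identity

      module _ (c : ℕ) (1≤c : 1 ℕ.≤ c) (few : ι Q * (ψ′ x₂ - ψ′ x₁) ≤ ι u) (1≤u : 1 ℕ.≤ u)
               (x₂≤cz : x₂ ℕ.≤ c ℕ.* (u ÷ Y₁)) (large : ι Q * (ι 388 + ι 10 * ι c) ≤ H x₂) where
        private
          z = u ÷ Y₁
          1≤x₁ = ℕₚ.≤-trans 1≤u u≤x₁
          1≤x₂ = ℕₚ.≤-trans 1≤x₁ x₁≤x₂
          x₁≤X = ℕₚ.≤-trans x₁≤x₂ x₂≤X

          1≤z : 1 ℕ.≤ z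
          1≤z = 1≤*⇒1≤ʳ c (ℕₚ.≤-trans 1≤x₂ x₂≤cz)

          z≤x₂ : z ℕ.≤ x₂
          z≤x₂ = ℕₚ.≤-trans (÷-≤ u Y₁) (ℕₚ.≤-trans u≤x₁ x₁≤x₂)

          H₂-Hz : H x₂ ≤ ι c + H z
          H₂-Hz = ≤-trans (H-mono x₂≤cz) (≤-trans (H-subadditive c z 1≤c) (+-mono-≤ (H≤ι c) ≤-refl))

          H₂-H₁ : H x₂ - H x₁ ≤ ι 1
          H₂-H₁ = arith 3 (λ a b c → a :≤ b ⇒ b :- c :≤ # 1 ⇒ a :- c :≤ # 1) (H-mono x₂≤2x₁) (H-double x₁)

          0≤H₂-H₁ : ι 0 ≤ H x₂ - H x₁
          0≤H₂-H₁ = diff-nonneg (H-mono x₁≤x₂)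

          few′ : ψ′ x₂ - ψ′ x₁ ≤ q * ι x₂
          few′ = cancel-ιˡ Q 1≤Q (arith 5 (λ Q w u x q → Q :* w :≤ u ⇒ u :≤ x ⇒ Q :* q :* x := # 1 :* x ⇒ Q :* w :≤ Q :*
              (q :* x))
            few (ι-mono (ℕₚ.≤-trans u≤x₁ x₁≤x₂)) (cong (_* ι x₂) q-cancel))

          A = ∑ x₂ (λ k → Λ k * Δ k)

          A-value : A ≡ (S lg x₂ - ψ′ x₂ * H x₂) - (S lg x₁ - ψ′ x₁ * H x₁)
          A-value = trans (∑-cong x₂ (λ k _ _ → arith 3 (λ l a b → l :* (a :- b) := l :* a :- l :* b)))
            (trans (∑-minus x₂ (λ k → Λ k * ψ′ (x₂ ÷ k)) (λ k → Λ k * ψ′ (x₁ ÷ k)))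
              (trans (cong (λ s → ∑ x₂ (λ k → Λ k * ψ′ (x₂ ÷ k)) - s) (∑Λψ-extend x₁≤x₂))
                (arith 4 (λ a b c d → a :- b := ((c :+ a) :- c) :- ((d :+ b) :- d)))))

          -- As the cell itself has almost no Λ-mass, the convolution sum must provide the whole
          -- main term in the difference of Selberg's formula at x₂ and x₁. The constant is 104 +
          -- 104 + 10, the last from ψ x₁ ≤ 10 x₁.
          A-lower : ι 2 * ι x₂ * H x₂ - ι 2 * ι x₁ * H x₁ - ι 218 * ι x₂ - q * ι x₂ * H x₂ ≤ A
          A-lower = arith 10 (λ a s₁ s₂ p₁ p₂ h₁ h₂ x₁ x₂ q →
              a := (s₂ :- p₂ :* h₂) :- (s₁ :- p₁ :* h₁) ⇒ :- (# 104 :* x₂) :≤ s₂ :- # 2 :* x₂ :* h₂ ⇒ s₁ :- # 2 :* x₁ :*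
                h₁ :≤ # 104 :* x₁ ⇒
              (p₂ :- p₁) :* h₂ :≤ q :* x₂ :* h₂ ⇒ p₁ :* (h₂ :- h₁) :≤ p₁ :* # 1 ⇒ p₁ :≤ # 10 :* x₁ ⇒ x₁ :≤ x₂ ⇒
              # 2 :* x₂ :* h₂ :- # 2 :* x₁ :* h₁ :- # 218 :* x₂ :- q :* x₂ :* h₂ :≤ a)
            A-value (proj₁ (selberg lg x₂ 1≤x₂ x₂≤X)) (proj₂ (selberg lg x₁ 1≤x₁ x₁≤X))
            (*-monoʳ (H x₂) (H-nonneg x₂) few′) (*-monoˡ (ψ′ x₁) (ψ-nonneg lg x₁) H₂-H₁) (chebyshev lg x₁ x₁≤X)
              (ι-mono x₁≤x₂)

          -- For k beyond z only Chebyshev's bound is used. Since x₂ ≤ c z, Mertens' sum over (z,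
          -- x₂] is bounded, so these k contribute O(x₂), which is negligible against x₂ H x₂.
          tail : A - ∑ z (λ k → Λ k * Δ k) ≤ ι 10 * ι x₂ * (M′ x₂ - M′ z)
          tail = ≤-trans (∑-tail-mono z≤x₂ (λ k z<k _ → bound k (ℕₚ.≤-trans ℕ.z<s z<k)))
            (≡⇒≤ (trans (cong₂ _-_ (∑-*ˡ x₂ (ι 10 * ι x₂) (λ k → Λ k * inv k))
              (∑-*ˡ z (ι 10 * ι x₂) (λ k → Λ k * inv k)))
              (arith 3 (λ c a b → c :* a :- c :* b := c :* (a :- b)))))
            where
            bound : ∀ k → 1 ℕ.≤ k → Λ k * Δ k ≤ ι 10 * ι x₂ * (Λ k * inv k)
            bound k 1≤k = ≤-trans (*-monoˡ (Λ k) (Λ-nonneg k 1≤k)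
              (arith 5 (λ p₁ p₂ a x i → p₂ :≤ # 10 :* a ⇒ a :≤ x :* i ⇒ # 0 :≤ p₁ ⇒ p₂ :- p₁ :≤ # 10 :* (x :* i))
                (chebyshev lg (x₂ ÷ k) (ℕₚ.≤-trans (÷-≤ x₂ k) x₂≤X)) (÷-inv-lower x₂ k 1≤k) (ψ-nonneg lg (x₁ ÷ k))))
              (≡⇒≤ (arith 3 (λ l x i → l :* (# 10 :* (x :* i)) := # 10 :* x :* (l :* i))))

          M-diff : M′ x₂ - M′ z ≤ ι c + ι 13
          M-diff = arith 5 (λ m₂ mz h₂ hz c → m₂ :≤ h₂ :+ # 10 ⇒ hz :≤ mz :+ # 3 ⇒ h₂ :≤ c :+ hz ⇒ m₂ :- mz :≤ c :+ #
              13)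
            (mertens-upper lg x₂ 1≤x₂ x₂≤X) (mertens-lower lg z 1≤z (ℕₚ.≤-trans z≤x₂ x₂≤X)) H₂-Hz

          large′ : ι x₂ * (ι 388 + ι 10 * ι c) ≤ q * ι x₂ * H x₂
          large′ = cancel-ιˡ Q 1≤Q (arith 5 (λ Q q x k h → x :* (Q :* k) :≤ x :* h ⇒ Q :* q :* (x :* h) := # 1 :*
              (x :* h) ⇒
              Q :* (x :* k) :≤ Q :* (q :* x :* h))
            (*-monoˡ (ι x₂) (ι-nonneg x₂) large) (cong (_* (ι x₂ * H x₂)) q-cancel))

        -- By Mertens' estimate the upper bounds D/k add up, with weights Λ k, to about 2 (x₂ - x₁)
        -- H x₂, and `A-lower` says that the actual masses nearly reach this. The multiples of x₂
        -- left over are 218 from `A-lower`, 130 + 10 c from `tail` and 40 from 10 D; `large`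
        -- absorbs these 388 + 10 c.
        excess-total : ∑ (u ÷ Y₁) (λ k → Λ k * excess k) ≤ ι 4 * (q * ι x₂ * H x₂)
        excess-total = ≤-trans (≡⇒≤ value)
          (arith 10 (λ D B a m h₁ h₂ x₁ x₂ q c →
              # 2 :* x₂ :* h₂ :- # 2 :* x₁ :* h₁ :- # 218 :* x₂ :- q :* x₂ :* h₂ :≤ a ⇒
              a :- B :≤ # 10 :* x₂ :* (c :+ # 13) ⇒ D :* m :≤ D :* (h₂ :+ # 10) ⇒
              D :* h₂ := (# 2 :* (x₂ :- x₁) :+ # 2 :* (q :* x₂)) :* h₂ ⇒ D := # 2 :* (x₂ :- x₁) :+ # 2 :* (q :* x₂) ⇒
              # 0 :≤ x₁ :* (h₂ :- h₁) ⇒ # 0 :≤ x₁ ⇒ q :* x₂ :≤ # 1 :* x₂ ⇒ x₂ :* (# 388 :+ # 10 :* c) :≤ q :* x₂ :* h₂ ⇒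
              D :* m :- B :≤ # 4 :* (q :* x₂ :* h₂))
            A-lower (≤-trans tail (*-monoˡ (ι 10 * ι x₂) (*-nonneg (ι-nonneg 10) (ι-nonneg x₂)) M-diff))
            (*-monoˡ D 0≤D Mz) refl refl (*-nonneg (ι-nonneg x₁) 0≤H₂-H₁) (ι-nonneg x₁)
            (*-monoʳ (ι x₂) (ι-nonneg x₂) (inv≤1 Q)) large′)
          where
          value : ∑ z (λ k → Λ k * excess k) ≡ D * M′ z - ∑ z (λ k → Λ k * Δ k)
          value = trans (∑-cong z (λ k _ _ → arith 4 (λ l d i e → l :* (d :* i :- e) := d :* (l :* i) :- l :* e)))
            (trans (∑-minus z (λ k → D * (Λ k * inv k)) (λ k → Λ k * Δ k))
              (cong (_- ∑ z (λ k → Λ k * Δ k)) (∑-*ˡ z D (λ k → Λ k * inv k))))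
          Mz : M′ z ≤ H x₂ + ι 10
          Mz = ≤-trans (mertens-upper lg z 1≤z (ℕₚ.≤-trans z≤x₂ x₂≤X)) (+-mono-≤ (H-mono z≤x₂) ≤-refl)

      module _ (b : ℕ) (18≤b : 18 ℕ.≤ b) (40b≤x₁ : 40 ℕ.* b ℕ.≤ x₁) (x₂≡ : x₂ ≡ x₁ ℕ.+ x₁ ÷ b)
               (k : ℕ) (1≤k : 1 ℕ.≤ k) (kY₁≤u : k ℕ.* Y₁ ℕ.≤ u) where
        private
          β = inv b
          1≤b = ℕₚ.≤-trans ℕ.z<s 18≤b
          1≤x₁ : 1 ℕ.≤ x₁
          1≤x₁ = ℕₚ.≤-trans (ℕₚ.*-mono-≤ {1} {40} ℕ.z<s 1≤b) 40b≤x₁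
          1≤x₂ = ℕₚ.≤-trans 1≤x₁ x₁≤x₂
          a₁ = x₁ ÷ k
          a₂ = x₂ ÷ k

          ιx₂ : ι x₂ ≡ ι x₁ + ι (x₁ ÷ b)
          ιx₂ = trans (cong ι x₂≡) (ι-+ x₁ (x₁ ÷ b))

          kY₁≤x₁ : k ℕ.* Y₁ ℕ.≤ x₁
          kY₁≤x₁ = ℕₚ.≤-trans kY₁≤u u≤x₁

          1≤a₂ : 1 ℕ.≤ a₂
          1≤a₂ = ÷-greatest k 1 1≤k (ℕₚ.≤-trans (ℕₚ.*-monoʳ-≤ k 1≤Y₁) (ℕₚ.≤-trans kY₁≤x₁ x₁≤x₂))

          inv-a₂ : ι k * inv x₂ ≤ inv a₂
          inv-a₂ = cancel-ιˡ x₂ 1≤x₂ (cancel-ιˡ a₂ 1≤a₂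
            (arith 5 (λ a x k i j → k :* a :≤ x ⇒ x :* i :* (a :* k) := # 1 :* (a :* k) ⇒ a :* j :* x := # 1 :* x ⇒
                a :* (x :* (k :* i)) :≤ a :* (x :* j))
              (subst (_≤ ι x₂) (ι-* k a₂) (ι-mono (÷-lower x₂ k)))
              (cong (_* (ι a₂ * ι k)) (inv-cancel x₂ 1≤x₂)) (cong (_* ι x₂) (inv-cancel a₂ 1≤a₂))))

        -- A small excess means density almost 2, hence almost 2/b in Mertens' sum. Out of 10 units
        -- one is lost: 1/4 to rounding by x₁ ≥ 40 b, 1/4 to the excess allowed here, and 1/2 to the
        -- ratio of x₂ to x₁ by b ≥ 18.
        cell-M : ι 20 * ι b * (ι k * excess k) ≤ ι u → ι 9 * inv b ≤ ι 5 * (M′ (x₂ ÷ k) - M′ (x₁ ÷ k))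
        cell-M good = ≤-trans (cancel-ιˡ x₂ 1≤x₂
            (arith 4 (λ x e b i → # 9 :* (b :* x) :≤ # 5 :* e ⇒ x :* i :* e := # 1 :* e ⇒ x :* (# 9 :* b) :≤ x :*
              (# 5 :* (e :* i)))
              mass (cong (_* (ι k * Δ k)) (inv-cancel x₂ 1≤x₂))))
          (arith 5 (λ k δ i j m → δ :* (k :* i) :≤ δ :* j ⇒ δ :* j :≤ m ⇒ # 5 :* (k :* δ :* i) :≤ # 5 :* m)
            (*-monoˡ (Δ k) (Δ-nonneg k) inv-a₂) M-lower)
          where
          M-lower : Δ k * inv a₂ ≤ M′ a₂ - M′ a₁
          M-lower = ≤-trans (≡⇒≤ (trans (arith 3 (λ a b i → (a :- b) :* i := i :* a :- i :* b))
              (sym (cong₂ _-_ (∑-*ˡ a₂ (inv a₂) Λ) (∑-*ˡ a₁ (inv a₂) Λ)))))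
            (∑-tail-mono (÷-mono k x₁≤x₂) (λ j a₁<j j≤a₂ → let 1≤j = ℕₚ.≤-trans ℕ.z<s a₁<j in
              ≤-trans (*-monoʳ (Λ j) (Λ-nonneg j 1≤j) (inv-anti 1≤j j≤a₂)) (≡⇒≤ *-swap)))
          kΔ : ι 2 * (ι x₂ - ι x₁) ≤ ι k * Δ k + ι k * excess k
          kΔ = arith 6 (λ k i δ x₁ x₂ c → k :* i :* (x₂ :- x₁ :+ c) := # 1 :* (x₂ :- x₁ :+ c) ⇒ # 0 :≤ c ⇒
              # 2 :* (x₂ :- x₁) :≤ k :* δ :+ k :* ((# 2 :* (x₂ :- x₁) :+ # 2 :* c) :* i :- δ))
            (cong (_* (ι x₂ - ι x₁ + q * ι x₂)) (inv-cancel k 1≤k)) (*-nonneg 0≤q (ι-nonneg x₂))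
          -- (x₂ − x₁)/x₂ is about β, with a relative error at most β ≤ 1/18.
          mass : ι 9 * (β * ι x₂) ≤ ι 5 * (ι k * Δ k)
          mass = cancel-ιˡ b 1≤b (arith 8 (λ b β x₁ x₂ d e f u →
              b :* β :* x₂ := # 1 :* x₂ ⇒ x₂ := x₁ :+ d ⇒ b :* d :≤ x₁ ⇒ x₁ :≤ b :* (# 1 :+ d) ⇒ # 18 :* d :≤ b :* d ⇒
              # 2 :* (b :* (x₂ :- x₁)) :≤ b :* f :+ b :* e ⇒ # 20 :* b :* e :≤ u ⇒ u :≤ x₁ ⇒ # 40 :* b :≤ x₁ ⇒ b :* x₂
                := b :* (x₁ :+ d) ⇒
              b :* (# 9 :* (β :* x₂)) :≤ b :* (# 5 :* f))
            (cong (_* ι x₂) (inv-cancel b 1≤b)) ιx₂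
            (subst (_≤ ι x₁) (ι-* b (x₁ ÷ b)) (ι-mono (÷-lower x₁ b)))
            (subst (ι x₁ ≤_) (trans (ι-* b (suc (x₁ ÷ b))) (cong (ι b *_) (ι-suc (x₁ ÷ b))))
              (ι-mono (ℕₚ.<⇒≤ (÷-upper x₁ b 1≤b))))
            (*-monoʳ (ι (x₁ ÷ b)) (ι-nonneg (x₁ ÷ b)) (ι-mono 18≤b))
            (arith 4 (λ b x y z → b :* (# 2 :* x) :≤ b :* (y :+ z) ⇒ # 2 :* (b :* x) :≤ b :* y :+ b :* z)
              (*-monoˡ (ι b) (ι-nonneg b) kΔ))
            good (ι-mono u≤x₁) (subst (_≤ ι x₁) (ι-* 40 b) (ι-mono 40b≤x₁)) (cong (ι b *_) ιx₂))

-- Positive density on R + 1 steps implies positive density on R steps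

module Descent (F : OrderedField) where
  open OrderedField F renaming (R to Carrier)
  open LinearArithmetic F
  open Sums F
  open Logarithm F
  open Moebius F
  open Selberg F
  open Growth F
  open Cells F

  ∑-term : ∀ n {f : ℕ → Carrier} i → 1 ℕ.≤ i → i ℕ.≤ n → (∀ k → 1 ℕ.≤ k → k ℕ.≤ n → ι 0 ≤ f k) → f i ≤ ∑ n f
  ∑-term n {f} (suc i) _ i<n h = ≤-trans
    (arith 2 (λ a b → # 0 :≤ a ⇒ b :≤ a :+ b) (∑-nonneg i (λ k l u → h k l (ℕₚ.≤-trans u (ℕₚ.<⇒≤ i<n)))))
    (∑-grow {suc i} {n} {f} i<n (λ k l u → h k (ℕₚ.≤-trans ℕ.z<s l) u))

  ∑-telescope : ∀ n (s : ℕ → Carrier) → ∑ n (λ t → s t - s (ℕ.pred t)) ≡ s n - s 0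
  ∑-telescope zero s = arith 1 (λ x → # 0 := x :- x)
  ∑-telescope (suc n) s = trans (cong (_+ (s (suc n) - s n)) (∑-telescope n s))
    (arith 3 (λ a b c → (a :- b) :+ (c :- a) := c :- b))

  -- At i = R + 5 this reads 3 (R + 6) ≤ 5 R, that is, R ≥ 9. At i = 2 it reads 9 ≤ 10, while i = 1
  -- would fail; hence at least two cells are required per step of the chain.
  3[1+i]≤5[R⊓i] : ∀ R i → 9 ℕ.≤ R → 2 ℕ.≤ i → i ℕ.≤ 2 ℕ.+ (R ℕ.+ 3) → 3 ℕ.* suc i ℕ.≤ 5 ℕ.* (R ℕ.⊓ i)
  3[1+i]≤5[R⊓i] R i 9≤R 2≤i i≤ with ℕₚ.≤-total R i
  ... | inj₁ R≤i = subst (λ s → 3 ℕ.* suc i ℕ.≤ 5 ℕ.* s) (sym (ℕₚ.m≤n⇒m⊓n≡m R≤i))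
    (arithℕ 2 (λ i R → i :≤ # 2 :+ (R :+ # 3) ⇒ # 9 :≤ R ⇒ # 3 :* (# 1 :+ i) :≤ # 5 :* R) i R i≤ 9≤R)
  ... | inj₂ i≤R = subst (λ s → 3 ℕ.* suc i ℕ.≤ 5 ℕ.* s) (sym (ℕₚ.m≥n⇒m⊓n≡n i≤R))
    (arithℕ 1 (λ i → # 2 :≤ i ⇒ # 3 :* (# 1 :+ i) :≤ # 5 :* i) i 2≤i)

  -- `ψ` depends on the approximate logarithm, so B and Y have to serve all scales X that reach the
  -- end of the interval.
  DenseFrom : ℕ → ℕ → ℕ → ℕ → Set
  DenseFrom b g B Y = ∀ {X} (lg : Log X) y → Y ℕ.≤ y → grow b g y ℕ.≤ X →
                      ι y ≤ ι B * (ψ lg (grow b g y) - ψ lg y)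

  Dense : ℕ → ℕ → Set
  Dense b g = ∃[ B ] ∃[ Y ] DenseFrom b g B Y

  -- Here n is the number of windows (K^t, K^(t+1)] among which one with a small total excess is found, and J is the
  -- number of steps of the chain of values k built in that window.
  module Contradiction {X : ℕ} (lg : Log X) (b R B J K Q₂ Q₃ Q Y₁ c j₀ n u : ℕ)
    (18≤b : 18 ℕ.≤ b) (9≤R : 9 ℕ.≤ R) (1≤B : 1 ℕ.≤ B)
    (J-large : 25 ℕ.* b ℕ.* 14 ℕ.≤ J)
    (K-large : 2 ℕ.^ ((R ℕ.+ 5) ℕ.* J) ℕ.≤ K)
    (Q₂-large : 40 ℕ.* b ℕ.* B ℕ.* 2 ℕ.^ suc R ℕ.≤ Q₂)
    (Q₃-large : 6 ℕ.* K ℕ.* Q₂ ℕ.≤ Q₃)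
    (Q-large : 8 ℕ.* 2 ℕ.^ R ℕ.* R ℕ.* Q₃ ℕ.≤ Q)
    (Y₁-large : 4 ℕ.^ (212 ℕ.* Q) ℕ.≤ Y₁) (2Q≤Y₁ : 2 ℕ.* Q ℕ.≤ Y₁) (25b≤Y₁ : 25 ℕ.* b ℕ.≤ Y₁)
    (c-large : 2 ℕ.^ R ℕ.* (2 ℕ.* Y₁) ℕ.≤ c)
    (j₀-large : 4 ℕ.* b ℕ.≤ 2 ℕ.^ j₀)
    (n-large : j₀ ℕ.+ 1 ℕ.+ Y₁ ℕ.≤ n)
    (n-upper : K ℕ.^ (j₀ ℕ.+ n) ℕ.* Y₁ ℕ.≤ u)
    (n-lower : u ℕ.≤ K ℕ.^ suc (j₀ ℕ.+ n) ℕ.* Y₁)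
    (u-large : 4 ℕ.^ (Q ℕ.* (388 ℕ.+ 10 ℕ.* c)) ℕ.≤ u)
    (b²+b≤u : b ℕ.* b ℕ.+ b ℕ.≤ u) (40b≤u : 40 ℕ.* b ℕ.≤ u)
    (dense : ∀ y → 2 ℕ.^ j₀ ℕ.≤ y → grow b (suc R) y ℕ.≤ X → ι y ≤ ι B * (ψ lg (grow b (suc R) y) - ψ lg y))
    (grow≤X : grow b R u ℕ.≤ X)
    (few : ι Q * (ψ lg (grow b R u) - ψ lg u) ≤ ι u)
    where

    open VonMangoldt lg

    private
      ψ′ = ψ lg
      M′ = M lg

      x : ℕ → ℕ
      x i = grow b i u

      e : ℕ → ℕ → Carrier
      e i k = Excess.excess lg Q (x (ℕ.pred i)) (x i) k

      E : ℕ → Carrier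
      E k = ∑ R (λ i → e i k)

      -- Its increments measure, with weight Λ, how far the k of a window are from having density 2
      -- in all R cells.
      Φ : ℕ → Carrier
      Φ m = ∑ m (λ k → Λ k * E k)

      z = u ÷ Y₁

      1≤b = ℕₚ.≤-trans ℕ.z<s 18≤b
      1≤2^ : ∀ i → 1 ℕ.≤ 2 ℕ.^ i
      1≤2^ i = 1≤^ {2} i ℕ.z<s
      1≤K : 1 ℕ.≤ K
      1≤K = ℕₚ.≤-trans (1≤2^ ((R ℕ.+ 5) ℕ.* J)) K-large
      1≤R = ℕₚ.≤-trans ℕ.z<s 9≤R
      1≤Q₂ : 1 ℕ.≤ Q₂
      1≤Q₂ = ℕₚ.≤-trans (ℕₚ.*-mono-≤ (ℕₚ.*-mono-≤ (ℕₚ.*-mono-≤ {1} {40} ℕ.z<s 1≤b) 1≤B) (1≤2^ (suc R))) Q₂-large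
      1≤Q₃ : 1 ℕ.≤ Q₃
      1≤Q₃ = ℕₚ.≤-trans (ℕₚ.*-mono-≤ (ℕₚ.*-mono-≤ {1} {6} ℕ.z<s 1≤K) 1≤Q₂) Q₃-large
      1≤Q : 1 ℕ.≤ Q
      1≤Q = ℕₚ.≤-trans (ℕₚ.*-mono-≤ (ℕₚ.*-mono-≤ (ℕₚ.*-mono-≤ {1} {8} ℕ.z<s (1≤2^ R)) 1≤R) 1≤Q₃) Q-large
      1≤Y₁ : 1 ℕ.≤ Y₁
      1≤Y₁ = ℕₚ.≤-trans (1≤^ {4} (212 ℕ.* Q) ℕ.z<s) Y₁-large
      1≤c : 1 ℕ.≤ c
      1≤c = ℕₚ.≤-trans (ℕₚ.*-mono-≤ (1≤2^ R) (ℕₚ.*-mono-≤ {1} {2} ℕ.z<s 1≤Y₁)) c-large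
      1≤u : 1 ℕ.≤ u
      1≤u = ℕₚ.≤-trans (ℕₚ.*-mono-≤ {1} {40} ℕ.z<s 1≤b) 40b≤u
      1≤n : 1 ℕ.≤ n
      1≤n = ℕₚ.≤-trans (ℕₚ.≤-trans 1≤Y₁ (ℕₚ.m≤n+m Y₁ (j₀ ℕ.+ 1))) n-large

      kY₁≤u : ∀ {k} → k ℕ.≤ z → k ℕ.* Y₁ ℕ.≤ u
      kY₁≤u {k} k≤z = ℕₚ.≤-trans (ℕₚ.*-monoˡ-≤ Y₁ k≤z) (subst (ℕ._≤ u) (ℕₚ.*-comm Y₁ z) (÷-lower u Y₁))

      a : ℕ → ℕ
      a t = K ℕ.^ (j₀ ℕ.+ t)

      1≤a : ∀ t → 1 ℕ.≤ a t
      1≤a t = 1≤^ (j₀ ℕ.+ t) 1≤K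

      a-mono : ∀ {s t} → s ℕ.≤ t → a s ℕ.≤ a t
      a-mono s≤t = ℕₚ.^-monoʳ-≤ K {{ℕ.>-nonZero 1≤K}} (ℕₚ.+-monoʳ-≤ j₀ s≤t)

      a≤z : ∀ {t} → t ℕ.≤ n → a t ℕ.≤ z
      a≤z t≤n = ℕₚ.≤-trans (a-mono t≤n) (÷-greatest Y₁ (a n) 1≤Y₁ (subst (ℕ._≤ u) (ℕₚ.*-comm (a n) Y₁) n-upper))

      1≤z : 1 ℕ.≤ z
      1≤z = ℕₚ.≤-trans (1≤a n) (a≤z ℕₚ.≤-refl)

      u≤x : ∀ i → u ℕ.≤ x i
      u≤x i = grow-≤ b {0} {i} u ℕ.z≤n

      x≤X : ∀ {i} → i ℕ.≤ R → x i ℕ.≤ X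
      x≤X i≤R = ℕₚ.≤-trans (grow-≤ b u i≤R) grow≤X

      x≤2^Ru : ∀ {i} → i ℕ.≤ R → x i ℕ.≤ 2 ℕ.^ R ℕ.* u
      x≤2^Ru {i} i≤R = ℕₚ.≤-trans (grow-≤ b u i≤R) (grow-double b R u)

      x-double : ∀ i → x (suc i) ℕ.≤ 2 ℕ.* x i
      x-double i = ℕₚ.+-monoʳ-≤ (x i) (ℕₚ.≤-trans (÷-≤ (x i) b) (ℕₚ.≤-reflexive (sym (ℕₚ.+-identityʳ (x i)))))

      module C {i} (i<R : i ℕ.< R) =
        Cell lg Q Y₁ u (x i) (x (suc i)) 1≤Q Y₁-large 2Q≤Y₁ (u≤x i) (grow-step b i u) (x-double i) (x≤X i<R)

      e-nonneg : ∀ {k} → 1 ℕ.≤ k → k ℕ.≤ z → ∀ i → 1 ℕ.≤ i → i ℕ.≤ R → ι 0 ≤ e i k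
      e-nonneg {k} 1≤k k≤z (suc i) _ i<R = C.excess-nonneg i<R k 1≤k (kY₁≤u k≤z)

      E-nonneg : ∀ {k} → 1 ℕ.≤ k → k ℕ.≤ z → ι 0 ≤ E k
      E-nonneg 1≤k k≤z = ∑-nonneg R (e-nonneg 1≤k k≤z)

      ΛE-nonneg : ∀ {k} → 1 ℕ.≤ k → k ℕ.≤ z → ι 0 ≤ Λ k * E k
      ΛE-nonneg {k} 1≤k k≤z = *-nonneg (Λ-nonneg k 1≤k) (E-nonneg 1≤k k≤z)

      Φ-mono : ∀ {s t} → s ℕ.≤ t → t ℕ.≤ z → Φ s ≤ Φ t
      Φ-mono s≤t t≤z = ∑-grow s≤t (λ k s<k k≤t → ΛE-nonneg (ℕₚ.≤-trans ℕ.z<s s<k) (ℕₚ.≤-trans k≤t t≤z))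

      Φ-nonneg : ∀ {t} → t ℕ.≤ z → ι 0 ≤ Φ t
      Φ-nonneg t≤z = Φ-mono {0} ℕ.z≤n t≤z

      H-u-large : ι Q * (ι 388 + ι 10 * ι c) ≤ H u
      H-u-large = subst (_≤ H u) (trans (ι-* Q (388 ℕ.+ 10 ℕ.* c))
          (cong (ι Q *_) (trans (ι-+ 388 (10 ℕ.* c)) (cong (ι 388 +_) (ι-* 10 c)))))
        (H-large (Q ℕ.* (388 ℕ.+ 10 ℕ.* c)) u u-large)

      2^R≤c : 2 ℕ.^ R ℕ.≤ c
      2^R≤c = ℕₚ.≤-trans (ℕₚ.≤-reflexive (sym (ℕₚ.*-identityʳ (2 ℕ.^ R))))
        (ℕₚ.≤-trans (ℕₚ.*-monoʳ-≤ (2 ℕ.^ R) (ℕₚ.*-mono-≤ {1} {2} ℕ.z<s 1≤Y₁)) c-large)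

      H-x : ∀ {i} → i ℕ.≤ R → H (x i) ≤ ι 2 * H u
      H-x {i} i≤R = ≤-trans (H-mono (x≤2^Ru i≤R)) (≤-trans (H-subadditive (2 ℕ.^ R) u (1≤2^ R))
        (arith 5 (λ h p c u q → h :≤ p ⇒ p :≤ c ⇒ # 1 :* (# 388 :+ # 10 :* c) :≤ q ⇒ q :≤ u ⇒ # 0 :≤ c ⇒ h :+ u :≤ # 2
          :* u)
          (H≤ι (2 ℕ.^ R)) (ι-mono 2^R≤c)
          (*-monoʳ (ι 388 + ι 10 * ι c) (arith 1 (λ c → # 0 :≤ c ⇒ # 0 :≤ # 388 :+ # 10 :* c) (ι-nonneg c))
            (ι-mono 1≤Q))
          H-u-large (ι-nonneg c)))

      x≤cz : ∀ {i} → i ℕ.≤ R → x i ℕ.≤ c ℕ.* z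
      x≤cz i≤R = ℕₚ.≤-trans (x≤2^Ru i≤R) (ℕₚ.≤-trans (ℕₚ.*-monoʳ-≤ (2 ℕ.^ R) u≤2Y₁z)
        (ℕₚ.≤-trans (ℕₚ.≤-reflexive (sym (ℕₚ.*-assoc (2 ℕ.^ R) (2 ℕ.* Y₁) z))) (ℕₚ.*-monoˡ-≤ z c-large)))
        where
        u≤2Y₁z : u ℕ.≤ 2 ℕ.* Y₁ ℕ.* z
        u≤2Y₁z = ℕₚ.≤-trans (ℕₚ.<⇒≤ (÷-upper u Y₁ 1≤Y₁))
          (arithℕ 2 (λ y z → y :* # 1 :≤ y :* z ⇒ y :* (# 1 :+ z) :≤ # 2 :* y :* z) Y₁ z (ℕₚ.*-monoʳ-≤ Y₁ 1≤z))

      cell-total : ∀ i → 1 ℕ.≤ i → i ℕ.≤ R →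
                   ∑ z (λ k → Λ k * e i k) ≤ ι 8 * (inv Q * (ι (2 ℕ.^ R) * (ι u * H u)))
      cell-total (suc i) _ i<R = ≤-trans
        (C.excess-total i<R c 1≤c few′ 1≤u (x≤cz i<R) (≤-trans H-u-large (H-mono (u≤x (suc i)))))
        (arith 6 (λ q p u h x y → q :* (x :* y) :≤ q :* ((p :* u) :* (# 2 :* h)) ⇒ # 4 :* (q :* x :* y) :≤ # 8 :*
          (q :* (p :* (u :* h))))
          (*-monoˡ (inv Q) (inv-nonneg Q) (*-mono (ι-nonneg (x (suc i))) (H-nonneg (x (suc i)))
            (subst (ι (x (suc i)) ≤_) (ι-* (2 ℕ.^ R) u) (ι-mono (x≤2^Ru i<R))) (H-x i<R))))
        where
        few′ : ι Q * (ψ′ (x (suc i)) - ψ′ (x i)) ≤ ι u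
        few′ = ≤-trans (*-monoˡ (ι Q) (ι-nonneg Q)
          (arith 4 (λ a b c d → a :≤ b ⇒ c :≤ d ⇒ a :- d :≤ b :- c) (ψ-mono lg (grow-≤ b u i<R)) (ψ-mono lg (u≤x i))))
            few

      Φ-z : ι Q₃ * Φ z ≤ ι u * H u
      Φ-z = ≤-trans (*-monoˡ (ι Q₃) (ι-nonneg Q₃) total) (cancel-ιˡ Q 1≤Q
          (arith 6 (λ Q q r p Q₃ w → # 8 :* p :* r :* Q₃ :* w :≤ Q :* w ⇒ Q :* q :* (# 8 :* p :* r :* Q₃ :* w) := # 1 :*
            (# 8 :* p :* r :* Q₃ :* w) ⇒
              Q :* (Q₃ :* (r :* (# 8 :* (q :* (p :* w))))) :≤ Q :* w)
            (*-monoʳ (ι u * H u) (*-nonneg (ι-nonneg u) (H-nonneg u))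
              (subst (_≤ ι Q) (trans (ι-* (8 ℕ.* 2 ℕ.^ R ℕ.* R) Q₃) (cong (_* ι Q₃) (trans (ι-* (8 ℕ.* 2 ℕ.^ R) R)
                (cong (_* ι R) (ι-* 8 (2 ℕ.^ R)))))) (ι-mono Q-large)))
            (cong (_* (ι 8 * ι (2 ℕ.^ R) * ι R * ι Q₃ * (ι u * H u))) (inv-cancel Q 1≤Q))))
        where
        total : Φ z ≤ ι R * (ι 8 * (inv Q * (ι (2 ℕ.^ R) * (ι u * H u))))
        total = ≤-trans (≡⇒≤ (trans (∑-cong z (λ k _ _ → sym (∑-*ˡ R (Λ k) (λ i → e i k))))
            (∑-swap z R (λ k i → Λ k * e i k))))
          (≤-trans (∑-mono R cell-total) (≡⇒≤ (∑-const R _)))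

      H-u-upper : H u ≤ ι 3 * (ι n * ι K)
      H-u-upper = ≤-trans (H-mono n-lower) (≤-trans (H-subadditive (K ℕ.^ suc (j₀ ℕ.+ n)) Y₁ (1≤^ (suc (j₀ ℕ.+ n)) 1≤K))
        (≤-trans (+-mono-≤ (H-^-upper K (suc (j₀ ℕ.+ n)) 1≤K) (H≤ι Y₁))
          (subst (_≤ ι 3 * (ι n * ι K)) (trans (ι-+ (suc (j₀ ℕ.+ n) ℕ.* K ℕ.+ 1) Y₁) (cong (_+ ι Y₁)
              (trans (ι-+ (suc (j₀ ℕ.+ n) ℕ.* K) 1) (cong (_+ ι 1) (ι-* (suc (j₀ ℕ.+ n)) K)))))
            (≤-trans (ι-mono natural) (≡⇒≤ (trans (ι-* 3 (n ℕ.* K)) (cong (ι 3 *_) (ι-* n K))))))))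
        where
        natural : suc (j₀ ℕ.+ n) ℕ.* K ℕ.+ 1 ℕ.+ Y₁ ℕ.≤ 3 ℕ.* (n ℕ.* K)
        natural = arithℕ 4 (λ j n k y → (j :+ # 1 :+ y) :* k :≤ n :* k ⇒ j :+ # 1 :+ y :≤ n ⇒ n :* # 1 :≤ n :* k ⇒ # 0
            :≤ y :* k ⇒
            (# 1 :+ (j :+ n)) :* k :+ # 1 :+ y :≤ # 3 :* (n :* k))
          j₀ n K Y₁ (ℕₚ.*-monoˡ-≤ K n-large) n-large (ℕₚ.*-monoʳ-≤ n 1≤K) ℕ.z≤n

      -- By `H-u-upper` the number n of windows is at least H u/(3 K), so the bound u H u/Q₃ with Q₃
      -- ≥ 6 K Q₂ is at most half of n u/Q₂.
      Φ-z′ : ι 2 * (ι Q₂ * Φ z) ≤ ι n * ι u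
      Φ-z′ = cancel-ιˡ (3 ℕ.* K) (ℕₚ.*-mono-≤ {1} {3} ℕ.z<s 1≤K)
        (subst (λ s → s * (ι 2 * (ι Q₂ * Φ z)) ≤ s * (ι n * ι u)) (sym (ι-* 3 K))
          (arith 7 (λ k q₂ q₃ f u h n → # 6 :* k :* q₂ :* f :≤ q₃ :* f ⇒ q₃ :* f :≤ u :* h ⇒ u :* h :≤ u :*
            (# 3 :* (n :* k)) ⇒
              # 3 :* k :* (# 2 :* (q₂ :* f)) :≤ # 3 :* k :* (n :* u))
            (*-monoʳ (Φ z) (Φ-nonneg ℕₚ.≤-refl) (subst (_≤ ι Q₃) (trans (ι-* (6 ℕ.* K) Q₂) (cong (_* ι Q₂) (ι-* 6 K)))
              (ι-mono Q₃-large)))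
            Φ-z (*-monoˡ (ι u) (ι-nonneg u) H-u-upper)))

      -- Pigeonhole: if each of the n increments were at least u/Q₂, their sum would be twice what
      -- `Φ-z′` allows.
      window : ∃[ t ] 0 ℕ.< t × t ℕ.≤ n × ι Q₂ * (Φ (a t) - Φ (a (ℕ.pred t))) ≤ ι u
      window = [ (λ w → w) , (λ none → ⊥-elim (impossible none)) ]′
        (scan {λ t → ι Q₂ * (Φ (a t) - Φ (a (ℕ.pred t))) ≤ ι u} {λ t → ι u ≤ ι Q₂ * (Φ (a t) - Φ (a (ℕ.pred t)))}
          0 n (λ t _ _ → ≤-total _ _))
        where
        impossible : (∀ t → 0 ℕ.< t → t ℕ.≤ n → ι u ≤ ι Q₂ * (Φ (a t) - Φ (a (ℕ.pred t)))) → ⊥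
        impossible none = ≤-irrefl-suc {0} (≤-trans (ι-mono (ℕₚ.*-mono-≤ 1≤n 1≤u)) (≤-trans (≡⇒≤ (ι-* n u))
          (arith 5 (λ nu q f f₀ fz → nu :≤ q :* (f :- f₀) ⇒ q :* f :≤ q :* fz ⇒ # 0 :≤ q :* f₀ ⇒ # 2 :* (q :* fz) :≤ nu
            ⇒ nu :≤ # 0)
            (≤-trans (≡⇒≤ (sym (∑-const n (ι u)))) (≤-trans (∑-mono n none)
              (≡⇒≤ (trans (∑-*ˡ n (ι Q₂) (λ t → Φ (a t) - Φ (a (ℕ.pred t))))
                (cong (ι Q₂ *_) (∑-telescope n (λ t → Φ (a t))))))))
            (*-monoˡ (ι Q₂) (ι-nonneg Q₂) (Φ-mono (a≤z ℕₚ.≤-refl) ℕₚ.≤-refl))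
            (*-nonneg (ι-nonneg Q₂) (Φ-nonneg (a≤z ℕ.z≤n))) Φ-z′)))

    module Window (t : ℕ) (t<n : suc t ℕ.≤ n) (light : ι Q₂ * (Φ (a (suc t)) - Φ (a t)) ≤ ι u) where
      private
        lo = a t
        hi = a (suc t)
        hi≤z = a≤z t<n
        hi≡ : hi ≡ K ℕ.* lo
        hi≡ = cong (K ℕ.^_) (ℕₚ.+-suc j₀ t)

        2^j₀≤lo : 2 ℕ.^ j₀ ℕ.≤ lo
        2^j₀≤lo = ℕₚ.≤-trans (ℕₚ.^-monoˡ-≤ j₀ 2≤K) (ℕₚ.^-monoʳ-≤ K {{ℕ.>-nonZero 1≤K}} (ℕₚ.m≤m+n j₀ t))
          where
          2≤K : 2 ℕ.≤ K
          2≤K = ℕₚ.≤-trans (ℕₚ.^-monoʳ-≤ 2 (ℕₚ.*-mono-≤ {1} {R ℕ.+ 5} (ℕₚ.≤-trans ℕ.z<s (ℕₚ.m≤n+m 5 R))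
            (ℕₚ.≤-trans (ℕₚ.*-mono-≤ (ℕₚ.*-mono-≤ {1} {25} ℕ.z<s 1≤b) (ℕ.s≤s {0} {13} ℕ.z≤n)) J-large))) K-large

        Good : ℕ → Set
        Good k = ι 20 * ι b * (ι k * E k) ≤ ι u

        -- If all k in the interval were bad, the Λ-mass that it has by `dense` would give an
        -- increment of Φ larger than the light window permits.
        good-exists : ∀ y → lo ℕ.≤ y → grow b (suc R) y ℕ.≤ hi → ∃[ k ] y ℕ.< k × k ℕ.≤ grow b (suc R) y × Good k
        good-exists y lo≤y y′≤hi = [ (λ w → w) , (λ none → ⊥-elim (impossible none)) ]′
          (scan {Good} {λ k → ι u ≤ ι 20 * ι b * (ι k * E k)} y y′ (λ k _ _ → ≤-total _ _))
          where
          y′ = grow b (suc R) y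
          y≤y′ : y ℕ.≤ y′
          y≤y′ = grow-≤ b {0} {suc R} y ℕ.z≤n
          y≤hi = ℕₚ.≤-trans y≤y′ y′≤hi
          1≤y = ℕₚ.≤-trans (1≤a t) lo≤y
          y′≤X : y′ ℕ.≤ X
          y′≤X = ℕₚ.≤-trans y′≤hi (ℕₚ.≤-trans hi≤z (ℕₚ.≤-trans (÷-≤ u Y₁) (ℕₚ.≤-trans (u≤x R) grow≤X)))
          impossible : (∀ k → y ℕ.< k → k ℕ.≤ y′ → ι u ≤ ι 20 * ι b * (ι k * E k)) → ⊥
          impossible none = ≤-irrefl-suc {0} (≤-trans (ι-mono (ℕₚ.*-mono-≤ 1≤y 1≤u)) (≤-trans (≡⇒≤ (ι-* y u)) final))
            where
            w = Φ hi - Φ lo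
            weighted : ι u * (ψ′ y′ - ψ′ y) ≤ ι 20 * ι b * ι y′ * (Φ y′ - Φ y)
            weighted = ≤-trans (≡⇒≤ (trans (arith 3 (λ u a b → u :* (a :- b) := u :* a :- u :* b))
                (sym (cong₂ _-_ (∑-*ˡ y′ (ι u) Λ) (∑-*ˡ y (ι u) Λ)))))
              (≤-trans (∑-tail-mono y≤y′ (λ k y<k k≤y′ → let 1≤k = ℕₚ.≤-trans ℕ.z<s y<k in
                ≤-trans (*-monoʳ (Λ k) (Λ-nonneg k 1≤k) (≤-trans (none k y<k k≤y′)
                  (*-monoˡ (ι 20 * ι b) (*-nonneg (ι-nonneg 20) (ι-nonneg b))
                    (*-monoʳ (E k) (E-nonneg 1≤k (ℕₚ.≤-trans k≤y′ (ℕₚ.≤-trans y′≤hi hi≤z))) (ι-mono k≤y′)))))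
                  (≡⇒≤ (arith 4 (λ c y e l → c :* (y :* e) :* l := c :* y :* (l :* e))))))
                (≡⇒≤ (trans (cong₂ _-_ (∑-*ˡ y′ (ι 20 * ι b * ι y′) (λ k → Λ k * E k))
                  (∑-*ˡ y (ι 20 * ι b * ι y′) (λ k → Λ k * E k)))
                  (arith 3 (λ u a b → u :* a :- u :* b := u :* (a :- b))))))
            0≤w : ι 0 ≤ w
            0≤w = diff-nonneg (Φ-mono (a-mono (ℕₚ.n≤1+n t)) hi≤z)
            mass : ι u * (ψ′ y′ - ψ′ y) ≤ ι 20 * ι b * (ι (2 ℕ.^ suc R) * ι y) * w
            mass = ≤-trans weighted (*-mono (*-nonneg (*-nonneg (ι-nonneg 20) (ι-nonneg b)) (ι-nonneg y′))
              (diff-nonneg (Φ-mono y≤y′ (ℕₚ.≤-trans y′≤hi hi≤z)))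
              (*-monoˡ (ι 20 * ι b) (*-nonneg (ι-nonneg 20) (ι-nonneg b))
                (subst (ι y′ ≤_) (ι-* (2 ℕ.^ suc R) y) (ι-mono (grow-double b (suc R) y))))
              (arith 4 (λ a b c d → a :≤ b ⇒ c :≤ d ⇒ a :- d :≤ b :- c) (Φ-mono y′≤hi hi≤z)
                (Φ-mono lo≤y (ℕₚ.≤-trans y≤hi hi≤z))))
            final : ι y * ι u ≤ ι 0
            final = arith 8 (λ y u B d b p w Q₂ → u :* y :≤ u :* (B :* d) ⇒ B :* (u :* d) :≤ B :*
                (# 20 :* b :* (p :* y) :* w) ⇒
                (# 40 :* b :* B :* p) :* (y :* w) :≤ Q₂ :* (y :* w) ⇒ y :* (Q₂ :* w) :≤ y :* u ⇒ y :* u :≤ # 0)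
              (*-monoˡ (ι u) (ι-nonneg u) (dense y (ℕₚ.≤-trans 2^j₀≤lo lo≤y) y′≤X))
              (*-monoˡ (ι B) (ι-nonneg B) mass)
              (*-monoʳ (ι y * w) (*-nonneg (ι-nonneg y) 0≤w)
                (subst (_≤ ι Q₂) (trans (ι-* (40 ℕ.* b ℕ.* B) (2 ℕ.^ suc R))
                (cong (_* ι (2 ℕ.^ suc R)) (trans (ι-* (40 ℕ.* b) B) (cong (_* ι B) (ι-* 40 b))))) (ι-mono Q₂-large)))
              (*-monoˡ (ι y) (ι-nonneg y) light)

        module _ (k : ℕ) (1≤k : 1 ℕ.≤ k) (k≤z : k ℕ.≤ z) (good : Good k) where

          M-cells : ∀ i → i ℕ.≤ R → ι i * (ι 9 * inv b) ≤ ι 5 * (M′ (x i ÷ k) - M′ (u ÷ k))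
          M-cells zero _ = arith 2 (λ c m → # 0 :* c :≤ # 5 :* (m :- m))
          M-cells (suc i) i<R = ≤-trans (≡⇒≤ (cong (_* (ι 9 * inv b)) (ι-suc i)))
            (arith 5 (λ i c m₀ m m′ → i :* c :≤ # 5 :* (m :- m₀) ⇒ c :≤ # 5 :* (m′ :- m) ⇒ (# 1 :+ i) :* c :≤ # 5 :*
              (m′ :- m₀))
              (M-cells i (ℕₚ.<⇒≤ i<R))
              (C.cell-M i<R b 18≤b (ℕₚ.≤-trans 40b≤u (u≤x i)) refl k 1≤k (kY₁≤u k≤z) good-cell))
            where
            good-cell : ι 20 * ι b * (ι k * e (suc i) k) ≤ ι u
            good-cell = ≤-trans (*-monoˡ (ι 20 * ι b) (*-nonneg (ι-nonneg 20) (ι-nonneg b)) (*-monoˡ (ι k) (ι-nonneg k)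
              (∑-term R (suc i) ℕ.z<s i<R (e-nonneg 1≤k k≤z)))) good

          H-cells : ∀ i → ι 25 * (H (x i ÷ k) - H (u ÷ k)) ≤ ι i * (ι 26 * inv b)
          H-cells zero = arith 2 (λ c m → # 25 :* (m :- m) :≤ # 0 :* c)
          H-cells (suc i) = ≤-trans
            (arith 5 (λ i c m₀ m m′ → # 25 :* (m :- m₀) :≤ i :* c ⇒ # 25 :* (m′ :- m) :≤ c ⇒ # 25 :* (m′ :- m₀) :≤
              (# 1 :+ i) :* c)
              (H-cells i) (cell-H b k (x i) 1≤b 1≤k (ℕₚ.≤-trans (ℕₚ.*-monoˡ-≤ k 25b≤Y₁)
                (ℕₚ.≤-trans (subst (ℕ._≤ u) (ℕₚ.*-comm k Y₁) (kY₁≤u k≤z)) (u≤x i)))))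
            (≡⇒≤ (cong (_* (ι 26 * inv b)) (sym (ι-suc i))))

        -- The gain of Mertens' sum over the logarithm between u/k′ and u/k. Mertens' estimates
        -- bound it by 10 + 3 = 13.
        gain : ℕ → ℕ → Carrier
        gain k k′ = (M′ (u ÷ k) - M′ (u ÷ k′)) - (H (u ÷ k) - H (u ÷ k′))

        module Step (k : ℕ) (lo≤k : lo ℕ.≤ k) (grow≤hi : grow b (R ℕ.+ 5) k ℕ.≤ hi) where
          -- Skipping four steps first ensures, by `grow-2-4`, that at least two cells fit between
          -- u/k′ and u/k.
          y = grow b 4 k
          grow≡ : grow b (R ℕ.+ 5) k ≡ grow b (suc R) y
          grow≡ = trans (cong (λ i → grow b i k) (ℕₚ.+-suc R 4)) (grow-+ b (suc R) 4 k)
          k≤y : k ℕ.≤ y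
          k≤y = grow-≤ b {0} {4} k ℕ.z≤n
          found = good-exists y (ℕₚ.≤-trans lo≤k k≤y) (subst (ℕ._≤ hi) grow≡ grow≤hi)
          k′ = proj₁ found
          y<k′ = proj₁ (proj₂ found)
          k′≤y′ = proj₁ (proj₂ (proj₂ found))
          good = proj₂ (proj₂ (proj₂ found))
          k′≤ : k′ ℕ.≤ grow b (R ℕ.+ 5) k
          k′≤ = subst (k′ ℕ.≤_) (sym grow≡) k′≤y′
          k≤k′ = ℕₚ.≤-trans k≤y (ℕₚ.<⇒≤ y<k′)
          lo≤k′ = ℕₚ.≤-trans lo≤k k≤k′
          1≤k = ℕₚ.≤-trans (1≤a t) lo≤k
          1≤k′ = ℕₚ.≤-trans 1≤k k≤k′
          k′≤z = ℕₚ.≤-trans k′≤ (ℕₚ.≤-trans grow≤hi hi≤z)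
          -- i is the number of cells that fit between u/k′ and u/k.
          crossed = crossing (λ i → x i ℕ.* k) (u ℕ.* k′) 2 (R ℕ.+ 3)
            (ℕₚ.≤-trans (grow-2-4 b 1≤b k u (ℕₚ.≤-trans j₀-large (ℕₚ.≤-trans 2^j₀≤lo lo≤k)))
              (ℕₚ.*-monoʳ-≤ u (ℕₚ.<⇒≤ y<k′)))
            (ℕₚ.≤-trans (ℕₚ.*-monoʳ-≤ u k′≤) (ℕₚ.≤-trans (grow-compare b 1≤b (R ℕ.+ 5) k u b²+b≤u)
              (ℕₚ.≤-reflexive (cong (λ j → x j ℕ.* k) (cong suc (trans (ℕₚ.+-suc R 4) (cong suc (ℕₚ.+-suc R 3))))))))
          i = proj₁ crossed
          2≤i = proj₁ (proj₂ crossed)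
          i≤ = proj₁ (proj₂ (proj₂ crossed))
          below = proj₁ (proj₂ (proj₂ (proj₂ crossed)))
          above = proj₂ (proj₂ (proj₂ (proj₂ crossed)))
          -- Only R cells are known to be dense, and only i of them surely lie below u/k.
          r = R ℕ.⊓ i
          M-gain : ι r * (ι 9 * inv b) ≤ ι 5 * (M′ (u ÷ k) - M′ (u ÷ k′))
          M-gain = ≤-trans (M-cells k′ 1≤k′ k′≤z good r (ℕₚ.m⊓n≤m R i))
            (arith 3 (λ a b c → a :≤ b ⇒ # 5 :* (a :- c) :≤ # 5 :* (b :- c))
              (∑-grow (÷-compare 1≤k′ 1≤k (ℕₚ.≤-trans (ℕₚ.*-monoˡ-≤ k (grow-≤ b u (ℕₚ.m⊓n≤n R i))) below))
                (λ j l _ → *-nonneg (Λ-nonneg j (ℕₚ.≤-trans ℕ.z<s l)) (inv-nonneg j))))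
          H-gain : ι 25 * (H (u ÷ k) - H (u ÷ k′)) ≤ ι (suc i) * (ι 26 * inv b)
          H-gain = ≤-trans (arith 3 (λ a b c → a :≤ b ⇒ # 25 :* (a :- c) :≤ # 25 :* (b :- c))
            (H-mono (÷-compare 1≤k 1≤k′ above))) (H-cells k′ 1≤k′ k′≤z good (suc i))
          3i≤5r : 3 ℕ.* suc i ℕ.≤ 5 ℕ.* r
          3i≤5r = 3[1+i]≤5[R⊓i] R i 9≤R 2≤i i≤
          -- In units of 1/b, r dense cells give at least 9r/5 and the logarithm grows by at most 26
          -- (i + 1)/25. As r ≥ 3 (i + 1)/5, the surplus is at least (i + 1)/25.
          gained : ι 1 ≤ ι 25 * ι b * gain k k′
          gained = arith 6 (λ m h r s b β →
              b :* (r :* (# 9 :* β)) :≤ b :* (# 5 :* m) ⇒ b :* (# 25 :* h) :≤ b :* (s :* (# 26 :* β)) ⇒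
              b :* β :* r := # 1 :* r ⇒ b :* β :* s := # 1 :* s ⇒ # 3 :* s :≤ # 5 :* r ⇒ # 1 :≤ s ⇒
              # 1 :≤ # 25 :* b :* (m :- h))
            (*-monoˡ (ι b) (ι-nonneg b) M-gain) (*-monoˡ (ι b) (ι-nonneg b) H-gain)
            (cong (_* ι r) (inv-cancel b 1≤b)) (cong (_* ι (suc i)) (inv-cancel b 1≤b))
            (subst₂ _≤_ (ι-* 3 (suc i)) (ι-* 5 r) (ι-mono 3i≤5r)) (ι-mono ℕ.z<s)

        step : ∀ k → lo ℕ.≤ k → grow b (R ℕ.+ 5) k ℕ.≤ hi →
               ∃[ k′ ] lo ℕ.≤ k′ × k′ ℕ.≤ grow b (R ℕ.+ 5) k × ι 1 ≤ ι 25 * ι b * gain k k′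
        step k lo≤k grow≤hi = k′ , lo≤k′ , k′≤ , gained
          where open Step k lo≤k grow≤hi

        chain : ∀ j → j ℕ.≤ J → ∃[ k ] lo ℕ.≤ k × k ℕ.≤ 2 ℕ.^ ((R ℕ.+ 5) ℕ.* j) ℕ.* lo × ι j ≤ ι 25 * ι b * gain lo k
        chain zero _ = lo , ℕₚ.≤-refl ,
          subst (λ s → lo ℕ.≤ 2 ℕ.^ s ℕ.* lo) (sym (ℕₚ.*-zeroʳ (R ℕ.+ 5))) (ℕₚ.≤-reflexive (sym (ℕₚ.+-identityʳ lo))) ,
          arith 3 (λ b m h → # 0 :≤ # 25 :* b :* ((m :- m) :- (h :- h)))
        chain (suc j) j<J with chain j (ℕₚ.<⇒≤ j<J)
        ... | k , lo≤k , k≤ , gained = k′ , lo≤k′ , ℕₚ.≤-trans k′≤ grow≤ ,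
          ≤-trans (≡⇒≤ (ι-suc j))
            (arith 8 (λ j b m₀ m m′ h₀ h h′ → j :≤ # 25 :* b :* ((m₀ :- m) :- (h₀ :- h)) ⇒ # 1 :≤ # 25 :* b :*
              ((m :- m′) :- (h :- h′)) ⇒
                # 1 :+ j :≤ # 25 :* b :* ((m₀ :- m′) :- (h₀ :- h′)))
              gained gained′)
          where
          grow≤ : grow b (R ℕ.+ 5) k ℕ.≤ 2 ℕ.^ ((R ℕ.+ 5) ℕ.* suc j) ℕ.* lo
          grow≤ = ℕₚ.≤-trans (grow-double b (R ℕ.+ 5) k) (ℕₚ.≤-trans (ℕₚ.*-monoʳ-≤ (2 ℕ.^ (R ℕ.+ 5)) k≤)
            (ℕₚ.≤-reflexive (trans (sym (ℕₚ.*-assoc (2 ℕ.^ (R ℕ.+ 5)) _ lo)) (cong (ℕ._* lo)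
              (trans (sym (ℕₚ.^-distribˡ-+-* 2 (R ℕ.+ 5) ((R ℕ.+ 5) ℕ.* j)))
                (cong (2 ℕ.^_) (sym (ℕₚ.*-suc (R ℕ.+ 5) j))))))))
          grow≤hi : grow b (R ℕ.+ 5) k ℕ.≤ hi
          grow≤hi = ℕₚ.≤-trans grow≤ (ℕₚ.≤-trans (ℕₚ.*-monoˡ-≤ lo (ℕₚ.≤-trans
            (ℕₚ.^-monoʳ-≤ 2 (ℕₚ.*-monoʳ-≤ (R ℕ.+ 5) j<J)) K-large)) (ℕₚ.≤-reflexive (sym hi≡)))
          stepped = step k lo≤k grow≤hi
          k′ = proj₁ stepped
          lo≤k′ = proj₁ (proj₂ stepped)
          k′≤ = proj₁ (proj₂ (proj₂ stepped))
          gained′ = proj₂ (proj₂ (proj₂ stepped))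

      private
        too-much-gained : (∃[ k ] lo ℕ.≤ k × k ℕ.≤ 2 ℕ.^ ((R ℕ.+ 5) ℕ.* J) ℕ.* lo × ι J ≤ ι 25 * ι b * gain lo k) → ⊥
        too-much-gained (k , lo≤k , k≤ , gained) = ≤-irrefl-suc {0} (≤-trans (ι-mono 1≤b)
          (arith 6 (λ b J m₀ m h₀ h → # 25 :* b :* # 14 :≤ J ⇒ J :≤ # 25 :* b :* ((m₀ :- m) :- (h₀ :- h)) ⇒
              b :* m₀ :≤ b :* (h₀ :+ # 10) ⇒ b :* h :≤ b :* (m :+ # 3) ⇒ b :≤ # 0)
            (subst (_≤ ι J) (trans (ι-* (25 ℕ.* b) 14) (cong (_* ι 14) (ι-* 25 b))) (ι-mono J-large)) gained
            (*-monoˡ (ι b) (ι-nonneg b) (mertens-upper lg (u ÷ lo)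
              (1≤u÷ (1≤a t) (ℕₚ.≤-trans (a-mono (ℕₚ.n≤1+n t)) hi≤z)) (u÷≤X lo)))
            (*-monoˡ (ι b) (ι-nonneg b) (mertens-lower lg (u ÷ k) (1≤u÷ (ℕₚ.≤-trans (1≤a t) lo≤k) k≤z) (u÷≤X k)))))
          where
          k≤z : k ℕ.≤ z
          k≤z = ℕₚ.≤-trans k≤ (ℕₚ.≤-trans (ℕₚ.*-monoˡ-≤ lo K-large) (ℕₚ.≤-trans (ℕₚ.≤-reflexive (sym hi≡)) hi≤z))
          u÷≤X : ∀ d → u ÷ d ℕ.≤ X
          u÷≤X d = ℕₚ.≤-trans (÷-≤ u d) (ℕₚ.≤-trans (u≤x R) grow≤X)
          1≤u÷ : ∀ {d} → 1 ℕ.≤ d → d ℕ.≤ z → 1 ℕ.≤ u ÷ d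
          1≤u÷ {d} 1≤d d≤z = ÷-greatest d 1 1≤d (ℕₚ.≤-trans (ℕₚ.≤-reflexive (ℕₚ.*-identityʳ d))
              (ℕₚ.≤-trans d≤z (÷-≤ u Y₁)))

      contradiction : ⊥
      contradiction = too-much-gained (chain J ℕₚ.≤-refl)

    contradiction : ⊥
    contradiction = impossible window
      where
      impossible : (∃[ t ] 0 ℕ.< t × t ℕ.≤ n × ι Q₂ * (Φ (a t) - Φ (a (ℕ.pred t))) ≤ ι u) → ⊥
      impossible (suc t , _ , t<n , light) = Window.contradiction t t<n light

-- From positive density to primes in (y, (1 + ε) y]

module ShortIntervals (F : OrderedField) where
  open OrderedField F
  open LinearArithmetic F
  open Sums F
  open Logarithm F
  open Moebius F using (module VonMangoldt)
  open Selberg F using (ψ; M; mertens-lower; mertens-upper; Λ≤H)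
  open Growth F
  open Cells F
  open Descent F

  module _ (b ρ B Y : ℕ) where
    private
      -- J₀ steps gaining 1/(25 b) each add up to 14, while Mertens' estimates allow only 13.
      J₀ = 25 ℕ.* b ℕ.* 14
      -- One window must hold the whole chain, each step of which has ratio at most 2^(ρ + 5). The
      -- factor 2 keeps K ≥ 2, so that its powers pass u.
      K = 2 ℕ.* 2 ℕ.^ ((ρ ℕ.+ 5) ℕ.* J₀)
      -- Twice the factor 20 b (B + 1) 2^(ρ + 1) arising in `good-exists`, so that the contradiction
      -- there is strict.
      Q₂ = 40 ℕ.* b ℕ.* suc B ℕ.* 2 ℕ.^ suc ρ
      Q₃ = 6 ℕ.* K ℕ.* Q₂
      Q = 8 ℕ.* 2 ℕ.^ ρ ℕ.* ρ ℕ.* Q₃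
      Y₁ = 4 ℕ.^ (212 ℕ.* Q) ℕ.+ (2 ℕ.* Q ℕ.+ 25 ℕ.* b)
      c₀ = 2 ℕ.^ ρ ℕ.* (2 ℕ.* Y₁)
      -- By n < 2^n, the windows start beyond both Y and 4 b.
      j₀ = Y ℕ.+ 4 ℕ.* b
      n₀ = j₀ ℕ.+ 1 ℕ.+ Y₁
      U = K ℕ.^ (j₀ ℕ.+ n₀) ℕ.* Y₁ ℕ.+ (4 ℕ.^ (Q ℕ.* (388 ℕ.+ 10 ℕ.* c₀)) ℕ.+ ((b ℕ.* b ℕ.+ b) ℕ.+ 40 ℕ.* b))

    -- Either the ρ steps from u carry mass at least u/Q, which is the claim with B = Q, or they
    -- carry so little that `Contradiction` applies.
    descend : 18 ℕ.≤ b → 9 ℕ.≤ ρ → DenseFrom b (suc ρ) B Y → Dense b ρ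
    descend 18≤b 9≤ρ dense = Q , U , λ lg u U≤u grow≤X →
      [ (λ h → h) , (λ few → ⊥-elim (impossible lg u U≤u grow≤X few)) ]′ (≤-total _ _)
      where
      impossible : ∀ {X} (lg : Log X) u → U ℕ.≤ u → grow b ρ u ℕ.≤ X → ι Q * (ψ lg (grow b ρ u) - ψ lg u) ≤ ι u → ⊥
      impossible lg u U≤u grow≤X few =
        Contradiction.contradiction lg b ρ (suc B) J₀ K Q₂ Q₃ Q Y₁ c₀ j₀ n u 18≤b 9≤ρ ℕ.z<s
          ℕₚ.≤-refl (ℕₚ.m≤m+n _ _) ℕₚ.≤-refl ℕₚ.≤-refl ℕₚ.≤-refl
          (ℕₚ.m≤m+n _ _) (ℕₚ.≤-trans (ℕₚ.m≤m+n (2 ℕ.* Q) (25 ℕ.* b)) (ℕₚ.m≤n+m _ (4 ℕ.^ (212 ℕ.* Q))))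
          (ℕₚ.≤-trans (ℕₚ.m≤n+m (25 ℕ.* b) (2 ℕ.* Q)) (ℕₚ.m≤n+m _ (4 ℕ.^ (212 ℕ.* Q))))
          ℕₚ.≤-refl (ℕₚ.≤-trans (ℕₚ.m≤n+m (4 ℕ.* b) Y) (ℕₚ.<⇒≤ (n<2^n j₀)))
          n₀≤n below (subst (λ i → u ℕ.≤ K ℕ.^ i ℕ.* Y₁) (ℕₚ.+-suc j₀ n) above)
          (ℕₚ.≤-trans (ℕₚ.m≤m+n _ _) rest) (ℕₚ.≤-trans (ℕₚ.m≤m+n _ (40 ℕ.* b))
            (ℕₚ.≤-trans (ℕₚ.m≤n+m _ (4 ℕ.^ (Q ℕ.* (388 ℕ.+ 10 ℕ.* c₀)))) rest))
          (ℕₚ.≤-trans (ℕₚ.m≤n+m (40 ℕ.* b) (b ℕ.* b ℕ.+ b))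
            (ℕₚ.≤-trans (ℕₚ.m≤n+m _ (4 ℕ.^ (Q ℕ.* (388 ℕ.+ 10 ℕ.* c₀)))) rest))
          (λ y 2^j₀≤y h → ≤-trans (dense lg y (ℕₚ.≤-trans (ℕₚ.m≤m+n Y (4 ℕ.* b))
            (ℕₚ.≤-trans (ℕₚ.<⇒≤ (n<2^n j₀)) 2^j₀≤y)) h)
            (*-monoʳ _ (ψ-diff lg (grow-≤ b {0} {suc ρ} y ℕ.z≤n)) (ι-mono (ℕₚ.n≤1+n B))))
          grow≤X few
        where
        rest = ℕₚ.≤-trans (ℕₚ.m≤n+m _ (K ℕ.^ (j₀ ℕ.+ n₀) ℕ.* Y₁)) U≤u
        2≤K : 2 ℕ.≤ K
        2≤K = ℕₚ.*-monoʳ-≤ 2 (1≤^ {2} ((ρ ℕ.+ 5) ℕ.* J₀) ℕ.z<s)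
        1≤Y₁ : 1 ℕ.≤ Y₁
        1≤Y₁ = ℕₚ.≤-trans (1≤^ {4} (212 ℕ.* Q) ℕ.z<s) (ℕₚ.m≤m+n _ _)
        large : u ℕ.≤ K ℕ.^ (j₀ ℕ.+ (n₀ ℕ.+ suc u)) ℕ.* Y₁
        large = ℕₚ.≤-trans (ℕₚ.<⇒≤ (n<2^n u)) (ℕₚ.≤-trans (ℕₚ.^-monoˡ-≤ u 2≤K)
          (ℕₚ.≤-trans (ℕₚ.^-monoʳ-≤ K {{ℕ.>-nonZero (ℕₚ.<⇒≤ 2≤K)}}
              (ℕₚ.≤-trans (ℕₚ.n≤1+n u) (ℕₚ.≤-trans (ℕₚ.m≤n+m (suc u) n₀) (ℕₚ.m≤n+m (n₀ ℕ.+ suc u) j₀))))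
            (ℕₚ.≤-trans (ℕₚ.≤-reflexive (sym (ℕₚ.*-identityʳ _))) (ℕₚ.*-monoʳ-≤ (K ℕ.^ (j₀ ℕ.+ (n₀ ℕ.+ suc u))) 1≤Y₁))))
        crossed = crossing (λ i → K ℕ.^ (j₀ ℕ.+ i) ℕ.* Y₁) u n₀ u (ℕₚ.≤-trans (ℕₚ.m≤m+n _ _) U≤u) large
        n = proj₁ crossed
        n₀≤n = proj₁ (proj₂ crossed)
        below = proj₁ (proj₂ (proj₂ (proj₂ crossed)))
        above = proj₂ (proj₂ (proj₂ (proj₂ crossed)))

  module _ (b : ℕ) (18≤b : 18 ℕ.≤ b) where
    private
      1≤b = ℕₚ.≤-trans ℕ.z<s 18≤b

    grow-linear : ∀ i y → b ℕ.* y ℕ.+ i ℕ.* y ℕ.≤ b ℕ.* grow b i y ℕ.+ i ℕ.* b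
    grow-linear zero y = ℕₚ.≤-refl
    grow-linear (suc i) y = arithℕ 6 (λ b i y v d d₀ → b :* y :+ i :* y :≤ b :* v :+ i :* b ⇒ y :≤ b :* (# 1 :+ d₀) ⇒ b
        :* d₀ :≤ b :* d ⇒
        b :* y :+ (# 1 :+ i) :* y :≤ b :* (v :+ d) :+ (# 1 :+ i) :* b)
      b i y (grow b i y) (grow b i y ÷ b) (y ÷ b) (grow-linear i y) (ℕₚ.<⇒≤ (÷-upper y b 1≤b))
      (ℕₚ.*-monoʳ-≤ b (÷-mono b (grow-≤ b {0} {i} y ℕ.z≤n)))

    grow-2b : ∀ y → 2 ℕ.* b ℕ.≤ y → 2 ℕ.* y ℕ.≤ grow b (2 ℕ.* b) y
    grow-2b y h = ℕₚ.*-cancelˡ-≤ b {{ℕ.>-nonZero 1≤b}}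
      (arithℕ 3 (λ b y v → b :* y :+ # 2 :* b :* y :≤ b :* v :+ # 2 :* b :* b ⇒ b :* (# 2 :* b) :≤ b :* y ⇒ b :*
        (# 2 :* y) :≤ b :* v)
        b y (grow b (2 ℕ.* b) y) (grow-linear (2 ℕ.* b) y) (ℕₚ.*-monoʳ-≤ b h))

    grow-2b* : ∀ m y → 2 ℕ.* b ℕ.≤ y → 2 ℕ.^ m ℕ.* y ℕ.≤ grow b (m ℕ.* (2 ℕ.* b)) y
    grow-2b* zero y h = ℕₚ.≤-reflexive (ℕₚ.+-identityʳ y)
    grow-2b* (suc m) y h = ℕₚ.≤-trans (ℕₚ.≤-reflexive (ℕₚ.*-assoc 2 (2 ℕ.^ m) y))
      (ℕₚ.≤-trans (ℕₚ.*-monoʳ-≤ 2 (grow-2b* m y h))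
        (ℕₚ.≤-trans (grow-2b (grow b (m ℕ.* (2 ℕ.* b)) y) (ℕₚ.≤-trans h (grow-≤ b {0} {m ℕ.* (2 ℕ.* b)} y ℕ.z≤n)))
          (ℕₚ.≤-reflexive (sym (grow-+ b (2 ℕ.* b) (m ℕ.* (2 ℕ.* b)) y)))))

    H-2^* : ∀ m y → 1 ℕ.≤ y → ι m ≤ ι 2 * (H (2 ℕ.^ m ℕ.* y) - H y)
    H-2^* zero y 1≤y = subst (λ k → ι 0 ≤ ι 2 * (H k - H y)) (sym (ℕₚ.+-identityʳ y))
        (arith 1 (λ h → # 0 :≤ # 2 :* (h :- h)))
    H-2^* (suc m) y 1≤y = subst₂ _≤_ (sym (ι-suc m)) (cong (λ k → ι 2 * (H k - H y)) (sym (ℕₚ.*-assoc 2 (2 ℕ.^ m) y)))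
      (arith 4 (λ m a b c → m :≤ # 2 :* (b :- a) ⇒ # 1 :≤ # 2 :* (c :- b) ⇒ # 1 :+ m :≤ # 2 :* (c :- a))
        (H-2^* m y 1≤y) (H-double-lower (2 ℕ.^ m ℕ.* y) (ℕₚ.*-mono-≤ (1≤^ {2} m ℕ.z<s) 1≤y)))

    private
      -- 2 b steps double a number, and 28 doublings raise H by 14, one more than the 13 lost in
      -- Mertens' estimates.
      G = 28 ℕ.* (2 ℕ.* b)

    -- On an interval as long as this Mertens' estimates suffice: they give at least 1 in the sum of
    -- Λ k / k, hence mass at least y.
    dense-initial : Dense b G
    dense-initial = 1 , 2 ℕ.* b , λ {X} lg y 2b≤y g≤X →
      let open VonMangoldt lg
          N = grow b G y
          y≤N = grow-≤ b {0} {G} y ℕ.z≤n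
          1≤y = ℕₚ.≤-trans (ℕₚ.*-mono-≤ {1} {2} ℕ.z<s 1≤b) 2b≤y
          H-gap : ι 28 ≤ ι 2 * (H N - H y)
          H-gap = ≤-trans (H-2^* 28 y 1≤y) (arith 3 (λ a b c → a :≤ b ⇒ # 2 :* (a :- c) :≤ # 2 :* (b :- c))
              (H-mono (grow-2b* 28 y 2b≤y)))
          M-gap : M lg N - M lg y ≤ inv y * (ψ lg N - ψ lg y)
          M-gap = ≤-trans (∑-tail-mono y≤N (λ k y<k _ → let 1≤k = ℕₚ.≤-trans ℕ.z<s y<k in
              ≤-trans (*-monoˡ (Λ k) (Λ-nonneg k 1≤k) (inv-anti 1≤y (ℕₚ.<⇒≤ y<k))) (≡⇒≤ *-swap)))
            (≡⇒≤ (trans (cong₂ _-_ (∑-*ˡ N (inv y) Λ) (∑-*ˡ y (inv y) Λ))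
              (arith 3 (λ i a b → i :* a :- i :* b := i :* (a :- b)))))
      in arith 3 (λ y i w → y :* # 1 :≤ y :* (i :* w) ⇒ y :* i :* w := # 1 :* w ⇒ y :≤ # 1 :* w)
           (*-monoˡ (ι y) (ι-nonneg y)
             (arith 5 (λ w mN my hN hy → # 28 :≤ # 2 :* (hN :- hy) ⇒ mN :- my :≤ w ⇒ hN :≤ mN :+ # 3 ⇒ my :≤ hy :+ # 10
               ⇒ # 1 :≤ w)
               H-gap M-gap (mertens-lower lg N (ℕₚ.≤-trans 1≤y y≤N) g≤X) (mertens-upper lg y 1≤y (ℕₚ.≤-trans y≤N g≤X))))
           (cong (_* (ψ lg N - ψ lg y)) (inv-cancel y 1≤y))

    dense-9 : Dense b 9
    dense-9 = down (G ℕ.∸ 9) (subst (Dense b) (sym (ℕₚ.m+[n∸m]≡n 9≤G)) dense-initial)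
      where
      9≤G : 9 ℕ.≤ G
      9≤G = ℕₚ.≤-trans (ℕₚ.m≤m+n 9 (28 ℕ.* 2 ℕ.∸ 9)) (ℕₚ.*-monoʳ-≤ 28 (ℕₚ.*-monoʳ-≤ 2 1≤b))
      down : ∀ d → Dense b (9 ℕ.+ d) → Dense b 9
      down zero h = h
      down (suc d) h with subst (Dense b) (ℕₚ.+-suc 9 d) h
      ... | B , Y , dense = down d (descend b (9 ℕ.+ d) B Y 18≤b (ℕₚ.m≤m+n 9 d) dense)

  module PrimePowers {N : ℕ} (lg : Log N) (T : ℕ) (N<4^ : N ℕ.< 4 ℕ.^ suc T) where
    open VonMangoldt lg

    private
      root = 2 ℕ.^ suc T
      height = 2 ℕ.* suc T
      h = ι (4 ℕ.* suc T ℕ.+ 1)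

      4^≡ : ∀ t → 4 ℕ.^ t ≡ 2 ℕ.^ (2 ℕ.* t)
      4^≡ t = ℕₚ.^-*-assoc 2 2 t

      Λ≤h : ∀ k → 1 ℕ.≤ k → k ℕ.≤ N → Λ k ≤ h
      Λ≤h k 1≤k k≤N = ≤-trans (Λ≤H lg k 1≤k k≤N) (≤-trans (H-mono (ℕₚ.≤-trans k≤N (ℕₚ.<⇒≤ N<4^)))
        (≤-trans (H-^-upper 4 (suc T) ℕ.z<s) (≡⇒≤ (sym (trans (ι-+ (4 ℕ.* suc T) 1)
          (cong (_+ ι 1) (trans (ι-* 4 (suc T)) *-swap)))))))

      -- Counts the ways to write k as p^(j + 1) with j ≥ 1, over all bases p up to `root`; an upper
      -- bound for proper prime powers is enough.
      pairs : ℕ → R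
      pairs k = ∑ root (λ p → ∑ height (λ j → 𝟙 (k ℕ.≟ p ℕ.^ suc j)))

      bounded : ∀ {p j} → Prime p → 1 ℕ.≤ j → p ℕ.^ suc j ℕ.≤ N → p ℕ.≤ root × j ℕ.≤ height
      bounded {p} {j} pp 1≤j h =
        ℕₚ.<⇒≤ (ℕₚ.≰⇒> λ s<p → ℕₚ.<⇒≱ N<4^ (ℕₚ.≤-trans
          (ℕₚ.≤-trans (ℕₚ.≤-reflexive (trans (4^≡ (suc T))
            (trans (cong (2 ℕ.^_) (ℕₚ.*-comm 2 (suc T))) (sym (ℕₚ.^-*-assoc 2 (suc T) 2)))))
            (ℕₚ.^-monoˡ-≤ 2 s<p))
          (ℕₚ.≤-trans (ℕₚ.^-monoʳ-≤ p {{ℕ.>-nonZero (prime⇒1≤ pp)}} (ℕ.s≤s 1≤j)) h))) ,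
        ℕₚ.<⇒≤ (ℕₚ.≰⇒> λ m<j → ℕₚ.<⇒≱ N<4^ (ℕₚ.≤-trans
          (ℕₚ.≤-trans (ℕₚ.≤-reflexive (4^≡ (suc T))) (ℕₚ.^-monoʳ-≤ 2 m<j))
          (ℕₚ.≤-trans (ℕₚ.^-monoʳ-≤ 2 (ℕₚ.n≤1+n j)) (ℕₚ.≤-trans (ℕₚ.^-monoˡ-≤ (suc j) (prime⇒2≤ pp)) h))))

      pairs-nonneg : ∀ k → ι 0 ≤ pairs k
      pairs-nonneg k = ∑-nonneg root (λ p _ _ → ∑-nonneg height (λ j _ _ → 𝟙-nonneg (k ℕ.≟ p ℕ.^ suc j)))

      Λ≤pairs : ∀ k → 1 ℕ.≤ k → k ℕ.≤ N → ¬ Prime k → Λ k ≤ h * pairs k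
      Λ≤pairs k 1≤k k≤N ¬pk with Λ-support k 1≤k
      ... | inj₁ e = ≤-trans (≡⇒≤ e) (*-nonneg (ι-nonneg (4 ℕ.* suc T ℕ.+ 1)) (pairs-nonneg k))
      ... | inj₂ (p , zero , pp , refl) = ⊥-elim (¬pk (subst Prime (sym (ℕₚ.*-identityʳ p)) pp))
      ... | inj₂ (p , suc j , pp , refl) =
        ≤-trans (Λ≤h k 1≤k k≤N) (≤-trans (≡⇒≤ (sym *-one)) (*-monoˡ h (ι-nonneg (4 ℕ.* suc T ℕ.+ 1))
          (≤-trans (≡⇒≤ (sym (𝟙-yes (k ℕ.≟ p ℕ.^ suc (suc j)) refl)))
            (≤-trans (∑-term height (suc j) ℕ.z<s (proj₂ bound) (λ i _ _ → 𝟙-nonneg (k ℕ.≟ p ℕ.^ suc i)))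
              (∑-term root p (prime⇒1≤ pp) (proj₁ bound)
                (λ q _ _ → ∑-nonneg height (λ i _ _ → 𝟙-nonneg (k ℕ.≟ q ℕ.^ suc i))))))))
        where bound = bounded pp ℕ.z<s k≤N

      one-value : ∀ n a → ∑ n (λ k → 𝟙 (k ℕ.≟ a)) ≤ ι 1
      one-value zero a = 0≤1
      one-value (suc n) a with suc n ℕ.≟ a
      ... | no _ = ≤-trans (≡⇒≤ +-zeroʳ) (one-value n a)
      ... | yes refl = ≡⇒≤ (trans (cong (_+ ι 1)
          (trans (∑-cong n (λ k _ k≤n → 𝟙-no (k ℕ.≟ suc n) (λ e → ℕₚ.<⇒≢ (ℕ.s≤s k≤n) e))) (∑-zero n)))
          (arith 0 (# 0 :+ # 1 := # 1)))

      ∑-pairs : ∑ N pairs ≤ ι root * ι height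
      ∑-pairs = ≤-trans (≡⇒≤ (∑-swap N root (λ k p → ∑ height (λ j → 𝟙 (k ℕ.≟ p ℕ.^ suc j)))))
        (≤-trans (∑-mono root (λ p _ _ → ≤-trans (≡⇒≤ (∑-swap N height (λ k j → 𝟙 (k ℕ.≟ p ℕ.^ suc j))))
          (≤-trans (∑-mono height (λ j _ _ → one-value N (p ℕ.^ suc j))) (≡⇒≤ (trans (∑-const height (ι 1)) *-one)))))
          (≡⇒≤ (∑-const root (ι height))))

    -- Only proper prime powers remain. Their bases are at most `root`, of order √N, their exponents
    -- are logarithmic, and each has weight at most `h`, so the mass is O(√N log² N).
    no-primes : ∀ y → y ℕ.≤ N → (∀ k → y ℕ.< k → k ℕ.≤ N → ¬ Prime k) → ψ lg N - ψ lg y ≤ h * (ι root * ι height)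
    no-primes y y≤N none = ≤-trans
      (∑-tail-mono y≤N (λ k y<k k≤N → Λ≤pairs k (ℕₚ.≤-trans ℕ.z<s y<k) k≤N (none k y<k k≤N)))
      (≤-trans (arith 2 (λ a b → # 0 :≤ b ⇒ a :- b :≤ a)
        (∑-nonneg y (λ k _ _ → *-nonneg (ι-nonneg (4 ℕ.* suc T ℕ.+ 1)) (pairs-nonneg k))))
        (≤-trans (≡⇒≤ (∑-*ˡ N h pairs)) (*-monoˡ h (ι-nonneg (4 ℕ.* suc T ℕ.+ 1)) ∑-pairs)))

  -- With a = 2^(T ÷ 4) the two linear factors are O(a), so the left side is O(C a²), while 2^T is
  -- at least a⁴.
  exponential-beats : ∀ C T → 4 ℕ.* (288 ℕ.* C) ℕ.≤ T → C ℕ.* ((4 ℕ.* suc T ℕ.+ 1) ℕ.* (2 ℕ.* suc T)) ℕ.< 2 ℕ.^ T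
  exponential-beats C T h = ℕₚ.<-≤-trans
    (arithℕ 3 (λ C a s → s :≤ # 4 :* a ⇒ # 1 :+ # 288 :* C :≤ a ⇒
        C :* ((# 4 :* s :+ # 1) :* (# 2 :* s)) :≤ C :* ((# 16 :* a :+ a) :* (# 8 :* a)) ⇒
        (# 1 :+ # 288 :* C) :* (a :* a) :≤ a :* (a :* a) ⇒ # 1 :≤ a :* a ⇒ # 0 :≤ C :* (a :* a) ⇒
        # 1 :+ C :* ((# 4 :* s :+ # 1) :* (# 2 :* s)) :≤ a :* (a :* a))
      C a (suc T) sT≤4a C<a
      (ℕₚ.*-monoʳ-≤ C (ℕₚ.*-mono-≤
        (arithℕ 2 (λ a s → s :≤ # 4 :* a ⇒ # 1 :≤ a ⇒ # 4 :* s :+ # 1 :≤ # 16 :* a :+ a) a (suc T) sT≤4a 1≤a)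
        (arithℕ 2 (λ a s → s :≤ # 4 :* a ⇒ # 2 :* s :≤ # 8 :* a) a (suc T) sT≤4a)))
      (ℕₚ.*-monoˡ-≤ (a ℕ.* a) C<a) (ℕₚ.*-mono-≤ 1≤a 1≤a) ℕ.z≤n)
    (ℕₚ.≤-trans (arithℕ 1 (λ a → a :* (a :* a) :* # 1 :≤ a :* (a :* a) :* a ⇒ a :* (a :* a) :≤ a :*
      (a :* (a :* (a :* # 1)))) a
        (ℕₚ.*-monoʳ-≤ (a ℕ.* (a ℕ.* a)) 1≤a))
      (ℕₚ.≤-trans (ℕₚ.≤-reflexive (ℕₚ.^-*-assoc 2 t 4))
        (ℕₚ.^-monoʳ-≤ 2 (subst (ℕ._≤ T) (ℕₚ.*-comm 4 t) (÷-lower T 4)))))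
    where
    t = T ÷ 4
    a = 2 ℕ.^ t
    1≤a : 1 ℕ.≤ a
    1≤a = 1≤^ {2} t ℕ.z<s
    sT≤4a : suc T ℕ.≤ 4 ℕ.* a
    sT≤4a = ℕₚ.≤-trans (÷-upper T 4 ℕ.z<s) (ℕₚ.*-monoʳ-≤ 4 (n<2^n t))
    C<a : 1 ℕ.+ 288 ℕ.* C ℕ.≤ a
    C<a = ℕₚ.≤-trans (ℕ.s≤s (÷-greatest 4 (288 ℕ.* C) ℕ.z<s h)) (n<2^n t)

  -- Here w is of order √N. The constant 4096 is 4 · 512 · 2, from w² ≤ 4 v, N ≤ 512 y and the
  -- factor 2 w.
  count-contradiction : ∀ C B w y N P S v → 4096 ℕ.* B ℕ.≤ C → C ℕ.* (P ℕ.* S) ℕ.< w → w ℕ.* w ℕ.≤ 4 ℕ.* v → v ℕ.≤ N →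
                        N ℕ.≤ 512 ℕ.* y → y ℕ.≤ B ℕ.* (P ℕ.* ((2 ℕ.* w) ℕ.* S)) → ⊥
  count-contradiction C B w y N P S v B≤C C<w w²≤4v v≤N N≤512y y≤ =
    ℕₚ.<⇒≱ (ℕₚ.*-monoˡ-< w {{ℕ.>-nonZero (ℕₚ.≤-trans ℕ.z<s C<w)}} C<w)
      (arithℕ 8 (λ C B w y N P S v → (# 4096 :* B) :* (P :* S :* w) :≤ C :* (P :* S :* w) ⇒ w :* w :≤ # 4 :* v ⇒ v :≤ N
        ⇒ N :≤ # 512 :* y ⇒
          y :≤ B :* (P :* ((# 2 :* w) :* S)) ⇒ w :* w :≤ C :* (P :* S) :* w)
        C B w y N P S v (ℕₚ.*-monoˡ-≤ (P ℕ.* S ℕ.* w) B≤C) w²≤4v v≤N N≤512y y≤)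

  prime-from-mass : ∀ C B y N t → 4096 ℕ.* B ℕ.≤ C → 4 ℕ.* (288 ℕ.* C) ℕ.≤ t → y ℕ.≤ N → N ℕ.≤ 512 ℕ.* y →
                    4 ℕ.^ t ℕ.≤ N → N ℕ.≤ 4 ℕ.^ suc t → (lg : Log N) → ι y ≤ ι B * (ψ lg N - ψ lg y) →
                    ∃[ p ] Prime p × y ℕ.< p × p ℕ.≤ N
  prime-from-mass C B y N t B≤C T₀≤t y≤N N≤512y 4^t≤N N≤4^ lg mass =
    [ (λ (p , y<p , p≤N , pp) → p , pp , y<p , p≤N) , (λ none → ⊥-elim (impossible none)) ]′
    (scan {Prime} {λ k → ¬ Prime k} y N (λ k _ _ → decide-prime k))
    where
    decide-prime : ∀ k → Prime k ⊎ ¬ Prime k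
    decide-prime k with prime? k
    ... | yes p = inj₁ p
    ... | no ¬p = inj₂ ¬p
    T = suc t
    N<4^ : N ℕ.< 4 ℕ.^ suc T
    N<4^ = ℕₚ.≤-<-trans N≤4^ (ℕₚ.^-monoʳ-< 4 (ℕ.s≤s ℕ.z<s) (ℕₚ.n<1+n T))
    impossible : (∀ k → y ℕ.< k → k ℕ.≤ N → ¬ Prime k) → ⊥
    impossible none = count-contradiction C B (2 ℕ.^ T) y N (4 ℕ.* suc T ℕ.+ 1) (2 ℕ.* suc T) (4 ℕ.^ t) B≤C
      (exponential-beats C T (ℕₚ.≤-trans T₀≤t (ℕₚ.n≤1+n t)))
      (ℕₚ.≤-reflexive (trans (sym (ℕₚ.^-distribˡ-+-* 2 T T))
        (trans (cong (λ k → 2 ℕ.^ (T ℕ.+ k)) (sym (ℕₚ.+-identityʳ T))) (sym (ℕₚ.^-*-assoc 2 2 T)))))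
      4^t≤N N≤512y
      (ι-cancel (≤-trans mass (≤-trans (*-monoˡ (ι B) (ι-nonneg B) (PrimePowers.no-primes lg T N<4^ y y≤N none))
        (≡⇒≤ (sym (trans (ι-* B _) (cong (ι B *_)
          (trans (ι-* (4 ℕ.* suc T ℕ.+ 1) _) (cong (ι (4 ℕ.* suc T ℕ.+ 1) *_) (ι-* (2 ℕ.^ suc T) (2 ℕ.* suc T)))))))))))

  prime-between : ∀ b → 18 ℕ.≤ b → ∃[ Y ] (∀ y → Y ℕ.≤ y → ∃[ p ] Prime p × y ℕ.< p × p ℕ.≤ grow b 9 y)
  prime-between b 18≤b = from-dense (dense-9 b 18≤b)
    where
    from-dense : Dense b 9 → ∃[ Y ] (∀ y → Y ℕ.≤ y → ∃[ p ] Prime p × y ℕ.< p × p ℕ.≤ grow b 9 y)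
    from-dense (B , Y , dense) = Y ℕ.+ (4 ℕ.^ T₀ ℕ.+ 1) , λ y h →
        found y (grow b 9 y) (ℕₚ.≤-trans (ℕₚ.m≤n+m _ Y) h) (grow-≤ b {0} {9} y ℕ.z≤n) (grow-double b 9 y)
          (λ lg → dense lg y (ℕₚ.≤-trans (ℕₚ.m≤m+n Y _) h) ℕₚ.≤-refl)
      where
      C = 4096 ℕ.* B
      T₀ = 4 ℕ.* (288 ℕ.* C)
      found : ∀ y N → 4 ℕ.^ T₀ ℕ.+ 1 ℕ.≤ y → y ℕ.≤ N → N ℕ.≤ 512 ℕ.* y → ((lg : Log N) → ι y ≤ ι B * (ψ lg N - ψ lg y))
          →
              ∃[ p ] Prime p × y ℕ.< p × p ℕ.≤ N
      found y N large y≤N N≤512y mass = pass (crossing (4 ℕ.^_) N T₀ N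
          (ℕₚ.≤-trans (ℕₚ.m≤m+n _ 1) (ℕₚ.≤-trans large y≤N)) huge)
        where
        huge : N ℕ.≤ 4 ℕ.^ (T₀ ℕ.+ suc N)
        huge = ℕₚ.≤-trans (ℕₚ.<⇒≤ (n<2^n N)) (ℕₚ.≤-trans (ℕₚ.^-monoˡ-≤ N {2} {4} (ℕ.s≤s ℕ.z<s))
          (ℕₚ.^-monoʳ-≤ 4 (ℕₚ.≤-trans (ℕₚ.n≤1+n N) (ℕₚ.m≤n+m (suc N) T₀))))
        pass : ∃[ t ] T₀ ℕ.≤ t × t ℕ.≤ T₀ ℕ.+ N × 4 ℕ.^ t ℕ.≤ N × N ℕ.≤ 4 ℕ.^ suc t → ∃[ p ] Prime p × y ℕ.< p × p ℕ.≤ N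
        pass (t , T₀≤t , _ , 4^t≤N , N≤4^) = prime-from-mass C B y N t ℕₚ.≤-refl T₀≤t y≤N N≤512y 4^t≤N N≤4^ lg (mass lg)
          where
          lg : Log N
          lg = log N (ℕₚ.≤-trans (ℕₚ.≤-trans (ℕₚ.m≤n+m 1 (4 ℕ.^ T₀)) large) y≤N)

  -- Each step adds at most 1/b of a value that stays below 2^9 y = 512 y. Nine steps give the 4608
  -- = 9 · 512 used in choosing b.
  grow-9-bound : ∀ b i y → i ℕ.≤ 9 → b ℕ.* grow b i y ℕ.≤ b ℕ.* y ℕ.+ i ℕ.* (512 ℕ.* y)
  grow-9-bound b zero y _ = ℕₚ.≤-reflexive (sym (ℕₚ.+-identityʳ (b ℕ.* y)))
  grow-9-bound b (suc i) y i<9 = arithℕ 6 (λ b v y i d w → b :* v :≤ b :* y :+ i :* w ⇒ b :* d :≤ v ⇒ v :≤ w ⇒ b :*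
      (v :+ d) :≤ b :* y :+ (# 1 :+ i) :* w)
    b (grow b i y) y i (grow b i y ÷ b) (512 ℕ.* y) (grow-9-bound b i y (ℕₚ.<⇒≤ i<9)) (÷-lower (grow b i y) b)
    (ℕₚ.≤-trans (grow-double b i y) (ℕₚ.*-monoˡ-≤ y (ℕₚ.^-monoʳ-≤ 2 (ℕₚ.<⇒≤ i<9))))

  ratio-from-growth : ∀ b f p y v → b ≡ 4608 ℕ.* f → p ℕ.≤ v → b ℕ.* v ℕ.≤ b ℕ.* y ℕ.+ 9 ℕ.* (512 ℕ.* y) → f ℕ.* p ℕ.≤
      suc f ℕ.* y
  ratio-from-growth b f p y v b≡ p≤v h = ℕₚ.*-cancelˡ-≤ 4608
    (arithℕ 5 (λ b f p y v → b :* v :≤ b :* y :+ # 9 :* (# 512 :* y) ⇒ b :* p :≤ b :* v ⇒ b :* p := # 4608 :* f :* p ⇒ b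
      :* y := # 4608 :* f :* y ⇒
        # 4608 :* (f :* p) :≤ # 4608 :* ((# 1 :+ f) :* y)) b f p y v h (ℕₚ.*-monoʳ-≤ b p≤v) (cong (ℕ._* p) b≡)
          (cong (ℕ._* y) b≡))

  prime-ratio : ∀ f → 1 ℕ.≤ f → ∃[ Y ] (∀ y → Y ℕ.≤ y → ∃[ p ] Prime p × y ℕ.< p × f ℕ.* p ℕ.≤ suc f ℕ.* y)
  prime-ratio f 1≤f = go (4608 ℕ.* f) refl (ℕₚ.≤-trans (ℕₚ.m≤m+n 18 4590) (ℕₚ.*-monoʳ-≤ 4608 1≤f))
    where
    go : ∀ b → b ≡ 4608 ℕ.* f → 18 ℕ.≤ b → ∃[ Y ] (∀ y → Y ℕ.≤ y → ∃[ p ] Prime p × y ℕ.< p × f ℕ.* p ℕ.≤ suc f ℕ.* y)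
    go b b≡ 18≤b = proj₁ (prime-between b 18≤b) , λ y Y≤y → convert y (proj₂ (prime-between b 18≤b) y Y≤y)
      where
      convert : ∀ y → ∃[ p ] Prime p × y ℕ.< p × p ℕ.≤ grow b 9 y → ∃[ p ] Prime p × y ℕ.< p × f ℕ.* p ℕ.≤ suc f ℕ.* y
      convert y (p , pp , y<p , p≤) = p , pp , y<p , ratio-from-growth b f p y (grow b 9 y) b≡ p≤
          (grow-9-bound b 9 y ℕₚ.≤-refl)

  module _ (e f Y : ℕ) (1≤e : 1 ℕ.≤ e) (f≡15e : f ≡ 15 ℕ.* e)
           (ratio : ∀ y → Y ℕ.≤ y → ∃[ p ] Prime p × y ℕ.< p × f ℕ.* p ℕ.≤ suc f ℕ.* y) where
    private
      m = 2 ℕ.* Y ℕ.+ f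
      1≤f : 1 ℕ.≤ f
      1≤f = subst (1 ℕ.≤_) (sym f≡15e) (ℕₚ.*-mono-≤ {1} {15} ℕ.z<s 1≤e)
      f³ : f ℕ.* (f ℕ.* f ℕ.* f) ≡ 15 ℕ.* e ℕ.* (f ℕ.* f ℕ.* f)
      f³ = cong (ℕ._* (f ℕ.* f ℕ.* f)) f≡15e

    -- Let s be the integer part of √(n/3). The prime loses a factor (f + 1)/f against s, and s
    -- loses at most another against s + 1; squaring gives the fourth power in `quartic`.
    square-from-ratio : ∀ n → 3 ℕ.* (m ℕ.* m) ℕ.≤ n → ∃[ p ] Prime p × 3 ℕ.* (p ℕ.* p) ℕ.≤ n × e ℕ.* n ℕ.≤ suc e ℕ.*
        (3 ℕ.* (p ℕ.* p))
    square-from-ratio n h = p , pp , ℕₚ.≤-trans (ℕₚ.*-monoʳ-≤ 3 (ℕₚ.*-mono-≤ p≤s p≤s)) below , final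
      where
      crossed = crossing (λ i → 3 ℕ.* (i ℕ.* i)) n m n h
        (ℕₚ.≤-trans (ℕₚ.≤-trans (ℕₚ.n≤1+n n) (ℕₚ.m≤n+m (suc n) m))
          (ℕₚ.≤-trans (ℕₚ.m≤m*n _ (m ℕ.+ suc n) {{ℕ.>-nonZero (ℕₚ.≤-trans ℕ.z<s (ℕₚ.m≤n+m (suc n) m))}})
            (ℕₚ.m≤m+n _ _)))
      s = proj₁ crossed
      m≤s = proj₁ (proj₂ crossed)
      below = proj₁ (proj₂ (proj₂ (proj₂ crossed)))
      above = proj₂ (proj₂ (proj₂ (proj₂ crossed)))
      -- The prime found above y is at most (f + 1) y / f, hence at most s.
      y = (f ℕ.* s) ÷ suc f
      Y≤y : Y ℕ.≤ y
      Y≤y = ÷-greatest (suc f) Y ℕ.z<s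
        (arithℕ 3 (λ f Y s → # 1 :* Y :≤ f :* Y ⇒ f :* (# 2 :* Y :+ f) :≤ f :* s ⇒ # 0 :≤ f :* f ⇒ (# 1 :+ f) :* Y :≤ f
          :* s)
          f Y s (ℕₚ.*-monoˡ-≤ Y 1≤f) (ℕₚ.*-monoʳ-≤ f m≤s) ℕ.z≤n)
      r = ratio y Y≤y
      p = proj₁ r
      pp = proj₁ (proj₂ r)
      y<p = proj₁ (proj₂ (proj₂ r))
      p≤s : p ℕ.≤ s
      p≤s = ℕₚ.*-cancelˡ-≤ f {{ℕ.>-nonZero 1≤f}} (ℕₚ.≤-trans (proj₂ (proj₂ (proj₂ r))) (÷-lower (f ℕ.* s) (suc f)))
      s-lower : f ℕ.* s ℕ.≤ suc f ℕ.* p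
      s-lower = ℕₚ.≤-trans (ℕₚ.<⇒≤ (÷-upper (f ℕ.* s) (suc f) ℕ.z<s)) (ℕₚ.*-monoʳ-≤ (suc f) y<p)
      chain : f ℕ.* f ℕ.* suc s ℕ.≤ suc f ℕ.* suc f ℕ.* p
      chain = arithℕ 3 (λ f s p → (# 1 :+ f) :* (f :* s) :≤ (# 1 :+ f) :* ((# 1 :+ f) :* p) ⇒ f :* f :≤ f :* s ⇒
          f :* f :* (# 1 :+ s) :≤ (# 1 :+ f) :* (# 1 :+ f) :* p)
        f s p (ℕₚ.*-monoʳ-≤ (suc f) s-lower) (ℕₚ.*-monoʳ-≤ f (ℕₚ.≤-trans (ℕₚ.m≤n+m f (2 ℕ.* Y)) m≤s))
      -- e (f + 1)⁴ ≤ e f⁴ + 15 e f³ = (e + 1) f⁴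
      quartic : e ℕ.* (suc f ℕ.* suc f ℕ.* (suc f ℕ.* suc f)) ℕ.≤ suc e ℕ.* (f ℕ.* f ℕ.* (f ℕ.* f))
      quartic = arithℕ 2 (λ e f →
          e :* # 1 :≤ e :* f ⇒ e :* f :* # 1 :≤ e :* f :* f ⇒ e :* f :* f :* # 1 :≤ e :* f :* f :* f ⇒ f :*
            (f :* f :* f) := (# 15 :* e) :* (f :* f :* f) ⇒
          e :* ((# 1 :+ f) :* (# 1 :+ f) :* ((# 1 :+ f) :* (# 1 :+ f))) :≤ (# 1 :+ e) :* (f :* f :* (f :* f)))
        e f (ℕₚ.*-monoʳ-≤ e 1≤f) (ℕₚ.*-monoʳ-≤ (e ℕ.* f) 1≤f) (ℕₚ.*-monoʳ-≤ (e ℕ.* f ℕ.* f) 1≤f) f³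
      final : e ℕ.* n ℕ.≤ suc e ℕ.* (3 ℕ.* (p ℕ.* p))
      final = ℕₚ.≤-trans (ℕₚ.*-monoʳ-≤ e above)
          (ℕₚ.*-cancelˡ-≤ (f ℕ.* f ℕ.* (f ℕ.* f)) {{ℕ.>-nonZero
            (ℕₚ.*-mono-≤ (ℕₚ.*-mono-≤ 1≤f 1≤f) (ℕₚ.*-mono-≤ 1≤f 1≤f))}}
        (arithℕ 5 (λ e f s p g →
            e :* ((f :* f :* s) :* (f :* f :* s)) :≤ e :* ((g :* g :* p) :* (g :* g :* p)) ⇒
            e :* (g :* g :* (g :* g)) :* (p :* p) :≤ (# 1 :+ e) :* (f :* f :* (f :* f)) :* (p :* p) ⇒
            f :* f :* (f :* f) :* (e :* (# 3 :* (s :* s))) :≤ f :* f :* (f :* f) :* ((# 1 :+ e) :* (# 3 :* (p :* p))))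
          e f (suc s) p (suc f) (ℕₚ.*-monoʳ-≤ e (ℕₚ.*-mono-≤ chain chain)) (ℕₚ.*-monoˡ-≤ (p ℕ.* p) quartic)))

  prime-square : ∀ e → 1 ℕ.≤ e → ∃[ N ] (∀ n → N ℕ.≤ n →
                 ∃[ p ] Prime p × 3 ℕ.* (p ℕ.* p) ℕ.≤ n × e ℕ.* n ℕ.≤ suc e ℕ.* (3 ℕ.* (p ℕ.* p)))
  prime-square e 1≤e = go (15 ℕ.* e) refl (ℕₚ.*-mono-≤ {1} {15} ℕ.z<s 1≤e)
    where
    go : ∀ f → f ≡ 15 ℕ.* e → 1 ℕ.≤ f → ∃[ N ] (∀ n → N ℕ.≤ n →
         ∃[ p ] Prime p × 3 ℕ.* (p ℕ.* p) ℕ.≤ n × e ℕ.* n ℕ.≤ suc e ℕ.* (3 ℕ.* (p ℕ.* p)))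
    go f f≡ 1≤f = 3 ℕ.* ((2 ℕ.* Y ℕ.+ f) ℕ.* (2 ℕ.* Y ℕ.+ f)) , square-from-ratio e f Y 1≤e f≡
        (proj₂ (prime-ratio f 1≤f))
      where Y = proj₁ (prime-ratio f 1≤f)

-- The rationals as an ordered field

ratio : ℕ → ℕ → ℚ
ratio m n = ℚ.fromℚᵘ (mkℚᵘ (pos m) n)

ratio-suc : ∀ n → ratio (suc n) 0 ≡ ratio 1 0 ℚ.+ ratio n 0
ratio-suc n = ℚₚ.toℚᵘ-injective (begin
  ℚ.toℚᵘ (ratio (suc n) 0)                             ≈⟨ ℚₚ.toℚᵘ-fromℚᵘ (mkℚᵘ (pos (suc n)) 0) ⟩
  mkℚᵘ (pos (suc n)) 0                                 ≈⟨ *≡* (cong (ℤ._* pos 1) (sym numerator)) ⟩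
  mkℚᵘ (pos 1) 0 ℚᵘ.+ mkℚᵘ (pos n) 0                   ≈⟨ ℚᵘₚ.+-cong (ℚₚ.toℚᵘ-fromℚᵘ (mkℚᵘ (pos 1) 0))
    (ℚₚ.toℚᵘ-fromℚᵘ (mkℚᵘ (pos n) 0)) ⟨
  ℚ.toℚᵘ (ratio 1 0) ℚᵘ.+ ℚ.toℚᵘ (ratio n 0)           ≈⟨ ℚₚ.toℚᵘ-homo-+ (ratio 1 0) (ratio n 0) ⟨
  ℚ.toℚᵘ (ratio 1 0 ℚ.+ ratio n 0) ∎)
  where
  open ℚᵘₚ.≃-Reasoning
  numerator : pos 1 ℤ.* pos 1 ℤ.+ pos n ℤ.* pos 1 ≡ pos (suc n)
  numerator = cong (λ i → pos 1 ℤ.+ i) (ℤₚ.*-identityʳ (pos n))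

ratio-inverse : ∀ n → ratio (suc n) 0 ℚ.* ratio 1 n ≡ ratio 1 0
ratio-inverse n = ℚₚ.toℚᵘ-injective (begin
  ℚ.toℚᵘ (ratio (suc n) 0 ℚ.* ratio 1 n)               ≈⟨ ℚₚ.toℚᵘ-homo-* (ratio (suc n) 0) (ratio 1 n) ⟩
  ℚ.toℚᵘ (ratio (suc n) 0) ℚᵘ.* ℚ.toℚᵘ (ratio 1 n)     ≈⟨ ℚᵘₚ.*-cong (ℚₚ.toℚᵘ-fromℚᵘ (mkℚᵘ (pos (suc n)) 0))
    (ℚₚ.toℚᵘ-fromℚᵘ (mkℚᵘ (pos 1) n)) ⟩
  mkℚᵘ (pos (suc n)) 0 ℚᵘ.* mkℚᵘ (pos 1) n             ≈⟨ *≡* crossProducts ⟩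
  mkℚᵘ (pos 1) 0                                       ≈⟨ ℚₚ.toℚᵘ-fromℚᵘ (mkℚᵘ (pos 1) 0) ⟨
  ℚ.toℚᵘ (ratio 1 0) ∎)
  where
  open ℚᵘₚ.≃-Reasoning
  crossProducts : pos (suc n) ℤ.* pos 1 ℤ.* pos 1 ≡ pos 1 ℤ.* pos (1 ℕ.* suc n)
  crossProducts = trans (ℤₚ.*-identityʳ (pos (suc n) ℤ.* pos 1)) (trans (ℤₚ.*-identityʳ (pos (suc n)))
    (sym (trans (ℤₚ.*-identityˡ (pos (1 ℕ.* suc n))) (cong pos (ℕₚ.*-identityˡ (suc n))))))

rationals : OrderedField
rationals = record
  { R = ℚ
  ; ι = λ n → ratio n 0
  ; _+_ = ℚ._+_
  ; _*_ = ℚ._*_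
  ; -_ = ℚ.-_
  ; _≤_ = ℚ._≤_
  ; recip = λ n → ratio 1 n
  ; isCommutativeRing = ℚₚ.+-*-isCommutativeRing
  ; ι-suc = ratio-suc
  ; recip-inverse = ratio-inverse
  ; ≤-refl = ℚₚ.≤-refl
  ; ≤-trans = ℚₚ.≤-trans
  ; ≤-antisym = ℚₚ.≤-antisym
  ; ≤-total = ℚₚ.≤-total
  ; +-mono-≤ = ℚₚ.+-mono-≤
  ; *-nonneg = λ {x} {y} h k → subst (ℚ._≤ x ℚ.* y) (ℚₚ.*-zeroʳ x)
      (ℚₚ.*-monoˡ-≤-nonNeg x {{ℚ.nonNegative h}} k)
  ; 0≤1 = ℚ.*≤* (ℤ.+≤+ ℕ.z≤n)
  ; 1≰0 = λ { (ℚ.*≤* (ℤ.+≤+ ())) }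
  }

-- Sums over lists

module _ {A : Set} where
  open LinearArithmetic rationals

  S : List A → (A → ℕ) → ℕ
  S xs f = sum (map f xs)

  S-mono : ∀ xs {f g : A → ℕ} → (∀ x → f x ℕ.≤ g x) → S xs f ℕ.≤ S xs g
  S-mono [] h = ℕ.z≤n
  S-mono (x ∷ xs) h = ℕₚ.+-mono-≤ (h x) (S-mono xs h)

  S-cong : ∀ xs {f g : A → ℕ} → (∀ x → f x ≡ g x) → S xs f ≡ S xs g
  S-cong [] h = refl
  S-cong (x ∷ xs) h = cong₂ ℕ._+_ (h x) (S-cong xs h)

  S-+ : ∀ xs (f g : A → ℕ) → S xs (λ x → f x ℕ.+ g x) ≡ S xs f ℕ.+ S xs g
  S-+ [] f g = refl
  S-+ (x ∷ xs) f g = trans (cong (f x ℕ.+ g x ℕ.+_) (S-+ xs f g))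
    (arithℕ 4 (λ a b c d → (a :+ b) :+ (c :+ d) := (a :+ c) :+ (b :+ d)) (f x) (g x) (S xs f) (S xs g))

  S-*ˡ : ∀ xs c (f : A → ℕ) → S xs (λ x → c ℕ.* f x) ≡ c ℕ.* S xs f
  S-*ˡ [] c f = sym (ℕₚ.*-zeroʳ c)
  S-*ˡ (x ∷ xs) c f = trans (cong (c ℕ.* f x ℕ.+_) (S-*ˡ xs c f)) (sym (ℕₚ.*-distribˡ-+ c (f x) (S xs f)))

  S-const : ∀ xs c → S xs (λ _ → c) ≡ length xs ℕ.* c
  S-const [] c = refl
  S-const (x ∷ xs) c = cong (c ℕ.+_) (S-const xs c)

  S-term : ∀ {x xs} (f : A → ℕ) → x ∈ xs → f x ℕ.≤ S xs f
  S-term f (here refl) = ℕₚ.m≤m+n _ _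
  S-term f (there x∈) = ℕₚ.≤-trans (S-term f x∈) (ℕₚ.m≤n+m _ _)

S-swap : ∀ {A B : Set} (xs : List A) (ys : List B) (f : A → B → ℕ) →
         S xs (λ x → S ys (f x)) ≡ S ys (λ y → S xs (λ x → f x y))
S-swap [] ys f = sym (trans (S-const ys 0) (ℕₚ.*-zeroʳ (length ys)))
S-swap (x ∷ xs) ys f = trans (cong (S ys (f x) ℕ.+_) (S-swap xs ys f))
  (sym (S-+ ys (f x) (λ y → S xs (λ x → f x y))))

-- A lower bound for the number of walks of length three

module CubeBound (F : OrderedField) where
  open OrderedField F
  open LinearArithmetic F
  open Sums F

  module _ {A : Set} where
    Sᵣ : List A → (A → R) → R
    Sᵣ [] f = ι 0
    Sᵣ (x ∷ xs) f = f x + Sᵣ xs f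

    Sᵣ-mono : ∀ xs {f g : A → R} → (∀ x → f x ≤ g x) → Sᵣ xs f ≤ Sᵣ xs g
    Sᵣ-mono [] h = ≤-refl
    Sᵣ-mono (x ∷ xs) h = +-mono-≤ (h x) (Sᵣ-mono xs h)

    Sᵣ-+ : ∀ xs (f g : A → R) → Sᵣ xs (λ x → f x + g x) ≡ Sᵣ xs f + Sᵣ xs g
    Sᵣ-+ [] f g = arith 0 (# 0 := # 0 :+ # 0)
    Sᵣ-+ (x ∷ xs) f g = trans (cong (f x + g x +_) (Sᵣ-+ xs f g))
      (arith 4 (λ a b c d → (a :+ b) :+ (c :+ d) := (a :+ c) :+ (b :+ d)))

    Sᵣ-*ˡ : ∀ xs c (f : A → R) → Sᵣ xs (λ x → c * f x) ≡ c * Sᵣ xs f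
    Sᵣ-*ˡ [] c f = arith 1 (λ c → # 0 := c :* # 0)
    Sᵣ-*ˡ (x ∷ xs) c f = trans (cong (c * f x +_) (Sᵣ-*ˡ xs c f))
      (arith 3 (λ c a b → c :* a :+ c :* b := c :* (a :+ b)))

    Sᵣ-cong : ∀ xs {f g : A → R} → (∀ x → f x ≡ g x) → Sᵣ xs f ≡ Sᵣ xs g
    Sᵣ-cong [] h = refl
    Sᵣ-cong (x ∷ xs) h = cong₂ _+_ (h x) (Sᵣ-cong xs h)

    Sᵣ-ι : ∀ xs (f : A → ℕ) → Sᵣ xs (λ x → ι (f x)) ≡ ι (S xs f)
    Sᵣ-ι [] f = refl
    Sᵣ-ι (x ∷ xs) f = trans (cong (ι (f x) +_) (Sᵣ-ι xs f)) (sym (ι-+ (f x) (S xs f)))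

    Sᵣ-swap : ∀ xs (f : A → A → R) ys → Sᵣ xs (λ x → Sᵣ ys (f x)) ≡ Sᵣ ys (λ y → Sᵣ xs (λ x → f x y))
    Sᵣ-swap [] f ys = sym (zeros ys)
      where
      zeros : ∀ ys → Sᵣ ys (λ _ → ι 0) ≡ ι 0
      zeros [] = refl
      zeros (y ∷ ys) = trans (cong (ι 0 +_) (zeros ys)) (arith 0 (# 0 :+ # 0 := # 0))
    Sᵣ-swap (x ∷ xs) f ys = trans (cong (Sᵣ ys (f x) +_) (Sᵣ-swap xs f ys))
      (sym (Sᵣ-+ ys (f x) (λ y → Sᵣ xs (λ x → f x y))))

  -- The AM–GM inequality for p²q², e³p and e³q; its discriminant as a quadratic in q factors as (p − e)²(4p − e).
  am-gm : ∀ p q e → 1 ℕ.≤ p →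
          ι 3 * (ι e * ι e * ι p * ι q) ≤ ι p * ι p * ι q * ι q + ι e * ι e * ι e * (ι p + ι q)
  am-gm p q e 1≤p = [ small , large ]′ (≤-total (ι 3 * ι p) (ι e))
    where
    P = ι p
    T = ι q
    E = ι e
    0≤P = ι-nonneg p
    0≤T = ι-nonneg q
    0≤E = ι-nonneg e
    small : ι 3 * P ≤ E → _
    small h = arith 3 (λ p q e → # 0 :≤ e :* e :* q :* (e :- # 3 :* p) ⇒ # 0 :≤ p :* p :* (q :* q) ⇒ # 0 :≤ e :* e :* e
        :* p ⇒
        # 3 :* (e :* e :* p :* q) :≤ p :* p :* q :* q :+ e :* e :* e :* (p :+ q))
      (*-nonneg (*-nonneg (*-nonneg 0≤E 0≤E) 0≤T) (diff-nonneg h))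
      (*-nonneg (*-nonneg 0≤P 0≤P) (*-nonneg 0≤T 0≤T)) (*-nonneg (*-nonneg (*-nonneg 0≤E 0≤E) 0≤E) 0≤P)
    large : E ≤ ι 3 * P → _
    large h = cancel-ιˡ p 1≤p (cancel-ιˡ p 1≤p
      (arith 3 (λ p q e →
          # 0 :≤ (# 2 :* p :* p :* q :+ e :* e :* e :- # 3 :* e :* e :* p) :*
            (# 2 :* p :* p :* q :+ e :* e :* e :- # 3 :* e :* e :* p) ⇒
          # 0 :≤ e :* e :* e :* ((p :- e) :* (p :- e) :* (# 4 :* p :- e)) ⇒
          p :* (p :* (# 3 :* (e :* e :* p :* q))) :≤ p :* (p :* (p :* p :* q :* q :+ e :* e :* e :* (p :+ q))))
        (square-nonneg _)
        (*-nonneg (*-nonneg (*-nonneg 0≤E 0≤E) 0≤E) (*-nonneg (square-nonneg (P - E))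
          (arith 2 (λ p e → e :≤ # 3 :* p ⇒ # 0 :≤ p ⇒ # 0 :≤ # 4 :* p :- e) h 0≤P)))))

  module _ {A : Set} (vs : List A) (a : A → A → ℕ) (a-sym : ∀ u v → a u v ≡ a v u)
           (positive : ∀ u v → 1 ℕ.≤ a u v → 1 ℕ.≤ S vs (a u) × 1 ℕ.≤ S vs (a v)) where
    private
      d : A → ℕ
      d u = S vs (a u)

      n = length vs
      E = S vs d
      W = S vs (λ u → S vs (λ v → a u v ℕ.* (d u ℕ.* d v)))
      e³ = ι E * ι E * ι E
      n³ = ι n * ι n * ι n

      -- On an edge this is `am-gm` at p = n d u, q = n d v and e = E, divided by n d u d v. The
      -- three terms balance when both degrees are the average E/n.
      pointwise : 1 ℕ.≤ n → ∀ u v → ι (a u v) * (ι 3 * (ι E * ι E * ι n)) ≤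
                  n³ * ι (a u v ℕ.* (d u ℕ.* d v)) + e³ * (ι (a u v) * inv (d u) + ι (a u v) * inv (d v))
      pointwise 1≤n u v with a u v in eq
      ... | zero = arith 5 (λ c n e i j → # 0 :* c :≤ n :* # 0 :+ e :* (# 0 :* i :+ # 0 :* j))
      ... | suc k = ≤-trans (*-monoˡ (ι (suc k)) (ι-nonneg (suc k)) core)
          (≡⇒≤ (trans (arith 7 (λ a n e x y s t → a :* (n :* (x :* y) :+ e :* (s :+ t)) := n :* (a :* (x :* y)) :+ e :*
            (a :* s :+ a :* t)) {_} {ι (suc k)} {n³} {e³} {ι (d u)} {ι (d v)} {inv (d u)} {inv (d v)})
            (cong (λ z → n³ * z + e³ * (ι (suc k) * inv (d u) + ι (suc k) * inv (d v)))
              (sym (trans (ι-* (suc k) (d u ℕ.* d v)) (cong (ι (suc k) *_) (ι-* (d u) (d v))))))))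
        where
        degrees = positive u v (subst (1 ℕ.≤_) (sym eq) ℕ.z<s)
        s = inv (d u)
        t = inv (d v)
        xs = inv-cancel (d u) (proj₁ degrees)
        yt = inv-cancel (d v) (proj₂ degrees)
        xy = ι (d u) * ι (d v)
        base : ι 3 * (ι E * ι E * (ι n * ι (d u)) * (ι n * ι (d v))) ≤
               ι n * ι (d u) * (ι n * ι (d u)) * (ι n * ι (d v)) * (ι n * ι (d v)) + e³ *
                 (ι n * ι (d u) + ι n * ι (d v))
        base = subst₂ (λ p q → ι 3 * (ι E * ι E * p * q) ≤ p * p * q * q + e³ * (p + q)) (ι-* n (d u)) (ι-* n (d v))
          (am-gm (n ℕ.* d u) (n ℕ.* d v) E (ℕₚ.*-mono-≤ 1≤n (proj₁ degrees)))
        core : ι 3 * (ι E * ι E * ι n) ≤ n³ * (ι (d u) * ι (d v)) + e³ * (s + t)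
        core = cancel-ιˡ (d u) (proj₁ degrees) (cancel-ιˡ (d v) (proj₂ degrees) (cancel-ιˡ n 1≤n
          (arith 6 (λ n x y s t e →
              # 3 :* (e :* e :* (n :* x) :* (n :* y)) :≤ n :* x :* (n :* x) :* (n :* y) :* (n :* y) :+ e :* e :* e :*
                (n :* x :+ n :* y) ⇒
              x :* s :* (e :* e :* e :* n :* y) := # 1 :* (e :* e :* e :* n :* y) ⇒
              y :* t :* (e :* e :* e :* n :* x) := # 1 :* (e :* e :* e :* n :* x) ⇒
              n :* (y :* (x :* (# 3 :* (e :* e :* n)))) :≤ n :*
                (y :* (x :* (n :* n :* n :* (x :* y) :+ e :* e :* e :* (s :+ t)))))
            base (cong (_* (ι E * ι E * ι E * ι n * ι (d v))) xs) (cong (_* (ι E * ι E * ι E * ι n * ι (d u))) yt))))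

      inverses : Sᵣ vs (λ u → Sᵣ vs (λ v → ι (a u v) * inv (d u))) ≤ ι n
      inverses = ≤-trans (Sᵣ-mono vs each) (≡⇒≤
          (trans (Sᵣ-ι vs (λ _ → 1)) (cong ι (trans (S-const vs 1) (ℕₚ.*-identityʳ n)))))
        where
        each : ∀ u → Sᵣ vs (λ v → ι (a u v) * inv (d u)) ≤ ι 1
        each u = ≤-trans (≡⇒≤ (trans (Sᵣ-cong vs (λ v → *-swap))
            (trans (Sᵣ-*ˡ vs (inv (d u)) (λ v → ι (a u v))) (cong (inv (d u) *_) (Sᵣ-ι vs (a u)))))) (bound (d u))
          where
          bound : ∀ m → inv m * ι m ≤ ι 1
          bound zero = arith 0 (# 0 :* # 0 :≤ # 1)
          bound (suc m) = ≡⇒≤ (trans *-swap (inv-cancel (suc m) ℕ.z<s))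

      inverses′ : Sᵣ vs (λ u → Sᵣ vs (λ v → ι (a u v) * inv (d v))) ≤ ι n
      inverses′ = subst (_≤ ι n) (trans (Sᵣ-swap vs (λ u v → ι (a u v) * inv (d u)) vs)
        (Sᵣ-cong vs (λ u → Sᵣ-cong vs (λ v → cong (λ k → ι k * inv (d v)) (a-sym v u))))) inverses

      double-*ˡ : ∀ c (f : A → A → R) → Sᵣ vs (λ u → Sᵣ vs (λ v → c * f u v)) ≡ c * Sᵣ vs (λ u → Sᵣ vs (f u))
      double-*ˡ c f = trans (Sᵣ-cong vs (λ u → Sᵣ-*ˡ vs c (f u))) (Sᵣ-*ˡ vs c (λ u → Sᵣ vs (f u)))

      double-+ : ∀ (f g : A → A → R) → Sᵣ vs (λ u → Sᵣ vs (λ v → f u v + g u v)) ≡ Sᵣ vs (λ u → Sᵣ vs (f u)) + Sᵣ vs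
          (λ u → Sᵣ vs (g u))
      double-+ f g = trans (Sᵣ-cong vs (λ u → Sᵣ-+ vs (f u) (g u))) (Sᵣ-+ vs (λ u → Sᵣ vs (f u)) (λ u → Sᵣ vs (g u)))

      double-ι : ∀ (f : A → A → ℕ) → Sᵣ vs (λ u → Sᵣ vs (λ v → ι (f u v))) ≡ ι (S vs (λ u → S vs (f u)))
      double-ι f = trans (Sᵣ-cong vs (λ u → Sᵣ-ι vs (f u))) (Sᵣ-ι vs (λ u → S vs (f u)))

    -- Sidorenko's inequality for the path with three edges. In the sum of `pointwise` over the
    -- edges the inverse degrees add up to at most 2 n, so two of the three copies of n E³ cancel.
    cube-bound : 1 ℕ.≤ n → E ℕ.* E ℕ.* E ℕ.≤ n ℕ.* n ℕ.* W
    cube-bound 1≤n = ι-cancel (subst₂ _≤_ (sym (trans (ι-* (E ℕ.* E) E) (cong (_* ι E) (ι-* E E))))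
        (sym (trans (ι-* (n ℕ.* n) W) (cong (_* ι W) (ι-* n n)))) (cancel-ιˡ n 1≤n final))
      where
      summed : ι E * (ι 3 * (ι E * ι E * ι n)) ≤ n³ * ι W + e³ *
          (Sᵣ vs (λ u → Sᵣ vs (λ v → ι (a u v) * inv (d u))) + Sᵣ vs (λ u → Sᵣ vs (λ v → ι (a u v) * inv (d v))))
      summed = subst₂ _≤_
        (trans (trans (Sᵣ-cong vs (λ u → Sᵣ-cong vs (λ v → *-swap)))
          (trans (double-*ˡ (ι 3 * (ι E * ι E * ι n)) (λ u v → ι (a u v)))
            (cong ((ι 3 * (ι E * ι E * ι n)) *_) (double-ι a))))
          *-swap)
        (trans (double-+ (λ u v → n³ * ι (a u v ℕ.* (d u ℕ.* d v)))
          (λ u v → e³ * (ι (a u v) * inv (d u) + ι (a u v) * inv (d v))))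
          (cong₂ _+_ (trans (double-*ˡ n³ (λ u v → ι (a u v ℕ.* (d u ℕ.* d v))))
            (cong (n³ *_) (double-ι (λ u v → a u v ℕ.* (d u ℕ.* d v)))))
            (trans (double-*ˡ e³ (λ u v → ι (a u v) * inv (d u) + ι (a u v) * inv (d v)))
              (cong (e³ *_) (double-+ (λ u v → ι (a u v) * inv (d u)) (λ u v → ι (a u v) * inv (d v)))))))
        (Sᵣ-mono vs (λ u → Sᵣ-mono vs (pointwise 1≤n u)))
      final : ι n * (ι E * ι E * ι E) ≤ ι n * (ι n * ι n * ι W)
      final = arith 5 (λ n e w i j → e :* (# 3 :* (e :* e :* n)) :≤ n :* n :* n :* w :+ e :* e :* e :* (i :+ j) ⇒
          e :* e :* e :* i :≤ e :* e :* e :* n ⇒ e :* e :* e :* j :≤ e :* e :* e :* n ⇒ n :* (e :* e :* e) :≤ n :*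
            (n :* n :* w))
        summed (*-monoˡ e³ 0≤e³ inverses) (*-monoˡ e³ 0≤e³ inverses′)
        where 0≤e³ = *-nonneg (*-nonneg (ι-nonneg E) (ι-nonneg E)) (ι-nonneg E)

open import Data.Nat using (_+_; _*_; _≤_; _<_; z≤n; s≤s; z<s; _/_; _%_; NonZero; _^_)
open import Defs hiding (sym; irrefl)

-- The upper bound

open LinearArithmetic rationals using (arithℕ; #_; _:+_; _:*_; _:≤_; _:=_; _⇒_)

lookup-injective : ∀ {A : Set} {xs : List A} → Unique xs → ∀ i j → List.lookup xs i ≡ List.lookup xs j → i ≡ j
lookup-injective {xs = _ ∷ _} unique zero zero e = refl
lookup-injective {xs = _ ∷ _} (fresh ∷ _) zero (suc j) e = ⊥-elim (All.lookup fresh (∈-lookup j) e)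
lookup-injective {xs = _ ∷ _} (fresh ∷ _) (suc i) zero e = ⊥-elim (All.lookup fresh (∈-lookup i) (sym e))
lookup-injective {xs = _ ∷ _} (_ ∷ unique) (suc i) (suc j) e = cong suc (lookup-injective unique i j e)

length-allFin : ∀ n → length (allFin n) ≡ n
length-allFin n = Listₚ.length-tabulate {n = n} (λ i → i)

bit : Bool → ℕ
bit b = if b then 1 else 0

bit≤1 : ∀ b → bit b ≤ 1
bit≤1 true = ℕₚ.≤-refl
bit≤1 false = z≤n

∧-true : ∀ {b c} → b ∧ c ≡ true → b ≡ true × c ≡ true
∧-true {true} {true} _ = refl , refl

bit-∧ : ∀ b c → bit (b ∧ c) ≡ bit b * bit c
bit-∧ true true = refl
bit-∧ true false = refl
bit-∧ false c = refl

module _ {n : ℕ} where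

  δ : Fin n → Fin n → ℕ
  δ x y = bit (isYes (x Finₚ.≟ y))

  δ-refl : ∀ x → δ x x ≡ 1
  δ-refl x with x Finₚ.≟ x
  ... | yes _ = refl
  ... | no ≢ = ⊥-elim (≢ refl)

  δ-≢ : ∀ {x y} → x ≢ y → δ x y ≡ 0
  δ-≢ {x} {y} ≢ with x Finₚ.≟ y
  ... | yes e = ⊥-elim (≢ e)
  ... | no _ = refl

  S-δ : ∀ {xs} y → Unique xs → S xs (λ x → δ x y) ≤ 1
  S-δ y [] = z≤n
  S-δ {x ∷ xs} y (fresh ∷ unique) with x Finₚ.≟ y
  ... | no _ = S-δ y unique
  ... | yes refl = s≤s (ℕₚ.≤-reflexive (zeros fresh))
    where
    zeros : ∀ {xs} → All (x ≢_) xs → S xs (λ z → δ z x) ≡ 0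
    zeros [] = refl
    zeros (h ∷ hs) = cong₂ _+_ (δ-≢ (λ e → h (sym e))) (zeros hs)

  private
    vs : List (Fin n)
    vs = allFin n

  count : (Fin n → Bool) → ℕ
  count f = S vs (λ x → bit (f x))

  count-cover : ∀ f ys → (∀ x → f x ≡ true → x ∈ ys) → count f ≤ length ys
  count-cover f ys h = ℕₚ.≤-trans (S-mono vs covered) (ℕₚ.≤-trans (ℕₚ.≤-reflexive (S-swap vs ys δ))
    (ℕₚ.≤-trans (S-mono ys (λ y → S-δ y (allFin⁺ n)))
      (ℕₚ.≤-reflexive (trans (S-const ys 1) (ℕₚ.*-identityʳ (length ys))))))
    where
    covered : ∀ x → bit (f x) ≤ S ys (δ x)
    covered x with f x in eq
    ... | false = z≤n
    ... | true = subst (_≤ S ys (δ x)) (δ-refl x) (S-term (δ x) (h x eq))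

  -- Applied repeatedly it either produces new elements one after another or bounds their number.
  pick : ∀ f ys → (∃[ x ] f x ≡ true × x ∉ ys) ⊎ count f ≤ length ys
  pick f ys with Finₚ.any? (λ x → (f x Bool.≟ true) ×-dec ¬? (x ∈? ys))
    where open DecMembership (Finₚ._≟_ {n}) using (_∈?_)
  ... | yes found = inj₁ found
  ... | no none = inj₂ (count-cover f ys inside)
    where
    open DecMembership (Finₚ._≟_ {n}) using (_∈?_)
    inside : ∀ x → f x ≡ true → x ∈ ys
    inside x fx with x ∈? ys
    ... | yes x∈ = x∈
    ... | no x∉ = ⊥-elim (none (x , fx , x∉))

module Upper {n : ℕ} (G : Graph n) (admissible : Admissible G) where

  vs : List (Fin n)
  vs = allFin n

  A : Fin n → Fin n → Bool
  A = adj G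

  a : Fin n → Fin n → ℕ
  a u v = bit (A u v)

  a-sym : ∀ u v → a u v ≡ a v u
  a-sym u v = cong bit (Defs.sym G u v)

  A-sym : ∀ {u v} → A u v ≡ true → A v u ≡ true
  A-sym {u} {v} h = trans (Defs.sym G v u) h

  A-≢ : ∀ {u v} → A u v ≡ true → u ≢ v
  A-≢ {u} h refl with trans (sym h) (Defs.irrefl G u)
  ... | ()

  A-separates : ∀ {u v w} → A u v ≡ true → A u w ≡ false → v ≢ w
  A-separates h k refl with trans (sym h) k
  ... | ()

  -- Only the five nonconsecutive pairs have to be distinguished by hypothesis; consecutive vertices
  -- differ by irreflexivity.
  no-C5 : ∀ {v₀ v₁ v₂ v₃ v₄} → A v₀ v₁ ≡ true → A v₁ v₂ ≡ true → A v₂ v₃ ≡ true → A v₃ v₄ ≡ true → A v₄ v₀ ≡ true →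
          v₀ ≢ v₂ → v₀ ≢ v₃ → v₁ ≢ v₃ → v₁ ≢ v₄ → v₂ ≢ v₄ → ⊥
  no-C5 {v₀} {v₁} {v₂} {v₃} {v₄} e₀ e₁ e₂ e₃ e₄ n₀₂ n₀₃ n₁₃ n₁₄ n₂₄ =
    proj₁ admissible (List.lookup c , (λ {i} {j} → lookup-injective distinct i j) , cycle)
    where
    c : List (Fin n)
    c = v₀ ∷ v₁ ∷ v₂ ∷ v₃ ∷ v₄ ∷ []
    distinct : Unique c
    distinct = (A-≢ e₀ ∷ n₀₂ ∷ n₀₃ ∷ A-≢ (A-sym e₄) ∷ []) ∷ (A-≢ e₁ ∷ n₁₃ ∷ n₁₄ ∷ []) ∷ (A-≢ e₂ ∷ n₂₄ ∷ [])
      ∷ (A-≢ e₃ ∷ []) ∷ [] ∷ []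
    cycle : ∀ k → A (List.lookup c k) (List.lookup c (next5 k)) ≡ true
    cycle zero = e₀
    cycle (suc zero) = e₁
    cycle (suc (suc zero)) = e₂
    cycle (suc (suc (suc zero))) = e₃
    cycle (suc (suc (suc (suc zero)))) = e₄

  -- The form in which the exclusion of induced 4-cycles is used: two common neighbours of
  -- nonadjacent vertices are adjacent.
  no-induced-C4 : ∀ {u v w x} → A u w ≡ true → A w x ≡ true → A x v ≡ true → A v u ≡ true →
                  u ≢ x → w ≢ v → A u x ≡ false → A w v ≡ true
  no-induced-C4 {u} {v} {w} {x} uw wx xv vu u≢x w≢v ux with A w v in wv
  ... | true = refl
  ... | false = ⊥-elim (proj₂ admissible (List.lookup c , (λ {i} {j} → lookup-injective distinct i j) , induced))
    where
    c : List (Fin n)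
    c = u ∷ w ∷ x ∷ v ∷ []
    distinct : Unique c
    distinct = (A-≢ uw ∷ u≢x ∷ A-≢ (A-sym vu) ∷ []) ∷ (A-≢ wx ∷ w≢v ∷ []) ∷ (A-≢ xv ∷ []) ∷ [] ∷ []
    loop : ∀ y → A y y ≡ false
    loop = Defs.irrefl G
    flip : ∀ {y z} → A y z ≡ false → A z y ≡ false
    flip {y} {z} h = trans (Defs.sym G z y) h
    induced : ∀ i j → A (List.lookup c i) (List.lookup c j) ≡ k22adj i j
    induced zero zero = loop u
    induced zero (suc zero) = uw
    induced zero (suc (suc zero)) = ux
    induced zero (suc (suc (suc zero))) = A-sym vu
    induced (suc zero) zero = A-sym uw
    induced (suc zero) (suc zero) = loop w
    induced (suc zero) (suc (suc zero)) = wx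
    induced (suc zero) (suc (suc (suc zero))) = wv
    induced (suc (suc zero)) zero = flip ux
    induced (suc (suc zero)) (suc zero) = A-sym wx
    induced (suc (suc zero)) (suc (suc zero)) = loop x
    induced (suc (suc zero)) (suc (suc (suc zero))) = xv
    induced (suc (suc (suc zero))) zero = vu
    induced (suc (suc (suc zero))) (suc zero) = flip wv
    induced (suc (suc (suc zero))) (suc (suc zero)) = A-sym xv
    induced (suc (suc (suc zero))) (suc (suc (suc zero))) = loop v

  d : Fin n → ℕ
  d u = S vs (a u)

  common : Fin n → Fin n → Fin n → Bool
  common u x w = A u w ∧ A w x

  codeg : Fin n → Fin n → ℕ
  codeg u x = count (common u x)

  -- Of three common neighbours, w₂ and w₃ are adjacent by `no-induced-C4`, and then u w₁ x w₂ w₃ is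
  -- a pentagon.
  codeg-nonadjacent : ∀ {u x} → u ≢ x → A u x ≡ false → codeg u x ≤ 2
  codeg-nonadjacent {u} {x} u≢x ux with pick (common u x) []
  ... | inj₂ h = ℕₚ.≤-trans h z≤n
  ... | inj₁ (w₁ , c₁ , _) with pick (common u x) (w₁ ∷ [])
  ...   | inj₂ h = ℕₚ.≤-trans h z<s
  ...   | inj₁ (w₂ , c₂ , ∉₂) with pick (common u x) (w₁ ∷ w₂ ∷ [])
  ...     | inj₂ h = h
  ...     | inj₁ (w₃ , c₃ , ∉₃) = ⊥-elim (no-C5 uw₁ w₁x (A-sym w₂x)
              (no-induced-C4 uw₂ w₂x (A-sym w₃x) (A-sym uw₃) u≢x (λ e → ∉₃ (there (here (sym e)))) ux) (A-sym uw₃)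
              u≢x (A-≢ uw₂) (λ e → ∉₂ (here (sym e))) (λ e → ∉₃ (here (sym e))) (λ e → A-≢ w₃x (sym e)))
    where
    uw₁ = proj₁ (∧-true c₁)
    w₁x = proj₂ (∧-true c₁)
    uw₂ = proj₁ (∧-true c₂)
    w₂x = proj₂ (∧-true c₂)
    uw₃ = proj₁ (∧-true c₃)
    w₃x = proj₂ (∧-true c₃)

  -- If both counts are positive, avoiding a pentagon forces every vertex counted on one side to
  -- equal every vertex counted on the other, so each count is 1.
  codeg-edge : ∀ {u v x} → A u v ≡ true → A u x ≡ false → A v x ≡ false → codeg u x + codeg v x ≤ 2
  codeg-edge {u} {v} {x} uv ux vx with pick (common u x) [] | pick (common v x) []
  ... | inj₂ h | _ = ℕₚ.+-mono-≤ h (codeg-nonadjacent v≢x vx)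
    where v≢x = A-separates uv ux
  ... | inj₁ _ | inj₂ h = subst (codeg u x + codeg v x ≤_) (ℕₚ.+-identityʳ 2) (ℕₚ.+-mono-≤ (codeg-nonadjacent u≢x ux) h)
    where u≢x = A-separates (A-sym uv) vx
  ... | inj₁ (w , c , _) | inj₁ (w′ , c′ , _) =
    ℕₚ.+-mono-≤ (count-cover (common u x) (w′ ∷ []) (λ y cy → here (unique cy c′)))
                (count-cover (common v x) (w ∷ []) (λ y cy → here (sym (unique c cy))))
    where
    unique : ∀ {y y′} → common u x y ≡ true → common v x y′ ≡ true → y ≡ y′
    unique {y} {y′} cy cy′ with y Finₚ.≟ y′
    ... | yes e = e
    ... | no y≢y′ = ⊥-elim (no-C5 uy yx (A-sym y′x) (A-sym vy′) (A-sym uv)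
        (A-separates (A-sym uv) vx) (λ e → A-separates (A-sym y′x) (trans (Defs.sym G x u) ux) (sym e)) y≢y′
        (A-separates (A-sym yx) (trans (Defs.sym G x v) vx)) (λ e → A-separates uv ux (sym e)))
      where
      uy = proj₁ (∧-true cy)
      yx = proj₂ (∧-true cy)
      vy′ = proj₁ (∧-true cy′)
      y′x = proj₂ (∧-true cy′)

  -- The graph induced on a neighbourhood contains no path on four vertices.
  codeg-adjacent : ∀ {u x y} → A u x ≡ true → A u y ≡ true → A x y ≡ true → codeg u x ≤ 2 ⊎ codeg u y ≤ 1
  codeg-adjacent {u} {x} {y} ux uy xy with pick (common u y) (x ∷ [])
  ... | inj₂ h = inj₂ h
  ... | inj₁ (z , cz , z∉) with pick (common u x) (y ∷ z ∷ [])
  ...   | inj₂ h = inj₁ h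
  ...   | inj₁ (w , cw , w∉) = ⊥-elim (no-C5 (proj₁ (∧-true cz)) (proj₂ (∧-true cz)) (A-sym xy)
            (A-sym (proj₂ (∧-true cw))) (A-sym (proj₁ (∧-true cw)))
            (A-≢ uy) (A-≢ ux) (λ e → z∉ (here e)) (λ e → w∉ (there (here (sym e)))) (λ e → w∉ (here (sym e))))

  private
    low : ℕ → ℕ → ℕ
    low k m = bit (m ℕ.≤ᵇ k)

    low-≤ : ∀ k {m} → m ≤ k → low k m ≡ 1
    low-≤ k {m} h with m ℕ.≤ᵇ k | ℕₚ.≤⇒≤ᵇ h
    ... | true | _ = refl

    low-* : ∀ k m → low k m * m ≤ k
    low-* k m with m ℕ.≤ᵇ k in eq
    ... | false = z≤n
    ... | true = ℕₚ.≤-trans (ℕₚ.≤-reflexive (ℕₚ.+-identityʳ m)) (ℕₚ.≤ᵇ⇒≤ m k (subst Bool.T (sym eq) _))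

  -- The left side counts ordered edges x w inside the neighbourhood of u. By `codeg-adjacent` each
  -- has codeg u x ≤ 2 or codeg u w ≤ 1; at most 2 d u edges are of the first kind and d u of the
  -- second.
  neighbourhood : ∀ u → S vs (λ x → a u x * codeg u x) ≤ 3 * d u
  neighbourhood u = ℕₚ.≤-trans (ℕₚ.≤-reflexive (S-cong vs (λ x → sym (S-*ˡ vs (a u x) (λ w → bit (common u x w))))))
    (ℕₚ.≤-trans (S-mono vs (λ x → S-mono vs (pointwise x)))
    (ℕₚ.≤-trans (ℕₚ.≤-reflexive (trans (S-cong vs
      (λ x → S-+ vs (λ w → low 2 (codeg u x) * g x w) (λ w → low 1 (codeg u w) * g x w)))
        (S-+ vs (λ x → S vs (λ w → low 2 (codeg u x) * g x w)) (λ x → S vs (λ w → low 1 (codeg u w) * g x w)))))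
    (ℕₚ.≤-trans (ℕₚ.+-mono-≤ first second) (ℕₚ.≤-reflexive (arithℕ 1 (λ d → # 2 :* d :+ d := # 3 :* d) (d u))))))
    where
    g : Fin n → Fin n → ℕ
    g x w = a u x * bit (common u x w)
    pointwise : ∀ x w → g x w ≤ low 2 (codeg u x) * g x w + low 1 (codeg u w) * g x w
    pointwise x w with A u x in ux | A u w in uw | A w x in wx
    ... | false | _ | _ = z≤n
    ... | true | false | _ = z≤n
    ... | true | true | false = z≤n
    ... | true | true | true with codeg-adjacent ux uw (A-sym wx)
    ...   | inj₁ h = subst (λ l → 1 ≤ l * 1 + low 1 (codeg u w) * 1) (sym (low-≤ 2 h)) z<s
    ...   | inj₂ h = subst (λ l → 1 ≤ low 2 (codeg u x) * 1 + l * 1) (sym (low-≤ 1 h)) (ℕₚ.m≤n+m 1 _)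
    first : S vs (λ x → S vs (λ w → low 2 (codeg u x) * g x w)) ≤ 2 * d u
    first = ℕₚ.≤-trans (S-mono vs each) (ℕₚ.≤-reflexive (S-*ˡ vs 2 (a u)))
      where
      each : ∀ x → S vs (λ w → low 2 (codeg u x) * g x w) ≤ 2 * a u x
      each x = ℕₚ.≤-trans (ℕₚ.≤-reflexive (trans (S-*ˡ vs (low 2 (codeg u x)) (g x))
          (cong (low 2 (codeg u x) *_) (S-*ˡ vs (a u x) (λ w → bit (common u x w))))))
        (arithℕ 3 (λ l a c → a :* (l :* c) :≤ a :* # 2 ⇒ l :* (a :* c) :≤ # 2 :* a)
          (low 2 (codeg u x)) (a u x) (codeg u x) (ℕₚ.*-monoʳ-≤ (a u x) (low-* 2 (codeg u x))))
    second : S vs (λ x → S vs (λ w → low 1 (codeg u w) * g x w)) ≤ d u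
    second = ℕₚ.≤-trans (ℕₚ.≤-reflexive (S-swap vs vs (λ x w → low 1 (codeg u w) * g x w))) (S-mono vs each)
      where
      each : ∀ w → S vs (λ x → low 1 (codeg u w) * g x w) ≤ a u w
      each w = ℕₚ.≤-trans (ℕₚ.≤-reflexive (trans (S-*ˡ vs (low 1 (codeg u w)) (λ x → g x w))
          (cong (low 1 (codeg u w) *_) (trans (S-cong vs swapped) (S-*ˡ vs (a u w) (λ x → bit (common u w x)))))))
        (arithℕ 3 (λ l a c → a :* (l :* c) :≤ a :* # 1 ⇒ l :* (a :* c) :≤ a)
          (low 1 (codeg u w)) (a u w) (codeg u w) (ℕₚ.*-monoʳ-≤ (a u w) (low-* 1 (codeg u w))))
        where
        swapped : ∀ x → g x w ≡ a u w * bit (common u w x)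
        swapped x = trans (cong (a u x *_) (bit-∧ (A u w) (A w x))) (trans
          (arithℕ 3 (λ x y z → x :* (y :* z) := y :* (x :* z)) (a u x) (a u w) (a w x))
          (cong (a u w *_) (trans (cong (a u x *_) (a-sym w x)) (sym (bit-∧ (A u x) (A x w))))))

  codeg≤d : ∀ v → codeg v v ≤ d v
  codeg≤d v = S-mono vs (λ w → ℕₚ.≤-trans (ℕₚ.≤-reflexive (bit-∧ (A v w) (A w v)))
    (ℕₚ.≤-trans (ℕₚ.*-monoʳ-≤ (a v w) (bit≤1 (A w v))) (ℕₚ.≤-reflexive (ℕₚ.*-identityʳ (a v w)))))

  S-δ* : ∀ v c → S vs (λ x → δ x v * c) ≤ c
  S-δ* v c = ℕₚ.≤-trans (ℕₚ.≤-reflexive (trans (S-cong vs (λ x → ℕₚ.*-comm (δ x v) c)) (S-*ˡ vs c (λ x → δ x v))))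
    (ℕₚ.≤-trans (ℕₚ.*-monoʳ-≤ c (S-δ v (allFin⁺ n))) (ℕₚ.≤-reflexive (ℕₚ.*-identityʳ c)))

  T : Fin n → ℕ
  T u = S vs (codeg u)

  codeg-bound : ∀ u x → codeg u x ≤ 2 + (a u x * codeg u x + δ x u * d u)
  codeg-bound u x with A u x in ux
  ... | true = ℕₚ.≤-trans (ℕₚ.≤-reflexive (sym (ℕₚ.+-identityʳ (codeg u x))))
      (ℕₚ.≤-trans (ℕₚ.m≤m+n _ (δ x u * d u)) (ℕₚ.m≤n+m _ 2))
  ... | false with x Finₚ.≟ u
  ...   | yes refl = ℕₚ.≤-trans (codeg≤d x) (ℕₚ.≤-trans (ℕₚ.≤-reflexive (sym (ℕₚ.+-identityʳ (d x)))) (ℕₚ.m≤n+m _ 2))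
  ...   | no x≢u = codeg-nonadjacent (λ e → x≢u (sym e)) ux

  T-bound : ∀ u → T u ≤ 2 * n + 4 * d u
  T-bound u = ℕₚ.≤-trans (S-mono vs (codeg-bound u))
    (ℕₚ.≤-trans (ℕₚ.≤-reflexive (trans (S-+ vs (λ _ → 2) (λ x → a u x * codeg u x + δ x u * d u))
        (cong₂ _+_ (trans (S-const vs 2) (trans (cong (_* 2) (length-allFin n)) (ℕₚ.*-comm n 2)))
          (S-+ vs (λ x → a u x * codeg u x) (λ x → δ x u * d u)))))
      (ℕₚ.≤-trans (ℕₚ.+-monoʳ-≤ (2 * n) (ℕₚ.+-mono-≤ (neighbourhood u) (S-δ* u (d u))))
        (ℕₚ.≤-reflexive (arithℕ 2 (λ n d → # 2 :* n :+ (# 3 :* d :+ d) := # 2 :* n :+ # 4 :* d) n (d u)))))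

  -- For x adjacent to neither end this is `codeg-edge`. An x adjacent to one end has at most two
  -- common neighbours with the other end, up to the δ terms, and the summand 2 (a u x + a v x) pays
  -- for these.
  edge-pointwise : ∀ {u v} → A u v ≡ true → ∀ x →
                   codeg u x + codeg v x ≤ 2 + ((a u x * codeg u x + a v x * codeg v x) +
                     (2 * (a u x + a v x) + (δ x u * d u + δ x v * d v)))
  edge-pointwise {u} {v} uv x with A u x in ux | A v x in vx
  ... | true | true = arithℕ 4 (λ p q i j → p :+ q :≤ # 2 :+
      ((# 1 :* p :+ # 1 :* q) :+ (# 2 :* (# 1 :+ # 1) :+ (i :+ j))))
      (codeg u x) (codeg v x) (δ x u * d u) (δ x v * d v)
  ... | false | false = ℕₚ.≤-trans (codeg-edge uv ux vx) (ℕₚ.m≤m+n 2 _)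
  ... | true | false = arithℕ 4 (λ p q i j → q :≤ # 2 :+ (# 0 :* q :+ j) ⇒ p :+ q :≤ # 2 :+
      ((# 1 :* p :+ # 0 :* q) :+ (# 2 :* (# 1 :+ # 0) :+ (i :+ j))))
      (codeg u x) (codeg v x) (δ x u * d u) (δ x v * d v)
        (subst (λ b → codeg v x ≤ 2 + (bit b * codeg v x + δ x v * d v)) vx (codeg-bound v x))
  ... | false | true = arithℕ 4 (λ p q i j → p :≤ # 2 :+ (# 0 :* p :+ i) ⇒ p :+ q :≤ # 2 :+
      ((# 0 :* p :+ # 1 :* q) :+ (# 2 :* (# 0 :+ # 1) :+ (i :+ j))))
      (codeg u x) (codeg v x) (δ x u * d u) (δ x v * d v)
        (subst (λ b → codeg u x ≤ 2 + (bit b * codeg u x + δ x u * d u)) ux (codeg-bound u x))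

  -- `T-bound` for u and v separately would give 4 n. Treating both ends of an edge together halves
  -- this, and the constant 1/2 of the theorem depends on it.
  edge-bound : ∀ {u v} → A u v ≡ true → T u + T v ≤ 2 * n + 6 * (d u + d v)
  edge-bound {u} {v} uv = ℕₚ.≤-trans (ℕₚ.≤-reflexive (sym (S-+ vs (codeg u) (codeg v))))
    (ℕₚ.≤-trans (S-mono vs (edge-pointwise uv)) (ℕₚ.≤-trans (ℕₚ.≤-reflexive splitting)
      (ℕₚ.≤-trans (ℕₚ.+-monoʳ-≤ (2 * n) (ℕₚ.+-mono-≤ (ℕₚ.+-mono-≤ (neighbourhood u) (neighbourhood v))
          (ℕₚ.+-monoʳ-≤ (2 * (d u + d v)) (ℕₚ.+-mono-≤ (S-δ* u (d u)) (S-δ* v (d v))))))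
        (ℕₚ.≤-reflexive (arithℕ 3 (λ n p q → # 2 :* n :+ ((# 3 :* p :+ # 3 :* q) :+ (# 2 :* (p :+ q) :+ (p :+ q))) := #
          2 :* n :+ # 6 :* (p :+ q))
          n (d u) (d v))))))
    where
    splitting : S vs (λ x → 2 + ((a u x * codeg u x + a v x * codeg v x) +
        (2 * (a u x + a v x) + (δ x u * d u + δ x v * d v)))) ≡
                2 * n + ((S vs (λ x → a u x * codeg u x) + S vs (λ x → a v x * codeg v x)) +
                  (2 * (d u + d v) + (S vs (λ x → δ x u * d u) + S vs (λ x → δ x v * d v))))
    splitting = trans (S-+ vs (λ _ → 2) _) (cong₂ _+_
        (trans (S-const vs 2) (trans (cong (_* 2) (length-allFin n)) (ℕₚ.*-comm n 2)))
      (trans (S-+ vs (λ x → a u x * codeg u x + a v x * codeg v x) _) (cong₂ _+_ (S-+ vs (λ x → a u x * codeg u x) _)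
        (trans (S-+ vs (λ x → 2 * (a u x + a v x)) _)
          (cong₂ _+_ (trans (S-*ˡ vs 2 (λ x → a u x + a v x)) (cong (2 *_) (S-+ vs (a u) (a v))))
          (S-+ vs (λ x → δ x u * d u) _))))))

  d≤n : ∀ u → d u ≤ n
  d≤n u = ℕₚ.≤-trans (S-mono vs (λ v → bit≤1 (A u v)))
      (ℕₚ.≤-reflexive (trans (S-const vs 1) (trans (ℕₚ.*-identityʳ _) (length-allFin n))))

  T-walks : ∀ u → T u ≡ S vs (λ w → a u w * d w)
  T-walks u = trans (S-swap vs vs (λ x w → bit (common u x w)))
    (S-cong vs (λ w → trans (S-cong vs (λ x → bit-∧ (A u w) (A w x))) (S-*ˡ vs (a u w) (a w))))

  D² : ℕ
  D² = S vs (λ u → d u * d u)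

  E : ℕ
  E = S vs d

  W : ℕ
  W = S vs (λ u → S vs (λ v → a u v * (d u * d v)))

  D²-T : S vs T ≡ D²
  D²-T = trans (S-cong vs T-walks) (trans (S-swap vs vs (λ u w → a u w * d w))
    (S-cong vs (λ w → trans (S-cong vs (λ u → trans (cong (_* d w) (a-sym u w)) (ℕₚ.*-comm (a w u) (d w))))
      (S-*ˡ vs (d w) (a w)))))

  D²-bound : D² ≤ 6 * (n * n)
  D²-bound = ℕₚ.≤-trans (ℕₚ.≤-reflexive (sym D²-T)) (ℕₚ.≤-trans
    (S-mono vs {g = λ _ → 6 * n} (λ u → ℕₚ.≤-trans (T-bound u)
      (arithℕ 2 (λ n d → d :≤ n ⇒ # 2 :* n :+ # 4 :* d :≤ # 6 :* n) n (d u) (d≤n u))))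
    (ℕₚ.≤-reflexive (trans (S-const vs (6 * n))
      (trans (cong (_* (6 * n)) (length-allFin n)) (arithℕ 1 (λ n → n :* (# 6 :* n) := # 6 :* (n :* n)) n)))))

  dT : S vs (λ u → d u * T u) ≡ W
  dT = S-cong vs (λ u → trans (cong (d u *_) (T-walks u)) (trans (sym (S-*ˡ vs (d u) (λ w → a u w * d w)))
    (S-cong vs (λ v → arithℕ 3 (λ x y z → x :* (y :* z) := y :* (x :* z)) (d u) (a u v) (d v)))))

  private
    SS : (Fin n → Fin n → ℕ) → ℕ
    SS f = S vs (λ u → S vs (f u))

    left : ∀ (f : Fin n → ℕ) → SS (λ u v → a u v * f u) ≡ S vs (λ u → d u * f u)
    left f = S-cong vs (λ u → trans (S-cong vs (λ v → ℕₚ.*-comm (a u v) (f u)))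
        (trans (S-*ˡ vs (f u) (a u)) (ℕₚ.*-comm (f u) (d u))))

    right : ∀ (f : Fin n → ℕ) → SS (λ u v → a u v * f v) ≡ S vs (λ u → d u * f u)
    right f = trans (S-swap vs vs (λ u v → a u v * f v))
        (trans (S-cong vs (λ v → S-cong vs (λ u → cong (_* f v) (a-sym u v)))) (left f))

    SS-+ : ∀ (f g : Fin n → Fin n → ℕ) → SS (λ u v → f u v + g u v) ≡ SS f + SS g
    SS-+ f g = trans (S-cong vs (λ u → S-+ vs (f u) (g u))) (S-+ vs (λ u → S vs (f u)) (λ u → S vs (g u)))

  -- Summing T u + T v over the ordered edges counts each walk of length three twice. The error in
  -- `edge-bound` sums to 12 D², which is O(n²) because D² counts walks of length two.
  walks-bound : W ≤ n * E + 36 * (n * n)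
  walks-bound = ℕₚ.*-cancelˡ-≤ 2 (arithℕ 4
      (λ w e n d → w :+ w :≤ e :* (# 2 :* n) :+ (# 6 :* d :+ # 6 :* d) ⇒ d :≤ # 6 :* (n :* n) ⇒
      # 2 :* w :≤ # 2 :* (n :* e :+ # 36 :* (n :* n))) W E n D² doubled D²-bound)
    where
    doubled : W + W ≤ E * (2 * n) + (6 * D² + 6 * D²)
    doubled = ℕₚ.≤-trans (ℕₚ.≤-reflexive (sym
        (trans (trans (S-cong vs (λ u → S-cong vs (λ v → ℕₚ.*-distribˡ-+ (a u v) (T u) (T v))))
        (SS-+ (λ u v → a u v * T u) (λ u v → a u v * T v))) (cong₂ _+_ (trans (left T) dT) (trans (right T) dT)))))
      (ℕₚ.≤-trans (S-mono vs (λ u → S-mono vs (on-edge u))) (ℕₚ.≤-reflexive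
        (trans (trans (SS-+ (λ u v → a u v * (2 * n)) (λ u v → a u v * (6 * d u) + a u v * (6 * d v)))
            (cong (SS (λ u v → a u v * (2 * n)) +_) (SS-+ (λ u v → a u v * (6 * d u)) (λ u v → a u v * (6 * d v)))))
          (cong₂ _+_ (trans (left (λ _ → 2 * n)) (trans (S-cong vs (λ u → ℕₚ.*-comm (d u) (2 * n)))
            (trans (S-*ˡ vs (2 * n) d) (ℕₚ.*-comm (2 * n) E))))
            (cong₂ _+_ (trans (left (λ u → 6 * d u)) six) (trans (right (λ u → 6 * d u)) six))))))
      where
      six : S vs (λ u → d u * (6 * d u)) ≡ 6 * D²
      six = trans (S-cong vs (λ u → arithℕ 1 (λ d → d :* (# 6 :* d) := # 6 :* (d :* d)) (d u)))
          (S-*ˡ vs 6 (λ u → d u * d u))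
      on-edge : ∀ u v → a u v * (T u + T v) ≤ a u v * (2 * n) + (a u v * (6 * d u) + a u v * (6 * d v))
      on-edge u v with A u v in uv
      ... | false = z≤n
      ... | true = arithℕ 5 (λ s t n p q → s :+ t :≤ # 2 :* n :+ # 6 :* (p :+ q) ⇒ # 1 :* (s :+ t) :≤ # 1 :* (# 2 :* n)
          :+ (# 1 :* (# 6 :* p) :+ # 1 :* (# 6 :* q)))
          (T u) (T v) n (d u) (d v) (edge-bound uv)

  cube : 1 ≤ n → E * E * E ≤ n * n * (n * E + 36 * (n * n))
  cube 1≤n = ℕₚ.≤-trans
    (subst (λ m → E * E * E ≤ m * m * W) (length-allFin n)
      (CubeBound.cube-bound rationals vs a a-sym positive (subst (1 ≤_) (sym (length-allFin n)) 1≤n)))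
    (ℕₚ.*-monoʳ-≤ (n * n) walks-bound)
    where
    positive : ∀ u v → 1 ≤ a u v → 1 ≤ d u × 1 ≤ d v
    positive u v h = ℕₚ.≤-trans h (S-term (a u) (∈-allFin v)) , ℕₚ.≤-trans (subst (1 ≤_) (a-sym u v) h)
        (S-term (a v) (∈-allFin u))

  2edges≤E : 2 * edges G ≤ E
  2edges≤E = ℕₚ.≤-trans (ℕₚ.≤-reflexive (trans (cong (e +_) (trans (ℕₚ.+-identityʳ e) (S-swap vs vs forward)))
      (sym (SS-+ forward (λ u v → forward v u)))))
    (S-mono vs (λ u → S-mono vs (λ v → pointwise u v)))
    where
    e = edges G
    forward : Fin n → Fin n → ℕ
    forward u v = bit (A u v ∧ isYes (u Fin.<? v))
    pointwise : ∀ u v → forward u v + forward v u ≤ a u v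
    pointwise u v = subst (λ b → forward u v + bit (b ∧ isYes (v Fin.<? u)) ≤ a u v) (Defs.sym G u v) go
      where
      go : forward u v + bit (A u v ∧ isYes (v Fin.<? u)) ≤ a u v
      go with A u v | u Fin.<? v | v Fin.<? u
      ... | false | _ | _ = z≤n
      ... | true | yes p | yes q = ⊥-elim (ℕₚ.<-asym p q)
      ... | true | yes p | no _ = ℕₚ.≤-refl
      ... | true | no _ | yes _ = ℕₚ.≤-refl
      ... | true | no _ | no _ = z≤n

-- If E³ ≤ n³E + 36n⁴ and E is at least n^(3/2), then E² ≤ n³ + 36 n^(5/2), which is (1 + o(1)) n³.
upper-bound : ∀ p q n e E → q < 2 * p → 1296 * (q * q * (q * q)) < n → 2 * e ≤ E → E * E * E ≤ n * n *
    (n * E + 36 * (n * n)) →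
              q * q * (e * e) ≤ p * p * (n * n * n)
upper-bound p q n e E q<2p N<n 2e≤E cubic with ℕₚ.≤-total (q * q * (e * e)) (p * p * (n * n * n))
... | inj₁ h = h
... | inj₂ h = ⊥-elim (ℕₚ.<⇒≱ N<n n≤N)
  where
  -- If the conclusion fails, E² exceeds n³ by the factor 1 + 1/q² at least, since q + 1 ≤ 2 p.
  E-large : (q * q + 1) * (n * n * n) ≤ q * q * (E * E)
  E-large = arithℕ 5 (λ p q N e E →
      (# 1 :+ q) :* (# 1 :+ q) :* N :≤ # 2 :* p :* (# 2 :* p) :* N ⇒ p :* p :* N :≤ q :* q :* (e :* e) ⇒
      q :* q :* (# 2 :* e :* (# 2 :* e)) :≤ q :* q :* (E :* E) ⇒ # 0 :≤ q :* N ⇒ (q :* q :+ # 1) :* N :≤ q :* q :*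
        (E :* E))
    p q (n * n * n) e E (ℕₚ.*-monoˡ-≤ (n * n * n) (ℕₚ.*-mono-≤ q<2p q<2p)) h
    (ℕₚ.*-monoʳ-≤ (q * q) (ℕₚ.*-mono-≤ 2e≤E 2e≤E)) z≤n
  1≤n : 1 ≤ n
  1≤n = ℕₚ.≤-trans z<s N<n
  n≢0 = ℕ.>-nonZero 1≤n
  n³≢0 = ℕ.>-nonZero (ℕₚ.*-mono-≤ (ℕₚ.*-mono-≤ 1≤n 1≤n) 1≤n)
  -- The surplus of E² over n³ leaves n³ E ≤ 36 q² n⁴ in `cubic`. A linear bound for E against E² ≥
  -- n³ then bounds n, with 1296 = 36².
  E≤ : E ≤ 36 * (q * q) * n
  E≤ = ℕₚ.*-cancelˡ-≤ (n * n * n) {{n³≢0}}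
    (arithℕ 3 (λ q n E → (q :* q :+ # 1) :* (n :* n :* n) :* E :≤ q :* q :* (E :* E) :* E ⇒
        q :* q :* (E :* E :* E) :≤ q :* q :* (n :* n :* (n :* E :+ # 36 :* (n :* n))) ⇒
        n :* n :* n :* E :≤ n :* n :* n :* (# 36 :* (q :* q) :* n))
      q n E (ℕₚ.*-monoˡ-≤ E E-large) (ℕₚ.*-monoʳ-≤ (q * q) cubic))
  n≤N : n ≤ 1296 * (q * q * (q * q))
  n≤N = ℕₚ.*-cancelˡ-≤ (q * q + 1) {{ℕ.>-nonZero (ℕₚ.m≤n+m 1 (q * q))}}
      (ℕₚ.*-cancelˡ-≤ (n * n) {{ℕ.>-nonZero (ℕₚ.*-mono-≤ 1≤n 1≤n)}}
    (arithℕ 3 (λ q n E → (q :* q :+ # 1) :* (n :* n :* n) :≤ q :* q :* (E :* E) ⇒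
        q :* q :* (E :* E) :≤ q :* q :* ((# 36 :* (q :* q) :* n) :* (# 36 :* (q :* q) :* n)) ⇒
        # 0 :≤ n :* n :* (q :* q :* (q :* q)) ⇒
        n :* n :* ((q :* q :+ # 1) :* n) :≤ n :* n :* ((q :* q :+ # 1) :* (# 1296 :* (q :* q :* (q :* q)))))
      q n E E-large (ℕₚ.*-monoʳ-≤ (q * q) (ℕₚ.*-mono-≤ E≤ E≤)) z≤n))

-- The doubled affine plane

S-injection : ∀ {m n} (g : Fin m → Fin n) → (∀ {i j} → g i ≡ g j → i ≡ j) → (f : Fin n → ℕ) →
              S (allFin m) (λ k → f (g k)) ≤ S (allFin n) f
S-injection {m} {n} g injective f = ℕₚ.≤-trans (S-mono (allFin m) expand)
  (ℕₚ.≤-trans (ℕₚ.≤-reflexive (S-swap (allFin m) (allFin n) (λ k x → f x * δ x (g k))))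
    (S-mono (allFin n) (λ x → ℕₚ.≤-trans (ℕₚ.≤-reflexive (S-*ˡ (allFin m) (f x) (λ k → δ x (g k))))
      (ℕₚ.≤-trans (ℕₚ.*-monoʳ-≤ (f x) (fibre x)) (ℕₚ.≤-reflexive (ℕₚ.*-identityʳ (f x)))))))
  where
  open import Data.List.Membership.Propositional.Properties using (∈-allFin)
  expand : ∀ k → f (g k) ≤ S (allFin n) (λ x → f x * δ x (g k))
  expand k = ℕₚ.≤-trans (ℕₚ.≤-reflexive (trans (sym (ℕₚ.*-identityʳ (f (g k))))
      (cong (f (g k) *_) (sym (δ-refl (g k))))))
    (S-term (λ x → f x * δ x (g k)) (∈-allFin (g k)))
  fibre : ∀ x → S (allFin m) (λ k → δ x (g k)) ≤ 1
  fibre x with Finₚ.any? (λ k → g k Finₚ.≟ x)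
  ... | no none = ℕₚ.≤-trans (ℕₚ.≤-reflexive
      (trans (S-cong (allFin m) (λ k → δ-≢ (λ e → none (k , sym e)))) (S-*ˡ (allFin m) 0 (λ _ → 0)))) z≤n
  ... | yes (k₀ , refl) = ℕₚ.≤-trans (S-mono (allFin m) compare) (S-δ k₀ (allFin⁺ m))
    where
    compare : ∀ k → δ (g k₀) (g k) ≤ δ k k₀
    compare k with g k₀ Finₚ.≟ g k
    ... | no _ = z≤n
    ... | yes e = ℕₚ.≤-reflexive (sym (trans (cong (λ i → δ i k₀) (injective (sym e))) (δ-refl k₀)))

%-cancel : ∀ m e P .{{_ : NonZero P}} → (m + e) % P ≡ m % P → P ∣ e
%-cancel m e P h = ∣m+n∣m⇒∣n (divides ((m + e) / P) (ℕₚ.+-cancelˡ-≡ (m % P) _ _ (begin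
  m % P + (m / P * P + e)         ≡⟨ sym (ℕₚ.+-assoc (m % P) (m / P * P) e) ⟩
  m % P + m / P * P + e           ≡⟨ cong (_+ e) (sym (DivMod.m≡m%n+[m/n]*n m P)) ⟩
  m + e                           ≡⟨ DivMod.m≡m%n+[m/n]*n (m + e) P ⟩
  (m + e) % P + (m + e) / P * P   ≡⟨ cong (_+ (m + e) / P * P) h ⟩
  m % P + (m + e) / P * P ∎))) (n∣m*n (m / P))
  where open ≡-Reasoning

∣<⇒≡0 : ∀ {P e} → P ∣ e → e < P → e ≡ 0
∣<⇒≡0 {e = zero} _ _ = refl
∣<⇒≡0 {e = suc e} h e<P = ⊥-elim (ℕₚ.<⇒≱ e<P (∣⇒≤ h))

≡ᵇ-true : ∀ {m n} → (m ℕ.≡ᵇ n) ≡ true → m ≡ n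
≡ᵇ-true {m} {n} h = ℕₚ.≡ᵇ⇒≡ m n (subst Bool.T (sym h) _)

≡ᵇ-refl : ∀ m → (m ℕ.≡ᵇ m) ≡ true
≡ᵇ-refl zero = refl
≡ᵇ-refl (suc m) = ≡ᵇ-refl m

≡ᵇ-sym : ∀ m n → (m ℕ.≡ᵇ n) ≡ (n ℕ.≡ᵇ m)
≡ᵇ-sym zero zero = refl
≡ᵇ-sym zero (suc n) = refl
≡ᵇ-sym (suc m) zero = refl
≡ᵇ-sym (suc m) (suc n) = ≡ᵇ-sym m n

-- Vertices are numbered k P² + s P + t: the line y = s x + t for k = 0, and two copies of the point (s , t) for k = 1, 2.
module DoubledPlane (P : ℕ) (P-prime : Prime P) where
  instance
    P≢0 : NonZero P
    P≢0 = prime⇒nonZero P-prime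

    P²≢0 : NonZero (P * P)
    P²≢0 = ℕₚ.m*n≢0 P P

  onLine : ℕ → ℕ → ℕ → ℕ → Bool
  onLine a b x y = ((a * x + b) % P) ℕ.≡ᵇ y

  related : (k s t k′ s′ t′ : ℕ) → Bool
  related 0 a b 1 x y = onLine a b x y
  related 0 a b 2 x y = onLine a b x y
  related 1 x y 0 a b = onLine a b x y
  related 2 x y 0 a b = onLine a b x y
  related 1 x y 2 x′ y′ = (x ℕ.≡ᵇ x′) ∧ (y ℕ.≡ᵇ y′)
  related 2 x y 1 x′ y′ = (x ℕ.≡ᵇ x′) ∧ (y ℕ.≡ᵇ y′)
  -- This also covers kinds from 3 on: vertices numbered 3P² or more stay isolated and pad the graph
  -- to n vertices.
  related _ _ _ _ _ _ = false

  related-sym : ∀ k s t k′ s′ t′ → related k s t k′ s′ t′ ≡ related k′ s′ t′ k s t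
  related-sym 0 s t 0 s′ t′ = refl
  related-sym 0 s t 1 s′ t′ = refl
  related-sym 0 s t 2 s′ t′ = refl
  related-sym 0 s t (suc (suc (suc _))) s′ t′ = refl
  related-sym 1 s t 0 s′ t′ = refl
  related-sym 1 s t 1 s′ t′ = refl
  related-sym 1 s t 2 s′ t′ = cong₂ _∧_ (≡ᵇ-sym s s′) (≡ᵇ-sym t t′)
  related-sym 1 s t (suc (suc (suc _))) s′ t′ = refl
  related-sym 2 s t 0 s′ t′ = refl
  related-sym 2 s t 1 s′ t′ = cong₂ _∧_ (≡ᵇ-sym s s′) (≡ᵇ-sym t t′)
  related-sym 2 s t 2 s′ t′ = refl
  related-sym 2 s t (suc (suc (suc _))) s′ t′ = refl
  related-sym (suc (suc (suc _))) s t 0 s′ t′ = refl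
  related-sym (suc (suc (suc _))) s t 1 s′ t′ = refl
  related-sym (suc (suc (suc _))) s t 2 s′ t′ = refl
  related-sym (suc (suc (suc _))) s t (suc (suc (suc _))) s′ t′ = refl

  related-irrefl : ∀ k s t → related k s t k s t ≡ false
  related-irrefl 0 s t = refl
  related-irrefl 1 s t = refl
  related-irrefl 2 s t = refl
  related-irrefl (suc (suc (suc _))) s t = refl

  abstract
    kind ordinate abscissa : ℕ → ℕ
    kind v = v / (P * P)
    abscissa v = v % (P * P) / P
    ordinate v = v % (P * P) % P

    code : ℕ → ℕ → ℕ → ℕ
    code k s t = t + s * P + k * (P * P)

    decode : ∀ v → v ≡ code (kind v) (abscissa v) (ordinate v)
    decode v = trans (DivMod.m≡m%n+[m/n]*n v (P * P))
        (cong (_+ kind v * (P * P)) (DivMod.m≡m%n+[m/n]*n (v % (P * P)) P))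

    abscissa<P : ∀ v → abscissa v < P
    abscissa<P v = DivMod.m<n*o⇒m/o<n (DivMod.m%n<n v (P * P))

    ordinate<P : ∀ v → ordinate v < P
    ordinate<P v = DivMod.m%n<n (v % (P * P)) P

    remainder<P² : ∀ {s t} → s < P → t < P → t + s * P < P * P
    remainder<P² {s} {t} s<P t<P = arithℕ 3 (λ t s P → # 1 :+ t :≤ P ⇒ (# 1 :+ s) :* P :≤ P :* P ⇒ # 1 :+ (t :+ s :* P)
        :≤ P :* P)
      t s P t<P (ℕₚ.*-monoˡ-≤ P s<P)

    code-remainder : ∀ k {s t} → s < P → t < P → code k s t % (P * P) ≡ t + s * P
    code-remainder k {s} {t} s<P t<P = trans (DivMod.[m+kn]%n≡m%n (t + s * P) k (P * P))
        (DivMod.m<n⇒m%n≡m (remainder<P² s<P t<P))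

    kind-code : ∀ k s t → s < P → t < P → kind (code k s t) ≡ k
    kind-code k s t s<P t<P = trans (DivMod.+-distrib-/-∣ʳ (t + s * P) (n∣m*n k))
      (cong₂ _+_ (DivMod.m<n⇒m/n≡0 (remainder<P² s<P t<P)) (DivMod.m*n/n≡m k (P * P)))

    abscissa-code : ∀ k s t → s < P → t < P → abscissa (code k s t) ≡ s
    abscissa-code k s t s<P t<P = trans (cong (_/ P) (code-remainder k s<P t<P))
        (trans (DivMod.+-distrib-/-∣ʳ t (n∣m*n s))
      (cong₂ _+_ (DivMod.m<n⇒m/n≡0 t<P) (DivMod.m*n/n≡m s P)))

    ordinate-code : ∀ k s t → s < P → t < P → ordinate (code k s t) ≡ t
    ordinate-code k s t s<P t<P = trans (cong (_% P) (code-remainder k s<P t<P))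
        (trans (DivMod.[m+kn]%n≡m%n t s P) (DivMod.m<n⇒m%n≡m t<P))

    kind-small : ∀ {v} → v < P * P → kind v ≡ 0
    kind-small = DivMod.m<n⇒m/n≡0

    code-upper : ∀ {k s t} → k ≤ 2 → s < P → t < P → code k s t < 3 * (P * P)
    code-upper {k} {s} {t} k≤2 s<P t<P =
      arithℕ 4 (λ s t P k → # 1 :+ t :≤ P ⇒ (# 1 :+ s) :* P :≤ P :* P ⇒ k :* (P :* P) :≤ # 2 :* (P :* P) ⇒
          # 1 :+ ((t :+ s :* P) :+ k :* (P :* P)) :≤ # 3 :* (P :* P))
        s t P k t<P (ℕₚ.*-monoˡ-≤ P s<P) (ℕₚ.*-monoˡ-≤ (P * P) k≤2)

    code-lower : ∀ {k} s t → 1 ≤ k → P * P ≤ code k s t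
    code-lower {k} s t 1≤k = ℕₚ.≤-trans (ℕₚ.≤-trans (ℕₚ.≤-reflexive (sym (ℕₚ.*-identityˡ (P * P))))
        (ℕₚ.*-monoˡ-≤ (P * P) 1≤k))
      (ℕₚ.m≤n+m (k * (P * P)) (t + s * P))

  %-injective : ∀ c {i j} → i < P → j < P → (c + i) % P ≡ (c + j) % P → i ≡ j
  %-injective c {i} {j} i<P j<P h = [ (λ i≤j → ordered i≤j j<P h) , (λ j≤i → sym (ordered j≤i i<P (sym h))) ]′
      (ℕₚ.≤-total i j)
    where
    ordered : ∀ {i j} → i ≤ j → j < P → (c + i) % P ≡ (c + j) % P → i ≡ j
    ordered {i} {j} i≤j j<P h = sym (trans (sym j≡) (trans (cong (i +_) gap) (ℕₚ.+-identityʳ i)))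
      where
      j≡ = ℕₚ.m+[n∸m]≡n i≤j
      gap : j ℕ.∸ i ≡ 0
      gap = ∣<⇒≡0 (%-cancel (c + i) (j ℕ.∸ i) P
        (trans (cong (_% P) (trans (ℕₚ.+-assoc c i (j ℕ.∸ i)) (cong (c +_) j≡))) (sym h)))
          (ℕₚ.≤-<-trans (ℕₚ.m∸n≤m j i) j<P)

  cross-product : ∀ {m e α ξ} → α < P → ξ < P → (m + e) % P ≡ m % P → e ≡ α * ξ → α ≡ 0 ⊎ ξ ≡ 0
  cross-product {m} {e} {α} {ξ} α<P ξ<P h refl with euclidsLemma α ξ P-prime (%-cancel m e P h)
  ... | inj₁ P∣α = inj₁ (∣<⇒≡0 P∣α α<P)
  ... | inj₂ P∣ξ = inj₂ (∣<⇒≡0 P∣ξ ξ<P)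

  private
    sums : ∀ {u v u′ v′} → u % P ≡ u′ % P → v % P ≡ v′ % P → (u + v) % P ≡ (u′ + v′) % P
    sums {u} {v} {u′} {v′} h k = trans (DivMod.%-distribˡ-+ u v P)
      (trans (cong₂ (λ i j → (i + j) % P) h k) (sym (DivMod.%-distribˡ-+ u′ v′ P)))

    -- The two crosswise sums differ by (a′ - a) (x′ - x), so this product is divisible by P; the
    -- ordering hypotheses keep its factors natural.
    ordered : ∀ {a b a′ b′ x x′} → a ≤ a′ → x ≤ x′ → a′ < P → x′ < P →
              ((a * x + b) + (a′ * x′ + b′)) % P ≡ ((a′ * x + b′) + (a * x′ + b)) % P → a ≡ a′ ⊎ x ≡ x′
    ordered {a} {b} {a′} {b′} {x} {x′} a≤a′ x≤x′ a′<P x′<P h =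
      [ (λ e → inj₁ (trans (sym (ℕₚ.+-identityʳ a)) (trans (cong (a +_) (sym e)) a≡)))
      , (λ e → inj₂ (trans (sym (ℕₚ.+-identityʳ x)) (trans (cong (x +_) (sym e)) x≡))) ]′
      (cross-product {m = (a′ * x + b′) + (a * x′ + b)} (ℕₚ.≤-<-trans (ℕₚ.m∸n≤m a′ a) a′<P)
        (ℕₚ.≤-<-trans (ℕₚ.m∸n≤m x′ x) x′<P)
        (trans (cong (_% P) identity) h) refl)
      where
      α = a′ ℕ.∸ a
      ξ = x′ ℕ.∸ x
      a≡ = ℕₚ.m+[n∸m]≡n a≤a′
      x≡ = ℕₚ.m+[n∸m]≡n x≤x′
      identity : (a′ * x + b′) + (a * x′ + b) + α * ξ ≡ (a * x + b) + (a′ * x′ + b′)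
      identity = subst₂ (λ a″ x″ → (a″ * x + b′) + (a * x″ + b) + α * ξ ≡ (a * x + b) + (a″ * x″ + b′)) a≡ x≡
        (arithℕ 6 (λ a x α ξ b b′ → ((a :+ α) :* x :+ b′) :+ (a :* (x :+ ξ) :+ b) :+ α :* ξ := (a :* x :+ b) :+
          ((a :+ α) :* (x :+ ξ) :+ b′))
          a x α ξ b b′)

    module Coincidence {a b a′ b′ x y x′ y′} (e₁ : (a * x + b) % P ≡ y) (e₂ : (a′ * x + b′) % P ≡ y)
        (e₃ : (a * x′ + b) % P ≡ y′)
                       (b<P : b < P) (b′<P : b′ < P) where
      same-slope : a ≡ a′ → (a ≡ a′ × b ≡ b′) ⊎ (x ≡ x′ × y ≡ y′)
      same-slope refl = inj₁ (refl , %-injective (a * x) b<P b′<P (trans e₁ (sym e₂)))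
      same-abscissa : x ≡ x′ → (a ≡ a′ × b ≡ b′) ⊎ (x ≡ x′ × y ≡ y′)
      same-abscissa refl = inj₂ (refl , trans (sym e₁) e₃)

  -- Two distinct lines meet at most once. The four cases are the possible orders of the slopes and
  -- of the abscissas, each reduced to `ordered`.
  two-points : ∀ {a b a′ b′ x y x′ y′} → a < P → b < P → a′ < P → b′ < P → x < P → x′ < P →
               (a * x + b) % P ≡ y → (a′ * x + b′) % P ≡ y → (a * x′ + b) % P ≡ y′ → (a′ * x′ + b′) % P ≡ y′ →
               (a ≡ a′ × b ≡ b′) ⊎ (x ≡ x′ × y ≡ y′)
  two-points {a} {b} {a′} {b′} {x} {y} {x′} {y′} a< b< a′< b′< x< x′< e₁ e₂ e₃ e₄ with ℕₚ.≤-total a a′ | ℕₚ.≤-total x x′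
  ... | inj₁ h | inj₁ k = [ same-slope , same-abscissa ]′
      (ordered h k a′< x′< (sums (trans e₁ (sym e₂)) (trans e₄ (sym e₃))))
    where open Coincidence {a} {b} {a′} {b′} {x} {y} {x′} {y′} e₁ e₂ e₃ b< b′<
  ... | inj₁ h | inj₂ k = [ same-slope , (λ e → same-abscissa (sym e)) ]′
      (ordered h k a′< x< (sums (trans e₃ (sym e₄)) (trans e₂ (sym e₁))))
    where open Coincidence {a} {b} {a′} {b′} {x} {y} {x′} {y′} e₁ e₂ e₃ b< b′<
  ... | inj₂ h | inj₁ k = [ (λ e → same-slope (sym e)) , same-abscissa ]′
      (ordered h k a< x′< (sums (trans e₂ (sym e₁)) (trans e₃ (sym e₄))))
    where open Coincidence {a} {b} {a′} {b′} {x} {y} {x′} {y′} e₁ e₂ e₃ b< b′<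
  ... | inj₂ h | inj₂ k = [ (λ e → same-slope (sym e)) , (λ e → same-abscissa (sym e)) ]′
      (ordered h k a< x< (sums (trans e₄ (sym e₃)) (trans e₁ (sym e₂))))
    where open Coincidence {a} {b} {a′} {b′} {x} {y} {x′} {y′} e₁ e₂ e₃ b< b′<

  module _ {n : ℕ} (3P²≤n : 3 * (P * P) ≤ n) where

    κ σ τ : Fin n → ℕ
    κ i = kind (toℕ i)
    σ i = abscissa (toℕ i)
    τ i = ordinate (toℕ i)

    plane : Graph n
    plane = record
      { adj = λ i j → related (κ i) (σ i) (τ i) (κ j) (σ j) (τ j)
      ; sym = λ i j → related-sym (κ i) (σ i) (τ i) (κ j) (σ j) (τ j)
      ; irrefl = λ i → related-irrefl (κ i) (σ i) (τ i)
      }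

    _~_ : Fin n → Fin n → Set
    i ~ j = adj plane i j ≡ true

    ~-sym : ∀ {i j} → i ~ j → j ~ i
    ~-sym {i} {j} h = trans (Graph.sym plane j i) h

    coordinates-injective : ∀ {i j} → κ i ≡ κ j → σ i ≡ σ j → τ i ≡ τ j → i ≡ j
    coordinates-injective {i} {j} e f g = Finₚ.toℕ-injective
      (trans (decode (toℕ i)) (trans (trans (cong (λ k → code k (σ i) (τ i)) e) (cong₂ (code (κ j)) f g))
        (sym (decode (toℕ j)))))

    Line Point : Fin n → Set
    Line i = κ i ≡ 0
    Point i = κ i ≡ 1 ⊎ κ i ≡ 2

    Incident : Fin n → Fin n → Set
    Incident l p = (σ l * σ p + τ l) % P ≡ τ p

    data Edge (i j : Fin n) : Set where
      line-point : Line i → Point j → Incident i j → Edge i j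
      point-line : Point i → Line j → Incident j i → Edge i j
      copies : Point i → Point j → κ i ≢ κ j → σ i ≡ σ j → τ i ≡ τ j → Edge i j

    edge : ∀ {i j} → i ~ j → Edge i j
    edge {i} {j} h = go (κ i) (κ j) refl refl h
      where
      same : (σ i ℕ.≡ᵇ σ j) ∧ (τ i ℕ.≡ᵇ τ j) ≡ true → σ i ≡ σ j × τ i ≡ τ j
      same h = ≡ᵇ-true (proj₁ (∧-true h)) , ≡ᵇ-true (proj₂ (∧-true h))
      go : ∀ k k′ → κ i ≡ k → κ j ≡ k′ → related k (σ i) (τ i) k′ (σ j) (τ j) ≡ true → Edge i j
      go 0 1 e f h = line-point e (inj₁ f) (≡ᵇ-true h)
      go 0 2 e f h = line-point e (inj₂ f) (≡ᵇ-true h)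
      go 1 0 e f h = point-line (inj₁ e) f (≡ᵇ-true h)
      go 2 0 e f h = point-line (inj₂ e) f (≡ᵇ-true h)
      go 1 2 e f h = copies (inj₁ e) (inj₂ f) (λ k → case-12 (trans (sym e) (trans k f))) (proj₁ (same h))
          (proj₂ (same h))
        where
        case-12 : 1 ≡ 2 → ⊥
        case-12 ()
      go 2 1 e f h = copies (inj₂ e) (inj₁ f) (λ k → case-21 (trans (sym e) (trans k f))) (proj₁ (same h))
          (proj₂ (same h))
        where
        case-21 : 2 ≡ 1 → ⊥
        case-21 ()
      go 0 0 e f ()
      go 0 (suc (suc (suc _))) e f ()
      go 1 1 e f ()
      go 1 (suc (suc (suc _))) e f ()
      go 2 2 e f ()
      go 2 (suc (suc (suc _))) e f ()
      go (suc (suc (suc _))) 0 e f ()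
      go (suc (suc (suc _))) 1 e f ()
      go (suc (suc (suc _))) 2 e f ()
      go (suc (suc (suc _))) (suc (suc (suc _))) e f ()

    not-both : ∀ {i} → Line i → Point i → ⊥
    not-both l (inj₁ p) with trans (sym l) p
    ... | ()
    not-both l (inj₂ p) with trans (sym l) p
    ... | ()

    line-or-point : ∀ {i j} → i ~ j → Line i ⊎ Point i
    line-or-point h with edge h
    ... | line-point l _ _ = inj₁ l
    ... | point-line p _ _ = inj₂ p
    ... | copies p _ _ _ _ = inj₂ p

    incident : ∀ {l p} → Line l → l ~ p → Incident l p
    incident l h with edge h
    ... | line-point _ _ inc = inc
    ... | point-line p _ _ = ⊥-elim (not-both l p)
    ... | copies p _ _ _ _ = ⊥-elim (not-both l p)

    no-lines : ∀ {l l′} → Line l → Line l′ → l ~ l′ → ⊥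
    no-lines l l′ h with edge h
    ... | line-point _ p _ = not-both l′ p
    ... | point-line p _ _ = not-both l p
    ... | copies p _ _ _ _ = not-both l p

    copies-of : ∀ {p q} → Point p → Point q → p ~ q → κ p ≢ κ q × σ p ≡ σ q × τ p ≡ τ q
    copies-of p q h with edge h
    ... | line-point l _ _ = ⊥-elim (not-both l p)
    ... | point-line _ l _ = ⊥-elim (not-both l q)
    ... | copies _ _ k s t = k , s , t

    only-two : ∀ {i j k} → Point i → Point j → Point k → κ i ≢ κ j → κ j ≢ κ k → κ i ≡ κ k
    only-two (inj₁ p) _ (inj₁ r) _ _ = trans p (sym r)
    only-two (inj₂ p) _ (inj₂ r) _ _ = trans p (sym r)
    only-two (inj₁ p) (inj₁ q) (inj₂ r) h _ = ⊥-elim (h (trans p (sym q)))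
    only-two (inj₁ p) (inj₂ q) (inj₂ r) _ h = ⊥-elim (h (trans q (sym r)))
    only-two (inj₂ p) (inj₁ q) (inj₁ r) _ h = ⊥-elim (h (trans q (sym r)))
    only-two (inj₂ p) (inj₂ q) (inj₁ r) h _ = ⊥-elim (h (trans p (sym q)))

    no-three-points : ∀ {p q r} → Point p → Point q → Point r → p ~ q → q ~ r → p ≢ r → ⊥
    no-three-points p q r pq qr p≢r with copies-of p q pq | copies-of q r qr
    ... | k , s , t | k′ , s′ , t′ = p≢r (coordinates-injective (only-two p q r k k′) (trans s s′) (trans t t′))

    same-coordinates : ∀ {l l′ p p′} → Line l → Line l′ → l ≢ l′ → Incident l p → Incident l′ p → Incident l p′ →
        Incident l′ p′ →
                       σ p ≡ σ p′ × τ p ≡ τ p′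
    same-coordinates {l} {l′} {p} {p′} line line′ l≢l′ e₁ e₂ e₃ e₄
      with two-points (abscissa<P (toℕ l)) (ordinate<P (toℕ l)) (abscissa<P (toℕ l′)) (ordinate<P (toℕ l′))
             (abscissa<P (toℕ p)) (abscissa<P (toℕ p′)) e₁ e₂ e₃ e₄
    ... | inj₁ (s , t) = ⊥-elim (l≢l′ (coordinates-injective (trans line (sym line′)) s t))
    ... | inj₂ st = st

    -- As q and r are copies, both lines pass through p and through the place of q. They share one
    -- place only, so p is a third copy and equals q or r.
    no-pentagon-lplpp : ∀ {l p l′ q r} → Line l → Point p → Line l′ → Point q → Point r →
                        l ~ p → p ~ l′ → l′ ~ q → q ~ r → r ~ l → l ≢ l′ → p ≢ q → p ≢ r → ⊥
    no-pentagon-lplpp {l} {p} {l′} {q} {r} L-l P-p L-l′ P-q P-r lp pl′ l′q qr rl l≢l′ p≢q p≢r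
      with copies-of P-q P-r qr
    ... | k , s , t with same-coordinates L-l L-l′ l≢l′ (incident L-l lp) (incident L-l′ (~-sym pl′))
                           (subst₂ (λ x y → (σ l * x + τ l) % P ≡ y) (sym s) (sym t) (incident L-l (~-sym rl)))
                             (incident L-l′ l′q)
    ...   | s′ , t′ with κ p ℕ.≟ κ q
    ...     | yes e = p≢q (coordinates-injective e s′ t′)
    ...     | no e = p≢r (coordinates-injective (only-two P-p P-q P-r e k) (trans s′ s) (trans t′ t))

    -- Lines are pairwise nonadjacent and three consecutive vertices are never all points. Up to
    -- rotation this leaves the pattern line, point, line, point, point.
    no-pentagon : ∀ {v₀ v₁ v₂ v₃ v₄} → v₀ ~ v₁ → v₁ ~ v₂ → v₂ ~ v₃ → v₃ ~ v₄ → v₄ ~ v₀ →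
                  v₀ ≢ v₂ → v₀ ≢ v₃ → v₁ ≢ v₃ → v₁ ≢ v₄ → v₂ ≢ v₄ → ⊥
    no-pentagon e₀ e₁ e₂ e₃ e₄ n₀₂ n₀₃ n₁₃ n₁₄ n₂₄
      with line-or-point e₀ | line-or-point e₁ | line-or-point e₂ | line-or-point e₃ | line-or-point e₄
    ... | inj₁ l₀ | inj₁ l₁ | _ | _ | _ = no-lines l₀ l₁ e₀
    ... | _ | inj₁ l₁ | inj₁ l₂ | _ | _ = no-lines l₁ l₂ e₁
    ... | _ | _ | inj₁ l₂ | inj₁ l₃ | _ = no-lines l₂ l₃ e₂
    ... | _ | _ | _ | inj₁ l₃ | inj₁ l₄ = no-lines l₃ l₄ e₃
    ... | inj₁ l₀ | _ | _ | _ | inj₁ l₄ = no-lines l₄ l₀ e₄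
    ... | inj₂ p₀ | inj₂ p₁ | inj₂ p₂ | _ | _ = no-three-points p₀ p₁ p₂ e₀ e₁ n₀₂
    ... | _ | inj₂ p₁ | inj₂ p₂ | inj₂ p₃ | _ = no-three-points p₁ p₂ p₃ e₁ e₂ n₁₃
    ... | _ | _ | inj₂ p₂ | inj₂ p₃ | inj₂ p₄ = no-three-points p₂ p₃ p₄ e₂ e₃ n₂₄
    ... | inj₂ p₀ | _ | _ | inj₂ p₃ | inj₂ p₄ = no-three-points p₃ p₄ p₀ e₃ e₄ (λ e → n₀₃ (sym e))
    ... | inj₁ l₀ | inj₂ p₁ | inj₁ l₂ | inj₂ p₃ | inj₂ p₄ = no-pentagon-lplpp l₀ p₁ l₂ p₃ p₄ e₀ e₁ e₂ e₃ e₄ n₀₂ n₁₃ n₁₄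
    ... | inj₁ l₀ | inj₂ p₁ | inj₂ p₂ | inj₁ l₃ | inj₂ p₄ = no-pentagon-lplpp l₃ p₄ l₀ p₁ p₂ e₃ e₄ e₀ e₁ e₂
        (λ e → n₀₃ (sym e)) (λ e → n₁₄ (sym e)) (λ e → n₂₄ (sym e))
    ... | inj₂ p₀ | inj₁ l₁ | inj₂ p₂ | inj₁ l₃ | inj₂ p₄ = no-pentagon-lplpp l₁ p₂ l₃ p₄ p₀ e₁ e₂ e₃ e₄ e₀ n₁₃ n₂₄
        (λ e → n₀₂ (sym e))
    ... | inj₂ p₀ | inj₁ l₁ | inj₂ p₂ | inj₂ p₃ | inj₁ l₄ = no-pentagon-lplpp l₄ p₀ l₁ p₂ p₃ e₄ e₀ e₁ e₂ e₃
        (λ e → n₁₄ (sym e)) n₀₂ n₀₃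
    ... | inj₂ p₀ | inj₂ p₁ | inj₁ l₂ | inj₂ p₃ | inj₁ l₄ = no-pentagon-lplpp l₂ p₃ l₄ p₀ p₁ e₂ e₃ e₄ e₀ e₁ n₂₄
        (λ e → n₀₃ (sym e)) (λ e → n₁₃ (sym e))

    -- Two lines share one place only, so p and q are the two copies there and are adjacent: the
    -- 4-cycle has a chord.
    no-square-lplp : ∀ {l p l′ q} → Line l → Point p → Line l′ → Point q →
                     l ~ p → p ~ l′ → l′ ~ q → q ~ l → l ≢ l′ → p ≢ q → adj plane p q ≡ false → ⊥
    no-square-lplp {l} {p} {l′} {q} L-l P-p L-l′ P-q lp pl′ l′q ql l≢l′ p≢q p≁q
      with same-coordinates L-l L-l′ l≢l′ (incident L-l lp) (incident L-l′ (~-sym pl′)) (incident L-l (~-sym ql))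
        (incident L-l′ l′q)
    ... | s , t = contradict (go (κ p) (κ q) P-p P-q refl refl)
      where
      contradict : adj plane p q ≡ true → ⊥
      contradict h with trans (sym p≁q) h
      ... | ()
      coincide : (σ p ℕ.≡ᵇ σ q) ∧ (τ p ℕ.≡ᵇ τ q) ≡ true
      coincide = trans (cong₂ (λ x y → (σ p ℕ.≡ᵇ x) ∧ (τ p ℕ.≡ᵇ y)) (sym s) (sym t))
          (cong₂ _∧_ (≡ᵇ-refl (σ p)) (≡ᵇ-refl (τ p)))
      go : ∀ k k′ → k ≡ 1 ⊎ k ≡ 2 → k′ ≡ 1 ⊎ k′ ≡ 2 → κ p ≡ k → κ q ≡ k′ → related k (σ p) (τ p) k′ (σ q) (τ q) ≡ true
      go _ _ (inj₁ refl) (inj₁ refl) e f = ⊥-elim (p≢q (coordinates-injective (trans e (sym f)) s t))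
      go _ _ (inj₁ refl) (inj₂ refl) e f = coincide
      go _ _ (inj₂ refl) (inj₁ refl) e f = coincide
      go _ _ (inj₂ refl) (inj₂ refl) e f = ⊥-elim (p≢q (coordinates-injective (trans e (sym f)) s t))

    no-square : ∀ {v₀ v₁ v₂ v₃} → v₀ ~ v₁ → v₁ ~ v₂ → v₂ ~ v₃ → v₃ ~ v₀ → v₀ ≢ v₂ → v₁ ≢ v₃ →
                adj plane v₀ v₂ ≡ false → adj plane v₁ v₃ ≡ false → ⊥
    no-square e₀ e₁ e₂ e₃ n₀₂ n₁₃ f₀₂ f₁₃ with line-or-point e₀ | line-or-point e₁ | line-or-point e₂ | line-or-point e₃
    ... | inj₁ l₀ | inj₁ l₁ | _ | _ = no-lines l₀ l₁ e₀
    ... | _ | inj₁ l₁ | inj₁ l₂ | _ = no-lines l₁ l₂ e₁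
    ... | _ | _ | inj₁ l₂ | inj₁ l₃ = no-lines l₂ l₃ e₂
    ... | inj₁ l₀ | _ | _ | inj₁ l₃ = no-lines l₃ l₀ e₃
    ... | inj₂ p₀ | inj₂ p₁ | inj₂ p₂ | _ = no-three-points p₀ p₁ p₂ e₀ e₁ n₀₂
    ... | _ | inj₂ p₁ | inj₂ p₂ | inj₂ p₃ = no-three-points p₁ p₂ p₃ e₁ e₂ n₁₃
    ... | inj₂ p₀ | _ | inj₂ p₂ | inj₂ p₃ = no-three-points p₂ p₃ p₀ e₂ e₃ (λ e → n₀₂ (sym e))
    ... | inj₂ p₀ | inj₂ p₁ | _ | inj₂ p₃ = no-three-points p₃ p₀ p₁ e₃ e₀ (λ e → n₁₃ (sym e))
    ... | inj₁ l₀ | inj₂ p₁ | inj₁ l₂ | inj₂ p₃ = no-square-lplp l₀ p₁ l₂ p₃ e₀ e₁ e₂ e₃ n₀₂ n₁₃ f₁₃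
    ... | inj₂ p₀ | inj₁ l₁ | inj₂ p₂ | inj₁ l₃ = no-square-lplp l₃ p₀ l₁ p₂ e₃ e₀ e₁ e₂ (λ e → n₁₃ (sym e)) n₀₂ f₀₂

    admissible : Admissible plane
    admissible = pentagon , square
      where
      distinct : ∀ {m} {f : Fin m → Fin n} → (∀ {i j} → f i ≡ f j → i ≡ j) → ∀ i j → i ≢ j → f i ≢ f j
      distinct injective i j i≢j e = i≢j (injective e)
      pentagon : ¬ ContainsC5 plane
      pentagon (f , injective , cycle) = no-pentagon (cycle zero) (cycle (suc zero)) (cycle (suc (suc zero)))
          (cycle (suc (suc (suc zero))))
        (cycle (suc (suc (suc (suc zero)))))
        (distinct injective zero (suc (suc zero)) (λ ())) (distinct injective zero (suc (suc (suc zero))) (λ ()))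
        (distinct injective (suc zero) (suc (suc (suc zero))) (λ ()))
          (distinct injective (suc zero) (suc (suc (suc (suc zero)))) (λ ()))
        (distinct injective (suc (suc zero)) (suc (suc (suc (suc zero)))) (λ ()))
      square : ¬ ContainsInducedK22 plane
      square (f , injective , induced) = no-square (induced zero (suc zero)) (induced (suc zero) (suc (suc zero)))
        (induced (suc (suc zero)) (suc (suc (suc zero)))) (induced (suc (suc (suc zero))) zero)
        (distinct injective zero (suc (suc zero)) (λ ())) (distinct injective (suc zero) (suc (suc (suc zero))) (λ ()))
        (induced zero (suc (suc zero))) (induced (suc zero) (suc (suc (suc zero))))

    -- Each of the P² lines is joined to two copies of a point at each of P abscissas. Lines have
    -- the smallest numbers, so `edges` counts these pairs at the line.
    plane-edges : 2 * (P * P * P) ≤ edges plane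
    plane-edges = ℕₚ.≤-trans (ℕₚ.≤-trans (ℕₚ.≤-reflexive count-lines) (S-mono (allFin (P * P)) on-line))
      (S-injection inject (λ {i} {j} e → Finₚ.inject≤-injective _ _ i j e)
        (λ i → S (allFin n) (λ j → bit (adj plane i j ∧ isYes (i Fin.<? j)))))
      where
      P²≤n : P * P ≤ n
      P²≤n = ℕₚ.≤-trans (ℕₚ.m≤m+n (P * P) _) 3P²≤n
      inject : Fin (P * P) → Fin n
      inject i = inject≤ i P²≤n
      count-lines : 2 * (P * P * P) ≡ S (allFin (P * P)) (λ _ → 2 * P)
      count-lines = sym (trans (S-const (allFin (P * P)) (2 * P)) (trans (cong (_* (2 * P)) (length-allFin (P * P)))
        (arithℕ 1 (λ P → P :* P :* (# 2 :* P) := # 2 :* (P :* P :* P)) P)))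
      module _ (l : Fin (P * P)) where
        i = inject l
        toℕ-i : toℕ i ≡ toℕ l
        toℕ-i = Finₚ.toℕ-inject≤ l P²≤n
        i<P² : toℕ i < P * P
        i<P² = subst (_< P * P) (sym toℕ-i) (Finₚ.toℕ<n l)
        κ-i : κ i ≡ 0
        κ-i = kind-small i<P²
        x c y vertex : Fin (2 * P) → ℕ
        x m = toℕ m % P
        c m = suc (toℕ m / P)
        y m = (σ i * x m + τ i) % P
        vertex m = code (c m) (x m) (y m)
        x<P : ∀ m → x m < P
        x<P m = DivMod.m%n<n (toℕ m) P
        y<P : ∀ m → y m < P
        y<P m = DivMod.m%n<n (σ i * x m + τ i) P
        c≤2 : ∀ m → c m ≤ 2
        c≤2 m = DivMod.m<n*o⇒m/o<n (Finₚ.toℕ<n m)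
        vertex<n : ∀ m → vertex m < n
        vertex<n m = ℕₚ.<-≤-trans (code-upper (c≤2 m) (x<P m) (y<P m)) 3P²≤n
        point : Fin (2 * P) → Fin n
        point m = fromℕ< (vertex<n m)
        toℕ-point : ∀ m → toℕ (point m) ≡ vertex m
        toℕ-point m = Finₚ.toℕ-fromℕ< (vertex<n m)
        κ-point : ∀ m → κ (point m) ≡ c m
        κ-point m = trans (cong kind (toℕ-point m)) (kind-code (c m) (x m) (y m) (x<P m) (y<P m))
        σ-point : ∀ m → σ (point m) ≡ x m
        σ-point m = trans (cong abscissa (toℕ-point m)) (abscissa-code (c m) (x m) (y m) (x<P m) (y<P m))
        τ-point : ∀ m → τ (point m) ≡ y m
        τ-point m = trans (cong ordinate (toℕ-point m)) (ordinate-code (c m) (x m) (y m) (x<P m) (y<P m))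
        point-injective : ∀ {m m′} → point m ≡ point m′ → m ≡ m′
        point-injective {m} {m′} e = Finₚ.toℕ-injective (trans (DivMod.m≡m%n+[m/n]*n (toℕ m) P) (trans
          (cong₂ (λ r q → r + q * P) (trans (sym (σ-point m)) (trans (cong σ e) (σ-point m′)))
            (ℕₚ.suc-injective (trans (sym (κ-point m)) (trans (cong κ e) (κ-point m′)))))
          (sym (DivMod.m≡m%n+[m/n]*n (toℕ m′) P))))
        adjacent : ∀ m → adj plane i (point m) ≡ true
        adjacent m = go (c m) z<s (c≤2 m) (κ-point m)
          where
          on : onLine (σ i) (τ i) (σ (point m)) (τ (point m)) ≡ true
          on = trans (cong₂ (onLine (σ i) (τ i)) (σ-point m) (τ-point m)) (≡ᵇ-refl (y m))
          go : ∀ k → 1 ≤ k → k ≤ 2 → κ (point m) ≡ k → adj plane i (point m) ≡ true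
          go 1 _ _ e = trans (cong₂ (λ k k′ → related k (σ i) (τ i) k′ (σ (point m)) (τ (point m))) κ-i e) on
          go 2 _ _ e = trans (cong₂ (λ k k′ → related k (σ i) (τ i) k′ (σ (point m)) (τ (point m))) κ-i e) on
          go (suc (suc (suc _))) _ (s≤s (s≤s ())) _
        below : ∀ m → toℕ i < toℕ (point m)
        below m = ℕₚ.<-≤-trans i<P² (subst (P * P ≤_) (sym (toℕ-point m)) (code-lower (x m) (y m) z<s))
        counted : ∀ m → 1 ≤ bit (adj plane i (point m) ∧ isYes (i Fin.<? point m))
        counted m = subst (λ b → 1 ≤ bit (b ∧ isYes (i Fin.<? point m))) (sym (adjacent m)) go
          where
          go : 1 ≤ bit (isYes (i Fin.<? point m))
          go with i Fin.<? point m
          ... | yes _ = ℕₚ.≤-refl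
          ... | no ≮ = ⊥-elim (≮ (below m))
        on-line : 2 * P ≤ S (allFin n) (λ j → bit (adj plane i j ∧ isYes (i Fin.<? j)))
        on-line = ℕₚ.≤-trans (ℕₚ.≤-trans (ℕₚ.≤-reflexive
            (sym (trans (S-const (allFin (2 * P)) 1) (trans (ℕₚ.*-identityʳ _) (length-allFin (2 * P))))))
            (S-mono (allFin (2 * P)) counted))
          (S-injection point point-injective (λ j → bit (adj plane i j ∧ isYes (i Fin.<? j))))

-- (e + 1)³ ≤ e³ + 7e² turns n ≤ 3P²(1 + 1/e) into 27p²n³ ≤ (27p² + 1)(3P²)³.
lower-bound : ∀ p q n P e m → 27 * (p * p) < 4 * (q * q) → 1 ≤ e → 189 * (p * p) ≤ e → e * n ≤ suc e * (3 * (P * P)) →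
              2 * (P * P * P) ≤ m → p * p * (n * n * n) ≤ q * q * (m * m)
lower-bound p q n P e m 27p²<4q² 1≤e 189p²≤e close 2P³≤m = ℕₚ.≤-trans
  (ℕₚ.*-cancelˡ-≤ (27 * (e * e * e)) {{ℕ.>-nonZero (ℕₚ.*-mono-≤ {1} {27} z<s (ℕₚ.*-mono-≤ (ℕₚ.*-mono-≤ 1≤e 1≤e) 1≤e))}}
    scaled)
  (ℕₚ.*-monoʳ-≤ (q * q) (ℕₚ.*-mono-≤ 2P³≤m 2P³≤m))
  where
  z = 3 * (P * P)
  cubes : e * n * (e * n) * (e * n) ≤ suc e * z * (suc e * z) * (suc e * z)
  cubes = ℕₚ.*-mono-≤ (ℕₚ.*-mono-≤ close close) close
  -- 27 p² and 4 q² differ by at least 1, and 27 p² · 7 e² = 189 p² e² ≤ e³ fits into this gap.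
  factor : 27 * (p * p) * (suc e * suc e * suc e) ≤ 4 * (q * q) * (e * e * e)
  factor = arithℕ 3 (λ p q e → (# 1 :+ # 27 :* (p :* p)) :* (e :* e :* e) :≤ # 4 :* (q :* q) :* (e :* e :* e) ⇒
      # 189 :* (p :* p) :* (e :* e) :≤ e :* (e :* e) ⇒ p :* p :* e :* # 1 :≤ p :* p :* e :* e ⇒ p :* p :* # 1 :≤ p :* p
        :* e ⇒
      # 27 :* (p :* p) :* ((# 1 :+ e) :* (# 1 :+ e) :* (# 1 :+ e)) :≤ # 4 :* (q :* q) :* (e :* e :* e))
    p q e (ℕₚ.*-monoˡ-≤ (e * e * e) 27p²<4q²) (ℕₚ.*-monoˡ-≤ (e * e) 189p²≤e) (ℕₚ.*-monoʳ-≤ (p * p * e) 1≤e)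
      (ℕₚ.*-monoʳ-≤ (p * p) 1≤e)
  scaled : 27 * (e * e * e) * (p * p * (n * n * n)) ≤ 27 * (e * e * e) * (q * q * (2 * (P * P * P) * (2 * (P * P * P))))
  scaled = arithℕ 6 (λ p q n P e f →
      # 27 :* (p :* p) :* (e :* n :* (e :* n) :* (e :* n)) :≤ # 27 :* (p :* p) :*
        (f :* (# 3 :* (P :* P)) :* (f :* (# 3 :* (P :* P))) :* (f :* (# 3 :* (P :* P)))) ⇒
      # 27 :* (p :* p) :* (f :* f :* f) :* (P :* P :* P :* P :* P :* P) :≤ # 4 :* (q :* q) :* (e :* e :* e) :*
        (P :* P :* P :* P :* P :* P) ⇒
      # 27 :* (e :* e :* e) :* (p :* p :* (n :* n :* n)) :≤ # 27 :* (e :* e :* e) :*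
        (q :* q :* (# 2 :* (P :* P :* P) :* (# 2 :* (P :* P :* P)))))
    p q n P e (suc e) (ℕₚ.*-monoʳ-≤ (27 * (p * p)) cubes) (ℕₚ.*-monoˡ-≤ (P * P * P * P * P * P) factor)

-- The asymptotic bounds with roots and denominators cleared

m^2 : ∀ m → m ^ 2 ≡ m * m
m^2 m = cong (m *_) (ℕₚ.*-identityʳ m)

m^3 : ∀ m → m ^ 3 ≡ m * m * m
m^3 m = trans (cong (m *_) (m^2 m)) (sym (ℕₚ.*-assoc m m m))

-- The terms o(1) are expressed by fractions p/q: any p/q < 2/(3√3), that is 27 p² < 4 q², is a
-- valid lower constant for all large n, and any p/q > 1/2 is a valid upper one. Squaring the
-- inequalities removes n^(3/2).
theorem4 : (∀ (p q : ℕ) → 27 * p ^ 2 < 4 * q ^ 2 →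
    ∃[ N ] ∀ n → N ≤ n →
    Σ (Graph n) λ G → Admissible G × p ^ 2 * n ^ 3 ≤ q ^ 2 * edges G ^ 2)
    ×
    (∀ (p q : ℕ) → q < 2 * p →
    ∃[ N ] ∀ n → N ≤ n →
    ∀ (G : Graph n) → Admissible G → q ^ 2 * edges G ^ 2 ≤ p ^ 2 * n ^ 3)
theorem4 = lower , upper
  where
  lower : ∀ (p q : ℕ) → 27 * p ^ 2 < 4 * q ^ 2 →
          ∃[ N ] ∀ n → N ≤ n → Σ (Graph n) λ G → Admissible G × p ^ 2 * n ^ 3 ≤ q ^ 2 * edges G ^ 2
  lower p q h = N , λ n N≤n → construct n (primes n N≤n)
    where
    -- Large enough for `lower-bound`; the successor keeps e positive when p = 0.
    e = suc (189 * (p * p))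
    N = proj₁ (ShortIntervals.prime-square rationals e z<s)
    primes = proj₂ (ShortIntervals.prime-square rationals e z<s)
    construct : ∀ n → ∃[ P ] Prime P × 3 * (P * P) ≤ n × e * n ≤ suc e * (3 * (P * P)) → Σ (Graph n) λ G → Admissible G
        × p ^ 2 * n ^ 3 ≤ q ^ 2 * edges G ^ 2
    construct n (P , P-prime , 3P²≤n , close) = DoubledPlane.plane P P-prime 3P²≤n , DoubledPlane.admissible P P-prime
        3P²≤n ,
      subst₂ _≤_ (sym (cong₂ _*_ (m^2 p) (m^3 n))) (sym (cong₂ _*_ (m^2 q) (m^2 m)))
        (lower-bound p q n P e m (subst₂ _<_ (cong (27 *_) (m^2 p)) (cong (4 *_) (m^2 q)) h) z<s (ℕₚ.n≤1+n _) close
          (DoubledPlane.plane-edges P P-prime 3P²≤n))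
      where m = edges (DoubledPlane.plane P P-prime 3P²≤n)
  upper : ∀ (p q : ℕ) → q < 2 * p →
          ∃[ N ] ∀ n → N ≤ n → ∀ (G : Graph n) → Admissible G → q ^ 2 * edges G ^ 2 ≤ p ^ 2 * n ^ 3
  upper p q h = suc (1296 * (q * q * (q * q))) , λ n N<n G admissible →
    subst₂ _≤_ (sym (cong₂ _*_ (m^2 q) (m^2 (edges G)))) (sym (cong₂ _*_ (m^2 p) (m^3 n)))
      (upper-bound p q n (edges G) (Upper.E G admissible) h N<n (Upper.2edges≤E G admissible)
        (Upper.cube G admissible (ℕₚ.≤-trans z<s N<n)))
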